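{- Algorithm 2 (written out in the context) is correct. That is, given finite fuzzy graphs $G = \langle V, E, L, \Sigma_V, \Sigma_E\rangle$ and $G' = \langle V', E', L', \Sigma_V, \Sigma_E\rangle$, it returns the greatest fuzzy directed simulation between $G$ and $G'$ under the Gödel semantics. Moreover, Algorithm 2 can be implemented so that its time complexity is $O((m+n)n)$, where $n = |V| + |V'|$ and $m = |E| + |E'|$, assuming that the signature $\langle \Sigma_V, \Sigma_E\rangle$ is fixed.
   Context: Gödel structure on $[0,1]$: $a \land b = \min(a,b)$, $a \lor b = \max(a,b)$, $a \otimes b = \min(a,b)$, and $(a \Rightarrow b) = b$ if $a > b$, and $(a \Rightarrow b) = 1$ otherwise. Infima and suprema are taken in $[0,1]$. A fuzzy subset of $X$ is a function $X \to [0,1]$; fuzzy subsets are ordered pointwise, and $f\lor g$ is the pointwise maximum. $\{x_1\!:\!a_1,\ldots\}$ denotes the fuzzy set taking value $a_i$ at $x_i$ and $0$ elsewhere. Fuzzy graphs. A fuzzy (labeled) graph is $G = \langle V, E, L, \Sigma_V, \Sigma_E\rangle$, where $V$ is a non-empty set of vertices, $\Sigma_V$ (resp. $\Sigma_E$) is a set of vertex labels (resp. edge labels), $E: V\times\Sigma_E\times V \to [0,1]$, and $L: V \to (\Sigma_V \to [0,1])$. Write $E_r(x,y) = E(x,r,y)$. A positive edge is a triple $\langle x,r,y\rangle$ with $E(x,r,y)>0$, and $|E|$ is the number of positive edges. $G$ is finite if $V$, $\Sigma_V$, $\Sigma_E$ are finite. Fuzzy directed simulation. For fuzzy graphs $G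 = \langle V, E, L, \Sigma_V, \Sigma_E\rangle$ and $G' = \langle V', E', L', \Sigma_V, \Sigma_E\rangle$, a function $Z: V\times V' \to [0,1]$ is a fuzzy directed simulation between $G$ and $G'$ if for all $p \in \Sigma_V$, $r\in\Sigma_E$: - for all $x\in V$, $x'\in V'$: $Z(x,x') \leq (L(x)(p) \Rightarrow L'(x')(p))$; - for all $x,y\in V$, $x'\in V'$ there exists $y'\in V'$ with $Z(x,x')\otimes E_r(x,y) \leq E'_r(x',y')\otimes Z(y,y')$; - for all $x\in V$, $x',y'\in V'$ there exists $y\in V$ with $Z(x,x')\otimes E'_r(x',y') \leq E_r(x,y)\otimes Z(y,y')$. The greatest one is the one pointwise greater than or equal to all others. Minimax nets. A minimax net is $\mathcal{N} = \langle V_{min}, V_{max}, E, L\rangle$ with $V_{min},V_{max}$ non-empty disjoint sets of nodes, $E: (V_{min}\times V_{max})\cup(V_{max}\times V_{min}) \to [0,1]$ a fuzzy set of edges, and $L: V_{min}\to[0,1]$; positive edges are pairs with positive $E$-value. A marking is a function $M: V_{min}\cup V_{max}\to[0,1]$; it is correct if for all $x\in V_{min}$, $y\in V_{max}$: $M(x)\leq L(x)$, $M(x)\leq\bigwedge_{z\in V_{max}}(E(z,x)\Rightarrow M(z))$, and $M(y)\leq\bigvee_{z\in V_{min}}(E(z,y)\otimes M(z))$. The minimax net corresponding to $\langle G,G'\rangle$ via directed simulation is $\mathcal{N} = \langle V_{min}, V_{max}, E'', L''\rangle$ with $V_{min} = V\times V'$; $V_{max} = (V\times V'\times\Sigma_E)\cup(V'\times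 V\times\Sigma_E)$ (the two parts being regarded as disjoint); $E''$ the fuzzy set $\{\langle\langle y,y'\rangle,\langle x',y,r\rangle\rangle : E'_r(x',y') \mid y\in V, x',y'\in V', r\in\Sigma_E\}$ $\lor$ $\{\langle\langle x',y,r\rangle,\langle x,x'\rangle\rangle : E_r(x,y) \mid x,y\in V, x'\in V', r\in\Sigma_E\}$ $\lor$ $\{\langle\langle y,y'\rangle,\langle x,y',r\rangle\rangle : E_r(x,y)\mid x,y\in V, y'\in V', r\in\Sigma_E\}$ $\lor$ $\{\langle\langle x,y',r\rangle,\langle x,x'\rangle\rangle : E'_r(x',y')\mid x\in V, x',y'\in V', r\in\Sigma_E\}$; and $L''(\langle x,x'\rangle) = \bigwedge_{p\in\Sigma_V}(L(x)(p)\Rightarrow L'(x')(p))$. Algorithm 1 (input: a finite minimax net $\langle V_{min},V_{max},E,L\rangle$; $\mathit{Succ}(x)$, $\mathit{Pred}(x)$ denote the sets of successors/predecessors of $x$ via positive edges). It maintains a marking $M$, Boolean flags $x.\mathit{done}$ ($x\in V_{min}$) and $\langle z,y\rangle.\mathit{done}$ (positive edges in $V_{min}\times V_{max}$), counters $y.\mathit{count}$ ($y\in V_{max}$), and a priority queue $Q$ (smaller keys have higher priority; a node may occur several times, each occurrence keeping its insertion key). Initialization: $Q$ empty. For each $x\in V_{min}$: $M(x):=L(x)$, $x.\mathit{done}:=\mathit{false}$, insert $x$ into $Q$ with key $M(x)$. For each $y\in V_{max}$: $M(y):=0$, $y.\mathit{count}:=|\mathit{Pred}(y)|$, and if $y.\mathit{count}=0$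 insert $y$ into $Q$ with key $M(y)$. For each positive edge $\langle z,y\rangle\in V_{min}\times V_{max}$: $\langle z,y\rangle.\mathit{done}:=\mathit{false}$, insert it into $Q$ with key $E(z,y)$. Main loop: while $Q$ is not empty, extract a smallest-key object $\mathit{obj}$ (ties arbitrary), and: (1) if $\mathit{obj}$ is $z\in V_{max}$: for each $x\in\mathit{Succ}(z)$ with $\lnot x.\mathit{done}$ and $E(z,x)>M(z)$, set $M(x):=M(z)$ and insert $x$ into $Q$ with key $M(x)$; (2) else if $\mathit{obj}$ is $z\in V_{min}$ with $\lnot z.\mathit{done}$: for each $y\in\mathit{Succ}(z)$ with $\lnot\langle z,y\rangle.\mathit{done}$, set $M(y):=M(z)$, $\langle z,y\rangle.\mathit{done}:=\mathit{true}$, decrease $y.\mathit{count}$ by 1, and if it becomes $0$ insert $y$ into $Q$ with key $M(y)$; then set $z.\mathit{done}:=\mathit{true}$; (3) else if $\mathit{obj}$ is an edge $\langle z,y\rangle$ with $\lnot\langle z,y\rangle.\mathit{done}$: set $M(y):=E(z,y)$, $\langle z,y\rangle.\mathit{done}:=\mathit{true}$, decrease $y.\mathit{count}$ by 1, and if it becomes $0$ insert $y$ into $Q$ with key $M(y)$. Otherwise ignore $\mathit{obj}$. Finally return $M$. Algorithm 2 (input: finite fuzzy graphs $G$, $G'$ over the same signature): construct the minimax net $\mathcal{N} = \langle V_{min},V_{max},E'',L''\rangle$ corresponding to $\langle G,G'\rangle$ via directed simulation, with $V_{min}$ sorted according to $L''$ and the positive edges in $V_{min}\times V_{max}$ sorted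 according to $E''$; apply Algorithm 1 to $\mathcal{N}$, obtaining $M$; return the restriction $M|_{V_{min}}$. -}

module Defs where

open import Level using (Level; 0ℓ; _⊔_) renaming (suc to lsuc)
open import Data.Bool using (Bool; true; false; if_then_else_; not; _∧_)
open import Data.Empty using (⊥)
open import Data.Fin using (Fin; toℕ; fromℕ<)
import Data.Fin.Properties as Fin
open import Data.List
  using (List; []; _∷_; _++_; map; filter; foldl; length; allFin; cartesianProduct)
import Data.List.Properties as List
open import Data.List.Membership.Propositional using (_∈_)
import Data.List.Membership.Propositional.Properties as ∈
open import Data.List.Relation.Binary.Permutation.Propositional using (_↭_)
open import Data.List.Relation.Unary.All using (All)
open import Data.List.Relation.Unary.Unique.Propositional using (Unique)
import Data.List.Relation.Unary.Unique.Propositional.Properties as Unique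
open import Data.Nat as ℕ using (ℕ; _+_; _∸_; pred; NonZero)
import Data.Nat.Properties as ℕ
open import Data.Product using (_×_; _,_; proj₁; proj₂; ∃; ∃-syntax; curry)
import Data.Product.Properties as Prod
open import Data.Rational as ℚ using (ℚ; 0ℚ; 1ℚ)
import Data.Rational.Properties as ℚ
open import Data.Sum using (_⊎_; inj₁; inj₂)
import Data.Sum.Properties as Sum
open import Data.Vec.Functional using (foldr)
open import Relation.Binary
  using (DecTotalOrder; Decidable; DecidableEquality; Maximum; Minimum; tri<; tri≈; tri>)
open import Relation.Binary.PropositionalEquality using (_≡_; refl; cong)
open import Relation.Nullary using (¬_; Dec; yes; no; does; ¬?; contradiction)
open import Relation.Nullary.Decidable using (_×-dec_)
open import Function using (id; _∘_)

------------------------------------------------------------------------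
-- A real number in [0,1] is a (two-sided, located) Dedekind cut that contains
-- every negative rational in its lower part and every rational above 1 in
-- its upper part.
record UnitInterval : Set₁ where
  field
    Lower Upper   : ℚ → Set
    lower-bound   : ∀ {q} → q ℚ.< 0ℚ → Lower q
    upper-bound   : ∀ {q} → 1ℚ ℚ.< q → Upper q
    lower-closed  : ∀ {p q} → p ℚ.< q → Lower q → Lower p
    upper-closed  : ∀ {p q} → p ℚ.< q → Upper p → Upper q
    lower-rounded : ∀ {p} → Lower p → ∃[ q ] p ℚ.< q × Lower q
    upper-rounded : ∀ {q} → Upper q → ∃[ p ] p ℚ.< q × Upper p
    disjoint      : ∀ {q} → Lower q → Upper q → ⊥
    located       : ∀ {p q} → p ℚ.< q → Lower p ⊎ Upper q

open UnitInterval

infix 4 _≤ᵢ_ _≈ᵢ_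

_≤ᵢ_ : UnitInterval → UnitInterval → Set
x ≤ᵢ y = ∀ q → Lower x q → Lower y q

_≈ᵢ_ : UnitInterval → UnitInterval → Set
x ≈ᵢ y = x ≤ᵢ y × y ≤ᵢ x

rational : (a : ℚ) → 0ℚ ℚ.≤ a → a ℚ.≤ 1ℚ → UnitInterval
rational a 0≤a a≤1 = record
  { Lower         = ℚ._< a
  ; Upper         = a ℚ.<_
  ; lower-bound   = λ q<0 → ℚ.<-≤-trans q<0 0≤a
  ; upper-bound   = λ 1<q → ℚ.≤-<-trans a≤1 1<q
  ; lower-closed  = ℚ.<-trans
  ; upper-closed  = λ p<q a<p → ℚ.<-trans a<p p<q
  ; lower-rounded = λ p<a → let q , p<q , q<a = ℚ.<-dense p<a in q , p<q , q<a
  ; upper-rounded = λ a<q → let p , a<p , p<q = ℚ.<-dense a<q in p , p<q , a<p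
  ; disjoint      = ℚ.<-asym
  ; located       = located′
  }
  where
  located′ : ∀ {p q} → p ℚ.< q → p ℚ.< a ⊎ a ℚ.< q
  located′ {p} p<q with p ℚ.<? a
  ... | yes p<a = inj₁ p<a
  ... | no  p≮a = inj₂ (ℚ.≤-<-trans (ℚ.≮⇒≥ p≮a) p<q)

0≤1 : 0ℚ ℚ.≤ 1ℚ
0≤1 = ℚ.<⇒≤ (ℚ.positive⁻¹ 1ℚ)

0ᵢ 1ᵢ : UnitInterval
0ᵢ = rational 0ℚ ℚ.≤-refl 0≤1
1ᵢ = rational 1ℚ 0≤1 ℚ.≤-refl

≰ᵢ⇒≥ᵢ : ∀ x y → ¬ x ≤ᵢ y → y ≤ᵢ x
≰ᵢ⇒≥ᵢ x y x≰y q q∈y with lower-rounded y q∈y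
... | r , q<r , r∈y with located x q<r
... | inj₁ q∈x = q∈x
... | inj₂ r∈Ux = contradiction x≤y x≰y
  where
  x≤y : x ≤ᵢ y
  x≤y p p∈x with ℚ.<-cmp p r
  ... | tri< p<r _ _    = lower-closed y p<r r∈y
  ... | tri≈ _ refl _   = contradiction r∈Ux (disjoint x p∈x)
  ... | tri> _ _ r<p    = contradiction r∈Ux (disjoint x (lower-closed x r<p p∈x))

------------------------------------------------------------------------
-- All that the Gödel operations need of [0,1].
record BoundedChain c ℓ₁ ℓ₂ : Set (lsuc (c ⊔ ℓ₁ ⊔ ℓ₂)) where
  field
    decTotalOrder : DecTotalOrder c ℓ₁ ℓ₂
  open DecTotalOrder decTotalOrder public
  field
    𝟎 𝟏     : Carrier
    minimum : Minimum _≤_ 𝟎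
    maximum : Maximum _≤_ 𝟏

-- The order of [0,1] is decidable classically but not constructively, so a
-- comparison test is an argument; it is also the basic operation on truth
-- values of the machine below.
[0,1] : Decidable _≤ᵢ_ → BoundedChain (lsuc 0ℓ) 0ℓ 0ℓ
[0,1] _≤?_ = record
  { decTotalOrder = record
    { Carrier = UnitInterval
    ; _≈_     = _≈ᵢ_
    ; _≤_     = _≤ᵢ_
    ; isDecTotalOrder = record
      { isTotalOrder = record
        { isPartialOrder = record
          { isPreorder = record
            { isEquivalence = record
              { refl  = (λ _ → id) , (λ _ → id)
              ; sym   = λ (x≤y , y≤x) → y≤x , x≤y
              ; trans = λ (x≤y , y≤x) (y≤z , z≤y) →
                  (λ q → y≤z q ∘ x≤y q) , (λ q → y≤x q ∘ z≤y q)
              }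
            ; reflexive = proj₁
            ; trans     = λ x≤y y≤z q → y≤z q ∘ x≤y q
            }
          ; antisym = λ x≤y y≤x → x≤y , y≤x
          }
        ; total = total
        }
      ; _≟_  = λ x y → (x ≤? y) ×-dec (y ≤? x)
      ; _≤?_ = _≤?_
      }
    }
  ; 𝟎       = 0ᵢ
  ; 𝟏       = 1ᵢ
  ; minimum = λ x q → lower-bound x
  ; maximum = below-1
  }
  where
  total : ∀ x y → x ≤ᵢ y ⊎ y ≤ᵢ x
  total x y with x ≤? y
  ... | yes x≤y = inj₁ x≤y
  ... | no  x≰y = inj₂ (≰ᵢ⇒≥ᵢ x y x≰y)

  below-1 : ∀ x → x ≤ᵢ 1ᵢ
  below-1 x q q∈x with lower-rounded x q∈x
  ... | r , q<r , r∈x with q ℚ.<? 1ℚ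
  ... | yes q<1 = q<1
  ... | no  q≮1 = contradiction
    (upper-bound x (ℚ.≤-<-trans (ℚ.≮⇒≥ q≮1) q<r)) (disjoint x r∈x)

------------------------------------------------------------------------
record Finite (X : Set) : Set where
  field
    _≟_      : DecidableEquality X
    elements : List X
    complete : ∀ x → x ∈ elements
    unique   : Unique elements

open Finite

Fin-finite : ∀ n → Finite (Fin n)
Fin-finite n = record
  { _≟_      = Fin._≟_
  ; elements = allFin n
  ; complete = ∈.∈-allFin
  ; unique   = Unique.allFin⁺ n
  }

×-finite : ∀ {X Y} → Finite X → Finite Y → Finite (X × Y)
×-finite X Y = record
  { _≟_      = Prod.≡-dec (_≟_ X) (_≟_ Y)
  ; elements = cartesianProduct (elements X) (elements Y)
  ; complete = λ (x , y) → ∈.∈-cartesianProduct⁺ (complete X x) (complete Y y)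
  ; unique   = Unique.cartesianProduct⁺ (unique X) (unique Y)
  }

⊎-finite : ∀ {X Y} → Finite X → Finite Y → Finite (X ⊎ Y)
⊎-finite X Y = record
  { _≟_      = Sum.≡-dec (_≟_ X) (_≟_ Y)
  ; elements = map inj₁ (elements X) ++ map inj₂ (elements Y)
  ; complete = λ where
      (inj₁ x) → ∈.∈-++⁺ˡ (∈.∈-map⁺ inj₁ (complete X x))
      (inj₂ y) → ∈.∈-++⁺ʳ _ (∈.∈-map⁺ inj₂ (complete Y y))
  ; unique   = Unique.++⁺
      (Unique.map⁺ Sum.inj₁-injective (unique X))
      (Unique.map⁺ Sum.inj₂-injective (unique Y))
      λ (p , q) → inj-disjoint (∈.∈-map⁻ inj₁ p) (∈.∈-map⁻ inj₂ q)
  }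
  where
  inj-disjoint : ∀ {A B : Set} {P : A → Set} {Q : B → Set} {v : A ⊎ B} →
                 ∃[ x ] P x × v ≡ inj₁ x → ∃[ y ] Q y × v ≡ inj₂ y → ⊥
  inj-disjoint (_ , _ , refl) (_ , _ , ())

update : ∀ {a} {X : Set} {B : Set a} → DecidableEquality X → X → B → (X → B) → X → B
update _≟_ x b f y = if does (x ≟ y) then b else f y

------------------------------------------------------------------------
-- Programs of a real RAM.  Memory consists of arrays named by numbers and subscripted by finitely many
-- numbers (a scalar is an array without subscripts): integer arrays, and
-- arrays of truth values.  Integers can be added, subtracted (with cut-off at 0)
-- and compared; truth values can only be copied and compared.

Name : Set
Name = ℕ

data IntExp : Set where
  lit     : ℕ → IntExp
  int     : Name → List IntExp → IntExp
  _⊕_ _⊖_ : IntExp → IntExp → IntExp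

data ValExp : Set where
  zeroᵥ oneᵥ : ValExp
  val        : Name → List IntExp → ValExp

data Test : Set where
  _≤ⁿ_ : IntExp → IntExp → Test
  _≤ᵛ_ : ValExp → ValExp → Test

infixr 5 _⨾_

-- `emit` appends a tuple of integers to the output stream.
data Program : Set where
  skip   : Program
  setInt : Name → List IntExp → IntExp → Program
  setVal : Name → List IntExp → ValExp → Program
  emit   : List IntExp → Program
  _⨾_    : Program → Program → Program
  ifte   : Test → Program → Program → Program
  while  : Test → Program → Program

-- The time for evaluating an expression is the number of its operations.

intTime  : IntExp → ℕ
intsTime : List IntExp → ℕ
intTime (lit _)    = 1
intTime (int _ is) = 1 + intsTime is
intTime (i ⊕ j)    = 1 + (intTime i + intTime j)
intTime (i ⊖ j)    = 1 + (intTime i + intTime j)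
intsTime []       = 0
intsTime (i ∷ is) = intTime i + intsTime is

valTime : ValExp → ℕ
valTime zeroᵥ      = 1
valTime oneᵥ       = 1
valTime (val _ is) = 1 + intsTime is

testTime : Test → ℕ
testTime (i ≤ⁿ j) = 1 + (intTime i + intTime j)
testTime (a ≤ᵛ b) = 1 + (valTime a + valTime b)

------------------------------------------------------------------------

module Gödel {c ℓ₁ ℓ₂} (𝕀 : BoundedChain c ℓ₁ ℓ₂) where

  open BoundedChain 𝕀
    using (Carrier; _≈_; _≤_; _≤?_; 𝟎; 𝟏)
  open DecTotalOrder (BoundedChain.decTotalOrder 𝕀) using (totalOrder)
  open import Algebra.Construct.NaturalChoice.Min totalOrder using (_⊓_)

  infix  4 _>_ _>?_
  infixr 7 _⊗_
  infixr 6 _⇒_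

  _>_ : Carrier → Carrier → Set ℓ₂
  a > b = ¬ a ≤ b

  _>?_ : Decidable _>_
  a >? b = ¬? (a ≤? b)

  _⊗_ _⇒_ : Carrier → Carrier → Carrier
  a ⊗ b = a ⊓ b
  a ⇒ b = if does (a >? b) then b else 𝟏

  ⋀ : ∀ {n} → (Fin n → Carrier) → Carrier
  ⋀ = foldr _⊓_ 𝟏

  ----------------------------------------------------------------------
  -- Finite fuzzy graphs, with the vertices, the vertex labels and the edge labels
  -- numbered.
  record FuzzyGraph (σV σE : ℕ) : Set c where
    field
      size     : ℕ
      nonEmpty : NonZero size
    V : Set
    V = Fin size
    field
      E : V → Fin σE → V → Carrier
      L : V → Fin σV → Carrier

  positiveEdges : ∀ {σV σE} → FuzzyGraph σV σE → ℕ
  positiveEdges {σE = σE} G =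
    length (filter (λ (x , r , y) → E x r y >? 𝟎)
      (cartesianProduct (allFin size) (cartesianProduct (allFin σE) (allFin size))))
    where open FuzzyGraph G

  module _ {σV σE} (G G′ : FuzzyGraph σV σE) where

    open FuzzyGraph G
    open FuzzyGraph G′ renaming (V to V′; E to E′; L to L′; size to size′)
      hiding (nonEmpty)

    record IsDirectedSimulation (Z : V → V′ → Carrier) : Set (c ⊔ ℓ₂) where
      field
        labels   : ∀ p x x′ → Z x x′ ≤ (L x p ⇒ L′ x′ p)
        forward  : ∀ r x y x′ → ∃[ y′ ] Z x x′ ⊗ E x r y ≤ E′ x′ r y′ ⊗ Z y y′
        backward : ∀ r x x′ y′ → ∃[ y ] Z x x′ ⊗ E′ x′ r y′ ≤ E x r y ⊗ Z y y′

    IsGreatestDirectedSimulation : (V → V′ → Carrier) → Set (c ⊔ ℓ₂)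
    IsGreatestDirectedSimulation Z =
      IsDirectedSimulation Z ×
      (∀ Z₁ → IsDirectedSimulation Z₁ → ∀ x x′ → Z₁ x x′ ≤ Z x x′)

  ----------------------------------------------------------------------
  -- Vmin and Vmax are distinct types, hence disjoint.  Neither is required to
  -- be non-empty, so that a signature without edge labels is allowed.
  record MinimaxNet : Set (lsuc 0ℓ ⊔ c) where
    field
      Vmin Vmax   : Set
      Vmin-finite : Finite Vmin
      Vmax-finite : Finite Vmax
      E↑          : Vmin → Vmax → Carrier
      E↓          : Vmax → Vmin → Carrier
      L           : Vmin → Carrier

  ----------------------------------------------------------------------
  module MarkingAlgorithm (N : MinimaxNet) where

    open MinimaxNet N

    data Object : Set where
      minNode : Vmin → Object
      maxNode : Vmax → Object
      edge    : Vmin → Vmax → Object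

    -- The priority queue is a list, read up to permutation.
    record Config : Set c where
      field
        Mmin     : Vmin → Carrier
        Mmax     : Vmax → Carrier
        done     : Vmin → Bool
        edgeDone : Vmin × Vmax → Bool
        count    : Vmax → ℕ
        queue    : List (Object × Carrier)

    open Config public

    succMin : Vmin → List Vmax
    succMin z = filter (λ y → E↑ z y >? 𝟎) (elements Vmax-finite)

    succMax : Vmax → List Vmin
    succMax z = filter (λ x → E↓ z x >? 𝟎) (elements Vmin-finite)

    predMax : Vmax → List Vmin
    predMax y = filter (λ z → E↑ z y >? 𝟎) (elements Vmin-finite)

    initial : Config
    initial = record
      { Mmin     = L
      ; Mmax     = λ _ → 𝟎
      ; done     = λ _ → false
      ; edgeDone = λ _ → false
      ; count    = λ y → length (predMax y)
      ; queue    =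
          map (λ x → minNode x , L x) (elements Vmin-finite)
          ++ map (λ y → maxNode y , 𝟎)
               (filter (λ y → length (predMax y) ℕ.≟ 0) (elements Vmax-finite))
          ++ map (λ (z , y) → edge z y , E↑ z y)
               (filter (λ (z , y) → E↑ z y >? 𝟎)
                 (cartesianProduct (elements Vmin-finite) (elements Vmax-finite)))
      }

    -- The body of the loop run when z ∈ Vmax is extracted.
    lower : Vmax → Config → Vmin → Config
    lower z C x =
      if not (done C x) ∧ does (E↓ z x >? Mmax C z)
      then record C
        { Mmin  = update (_≟_ Vmin-finite) x (Mmax C z) (Mmin C)
        ; queue = (minNode x , Mmax C z) ∷ queue C
        }
      else C

    -- What an extracted node z ∈ Vmin does to each successor y, and an extracted
    -- edge ⟨z,y⟩ to its end; v is M(z) or E(z,y).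
    settle : Carrier → Vmin → Config → Vmax → Config
    settle v z C y =
      if edgeDone C (z , y) then C else record C
        { Mmax     = update (_≟_ Vmax-finite) y v (Mmax C)
        ; edgeDone = update (_≟_ (×-finite Vmin-finite Vmax-finite)) (z , y) true (edgeDone C)
        ; count    = update (_≟_ Vmax-finite) y (pred (count C y)) (count C)
        ; queue    = if does (pred (count C y) ℕ.≟ 0)
                     then (maxNode y , v) ∷ queue C
                     else queue C
        }

    setDone : Vmin → Config → Config
    setDone z C = record C { done = update (_≟_ Vmin-finite) z true (done C) }

    process : Object → Config → Config
    process (maxNode z) C = foldl (lower z) C (succMax z)
    process (minNode z) C =
      if done C z then C else setDone z (foldl (settle (Mmin C z) z) C (succMin z))
    process (edge z y)  C = settle (E↑ z y) z C y

    -- One iteration of the main loop, extracting the given object.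
    data Step (C : Config) : Object → Config → Set (c ⊔ ℓ₂) where
      extract : ∀ {obj k Q} →
                queue C ↭ (obj , k) ∷ Q →
                All (λ (_ , k₁) → k ≤ k₁) Q →
                Step C obj (process obj (record C { queue = Q }))

    -- Every execution from the given configuration reaches, after finitely
    -- many steps, one with an empty queue.
    data Terminating (C : Config) : Set (c ⊔ ℓ₂) where
      stop : queue C ≡ [] → Terminating C
      next : (∃[ obj ] ∃[ C₁ ] Step C obj C₁) →
             (∀ {obj C₁} → Step C obj C₁ → Terminating C₁) →
             Terminating C

    -- Complete executions, with the sequence of extracted objects.
    data Run (C : Config) : List Object → Config → Set (c ⊔ ℓ₂) where
      stop : queue C ≡ [] → Run C [] C
      _then_ : ∀ {obj objs C₁ C₂} →
               Step C obj C₁ → Run C₁ objs C₂ → Run C (obj ∷ objs) C₂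

  ----------------------------------------------------------------------
  module _ {σV σE} (G G′ : FuzzyGraph σV σE) where

    open FuzzyGraph G
    open FuzzyGraph G′ renaming (V to V′; E to E′; L to L′; size to size′)
      hiding (nonEmpty)

    -- inj₁ (x , y′ , r) and inj₂ (x′ , y , r) are the nodes ⟨x,y′,r⟩ and
    -- ⟨x′,y,r⟩.  The four fuzzy sets whose join is the edge relation have
    -- disjoint domains, one for each clause below.
    net : MinimaxNet
    net = record
      { Vmin        = V × V′
      ; Vmax        = (V × V′ × Fin σE) ⊎ (V′ × V × Fin σE)
      ; Vmin-finite = ×-finite (Fin-finite _) (Fin-finite _)
      ; Vmax-finite = ⊎-finite
          (×-finite (Fin-finite _) (×-finite (Fin-finite _) (Fin-finite _)))
          (×-finite (Fin-finite _) (×-finite (Fin-finite _) (Fin-finite _)))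
      ; E↑ = λ where
          (y , y′) (inj₂ (x′ , y₁ , r)) → if does (y Fin.≟ y₁) then E′ x′ r y′ else 𝟎
          (y , y′) (inj₁ (x , y′₁ , r)) → if does (y′ Fin.≟ y′₁) then E x r y else 𝟎
      ; E↓ = λ where
          (inj₂ (x′ , y , r)) (x , x′₁) → if does (x′ Fin.≟ x′₁) then E x r y else 𝟎
          (inj₁ (x , y′ , r)) (x₁ , x′) → if does (x Fin.≟ x₁) then E′ x′ r y′ else 𝟎
      ; L = λ (x , x′) → ⋀ (λ p → L x p ⇒ L′ x′ p)
      }

    open MarkingAlgorithm net

    -- SimulationAlgorithm objs Z: some execution on G and G′, in the course of which the
    -- objects objs are extracted from the queue, returns Z.
    data SimulationAlgorithm : List Object → (V → V′ → Carrier) → Set (c ⊔ ℓ₂) where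
      returns : ∀ {objs C} → Run initial objs C → SimulationAlgorithm objs (curry (Mmin C))

    SimulationAlgorithmTerminates : Set (c ⊔ ℓ₂)
    SimulationAlgorithmTerminates = Terminating initial

    encodeMin : V × V′ → List ℕ
    encodeMin (x , x′) = 0 ∷ toℕ x ∷ toℕ x′ ∷ []

    encodeMax : (V × V′ × Fin σE) ⊎ (V′ × V × Fin σE) → List ℕ
    encodeMax (inj₁ (x , y′ , r)) = 1 ∷ toℕ x ∷ toℕ y′ ∷ toℕ r ∷ []
    encodeMax (inj₂ (x′ , y , r)) = 2 ∷ toℕ x′ ∷ toℕ y ∷ toℕ r ∷ []

    encode : Object → List ℕ
    encode (minNode x) = encodeMin x
    encode (maxNode y) = encodeMax y
    encode (edge z y)  = encodeMin z ++ encodeMax y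

  ----------------------------------------------------------------------
  record State : Set c where
    field
      ints   : Name → List ℕ → ℕ
      vals   : Name → List ℕ → Carrier
      output : List (List ℕ)

  open State public

  assign : ∀ {a} {B : Set a} → Name → List ℕ → B → (Name → List ℕ → B) → Name → List ℕ → B
  assign a is b f = update ℕ._≟_ a (update (List.≡-dec ℕ._≟_) is b (f a)) f

  evalInt  : State → IntExp → ℕ
  evalInts : State → List IntExp → List ℕ
  evalInt s (lit n)    = n
  evalInt s (int a is) = ints s a (evalInts s is)
  evalInt s (i ⊕ j)    = evalInt s i + evalInt s j
  evalInt s (i ⊖ j)    = evalInt s i ∸ evalInt s j
  evalInts s []       = []
  evalInts s (i ∷ is) = evalInt s i ∷ evalInts s is

  evalVal : State → ValExp → Carrier
  evalVal s zeroᵥ      = 𝟎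
  evalVal s oneᵥ       = 𝟏
  evalVal s (val a is) = vals s a (evalInts s is)

  test : State → Test → Bool
  test s (i ≤ⁿ j) = does (evalInt s i ℕ.≤? evalInt s j)
  test s (a ≤ᵛ b) = does (evalVal s a ≤? evalVal s b)

  infix 3 ⟨_,_⟩⇓[_]_

  -- ⟨ P , s ⟩⇓[ t ] s₁: started in s, P halts in s₁ after t operations.
  data ⟨_,_⟩⇓[_]_ : Program → State → ℕ → State → Set c where
    skip⇓ : ∀ {s} → ⟨ skip , s ⟩⇓[ 1 ] s
    setInt⇓ : ∀ {s a is i} →
      ⟨ setInt a is i , s ⟩⇓[ 1 + (intsTime is + intTime i) ]
        record s { ints = assign a (evalInts s is) (evalInt s i) (ints s) }
    setVal⇓ : ∀ {s a is v} →
      ⟨ setVal a is v , s ⟩⇓[ 1 + (intsTime is + valTime v) ]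
        record s { vals = assign a (evalInts s is) (evalVal s v) (vals s) }
    emit⇓ : ∀ {s is} →
      ⟨ emit is , s ⟩⇓[ 1 + intsTime is ]
        record s { output = output s ++ evalInts s is ∷ [] }
    seq⇓ : ∀ {P Q s s₁ s₂ t u} →
      ⟨ P , s ⟩⇓[ t ] s₁ → ⟨ Q , s₁ ⟩⇓[ u ] s₂ → ⟨ P ⨾ Q , s ⟩⇓[ t + u ] s₂
    if-true⇓ : ∀ {b P Q s s₁ t} → test s b ≡ true →
      ⟨ P , s ⟩⇓[ t ] s₁ → ⟨ ifte b P Q , s ⟩⇓[ testTime b + t ] s₁
    if-false⇓ : ∀ {b P Q s s₁ t} → test s b ≡ false →
      ⟨ Q , s ⟩⇓[ t ] s₁ → ⟨ ifte b P Q , s ⟩⇓[ testTime b + t ] s₁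
    while-true⇓ : ∀ {b P s s₁ s₂ t u} → test s b ≡ true →
      ⟨ P , s ⟩⇓[ t ] s₁ → ⟨ while b P , s₁ ⟩⇓[ u ] s₂ →
      ⟨ while b P , s ⟩⇓[ testTime b + (t + u) ] s₂
    while-false⇓ : ∀ {b P s} → test s b ≡ false →
      ⟨ while b P , s ⟩⇓[ testTime b ] s

  extend : ∀ {n} → (Fin n → Carrier) → ℕ → Carrier
  extend {n} f i with i ℕ.<? n
  ... | yes i<n = f (fromℕ< i<n)
  ... | no  _   = 𝟎

  module _ {σV σE} (G G′ : FuzzyGraph σV σE) where

    open FuzzyGraph G
    open FuzzyGraph G′ renaming (V to V′; E to E′; L to L′; size to size′)
      hiding (nonEmpty)

    -- The initial memory: the scalars 0 to 3 hold |V|, |V′|, |Σ_V|, |Σ_E|; the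
    -- arrays 0 to 3 hold the tables L, L′, E, E′.  The rest is zero.
    input : State
    input = record { ints = ints₀ ; vals = vals₀ ; output = [] }
      where
      ints₀ : Name → List ℕ → ℕ
      ints₀ 0 [] = size
      ints₀ 1 [] = size′
      ints₀ 2 [] = σV
      ints₀ 3 [] = σE
      ints₀ _ _  = 0

      vals₀ : Name → List ℕ → Carrier
      vals₀ 0 (x ∷ p ∷ [])     = extend (λ x → extend (λ p → L x p) p) x
      vals₀ 1 (x ∷ p ∷ [])     = extend (λ x → extend (λ p → L′ x p) p) x
      vals₀ 2 (x ∷ r ∷ y ∷ []) = extend (λ x → extend (λ r → extend (λ y → E x r y) y) r) x
      vals₀ 3 (x ∷ r ∷ y ∷ []) = extend (λ x → extend (λ r → extend (λ y → E′ x r y) y) r) x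
      vals₀ _ _                = 𝟎

    -- P implements the algorithm on the input G, G′ in time t: it carries out a
    -- complete execution, as witnessed by the
    -- output stream, which lists the objects extracted from the queue, and it
    -- leaves the result of this execution in array 4.
    record Implements (P : Program) (t : ℕ) : Set (c ⊔ ℓ₁ ⊔ ℓ₂) where
      field
        {final}   : State
        {objs}    : List (MarkingAlgorithm.Object (net G G′))
        {Z}       : V → V′ → Carrier
        halts     : ⟨ P , input ⟩⇓[ t ] final
        execution : SimulationAlgorithm G G′ objs Z
        trace     : output final ≡ map (encode G G′) objs
        result    : ∀ x x′ → vals final 4 (toℕ x ∷ toℕ x′ ∷ []) ≈ Z x x′

-- The keys extracted by Algorithm 1 never decrease, and a node is settled at the current key;
-- hence the final marking is correct. Every value that is written dominates any correct
-- marking, so the final one is the greatest. A correct marking of the net of ⟨G,G′⟩,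
-- restricted to Vmin, is the same as a directed simulation. Each extraction lowers a
-- potential that is linear in the size of the net.
--
-- No heap is needed for the time bound: an object that is inserted during the main loop has
-- the key that has just been extracted, which is minimal, so a stack serves. The initial queue
-- splits into O(m + n) classes of equal key, one for each positive edge of G or G′ and one for
-- each entry of L′ (a node in Vmin goes to the entry that is its key, or to a separate class
-- for the key 1). The next class is found in time O(n) from the cached minima of the rows of
-- a table of classes, and there are O((m + n) n) objects in all.

module Submission where

open import Level using (Level; _⊔_) renaming (suc to lsuc)
open import Data.Bool using (Bool; true; false; if_then_else_; not; _∧_; T)
import Data.Bool.Properties as Bool
open import Data.Empty using (⊥)
open import Data.Unit using (⊤; tt)
open import Data.Fin using (Fin; zero; suc; toℕ; fromℕ; inject₁)
import Data.Fin.Properties as Fin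
open import Data.List
  using (List; []; _∷_; _++_; map; filter; foldl; length; allFin; cartesianProduct; concatMap; tabulate)
import Data.List.Properties as List
open import Data.List.Membership.Propositional using (_∈_; _∉_; find; lose)
import Data.List.Membership.Propositional.Properties as ∈
open import Data.List.Relation.Binary.Permutation.Propositional as Perm using (_↭_; ↭-sym; ↭-trans; ↭-refl; prep; ↭-reflexive)
import Data.List.Relation.Binary.Permutation.Propositional.Properties as Perm
import Data.List.Relation.Binary.Permutation.Setoid.Properties as SetoidPerm
open import Data.List.Relation.Unary.All as All using (All; []; _∷_)
import Data.List.Relation.Unary.All.Properties as All
open import Data.List.Relation.Unary.Any using (here; there)
open import Data.List.Relation.Unary.AllPairs using ([]; _∷_)
open import Data.List.Relation.Unary.Unique.Propositional using (Unique)
import Data.List.Relation.Unary.Unique.Propositional.Properties as Unique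
open import Data.Nat as ℕ using (ℕ; zero; suc; _+_; _*_; _∸_; pred; NonZero; z≤n; s≤s)
import Data.Nat.Properties as ℕ
open import Data.Nat.Tactic.RingSolver using (solve-∀)
open import Data.Nat.Induction using (<-wellFounded)
open import Data.Nat.ListAction using (sum)
open import Data.Nat.ListAction.Properties using (sum-↭; sum-++)
open import Data.Product using (_×_; _,_; proj₁; proj₂; ∃-syntax; curry; uncurry)
import Data.Product.Properties as Prod
open import Data.Sum as Sum using (_⊎_; inj₁; inj₂; [_,_]′)
open import Function using (id; _∘_; case_of_)
open import Induction.WellFounded using (Acc; acc)
open import Relation.Binary using (DecTotalOrder; Decidable; DecidableEquality)
open import Relation.Binary.PropositionalEquality
  using (_≡_; _≢_; refl; sym; trans; cong; cong₂; subst; subst₂; setoid; module ≡-Reasoning)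
open import Relation.Nullary using (¬_; Dec; yes; no; does; contradiction)
open import Relation.Nullary.Decidable using (dec-true; dec-false)
open import Defs

-- Algorithm 1 on an arbitrary net

-- Residuation turns the condition on M(x) into min(M(x), E(z,x)) ≤ M(z), and over finitely many
-- nodes the supremum that bounds M(y) is attained. Eliminating the values on Vmax therefore leaves
-- a condition with a witness, which has the shape of the two transfer clauses of a simulation. In a
-- chain a minimum is below a bound iff one of its arguments is, so a final value on Vmax decides
-- each outgoing edge separately.
--
-- The time bound leaves no room for a sort or for any logarithmic factor, nor for visiting all
-- pairs in Vmin × Vmax, of which there are up to order n^4. Hence the program works on lists of
-- positive edges and relies on the memory being 0 at the start for the flags of all pairs. Classes
-- of equal key exist because one edge of G or G′ passes its value to an edge of the net for every
-- vertex of the other graph, and because a Gödel implication is either 1 or its right-hand side.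
-- Since the work caused by one edge of a graph is itself O(n), it has to be charged to the positive
-- edges only and not to every pair of vertices.

update-case : ∀ {a} {X : Set} {B : Set a} (_≟_ : DecidableEquality X) x (b : B) f y →
              (x ≡ y × update _≟_ x b f y ≡ b) ⊎ (x ≢ y × update _≟_ x b f y ≡ f y)
update-case _≟_ x b f y with x ≟ y
... | yes x≡y = inj₁ (x≡y , refl)
... | no  x≢y = inj₂ (x≢y , refl)

update-same : ∀ {a} {X : Set} {B : Set a} (_≟_ : DecidableEquality X) x (b : B) f →
              update _≟_ x b f x ≡ b
update-same _≟_ x b f rewrite dec-true (x ≟ x) refl = refl

update-other : ∀ {a} {X : Set} {B : Set a} (_≟_ : DecidableEquality X) {x y} (b : B) f →
               x ≢ y → update _≟_ x b f y ≡ f y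
update-other _≟_ {x} {y} b f x≢y rewrite dec-false (x ≟ y) x≢y = refl

unset : ∀ {X : Set} → (X → Bool) → List X → ℕ
unset d xs = length (filter (λ x → d x Bool.≟ false) xs)

unset-cong : ∀ {X : Set} {d d′ : X → Bool} xs → (∀ {x} → x ∈ xs → d′ x ≡ d x) →
             unset d′ xs ≡ unset d xs
unset-cong [] _ = refl
unset-cong {d = d} (x ∷ xs) eq rewrite eq (here refl) with d x
... | true  = unset-cong xs (eq ∘ there)
... | false = cong suc (unset-cong xs (eq ∘ there))

unset-flip : ∀ {X : Set} {d d′ : X → Bool} {z} {xs} → Unique xs → z ∈ xs →
             d z ≡ false → d′ z ≡ true → (∀ {x} → z ≢ x → d′ x ≡ d x) →
             unset d xs ≡ suc (unset d′ xs)
unset-flip {xs = x ∷ xs} (x∉xs ∷ _) (here refl) p q eq rewrite p | q =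
  cong suc (sym (unset-cong xs (λ y∈xs → eq (All.lookup x∉xs y∈xs))))
unset-flip {d = d} {xs = x ∷ xs} (x∉xs ∷ u) (there z∈xs) p q eq
  rewrite eq {x} (λ { refl → All.lookup x∉xs z∈xs refl }) with d x
... | true  = unset-flip u z∈xs p q eq
... | false = cong suc (unset-flip u z∈xs p q eq)

unset-zero : ∀ {X : Set} {d : X → Bool} xs → unset d xs ≡ 0 → ∀ {x} → x ∈ xs → d x ≡ true
unset-zero {d = d} (x ∷ xs) eq x∈ with d x in dx
unset-zero (x ∷ xs) eq (here refl) | true = dx
unset-zero (x ∷ xs) eq (there x∈)  | true = unset-zero xs eq x∈

unset-all : ∀ {X : Set} {d : X → Bool} xs → (∀ {x} → x ∈ xs → d x ≡ true) → unset d xs ≡ 0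
unset-all [] _ = refl
unset-all (x ∷ xs) p rewrite p (here refl) = unset-all xs (p ∘ there)

unset-none : ∀ {X : Set} (xs : List X) → unset (λ _ → false) xs ≡ length xs
unset-none [] = refl
unset-none (x ∷ xs) = cong suc (unset-none xs)

true≢false : ∀ {a} {A : Set a} {b : Bool} → b ≡ true → b ≡ false → A
true≢false refl ()

does-true : ∀ {a} {A : Set a} (d : Dec A) → does d ≡ true → A
does-true (yes p) _ = p

does-false : ∀ {a} {A : Set a} (d : Dec A) → does d ≡ false → ¬ A
does-false (no p) _ = p

∈-if⁺ : ∀ {a} {A : Set a} {x y : A} {xs} b → x ∈ xs → x ∈ (if b then y ∷ xs else xs)
∈-if⁺ true  = there
∈-if⁺ false = id

∈-if⁻ : ∀ {a} {A : Set a} {x y : A} {xs} b → x ∈ (if b then y ∷ xs else xs) →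
        (x ≡ y × b ≡ true) ⊎ x ∈ xs
∈-if⁻ true  (here p)  = inj₁ (p , refl)
∈-if⁻ true  (there p) = inj₂ p
∈-if⁻ false p         = inj₂ p

-- Partial correctness of the marking algorithm

module Marking {c ℓ₁ ℓ₂} (𝕀 : BoundedChain c ℓ₁ ℓ₂) where

  open BoundedChain 𝕀 using (Carrier; _≈_; _≤_; _≤?_; 𝟎; 𝟏)
    renaming (refl to ≤-refl; trans to ≤-trans; total to ≤-total)
  open DecTotalOrder (BoundedChain.decTotalOrder 𝕀) using (totalOrder)
  open import Algebra.Construct.NaturalChoice.Min totalOrder
    using (_⊓_; x⊓y≤x; x⊓y≤y; ⊓-glb; ⊓-sel)
  open Gödel 𝕀

  𝟎≤ : ∀ {a} → 𝟎 ≤ a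
  𝟎≤ {a} = BoundedChain.minimum 𝕀 a

  ≰⇒≥ : ∀ {a b} → ¬ a ≤ b → b ≤ a
  ≰⇒≥ {a} {b} a≰b with ≤-total a b
  ... | inj₁ a≤b = contradiction a≤b a≰b
  ... | inj₂ b≤a = b≤a

  ⊓-⊎ : ∀ {a b d} → a ⊓ b ≤ d → a ≤ d ⊎ b ≤ d
  ⊓-⊎ {a} {b} p with ≤-total a b
  ... | inj₁ a≤b = inj₁ p
  ... | inj₂ b≤a = inj₂ p

  ⊎-⊓ : ∀ {a b d} → a ≤ d ⊎ b ≤ d → a ⊓ b ≤ d
  ⊎-⊓ {a} {b} (inj₁ p) = ≤-trans (x⊓y≤x a b) p
  ⊎-⊓ {a} {b} (inj₂ p) = ≤-trans (x⊓y≤y a b) p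

  module Correctness (N : MinimaxNet) where

    open MinimaxNet N
    open MarkingAlgorithm N
    open Finite

    -- The part on Vmin of a correct marking, the part on Vmax being eliminated.
    record IsCorrect (m : Vmin → Carrier) : Set (c ⊔ ℓ₂) where
      field
        below-L : ∀ x → m x ≤ L x
        passes  : ∀ y x → ∃[ z ] m x ⊗ E↓ y x ≤ E↑ z y ⊗ m z

    open IsCorrect

    Positive : Vmin → Vmax → Set ℓ₂
    Positive z y = E↑ z y > 𝟎

    -- `settle` looks at the flag of an edge before it decrements, so every edge lowers the counter
    -- once. Counter 0 thus means that all positive edges into y have been settled.
    Counted : Config → Set
    Counted C = ∀ y → count C y ≡ unset (λ z → edgeDone C (z , y)) (predMax y)

    -- P holds for the object that is being processed; a is its key.
    record Invariant (P : Object → Set) (a : Carrier) (C : Config) : Set (c ⊔ ℓ₂) where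
      field
        -- This and the next field separate the values already given to Vmax from the keys still to
        -- come; that keys never decrease is expressed in this way.
        max≤a      : ∀ y → Mmax C y ≤ a
        a≤key      : ∀ {o k} → (o , k) ∈ queue C → a ≤ k
        -- Stale occurrences of x keep keys at or above its current value, while by `minQueued` an
        -- undone x has some occurrence with a key at most that value. So the first one extracted
        -- carries exactly M(x).
        minKey     : ∀ {x k} → (minNode x , k) ∈ queue C → Mmin C x ≤ k
        minQueued  : ∀ x → done C x ≡ false →
                     P (minNode x) ⊎ ∃[ k ] (minNode x , k) ∈ queue C × k ≤ Mmin C x
        edgeKey    : ∀ {z y k} → (edge z y , k) ∈ queue C →
                     Positive z y × E↑ z y ≤ k × k ≤ E↑ z y
        edgeQueued : ∀ z y → Positive z y → edgeDone C (z , y) ≡ false →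
                     P (edge z y) ⊎ ∃[ k ] (edge z y , k) ∈ queue C × k ≤ E↑ z y
        maxKey     : ∀ {y k} → (maxNode y , k) ∈ queue C →
                     count C y ≡ 0 × Mmax C y ≤ k × k ≤ Mmax C y
        -- Once its counter is 0, y is being processed, or waits, or has all its outgoing conditions
        -- established. Only the last alternative survives in an empty queue.
        maxQueued  : ∀ y → count C y ≡ 0 →
                     P (maxNode y) ⊎ (∃[ k ] (maxNode y , k) ∈ queue C)
                     ⊎ (∀ x → Mmin C x ≤ Mmax C y ⊎ E↓ y x ≤ Mmax C y)
        counted    : Counted C
        done≤a     : ∀ x → done C x ≡ true → Mmin C x ≤ a
        doneEdges  : ∀ z y → done C z ≡ true → Positive z y → edgeDone C (z , y) ≡ true
        min≤L      : ∀ x → Mmin C x ≤ L x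
        -- This supplies the condition on M(y): a single z already has E(z,y) ⊗ M(z) at least M(y),
        -- as the supremum requires.
        attained   : ∀ y → ∃[ z ] Mmax C y ≤ E↑ z y × Mmax C y ≤ Mmin C z
        above      : ∀ m → IsCorrect m → ∀ x → m x ≤ Mmin C x
        -- As soon as all edges into y are done, these bounds together make M(y) dominate the
        -- supremum formed with any competitor m.
        aboveEdge  : ∀ m → IsCorrect m → ∀ z y → Positive z y → edgeDone C (z , y) ≡ true →
                     E↑ z y ≤ Mmax C y ⊎ m z ≤ Mmax C y

    open Invariant

    ∈-predMax : ∀ {z y} → Positive z y → z ∈ predMax y
    ∈-predMax {z} {y} p = ∈.∈-filter⁺ (λ z → E↑ z y >? 𝟎) (complete Vmin-finite z) p

    ∈-succMin : ∀ {z y} → Positive z y → y ∈ succMin z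
    ∈-succMin {z} {y} p = ∈.∈-filter⁺ (λ y → E↑ z y >? 𝟎) (complete Vmax-finite y) p

    predMax-unique : ∀ y → Unique (predMax y)
    predMax-unique y = Unique.filter⁺ (λ z → E↑ z y >? 𝟎) (unique Vmin-finite)

    settled : Carrier → Vmin → Config → Vmax → Config
    settled v z C y = record C
      { Mmax     = update (_≟_ Vmax-finite) y v (Mmax C)
      ; edgeDone = update (_≟_ (×-finite Vmin-finite Vmax-finite)) (z , y) true (edgeDone C)
      ; count    = update (_≟_ Vmax-finite) y (pred (count C y)) (count C)
      ; queue    = if does (pred (count C y) ℕ.≟ 0)
                   then (maxNode y , v) ∷ queue C
                   else queue C
      }

    settle-done : ∀ {v z C y} → edgeDone C (z , y) ≡ true → settle v z C y ≡ C
    settle-done p rewrite p = refl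

    settle-undone : ∀ {v z C y} → edgeDone C (z , y) ≡ false → settle v z C y ≡ settled v z C y
    settle-undone p rewrite p = refl

    -- An undone edge into y is itself counted: compare the flags with those in which it alone is
    -- set. Hence the `pred` in `settle` never truncates.
    count-positive : ∀ {C z y} → Counted C → Positive z y →
                     edgeDone C (z , y) ≡ false → ∃[ n ] count C y ≡ suc n
    count-positive {C = C} {z} {y} I p q = _ , trans (I y)
      (unset-flip {d′ = update (_≟_ Vmin-finite) z true d} (predMax-unique y) (∈-predMax p) q
        (update-same (_≟_ Vmin-finite) z true d) (update-other (_≟_ Vmin-finite) true d))
      where
      d : Vmin → Bool
      d z = edgeDone C (z , y)

    settled-counted : ∀ {v C} z y → Counted C → Positive z y → edgeDone C (z , y) ≡ false →
                      Counted (settled v z C y)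
    settled-counted {v} {C} z y I pos undone y₁
      with update-case (_≟_ Vmax-finite) y (pred (count C y)) (count C) y₁
    ... | inj₁ (refl , p) = trans p (cong pred (trans (I y)
            (unset-flip (predMax-unique y) (∈-predMax pos) undone
              (update-same (_≟_ (×-finite Vmin-finite Vmax-finite)) (z , y) true (edgeDone C))
              (λ z≢x → update-other (_≟_ (×-finite Vmin-finite Vmax-finite)) true (edgeDone C)
                λ { refl → z≢x refl }))))
    ... | inj₂ (y≢y₁ , p) = trans p (trans (I y₁) (sym (unset-cong (predMax y₁)
            λ _ → update-other (_≟_ (×-finite Vmin-finite Vmax-finite)) true (edgeDone C)
              λ { refl → y≢y₁ refl })))

    -- Covers both ways of settling: v is E(z,y) when the edge is extracted and M(z) when the node
    -- is. In either case v is the minimum of the two, because the other one is still waiting with a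
    -- key at least a; the last hypothesis records which of the two bounds a competitor's
    -- contribution.
    settled-invariant : ∀ {P a v C} z y → Invariant P a C → Positive z y →
                        edgeDone C (z , y) ≡ false →
                        v ≤ a → a ≤ v → v ≤ E↑ z y → v ≤ Mmin C z →
                        (∀ m → IsCorrect m → E↑ z y ≤ v ⊎ m z ≤ v) →
                        Invariant P a (settled v z C y)
    settled-invariant {P} {a} {v} {C} z y I pos undone v≤a a≤v v≤E v≤M above-v = record
      { max≤a = max≤a′
      ; a≤key = λ e → case queue⁻ e of λ where
          (inj₁ (refl , _)) → a≤v
          (inj₂ e) → a≤key I e
      ; minKey = λ e → case queue⁻ e of λ where
          (inj₁ (() , _))
          (inj₂ e) → minKey I e
      ; minQueued = λ x q → Sum.map₂ (λ (k , e , p) → k , queue⁺ e , p) (minQueued I x q)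
      ; edgeKey = λ e → case queue⁻ e of λ where
          (inj₁ (() , _))
          (inj₂ e) → edgeKey I e
      ; edgeQueued = λ z₁ y₁ p q → Sum.map₂ (λ (k , e , p) → k , queue⁺ e , p)
          (edgeQueued I z₁ y₁ p (stillUndone q))
      ; maxKey = maxKey′
      ; maxQueued = maxQueued′
      ; counted = settled-counted {v} {C} z y (counted I) pos undone
      ; done≤a = done≤a I
      ; doneEdges = λ z₁ y₁ q p → stillDone (doneEdges I z₁ y₁ q p)
      ; min≤L = min≤L I
      ; attained = attained′
      ; above = above I
      ; aboveEdge = aboveEdge′
      }
      where
      C′ = settled v z C y
      ≟max = _≟_ Vmax-finite
      ≟edge = _≟_ (×-finite Vmin-finite Vmax-finite)

      suc-count = count-positive {C = C} (counted I) pos undone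

      queue⁺ : ∀ {e} → e ∈ queue C → e ∈ queue C′
      queue⁺ = ∈-if⁺ (does (pred (count C y) ℕ.≟ 0))

      queue⁻ : ∀ {e} → e ∈ queue C′ → (e ≡ (maxNode y , v) × pred (count C y) ≡ 0) ⊎ e ∈ queue C
      queue⁻ e = Sum.map₁ (λ (p , q) → p , does-true (pred (count C y) ℕ.≟ 0) q)
        (∈-if⁻ (does (pred (count C y) ℕ.≟ 0)) e)

      stillUndone : ∀ {e} → edgeDone C′ e ≡ false → edgeDone C e ≡ false
      stillUndone {e} q with update-case ≟edge (z , y) true (edgeDone C) e
      ... | inj₁ (_ , p) = true≢false p q
      ... | inj₂ (_ , p) = trans (sym p) q

      stillDone : ∀ {e} → edgeDone C e ≡ true → edgeDone C′ e ≡ true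
      stillDone {e} q with update-case ≟edge (z , y) true (edgeDone C) e
      ... | inj₁ (_ , p) = p
      ... | inj₂ (_ , p) = trans p q

      max≤a′ : ∀ y₁ → Mmax C′ y₁ ≤ a
      max≤a′ y₁ with update-case ≟max y v (Mmax C) y₁
      ... | inj₁ (_ , p) rewrite p = v≤a
      ... | inj₂ (_ , p) rewrite p = max≤a I y₁

      maxKey′ : ∀ {y₁ k} → (maxNode y₁ , k) ∈ queue C′ →
                count C′ y₁ ≡ 0 × Mmax C′ y₁ ≤ k × k ≤ Mmax C′ y₁
      maxKey′ {y₁} e with queue⁻ e
      ... | inj₁ (refl , q) rewrite update-same ≟max y v (Mmax C)
                                  | update-same ≟max y (pred (count C y)) (count C) =
            q , ≤-refl , ≤-refl
      ... | inj₂ e with y₁ ≡y? y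
        where _≡y?_ = ≟max
      -- y cannot be in the queue yet: its counter is still positive, since ⟨z,y⟩ was undone.
      ...   | yes refl = case trans (sym (proj₂ suc-count)) (proj₁ (maxKey I e)) of λ ()
      ...   | no y₁≢y rewrite update-other ≟max v (Mmax C) (y₁≢y ∘ sym)
                            | update-other ≟max (pred (count C y)) (count C) (y₁≢y ∘ sym) =
            maxKey I e

      maxQueued′ : ∀ y₁ → count C′ y₁ ≡ 0 →
                   P (maxNode y₁) ⊎ (∃[ k ] (maxNode y₁ , k) ∈ queue C′)
                   ⊎ (∀ x → Mmin C x ≤ Mmax C′ y₁ ⊎ E↓ y₁ x ≤ Mmax C′ y₁)
      maxQueued′ y₁ q with update-case ≟max y (pred (count C y)) (count C) y₁
      ... | inj₁ (refl , p) rewrite dec-true (pred (count C y) ℕ.≟ 0) (trans (sym p) q) =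
            inj₂ (inj₁ (v , here refl))
      ... | inj₂ (y≢y₁ , p) rewrite update-other ≟max v (Mmax C) y≢y₁ =
            Sum.map₂ (Sum.map₁ (λ (k , e) → k , queue⁺ e)) (maxQueued I y₁ (trans (sym p) q))

      attained′ : ∀ y₁ → ∃[ z₁ ] Mmax C′ y₁ ≤ E↑ z₁ y₁ × Mmax C′ y₁ ≤ Mmin C z₁
      attained′ y₁ with update-case ≟max y v (Mmax C) y₁
      ... | inj₁ (refl , p) rewrite p = z , v≤E , v≤M
      ... | inj₂ (_ , p) rewrite p = attained I y₁

      aboveEdge′ : ∀ m → IsCorrect m → ∀ z₁ y₁ → Positive z₁ y₁ → edgeDone C′ (z₁ , y₁) ≡ true →
                   E↑ z₁ y₁ ≤ Mmax C′ y₁ ⊎ m z₁ ≤ Mmax C′ y₁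
      aboveEdge′ m mc z₁ y₁ p q
        with update-case ≟edge (z , y) true (edgeDone C) (z₁ , y₁)
           | update-case ≟max y v (Mmax C) y₁
      ... | inj₁ (refl , _) | inj₁ (_ , r) rewrite r = above-v m mc
      ... | inj₁ (refl , _) | inj₂ (y≢y , _) = contradiction refl y≢y
      -- An edge into y that was settled earlier: the overwritten value `Mmax C y` is at most a and
      -- hence at most v, so the old bound carries over.
      ... | inj₂ (_ , s) | inj₁ (refl , r) rewrite r =
            Sum.map below below (aboveEdge I m mc z₁ y p (trans (sym s) q))
        where
        below : ∀ {b} → b ≤ Mmax C y → b ≤ v
        below b≤ = ≤-trans b≤ (≤-trans (max≤a I y) a≤v)
      ... | inj₂ (_ , s) | inj₂ (_ , r) rewrite r = aboveEdge I m mc z₁ y₁ p (trans (sym s) q)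

    lowered : Vmax → Config → Vmin → Config
    lowered z C x = record C
      { Mmin  = update (_≟_ Vmin-finite) x (Mmax C z) (Mmin C)
      ; queue = (minNode x , Mmax C z) ∷ queue C
      }

    -- `lower` tests a conjunction; the two ways in which it fails are used differently, so the view
    -- keeps them apart.
    data LowerView (z : Vmax) (C : Config) (x : Vmin) : Config → Set (c ⊔ ℓ₂) where
      done-min : done C x ≡ true → LowerView z C x C
      blocked  : E↓ z x ≤ Mmax C z → LowerView z C x C
      lowering : done C x ≡ false → E↓ z x > Mmax C z → LowerView z C x (lowered z C x)

    lowerView : ∀ z C x → LowerView z C x (lower z C x)
    lowerView z C x with done C x in d | E↓ z x ≤? Mmax C z
    ... | true  | _      = done-min d
    ... | false | yes p  = blocked p
    ... | false | no  ¬p = lowering d ¬p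

    predecessors-done : ∀ {P a C y} → Invariant P a C → count C y ≡ 0 →
                        ∀ {z} → Positive z y → edgeDone C (z , y) ≡ true
    predecessors-done {y = y} I q p =
      unset-zero (predMax y) (trans (sym (counted I y)) q) (∈-predMax p)

    -- With counter 0 every positive edge into y is done and bounded by `aboveEdge`, and the other
    -- edges contribute 0. So M(y) bounds the right-hand side of `passes` whatever its witness is,
    -- and a minimum below M(y) has an argument below M(y).
    above-max : ∀ {P a C y} → Invariant P a C → count C y ≡ 0 →
                ∀ m → IsCorrect m → ∀ x → m x ≤ Mmax C y ⊎ E↓ y x ≤ Mmax C y
    above-max {C = C} {y} I q m mc x = let z , p = passes mc y x in ⊓-⊎ (≤-trans p (bound z))
      where
      bound : ∀ z → E↑ z y ⊗ m z ≤ Mmax C y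
      bound z with E↑ z y ≤? 𝟎
      ... | yes p = ⊎-⊓ (inj₁ (≤-trans p 𝟎≤))
      ... | no ¬p = ⊎-⊓ (aboveEdge I m mc z y ¬p (predecessors-done I q ¬p))

    undone-above : ∀ {P a C} → Invariant P a C → ∀ {x} → ¬ P (minNode x) → done C x ≡ false → a ≤ Mmin C x
    undone-above I {x} ¬P q with minQueued I x q
    ... | inj₁ p = contradiction p ¬P
    ... | inj₂ (k , e , k≤) = ≤-trans (a≤key I e) k≤

    -- M(z) agrees with a, and an undone x has a value at least a because it waits in the queue. So
    -- the value of x decreases, yet not below any value on Vmax, which preserves `attained`. For
    -- `above`, the test E(z,x) > M(z) excludes the second alternative of `above-max`.
    lowered-invariant : ∀ {P a C} z x → Invariant P a C → (∀ {x} → ¬ P (minNode x)) →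
                        count C z ≡ 0 → a ≤ Mmax C z →
                        done C x ≡ false → E↓ z x > Mmax C z →
                        Invariant P a (lowered z C x) × (∀ x₁ → Mmin (lowered z C x) x₁ ≤ Mmin C x₁)
    lowered-invariant {P} {a} {C} z x I ¬P q a≤ undone E> = record
      { max≤a = max≤a I
      ; a≤key = λ where
          (here refl) → a≤
          (there e)   → a≤key I e
      ; minKey = λ where
          (here refl) → subst (_≤ Mmax C z) (sym (update-same ≟min x (Mmax C z) (Mmin C))) ≤-refl
          (there e)   → ≤-trans (decreasing _) (minKey I e)
      ; minQueued = minQueued′
      ; edgeKey = λ where (there e) → edgeKey I e
      ; edgeQueued = λ z₁ y p r → Sum.map₂ (λ (k , e , s) → k , there e , s) (edgeQueued I z₁ y p r)
      ; maxKey = λ where (there e) → maxKey I e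
      ; maxQueued = λ y r → Sum.map₂ (Sum.map (λ (k , e) → k , there e)
          (λ f x₁ → Sum.map₁ (≤-trans (decreasing x₁)) (f x₁))) (maxQueued I y r)
      ; counted = counted I
      ; done≤a = λ x₁ d → ≤-trans (decreasing x₁) (done≤a I x₁ d)
      ; doneEdges = doneEdges I
      ; min≤L = λ x₁ → ≤-trans (decreasing x₁) (min≤L I x₁)
      ; attained = λ y → let z₁ , p , r = attained I y in
          z₁ , p , attained′ y z₁ r
      ; above = above′
      ; aboveEdge = aboveEdge I
      } , decreasing
      where
      C′ = lowered z C x
      ≟min = _≟_ Vmin-finite

      decreasing : ∀ x₁ → Mmin C′ x₁ ≤ Mmin C x₁
      decreasing x₁ with update-case ≟min x (Mmax C z) (Mmin C) x₁
      ... | inj₁ (refl , p) rewrite p = ≤-trans (max≤a I z) (undone-above I ¬P undone)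
      ... | inj₂ (_ , p) rewrite p = ≤-refl

      minQueued′ : ∀ x₁ → done C x₁ ≡ false →
                   P (minNode x₁) ⊎ ∃[ k ] (minNode x₁ , k) ∈ queue C′ × k ≤ Mmin C′ x₁
      minQueued′ x₁ r with update-case ≟min x (Mmax C z) (Mmin C) x₁
      ... | inj₁ (refl , p) rewrite p = inj₂ (Mmax C z , here refl , ≤-refl)
      ... | inj₂ (_ , p) rewrite p = Sum.map₂ (λ (k , e , s) → k , there e , s) (minQueued I x₁ r)

      attained′ : ∀ y z₁ → Mmax C y ≤ Mmin C z₁ → Mmax C y ≤ Mmin C′ z₁
      attained′ y z₁ r with update-case ≟min x (Mmax C z) (Mmin C) z₁
      ... | inj₁ (refl , p) rewrite p = ≤-trans (max≤a I y) a≤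
      ... | inj₂ (_ , p) rewrite p = r

      above′ : ∀ m → IsCorrect m → ∀ x₁ → m x₁ ≤ Mmin C′ x₁
      above′ m mc x₁ with update-case ≟min x (Mmax C z) (Mmin C) x₁
      ... | inj₂ (_ , p) rewrite p = above I m mc x₁
      ... | inj₁ (refl , p) rewrite p with above-max I q m mc x
      ...   | inj₁ r = r
      ...   | inj₂ r = contradiction r E>

    lower-fold : ∀ {P a} z xs {C} → Invariant P a C → (∀ {x} → ¬ P (minNode x)) →
                 count C z ≡ 0 → a ≤ Mmax C z →
                 let C′ = foldl (lower z) C xs in
                 Invariant P a C′ × Mmax C′ ≡ Mmax C × count C′ ≡ count C ×
                 (∀ x → Mmin C′ x ≤ Mmin C x) ×
                 (∀ {x} → x ∈ xs → Mmin C′ x ≤ Mmax C z ⊎ E↓ z x ≤ Mmax C z)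
    lower-fold z [] I ¬P q a≤ = I , refl , refl , (λ _ → ≤-refl) , λ ()
    lower-fold z (x ∷ xs) {C} I ¬P q a≤ with lower z C x | lowerView z C x
    ... | _ | done-min d =
      let I′ , p₁ , p₂ , dec , cov = lower-fold z xs I ¬P q a≤ in
      I′ , p₁ , p₂ , dec , λ where
        -- A node that is done got its value at an earlier key, so its value is already at most M(z)
        -- and skipping it is sound.
        (here refl) → inj₁ (≤-trans (dec x) (≤-trans (done≤a I x d) a≤))
        (there e)   → cov e
    ... | _ | blocked p =
      let I′ , p₁ , p₂ , dec , cov = lower-fold z xs I ¬P q a≤ in
      I′ , p₁ , p₂ , dec , λ where
        (here refl) → inj₂ p
        (there e)   → cov e
    ... | _ | lowering d E> =
      let I₁ , dec₁ = lowered-invariant z x I ¬P q a≤ d E>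
          I′ , p₁ , p₂ , dec , cov = lower-fold z xs I₁ ¬P q a≤ in
      I′ , p₁ , p₂ , (λ x₁ → ≤-trans (dec x₁) (dec₁ x₁)) , λ where
        (here refl) → inj₁ (≤-trans (dec x)
          (subst (_≤ Mmax C z) (sym (update-same (_≟_ Vmin-finite) x (Mmax C z) (Mmin C))) ≤-refl))
        (there e)   → cov e

    settle-fold : ∀ {P a v} z ys {C} → Invariant P a C → (∀ {z y} → ¬ P (edge z y)) →
                  (∀ {y} → y ∈ ys → Positive z y) →
                  v ≤ a → a ≤ v → v ≡ Mmin C z →
                  let C′ = foldl (settle v z) C ys in
                  Invariant P a C′ × Mmin C′ ≡ Mmin C × done C′ ≡ done C ×
                  (∀ e → edgeDone C e ≡ true → edgeDone C′ e ≡ true) ×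
                  (∀ {y} → y ∈ ys → edgeDone C′ (z , y) ≡ true)
    settle-fold z [] I ¬P pos v≤a a≤v v≡M = I , refl , refl , (λ _ → id) , λ ()
    settle-fold {a = a} {v} z (y ∷ ys) {C} I ¬P pos v≤a a≤v v≡M with edgeDone C (z , y) in d
    ... | true =
      let I′ , p₁ , p₂ , inc , all = settle-fold z ys I ¬P (pos ∘ there) v≤a a≤v v≡M in
      I′ , p₁ , p₂ , inc , λ where
        (here refl) → inc (z , y) d
        (there e)   → all e
    ... | false =
      let I₁ = settled-invariant z y I (pos (here refl)) d v≤a a≤v v≤E
                 (subst (_≤ Mmin C z) (sym v≡M) ≤-refl)
                 (λ m mc → inj₂ (subst (m z ≤_) (sym v≡M) (above I m mc z)))
          I′ , p₁ , p₂ , inc , all = settle-fold z ys I₁ ¬P (pos ∘ there) v≤a a≤v v≡M in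
      I′ , p₁ , p₂ , (λ e q → inc e (mono e q)) , λ where
        (here refl) → inc (z , y) (update-same ≟edge (z , y) true (edgeDone C))
        (there e)   → all e
      where
      ≟edge = _≟_ (×-finite Vmin-finite Vmax-finite)

      -- The edge is undone and therefore still queued with key E(z,y), which is at least a. So
      -- writing M(z) writes the minimum of M(z) and E(z,y).
      v≤E : v ≤ E↑ z y
      v≤E with edgeQueued I z y (pos (here refl)) d
      ... | inj₁ p = contradiction p ¬P
      ... | inj₂ (k , e , k≤) = ≤-trans v≤a (≤-trans (a≤key I e) k≤)

      mono : ∀ e → edgeDone C e ≡ true → edgeDone (settled v z C y) e ≡ true
      mono e q with update-case ≟edge (z , y) true (edgeDone C) e
      ... | inj₁ (_ , p) = p
      ... | inj₂ (_ , p) = trans p q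

    setDone-invariant : ∀ {P a C} z → Invariant P a C → Mmin C z ≤ a →
                        (∀ y → Positive z y → edgeDone C (z , y) ≡ true) →
                        Invariant P a (setDone z C)
    setDone-invariant {P} {a} {C} z I M≤a edges = record
      { max≤a = max≤a I
      ; a≤key = a≤key I
      ; minKey = minKey I
      ; minQueued = λ x q → minQueued I x (undone x q)
      ; edgeKey = edgeKey I
      ; edgeQueued = edgeQueued I
      ; maxKey = maxKey I
      ; maxQueued = maxQueued I
      ; counted = counted I
      ; done≤a = done≤a′
      ; doneEdges = doneEdges′
      ; min≤L = min≤L I
      ; attained = attained I
      ; above = above I
      ; aboveEdge = aboveEdge I
      }
      where
      ≟min = _≟_ Vmin-finite

      undone : ∀ x → done (setDone z C) x ≡ false → done C x ≡ false
      undone x q with update-case ≟min z true (done C) x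
      ... | inj₁ (_ , p) = true≢false p q
      ... | inj₂ (_ , p) = trans (sym p) q

      done≤a′ : ∀ x → done (setDone z C) x ≡ true → Mmin C x ≤ a
      done≤a′ x q with update-case ≟min z true (done C) x
      ... | inj₁ (refl , _) = M≤a
      ... | inj₂ (_ , p) = done≤a I x (trans (sym p) q)

      doneEdges′ : ∀ z₁ y → done (setDone z C) z₁ ≡ true → Positive z₁ y → edgeDone C (z₁ , y) ≡ true
      doneEdges′ z₁ y q with update-case ≟min z true (done C) z₁
      ... | inj₁ (refl , _) = edges y
      ... | inj₂ (_ , p) = doneEdges I z₁ y (trans (sym p) q)

    -- Being processed may replace being queued only temporarily: here the processed object is shown
    -- to have met the obligation that its place in the queue stood for.
    discharge : ∀ {P a C} → Invariant P a C →
                (∀ x → P (minNode x) → done C x ≡ true) →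
                (∀ z y → P (edge z y) → edgeDone C (z , y) ≡ true) →
                (∀ y → P (maxNode y) → ∀ x → Mmin C x ≤ Mmax C y ⊎ E↓ y x ≤ Mmax C y) →
                Invariant (λ _ → ⊥) a C
    discharge I f g h = record
      { max≤a = max≤a I
      ; a≤key = a≤key I
      ; minKey = minKey I
      ; minQueued = λ x q → case minQueued I x q of λ where
          (inj₁ p) → true≢false (f x p) q
          (inj₂ r) → inj₂ r
      ; edgeKey = edgeKey I
      ; edgeQueued = λ z y p q → case edgeQueued I z y p q of λ where
          (inj₁ p) → true≢false (g z y p) q
          (inj₂ r) → inj₂ r
      ; maxKey = maxKey I
      ; maxQueued = λ y q → case maxQueued I y q of λ where
          (inj₁ p) → inj₂ (inj₂ (h y p))
          (inj₂ r) → inj₂ r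
      ; counted = counted I
      ; done≤a = done≤a I
      ; doneEdges = doneEdges I
      ; min≤L = min≤L I
      ; attained = attained I
      ; above = above I
      ; aboveEdge = aboveEdge I
      }

    -- The object leaves the queue with its obligation unmet, so it becomes the exception P, and the
    -- level rises to its key.
    extract-invariant : ∀ {a C o k Q} → Invariant (λ _ → ⊥) a C →
                        queue C ↭ (o , k) ∷ Q → All (λ (_ , k₁) → k ≤ k₁) Q →
                        Invariant (_≡ o) k (record C { queue = Q })
    extract-invariant {a} {C} {o} {k} {Q} I σ k≤ = record
      { max≤a = λ y → ≤-trans (max≤a I y) a≤k
      ; a≤key = λ e → All.lookup k≤ e
      ; minKey = minKey I ∘ old
      ; minQueued = λ x q → queued (minQueued I x q)
      ; edgeKey = edgeKey I ∘ old
      ; edgeQueued = λ z y p q → queued (edgeQueued I z y p q)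
      ; maxKey = maxKey I ∘ old
      ; maxQueued = λ y q → case maxQueued I y q of λ where
          (inj₂ (inj₁ (k₁ , e))) → case new e of λ where
            (inj₁ refl) → inj₁ refl
            (inj₂ e)    → inj₂ (inj₁ (k₁ , e))
          (inj₂ (inj₂ f)) → inj₂ (inj₂ f)
      ; counted = counted I
      ; done≤a = λ x q → ≤-trans (done≤a I x q) a≤k
      ; doneEdges = doneEdges I
      ; min≤L = min≤L I
      ; attained = attained I
      ; above = above I
      ; aboveEdge = aboveEdge I
      }
      where
      old : ∀ {e} → e ∈ Q → e ∈ queue C
      old e = Perm.∈-resp-↭ (↭-sym σ) (there e)

      new : ∀ {e} → e ∈ queue C → e ≡ (o , k) ⊎ e ∈ Q
      new e with Perm.∈-resp-↭ σ e
      ... | here p  = inj₁ p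
      ... | there p = inj₂ p

      a≤k : a ≤ k
      a≤k = a≤key I (Perm.∈-resp-↭ (↭-sym σ) (here refl))

      queued : ∀ {o₁ b} → ⊥ ⊎ (∃[ k₁ ] (o₁ , k₁) ∈ queue C × k₁ ≤ b) →
               o₁ ≡ o ⊎ (∃[ k₁ ] (o₁ , k₁) ∈ Q × k₁ ≤ b)
      queued (inj₂ (k₁ , e , p)) with new e
      ... | inj₁ refl = inj₁ refl
      ... | inj₂ e′   = inj₂ (k₁ , e′ , p)

    process-invariant : ∀ {a C} o {k Q} → Invariant (λ _ → ⊥) a C →
                        queue C ↭ (o , k) ∷ Q → All (λ (_ , k₁) → k ≤ k₁) Q →
                        Invariant (λ _ → ⊥) k (process o (record C { queue = Q }))
    process-invariant {a} {C} (minNode z) {k} {Q} I σ k≤ with done C z in d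
    ... | true = discharge (extract-invariant I σ k≤) (λ { _ refl → d }) (λ _ _ ()) (λ _ ())
    ... | false = discharge (setDone-invariant z I₂ M≤k′ edges)
        (λ { _ refl → update-same (_≟_ Vmin-finite) z true (done C₂) }) (λ _ _ ()) (λ _ ())
      where
      e : (minNode z , k) ∈ queue C
      e = Perm.∈-resp-↭ (↭-sym σ) (here refl)

      -- Some occurrence of z has a key at most M(z), and k is the least key of all.
      k≤M : k ≤ Mmin C z
      k≤M with minQueued I z d
      ... | inj₂ (k₁ , e₁ , k₁≤) with Perm.∈-resp-↭ σ e₁
      ...   | here refl = k₁≤
      ...   | there e₂  = ≤-trans (All.lookup k≤ e₂) k₁≤

      folded = settle-fold z (succMin z) (extract-invariant I σ k≤) (λ ())
        (λ y∈ → proj₂ (∈.∈-filter⁻ (λ y → E↑ z y >? 𝟎) {xs = elements Vmax-finite} y∈))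
        (minKey I e) k≤M refl
      I₂ = proj₁ folded

      C₂ = foldl (settle (Mmin C z) z) (record C { queue = Q }) (succMin z)

      M≤k′ : Mmin C₂ z ≤ k
      M≤k′ rewrite proj₁ (proj₂ folded) = minKey I e

      edges : ∀ y → Positive z y → edgeDone C₂ (z , y) ≡ true
      edges y p = proj₂ (proj₂ (proj₂ (proj₂ folded))) (∈-succMin p)
    process-invariant {a} {C} (maxNode z) {k} {Q} I σ k≤ =
      discharge (proj₁ folded) (λ _ ()) (λ _ _ ()) (λ { _ refl → covered })
      where
      key = maxKey I (Perm.∈-resp-↭ (↭-sym σ) (here refl))

      folded = lower-fold z (succMax z) (extract-invariant I σ k≤) (λ ()) (proj₁ key) (proj₂ (proj₂ key))

      C′ = foldl (lower z) (record C { queue = Q }) (succMax z)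

      covered : ∀ x → Mmin C′ x ≤ Mmax C′ z ⊎ E↓ z x ≤ Mmax C′ z
      covered x rewrite proj₁ (proj₂ folded) with E↓ z x ≤? 𝟎
      ... | yes p = inj₂ (≤-trans p 𝟎≤)
      ... | no ¬p = proj₂ (proj₂ (proj₂ (proj₂ folded)))
        (∈.∈-filter⁺ (λ x → E↓ z x >? 𝟎) (complete Vmin-finite x) ¬p)
    process-invariant {a} {C} (edge z y) {k} {Q} I σ k≤ with edgeDone C (z , y) in d
    ... | true = discharge (extract-invariant I σ k≤) (λ _ ()) (λ { _ _ refl → d }) (λ _ ())
    ... | false = discharge
        (settled-invariant z y (extract-invariant I σ k≤) pos d (proj₁ (proj₂ key)) (proj₂ (proj₂ key))
          ≤-refl (≤-trans (proj₁ (proj₂ key)) k≤M) (λ m mc → inj₁ ≤-refl))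
        (λ _ ()) (λ { _ _ refl → update-same (_≟_ (×-finite Vmin-finite Vmax-finite)) (z , y) true (edgeDone C) })
        (λ _ ())
      where
      key = edgeKey I (Perm.∈-resp-↭ (↭-sym σ) (here refl))
      pos = proj₁ key

      -- If z were done, this edge would be done as well. Hence z still waits, with a key at least k
      -- and at most M(z).
      k≤M : k ≤ Mmin C z
      k≤M with done C z in dz
      ... | true  = true≢false (doneEdges I z y dz pos) d
      ... | false = undone-above (extract-invariant I σ k≤) (λ ()) dz

    -- The node z₀ witnesses `attained`, which asks for an element of Vmin even while M(y) is 0.
    initial-invariant : Vmin → Invariant (λ _ → ⊥) 𝟎 initial
    initial-invariant z₀ = record
      { max≤a = λ _ → ≤-refl
      ; a≤key = λ _ → 𝟎≤
      ; minKey = λ e → case entry e of λ where (inMin refl) → ≤-refl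
      ; minQueued = λ x _ → inj₂ (L x , ∈.∈-++⁺ˡ (∈.∈-map⁺ _ (complete Vmin-finite x)) , ≤-refl)
      ; edgeKey = λ e → case entry e of λ where (inEdge p refl) → p , ≤-refl , ≤-refl
      ; edgeQueued = λ z y p _ → inj₂ (E↑ z y ,
          ∈.∈-++⁺ʳ mins (∈.∈-++⁺ʳ maxs (∈.∈-map⁺ _ (∈.∈-filter⁺ (λ (z , y) → E↑ z y >? 𝟎)
            (∈.∈-cartesianProduct⁺ (complete Vmin-finite z) (complete Vmax-finite y)) p))) , ≤-refl)
      ; maxKey = λ e → case entry e of λ where (inMax p refl) → p , ≤-refl , ≤-refl
      ; maxQueued = λ y q → inj₂ (inj₁ (𝟎 , ∈.∈-++⁺ʳ mins (∈.∈-++⁺ˡ (∈.∈-map⁺ _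
          (∈.∈-filter⁺ (λ y → length (predMax y) ℕ.≟ 0) (complete Vmax-finite y) q)))))
      ; counted = λ y → sym (unset-none (predMax y))
      ; done≤a = λ _ ()
      ; doneEdges = λ _ _ ()
      ; min≤L = λ _ → ≤-refl
      ; attained = λ _ → z₀ , 𝟎≤ , 𝟎≤
      ; above = λ m mc → below-L mc
      ; aboveEdge = λ _ _ _ _ _ ()
      }
      where
      mins = map (λ x → Object.minNode x , L x) (elements Vmin-finite)
      maxs = map (λ y → Object.maxNode y , 𝟎)
        (filter (λ y → length (predMax y) ℕ.≟ 0) (elements Vmax-finite))

      data Entry : Object → Carrier → Set (c ⊔ ℓ₂) where
        inMin  : ∀ {x k} → k ≡ L x → Entry (minNode x) k
        inMax  : ∀ {y k} → length (predMax y) ≡ 0 → k ≡ 𝟎 → Entry (maxNode y) k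
        inEdge : ∀ {z y k} → Positive z y → k ≡ E↑ z y → Entry (edge z y) k

      entry : ∀ {o k} → (o , k) ∈ queue initial → Entry o k
      entry e with ∈.∈-++⁻ mins e
      ... | inj₁ e₁ with ∈.∈-map⁻ _ e₁
      ...   | _ , _ , refl = inMin refl
      entry e | inj₂ e₁ with ∈.∈-++⁻ maxs e₁
      ...   | inj₁ e₂ with ∈.∈-map⁻ _ e₂
      ...     | _ , e₃ , refl = inMax (proj₂ (∈.∈-filter⁻ (λ y → length (predMax y) ℕ.≟ 0)
                  {xs = elements Vmax-finite} e₃)) refl
      entry e | inj₂ e₁ | inj₂ e₂ with ∈.∈-map⁻ _ e₂
      ...     | _ , e₃ , refl = inEdge (proj₂ (∈.∈-filter⁻ (λ (z , y) → E↑ z y >? 𝟎)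
                  {xs = cartesianProduct (elements Vmin-finite) (elements Vmax-finite)} e₃)) refl

    run-invariant : ∀ {a C objs C′} → Invariant (λ _ → ⊥) a C → Run C objs C′ →
                    ∃[ a′ ] Invariant (λ _ → ⊥) a′ C′ × queue C′ ≡ []
    run-invariant I (stop q) = _ , I , q
    run-invariant I (extract {obj} σ k≤ then r) = run-invariant (process-invariant obj I σ k≤) r

    -- With nothing queued, every positive edge is done, so every counter is 0 and `maxQueued` is
    -- left with its last alternative: each condition between y and x holds outright. Together with
    -- `attained` this yields a witness for `passes`.
    final-correct : ∀ {a C} → Invariant (λ _ → ⊥) a C → queue C ≡ [] → IsCorrect (Mmin C)
    final-correct {C = C} I q = record
      { below-L = min≤L I
      ; passes  = λ y x → let z , p , r = attained I y in
          z , ≤-trans (⊎-⊓ (low y x)) (⊓-glb p r)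
      }
      where
      none : ∀ {ℓ e} {A : Set ℓ} → e ∈ queue C → A
      none e rewrite q = case e of λ ()

      edges : ∀ y {z} → z ∈ predMax y → edgeDone C (z , y) ≡ true
      edges y {z} z∈ with edgeDone C (z , y) in d
      ... | true = refl
      ... | false with edgeQueued I z y
                        (proj₂ (∈.∈-filter⁻ (λ z → E↑ z y >? 𝟎) {xs = elements Vmin-finite} z∈)) d
      ...   | inj₂ (_ , e , _) = none e

      low : ∀ y x → Mmin C x ≤ Mmax C y ⊎ E↓ y x ≤ Mmax C y
      low y x with maxQueued I y (trans (counted I y) (unset-all (predMax y) (edges y)))
      ... | inj₂ (inj₁ (_ , e)) = none e
      ... | inj₂ (inj₂ f) = f x

    greatest-correct : ∀ {objs C} → Vmin → Run initial objs C →
                       IsCorrect (Mmin C) × (∀ m → IsCorrect m → ∀ x → m x ≤ Mmin C x)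
    greatest-correct z₀ r = let _ , I , q = run-invariant (initial-invariant z₀) r in
      final-correct I q , above I

-- The potential, and termination

sum-flip : ∀ {X : Set} (f f′ : X → ℕ) {z xs} → Unique xs → z ∈ xs → (∀ {x} → z ≢ x → f′ x ≡ f x) →
           sum (map f xs) + f′ z ≡ sum (map f′ xs) + f z
sum-flip f f′ {z} {.z ∷ xs} (z∉xs ∷ _) (here refl) eq = begin
  f z + sum (map f xs) + f′ z    ≡⟨ cong (λ t → f z + t + f′ z) (sum-cong xs z∉xs) ⟩
  f z + sum (map f′ xs) + f′ z   ≡⟨ cong (_+ f′ z) (ℕ.+-comm (f z) _) ⟩
  sum (map f′ xs) + f z + f′ z   ≡⟨ ℕ.+-comm _ (f′ z) ⟩
  f′ z + (sum (map f′ xs) + f z) ≡⟨ ℕ.+-assoc (f′ z) _ (f z) ⟨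
  f′ z + sum (map f′ xs) + f z   ∎
  where
  open ≡-Reasoning
  sum-cong : ∀ xs → All (z ≢_) xs → sum (map f xs) ≡ sum (map f′ xs)
  sum-cong [] [] = refl
  sum-cong (x ∷ xs) (p ∷ ps) = cong₂ _+_ (sym (eq p)) (sum-cong xs ps)
sum-flip f f′ {z} {x ∷ xs} (x∉xs ∷ u) (there z∈xs) eq = begin
  f x + sum (map f xs) + f′ z    ≡⟨ ℕ.+-assoc (f x) _ _ ⟩
  f x + (sum (map f xs) + f′ z)  ≡⟨ cong₂ _+_ (sym (eq z≢x)) (sum-flip f f′ u z∈xs eq) ⟩
  f′ x + (sum (map f′ xs) + f z) ≡⟨ ℕ.+-assoc (f′ x) _ _ ⟨
  f′ x + sum (map f′ xs) + f z   ∎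
  where
  open ≡-Reasoning
  z≢x : z ≢ x
  z≢x refl = All.lookup x∉xs z∈xs refl

module Potential {c ℓ₁ ℓ₂} (𝕀 : BoundedChain c ℓ₁ ℓ₂) (N : Gödel.MinimaxNet 𝕀) where

  open BoundedChain 𝕀 using (Carrier; _≤_; _≤?_; 𝟎)
    renaming (refl to ≤-refl; trans to ≤-trans; total to ≤-total)
  open Gödel 𝕀
  open Marking 𝕀
  open Correctness N
  open MinimaxNet N
  open MarkingAlgorithm N
  open Finite
  open Invariant

  -- Extracting an object lowers the potential by at least the work that it causes: a node
  -- in Vmax has its weight in reserve until its counter reaches 0, and a node in Vmin the
  -- number of its successors until it is done.
  weight : Object → ℕ
  weight (minNode _) = 1
  weight (maxNode y) = 1 + (length (succMax y) + length (succMax y))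
  weight (edge _ _)  = 1

  queueWeight : List (Object × Carrier) → ℕ
  queueWeight q = sum (map (weight ∘ proj₁) q)

  maxWeight minWeight : Config → ℕ
  maxWeight C = sum (map (λ y → if does (count C y ℕ.≟ 0) then 0 else weight (maxNode y)) (elements Vmax-finite))
  minWeight C = sum (map (λ z → if done C z then 0 else length (succMin z)) (elements Vmin-finite))

  potential : Config → ℕ
  potential C = queueWeight (queue C) + maxWeight C + minWeight C

  -- One more than the number of successors visited; the running time of an extraction is
  -- proportional to it.
  work : Object → Config → ℕ
  work (minNode z) C = 1 + (if done C z then 0 else length (succMin z))
  work (maxNode y) C = 1 + length (succMax y)
  work (edge _ _)  C = 1

  -- When the counter reaches 0, the reserve of y moves from `maxWeight` to the queue; otherwise
  -- neither sum changes.
  settled-weight : ∀ {v C} z y → Counted C → Positive z y → edgeDone C (z , y) ≡ false →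
                   queueWeight (queue (settled v z C y)) + maxWeight (settled v z C y) ≡
                   queueWeight (queue C) + maxWeight C
  settled-weight {v} {C} z y I pos d with count-positive {C = C} I pos d
  ... | n , p = lemma n p
    where
    open ≡-Reasoning
    C′ = settled v z C y
    W = weight (maxNode y)

    f f′ : Vmax → ℕ
    f  y = if does (count C y ℕ.≟ 0) then 0 else weight (maxNode y)
    f′ y = if does (count C′ y ℕ.≟ 0) then 0 else weight (maxNode y)

    flip : maxWeight C + f′ y ≡ maxWeight C′ + f y
    flip = sum-flip f f′ (unique Vmax-finite) (complete Vmax-finite y)
      λ {y₁} y≢y₁ → cong (λ t → if does (t ℕ.≟ 0) then 0 else weight (maxNode y₁))
        (update-other (_≟_ Vmax-finite) (pred (count C y)) (count C) y≢y₁)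

    count′ : ∀ {n} → count C y ≡ suc n → count C′ y ≡ n
    count′ p = trans (update-same (_≟_ Vmax-finite) y (pred (count C y)) (count C)) (cong pred p)

    fy : ∀ {n} → count C y ≡ suc n → f y ≡ W
    fy p rewrite p = refl

    lemma : ∀ n → count C y ≡ suc n →
            queueWeight (queue C′) + maxWeight C′ ≡ queueWeight (queue C) + maxWeight C
    lemma zero p = begin
      queueWeight (queue C′) + maxWeight C′
        ≡⟨ cong (λ t → queueWeight (if does (pred t ℕ.≟ 0) then (maxNode y , v) ∷ queue C else queue C) + maxWeight C′) p ⟩
      W + queueWeight (queue C) + maxWeight C′   ≡⟨ cong (_+ maxWeight C′) (ℕ.+-comm W _) ⟩
      queueWeight (queue C) + W + maxWeight C′   ≡⟨ ℕ.+-assoc (queueWeight (queue C)) _ _ ⟩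
      queueWeight (queue C) + (W + maxWeight C′) ≡⟨ cong (queueWeight (queue C) +_) (ℕ.+-comm W _) ⟩
      queueWeight (queue C) + (maxWeight C′ + W) ≡⟨ cong (λ t → queueWeight (queue C) + (maxWeight C′ + t)) (fy p) ⟨
      queueWeight (queue C) + (maxWeight C′ + f y) ≡⟨ cong (queueWeight (queue C) +_) flip ⟨
      queueWeight (queue C) + (maxWeight C + f′ y)
        ≡⟨ cong (λ t → queueWeight (queue C) + (maxWeight C + (if does (t ℕ.≟ 0) then 0 else W))) (count′ p) ⟩
      queueWeight (queue C) + (maxWeight C + 0)  ≡⟨ cong (queueWeight (queue C) +_) (ℕ.+-identityʳ _) ⟩
      queueWeight (queue C) + maxWeight C        ∎
    lemma (suc n) p = cong₂ _+_
      (cong (λ t → queueWeight (if does (pred t ℕ.≟ 0) then (maxNode y , v) ∷ queue C else queue C)) p)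
      (ℕ.+-cancelʳ-≡ W _ _ (begin
        maxWeight C′ + W    ≡⟨ cong (maxWeight C′ +_) (fy p) ⟨
        maxWeight C′ + f y  ≡⟨ flip ⟨
        maxWeight C + f′ y
          ≡⟨ cong (λ t → maxWeight C + (if does (t ℕ.≟ 0) then 0 else W)) (count′ p) ⟩
        maxWeight C + W     ∎))

  settle-fold-weight : ∀ v z ys {C} → Counted C → (∀ {y} → y ∈ ys → Positive z y) →
                       let C′ = foldl (settle v z) C ys in
                       queueWeight (queue C′) + maxWeight C′ ≡ queueWeight (queue C) + maxWeight C ×
                       done C′ ≡ done C
  settle-fold-weight v z [] I pos = refl , refl
  settle-fold-weight v z (y ∷ ys) {C} I pos with edgeDone C (z , y) in d
  ... | true = settle-fold-weight v z ys I (pos ∘ there)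
  ... | false =
    let p , q = settle-fold-weight v z ys (settled-counted {v} {C} z y I (pos (here refl)) d) (pos ∘ there)
    in trans p (settled-weight {v} {C} z y I (pos (here refl)) d) , q

  lower-weight : ∀ z C x → let C′ = lower z C x in
                 queueWeight (queue C′) ℕ.≤ suc (queueWeight (queue C)) × count C′ ≡ count C × done C′ ≡ done C
  lower-weight z C x with lower z C x | lowerView z C x
  ... | _ | done-min _   = ℕ.n≤1+n _ , refl , refl
  ... | _ | blocked _    = ℕ.n≤1+n _ , refl , refl
  ... | _ | lowering _ _ = ℕ.≤-refl , refl , refl

  -- Each successor is pushed at most once, with weight 1. One of the two copies of
  -- `length (succMax y)` in the weight of y pays for these pushes, the other for the work.
  lower-fold-weight : ∀ z xs C → let C′ = foldl (lower z) C xs in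
                      queueWeight (queue C′) ℕ.≤ length xs + queueWeight (queue C) ×
                      count C′ ≡ count C × done C′ ≡ done C
  lower-fold-weight z [] C = ℕ.≤-refl , refl , refl
  lower-fold-weight z (x ∷ xs) C =
    let p , q , r = lower-fold-weight z xs (lower z C x)
        p₁ , q₁ , r₁ = lower-weight z C x
    in ℕ.≤-trans p (ℕ.≤-trans (ℕ.+-monoʳ-≤ (length xs) p₁) (ℕ.≤-reflexive (ℕ.+-suc (length xs) _)))
     , trans q q₁ , trans r r₁

  setDone-weight : ∀ z C → minWeight (setDone z C) + (if done C z then 0 else length (succMin z)) ≡ minWeight C
  setDone-weight z C = begin
    minWeight (setDone z C) + f z  ≡⟨ sum-flip f f′ (unique Vmin-finite) (complete Vmin-finite z)
      (λ {x} z≢x → cong (λ t → if t then 0 else length (succMin x)) (update-other (_≟_ Vmin-finite) true (done C) z≢x)) ⟨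
    minWeight C + f′ z             ≡⟨ cong (λ t → minWeight C + (if t then 0 else length (succMin z)))
                                        (update-same (_≟_ Vmin-finite) z true (done C)) ⟩
    minWeight C + 0                ≡⟨ ℕ.+-identityʳ _ ⟩
    minWeight C                    ∎
    where
    open ≡-Reasoning
    f f′ : Vmin → ℕ
    f x = if done C x then 0 else length (succMin x)
    f′ x = if done (setDone z C) x then 0 else length (succMin x)

  rotate : ∀ a b d e → (a + b) + d + e ≡ (e + a) + b + d
  rotate a b d e = trans (ℕ.+-comm (a + b + d) e)
    (trans (sym (ℕ.+-assoc e (a + b) d)) (cong (_+ d) (sym (ℕ.+-assoc e a b))))

  -- Keeping `work` on the left makes one inequality serve twice: `work` is at least 1, which yields
  -- termination, and it measures the time of the extraction. Extracted edges must be positive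
  -- because only positive ones are counted.
  process-potential : ∀ {C o k Q} → Counted C →
                      (∀ {z y k} → (edge z y , k) ∈ queue C → Positive z y) →
                      queue C ↭ (o , k) ∷ Q →
                      potential (process o (record C { queue = Q })) + work o C ℕ.≤ potential C
  process-potential {C} {o} {k} {Q} I pos σ = begin
    potential (process o C₁) + work o C  ≤⟨ lemma o (λ { z y refl → pos (Perm.∈-resp-↭ (↭-sym σ) (here refl)) }) ⟩
    (weight o + queueWeight Q) + maxWeight C + minWeight C
      ≡⟨ cong (λ t → t + maxWeight C + minWeight C) (sum-↭ (Perm.map⁺ (weight ∘ proj₁) σ)) ⟨
    potential C                          ∎
    where
    open ℕ.≤-Reasoning
    C₁ = record C { queue = Q }

    lemma : ∀ o → (∀ z y → o ≡ edge z y → Positive z y) →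
            potential (process o C₁) + work o C ℕ.≤ (weight o + queueWeight Q) + maxWeight C + minWeight C
    lemma (minNode z) _ with done C z in d
    ... | true = ℕ.≤-reflexive (rotate (queueWeight Q) (maxWeight C) (minWeight C) 1)
    ... | false =
      let p , q = settle-fold-weight (Mmin C z) z (succMin z) {C₁} I
                    (λ y∈ → proj₂ (∈.∈-filter⁻ (λ y → E↑ z y >? 𝟎) {xs = elements Vmax-finite} y∈))
          n = length (succMin z)
          d₂ : done C₂ z ≡ false
          d₂ = trans (cong (λ f → f z) q) d
      in begin
      queueWeight (queue C₂) + maxWeight C₂ + minWeight (setDone z C₂) + suc n
        ≡⟨ cong (λ t → t + minWeight (setDone z C₂) + suc n) p ⟩
      queueWeight Q + maxWeight C + minWeight (setDone z C₂) + suc n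
        ≡⟨ trans (ℕ.+-suc _ n) (cong suc (ℕ.+-assoc (queueWeight Q + maxWeight C) _ n)) ⟩
      suc (queueWeight Q + maxWeight C + (minWeight (setDone z C₂) + n))
        ≡⟨ cong (λ t → suc (queueWeight Q + maxWeight C + (minWeight (setDone z C₂) + (if t then 0 else n)))) d₂ ⟨
      suc (queueWeight Q + maxWeight C + (minWeight (setDone z C₂) + (if done C₂ z then 0 else n)))
        ≡⟨ cong (λ t → suc (queueWeight Q + maxWeight C + t)) (setDone-weight z C₂) ⟩
      suc (queueWeight Q + maxWeight C + minWeight C₂)
        ≡⟨ cong (λ f → suc (queueWeight Q + maxWeight C
             + sum (map (λ z → if f z then 0 else length (succMin z)) (elements Vmin-finite)))) q ⟩
      suc (queueWeight Q + maxWeight C + minWeight C) ∎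
      where C₂ = foldl (settle (Mmin C z) z) C₁ (succMin z)
    lemma (maxNode y) _ =
      let p , q , r = lower-fold-weight y (succMax y) C₁
          n = length (succMax y)
      in begin
      queueWeight (queue C₂) + maxWeight C₂ + minWeight C₂ + suc n
        ≡⟨ cong₂ (λ f g → queueWeight (queue C₂)
             + sum (map (λ y → if does (f y ℕ.≟ 0) then 0 else weight (maxNode y)) (elements Vmax-finite))
             + sum (map (λ z → if g z then 0 else length (succMin z)) (elements Vmin-finite)) + suc n) q r ⟩
      queueWeight (queue C₂) + maxWeight C + minWeight C + suc n
        ≤⟨ ℕ.+-monoˡ-≤ (suc n) (ℕ.+-monoˡ-≤ (minWeight C) (ℕ.+-monoˡ-≤ (maxWeight C) p)) ⟩
      n + queueWeight Q + maxWeight C + minWeight C + suc n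
        ≡⟨ rotate (n + queueWeight Q) (maxWeight C) (minWeight C) (suc n) ⟩
      suc n + (n + queueWeight Q) + maxWeight C + minWeight C
        ≡⟨ cong (λ t → t + maxWeight C + minWeight C) (ℕ.+-assoc (suc n) n (queueWeight Q)) ⟨
      (suc (n + n) + queueWeight Q) + maxWeight C + minWeight C ∎
      where C₂ = foldl (lower y) C₁ (succMax y)
    lemma (edge z y) pos with edgeDone C (z , y) in d
    ... | true = ℕ.≤-reflexive (rotate (queueWeight Q) (maxWeight C) (minWeight C) 1)
    ... | false = begin
      queueWeight (queue C₂) + maxWeight C₂ + minWeight C + 1
        ≡⟨ cong (λ t → t + minWeight C + 1) (settled-weight {E↑ z y} {C₁} z y I (pos z y refl) d) ⟩
      queueWeight Q + maxWeight C + minWeight C + 1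
        ≡⟨ rotate (queueWeight Q) (maxWeight C) (minWeight C) 1 ⟩
      suc (queueWeight Q) + maxWeight C + minWeight C ∎
      where C₂ = settled (E↑ z y) z C₁ y

  work-positive : ∀ o C → 1 ℕ.≤ work o C
  work-positive (minNode _) _ = s≤s z≤n
  work-positive (maxNode _) _ = s≤s z≤n
  work-positive (edge _ _)  _ = s≤s z≤n

  -- `Terminating` demands that a nonempty queue allows some step, besides the termination of every
  -- step. This provides the step.
  smallest : (e : Object × Carrier) (q : List (Object × Carrier)) →
             ∃[ o ] ∃[ k ] ∃[ Q ] (e ∷ q) ↭ (o , k) ∷ Q × All (λ (_ , k₁) → k ≤ k₁) Q
  smallest e [] = _ , _ , _ , ↭-refl , []
  smallest (o₁ , k₁) (e ∷ q) with smallest e q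
  ... | o , k , Q , σ , k≤ with ≤-total k₁ k
  ...   | inj₁ k₁≤k = o₁ , k₁ , e ∷ q , ↭-refl ,
            Perm.All-resp-↭ (↭-sym σ) (k₁≤k ∷ All.map (≤-trans k₁≤k) k≤)
  ...   | inj₂ k≤k₁ = o , k , (o₁ , k₁) ∷ Q ,
            ↭-trans (prep _ σ) (Perm.swap _ _ ↭-refl) , k≤k₁ ∷ k≤

  terminating : ∀ {a C} → Invariant (λ _ → ⊥) a C → Acc ℕ._<_ (potential C) → Terminating C
  terminating {C = C} I (acc rs) = by-queue (queue C) refl
    where
    by-queue : ∀ q → queue C ≡ q → Terminating C
    by-queue [] p = stop p
    by-queue (e ∷ q) p with smallest e q
    ... | o , k , Q , σ , k≤ = next (o , _ , extract (subst (_↭ (o , k) ∷ Q) (sym p) σ) k≤) λ where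
      (extract {obj} σ₁ k₁≤) → terminating (process-invariant obj I σ₁ k₁≤)
        (rs (ℕ.<-≤-trans (ℕ.m<m+n _ (work-positive obj C))
          (process-potential (counted I) (proj₁ ∘ edgeKey I) σ₁)))

-- Directed simulations as correct markings

module Simulation {c ℓ₁ ℓ₂} (𝕀 : BoundedChain c ℓ₁ ℓ₂) where

  open BoundedChain 𝕀 using (Carrier; _≤_; _≤?_; 𝟎; 𝟏; maximum)
    renaming (refl to ≤-refl; trans to ≤-trans)
  open DecTotalOrder (BoundedChain.decTotalOrder 𝕀) using (totalOrder)
  open import Algebra.Construct.NaturalChoice.Min totalOrder
    using (_⊓_; x⊓y≤x; x⊓y≤y; ⊓-glb)
  open Gödel 𝕀
  open Marking 𝕀

  ⋀-glb : ∀ {n a} (f : Fin n → Carrier) → (∀ i → a ≤ f i) → a ≤ ⋀ f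
  ⋀-glb {zero} f p = maximum _
  ⋀-glb {suc n} f p = ⊓-glb (p zero) (⋀-glb (f ∘ suc) (p ∘ suc))

  ⋀-lower : ∀ {n} (f : Fin n → Carrier) i → ⋀ f ≤ f i
  ⋀-lower f zero = x⊓y≤x _ _
  ⋀-lower f (suc i) = ≤-trans (x⊓y≤y _ _) (⋀-lower (f ∘ suc) i)

  module _ {σV σE} (G G′ : FuzzyGraph σV σE) where

    open FuzzyGraph G
    open FuzzyGraph G′ renaming (V to V′; E to E′; L to L′; size to size′)
      hiding (nonEmpty)
    open Correctness (net G G′)
    open Potential 𝕀 (net G G′)
    open IsCorrect
    open IsDirectedSimulation

    vertex : ∀ {n} → NonZero n → Fin n
    vertex {suc n} _ = zero

    v₀ : V
    v₀ = vertex (FuzzyGraph.nonEmpty G)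

    v₀′ : V′
    v₀′ = vertex (FuzzyGraph.nonEmpty G′)

    -- The node ⟨x,y′,r⟩ expresses an instance of the backward clause and ⟨x′,y,r⟩ one of the
    -- forward clause, with the same witness.
    simulation⇒correct : ∀ {Z} → IsDirectedSimulation G G′ Z → IsCorrect (uncurry Z)
    simulation⇒correct {Z} S = record
      { below-L = λ (x , x′) → ⋀-glb _ λ p → labels S p x x′
      ; passes  = passes′
      }
      where
      passes′ : ∀ y x → ∃[ z ] uncurry Z x ⊗ MinimaxNet.E↓ (net G G′) y x ≤
                               MinimaxNet.E↑ (net G G′) z y ⊗ uncurry Z z
      passes′ (inj₁ (x , y′ , r)) (x₁ , x′) with x Fin.≟ x₁
      -- No edge of the net leads here, so the left-hand side is 0 and any witness serves.
      ... | no _ = (v₀ , v₀′) , ≤-trans (x⊓y≤y _ _) 𝟎≤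
      ... | yes refl with backward S r x x′ y′
      ...   | y , p = (y , y′) , subst
        (λ b → Z x x′ ⊗ E′ x′ r y′ ≤ (if b then E x r y else 𝟎) ⊗ Z y y′) (sym (dec-true (y′ Fin.≟ y′) refl)) p
      passes′ (inj₂ (x′ , y , r)) (x , x′₁) with x′ Fin.≟ x′₁
      ... | no _ = (v₀ , v₀′) , ≤-trans (x⊓y≤y _ _) 𝟎≤
      ... | yes refl with forward S r x y x′
      ...   | y′ , p = (y , y′) , subst
        (λ b → Z x x′ ⊗ E x r y ≤ (if b then E′ x′ r y′ else 𝟎) ⊗ Z y y′) (sym (dec-true (y Fin.≟ y) refl)) p

    correct⇒simulation : ∀ {m} → IsCorrect m → IsDirectedSimulation G G′ (curry m)
    correct⇒simulation {m} mc = record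
      { labels   = λ p x x′ → ≤-trans (below-L mc (x , x′)) (⋀-lower _ p)
      ; forward  = forward′
      ; backward = backward′
      }
      where
      forward′ : ∀ r x y x′ → ∃[ y′ ] m (x , x′) ⊗ E x r y ≤ E′ x′ r y′ ⊗ m (y , y′)
      forward′ r x y x′ with passes mc (inj₂ (x′ , y , r)) (x , x′)
      ... | (y₁ , y′) , p rewrite dec-true (x′ Fin.≟ x′) refl with y₁ Fin.≟ y
      ...   | yes refl = y′ , p
      -- The witness of `passes` may be a pair that is not joined to the node. Then its edge has
      -- value 0, hence so has the left-hand side, and any vertex does.
      ...   | no _     = v₀′ , ≤-trans p (≤-trans (x⊓y≤x _ _) 𝟎≤)

      backward′ : ∀ r x x′ y′ → ∃[ y ] m (x , x′) ⊗ E′ x′ r y′ ≤ E x r y ⊗ m (y , y′)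
      backward′ r x x′ y′ with passes mc (inj₁ (x , y′ , r)) (x , x′)
      ... | (y , y′₁) , p rewrite dec-true (x Fin.≟ x) refl with y′₁ Fin.≟ y′
      ...   | yes refl = y , p
      ...   | no _     = v₀ , ≤-trans p (≤-trans (x⊓y≤x _ _) 𝟎≤)

    simulation-terminates : SimulationAlgorithmTerminates G G′
    simulation-terminates = terminating (initial-invariant (v₀ , v₀′)) (<-wellFounded _)

    simulation-greatest : ∀ {objs Z} → SimulationAlgorithm G G′ objs Z →
                          IsGreatestDirectedSimulation G G′ Z
    simulation-greatest (returns r) =
      let mc , greatest = greatest-correct (v₀ , v₀′) r in
      correct⇒simulation mc , λ Z₁ S x x′ → greatest _ (simulation⇒correct S) (x , x′)

-- Programs and their running time

-- The cells beyond the end of xs are left open, so that lists can grow in place.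
at-list : ∀ {a} {A : Set a} → (ℕ → A) → ℕ → List A → Set a
at-list f k [] = Level.Lift _ ⊤
at-list f k (x ∷ xs) = f k ≡ x × at-list f (suc k) xs

-- The machine compares with ≤ only, hence the test index + 1 ≤ N. The bound N is evaluated before
-- every iteration, so its time enters `forTime` and its constancy has to be proved for each loop.
for : Name → IntExp → Program → Program
for v N P =
  setInt v [] (lit 0) ⨾
  while ((int v [] ⊕ lit 1) ≤ⁿ N) (P ⨾ setInt v [] (int v [] ⊕ lit 1))

-- Arrays are tracked by name and as a whole. The result is a Boolean that evaluates, so that a
-- frame condition for a concrete program is proved by `refl`.
writesInt writesVal : Program → Name → Bool
writesInt skip a           = false
writesInt (setInt b _ _) a = does (b ℕ.≟ a)
writesInt (setVal _ _ _) a = false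
writesInt (emit _) a       = false
writesInt (P ⨾ Q) a        = if writesInt P a then true else writesInt Q a
writesInt (ifte _ P Q) a   = if writesInt P a then true else writesInt Q a
writesInt (while _ P) a    = writesInt P a
writesVal skip a           = false
writesVal (setInt _ _ _) a = false
writesVal (setVal b _ _) a = does (b ℕ.≟ a)
writesVal (emit _) a       = false
writesVal (P ⨾ Q) a        = if writesVal P a then true else writesVal Q a
writesVal (ifte _ P Q) a   = if writesVal P a then true else writesVal Q a
writesVal (while _ P) a    = writesVal P a

emits : Program → Bool
emits (emit _)     = true
emits (P ⨾ Q)      = if emits P then true else emits Q
emits (ifte _ P Q) = if emits P then true else emits Q
emits (while _ P)  = emits P
emits _            = false

-- An upper bound for the time of a program without loops; the value at a loop is meaningless.
cost : Program → ℕ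
cost skip            = 1
cost (setInt _ is i) = 1 + (intsTime is + intTime i)
cost (setVal _ is v) = 1 + (intsTime is + valTime v)
cost (emit is)       = 1 + intsTime is
cost (P ⨾ Q)         = cost P + cost Q
cost (ifte b P Q)    = testTime b + (cost P + cost Q)
cost (while b P)     = 0

-- An iteration costs 4 and the time of N for the test and 4 for the increment, hence 8. The start
-- and the last test need 6 only; 8 makes the summands uniform.
forTime : IntExp → List ℕ → ℕ
forTime N ts = 8 + intTime N + sum (map (λ t → 8 + intTime N + t) ts)

or-false : ∀ b {b′} → (if b then true else b′) ≡ false → b ≡ false × b′ ≡ false
or-false false p = refl , p

if-false : ∀ {a} {A : Set a} {b} {x y : A} → b ≡ false → (if b then x else y) ≡ y
if-false refl = refl

-- Ties the loop counter to the element of `allFin` for which the iteration stands.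
Positions : ∀ {n} → ℕ → List (Fin n) → Set
Positions k []       = ⊤
Positions k (i ∷ is) = toℕ i ≡ k × Positions (suc k) is

tabulate-positions : ∀ {m n} k (f : Fin m → Fin n) → (∀ i → toℕ (f i) ≡ k + toℕ i) → Positions k (tabulate f)
tabulate-positions {zero} k f p = tt
tabulate-positions {suc m} k f p = trans (p zero) (ℕ.+-identityʳ k) ,
  tabulate-positions (suc k) (f ∘ suc) (λ i → trans (p (suc i)) (ℕ.+-suc k (toℕ i)))

-- Timed total correctness with frames

module Semantics {c ℓ₁ ℓ₂} (𝕀 : BoundedChain c ℓ₁ ℓ₂) where

  open Gödel 𝕀 public

  -- The frame rule in semantic form. It is derived from the syntax alone, so a postcondition has to
  -- mention only what its program writes.
  record Frame (P : Program) (s s′ : State) : Set c where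
    field
      int-frame : ∀ a → writesInt P a ≡ false → ints s′ a ≡ ints s a
      val-frame : ∀ a → writesVal P a ≡ false → vals s′ a ≡ vals s a
      out-frame : emits P ≡ false → output s′ ≡ output s

  open Frame public

  scalar-frame : ∀ {P s s′ n} → Frame P s s′ → ∀ a → writesInt P a ≡ false → ints s a [] ≡ n → ints s′ a [] ≡ n
  scalar-frame F a p q = trans (cong (λ f → f []) (int-frame F a p)) q

  frame-refl : ∀ {P s} → Frame P s s
  frame-refl = record { int-frame = λ _ _ → refl ; val-frame = λ _ _ → refl ; out-frame = λ _ → refl }

  frame-trans : ∀ {P s s₁ s₂} → Frame P s s₁ → Frame P s₁ s₂ → Frame P s s₂
  frame-trans F G = record
    { int-frame = λ a p → trans (int-frame G a p) (int-frame F a p)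
    ; val-frame = λ a p → trans (val-frame G a p) (val-frame F a p)
    ; out-frame = λ p → trans (out-frame G p) (out-frame F p)
    }

  frame-weaken : ∀ {P Q s s₁} → (∀ a → writesInt Q a ≡ false → writesInt P a ≡ false) →
                 (∀ a → writesVal Q a ≡ false → writesVal P a ≡ false) →
                 (emits Q ≡ false → emits P ≡ false) → Frame P s s₁ → Frame Q s s₁
  frame-weaken f g h F = record
    { int-frame = λ a p → int-frame F a (f a p)
    ; val-frame = λ a p → val-frame F a (g a p)
    ; out-frame = λ p → out-frame F (h p)
    }

  frame-left : ∀ {P Q s s₁} → Frame P s s₁ → Frame (P ⨾ Q) s s₁
  frame-left {P} = frame-weaken (λ a p → proj₁ (or-false (writesInt P a) p))
    (λ a p → proj₁ (or-false (writesVal P a) p)) (λ p → proj₁ (or-false (emits P) p))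

  frame-right : ∀ {P Q s s₁} → Frame Q s s₁ → Frame (P ⨾ Q) s s₁
  frame-right {P} = frame-weaken (λ a p → proj₂ (or-false (writesInt P a) p))
    (λ a p → proj₂ (or-false (writesVal P a) p)) (λ p → proj₂ (or-false (emits P) p))

  frame-ifte : ∀ {b P Q s s₁} → Frame (P ⨾ Q) s s₁ → Frame (ifte b P Q) s s₁
  frame-ifte F = record { Frame F }

  frame-while : ∀ {b P s s₁} → Frame P s s₁ → Frame (while b P) s s₁
  frame-while F = record { Frame F }

  frame : ∀ {P s t s₁} → ⟨ P , s ⟩⇓[ t ] s₁ → Frame P s s₁
  frame skip⇓ = frame-refl
  frame setInt⇓ = record { int-frame = λ a p → if-false p ; val-frame = λ _ _ → refl ; out-frame = λ _ → refl }
  frame setVal⇓ = record { int-frame = λ _ _ → refl ; val-frame = λ a p → if-false p ; out-frame = λ _ → refl }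
  frame emit⇓ = record { int-frame = λ _ _ → refl ; val-frame = λ _ _ → refl ; out-frame = λ () }
  frame (seq⇓ {P} {Q} d e) = frame-trans (frame-left {P} {Q} (frame d)) (frame-right {P} {Q} (frame e))
  frame (if-true⇓ {P = P} {Q} _ d) = frame-ifte {P = P} {Q} (frame-left {P} {Q} (frame d))
  frame (if-false⇓ {P = P} {Q} _ d) = frame-ifte {P = P} {Q} (frame-right {P} {Q} (frame d))
  frame (while-true⇓ {P = P} _ d e) = frame-trans (frame-while {P = P} (frame d)) (frame e)
  frame (while-false⇓ _) = frame-refl

  -- A Hoare triple for total correctness, started in a given state and with the time bound T.
  record Exec {ℓ} (P : Program) (s : State) (T : ℕ) (Q : State → Set ℓ) : Set (c ⊔ ℓ) where
    constructor executes
    field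
      {final} : State
      {time}  : ℕ
      halts   : ⟨ P , s ⟩⇓[ time ] final
      inTime  : time ℕ.≤ T
      post    : Q final

  open Exec public

  exec-mono : ∀ {ℓ ℓ′ P s T T′} {Q : State → Set ℓ} {Q′ : State → Set ℓ′} →
              T ℕ.≤ T′ → (∀ {s′} → Frame P s s′ → Q s′ → Q′ s′) → Exec P s T Q → Exec P s T′ Q′
  exec-mono p f (executes d t q) = executes d (ℕ.≤-trans t p) (f (frame d) q)

  exec-map : ∀ {ℓ ℓ′ P s T} {Q : State → Set ℓ} {Q′ : State → Set ℓ′} →
             (∀ {s′} → Frame P s s′ → Q s′ → Q′ s′) → Exec P s T Q → Exec P s T Q′
  exec-map = exec-mono ℕ.≤-refl

  exec-skip : ∀ {ℓ s} {Q : State → Set ℓ} → Q s → Exec skip s 1 Q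
  exec-skip q = executes skip⇓ ℕ.≤-refl q

  writeInt : Name → List ℕ → ℕ → State → State
  writeInt a is n s = record s { ints = assign a is n (ints s) }

  writeVal : Name → List ℕ → BoundedChain.Carrier 𝕀 → State → State
  writeVal a is v s = record s { vals = assign a is v (vals s) }

  write-scalar : ∀ v n s → ints (writeInt v [] n s) v [] ≡ n
  write-scalar v n s rewrite dec-true (v ℕ.≟ v) refl = refl

  exec-setInt : ∀ {ℓ s a is i} {Q : State → Set ℓ} →
                Q (writeInt a (evalInts s is) (evalInt s i) s) →
                Exec (setInt a is i) s (cost (setInt a is i)) Q
  exec-setInt q = executes setInt⇓ ℕ.≤-refl q

  exec-setVal : ∀ {ℓ s a is v} {Q : State → Set ℓ} →
                Q (writeVal a (evalInts s is) (evalVal s v) s) →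
                Exec (setVal a is v) s (cost (setVal a is v)) Q
  exec-setVal q = executes setVal⇓ ℕ.≤-refl q

  -- The frame of the first program is passed to the second, so Q may be silent about everything
  -- that P leaves alone.
  exec-seq : ∀ {ℓ ℓ′ P P′ s T T′} {Q : State → Set ℓ} {R : State → Set ℓ′} →
             Exec P s T Q → (∀ {s′} → Frame P s s′ → Q s′ → Exec P′ s′ T′ R) → Exec (P ⨾ P′) s (T + T′) R
  exec-seq (executes d t q) f with f (frame d) q
  ... | executes e u r = executes (seq⇓ d e) (ℕ.+-mono-≤ t u) r

  exec-after : ∀ {ℓ P P′ s t s₁ T T′} {Q : State → Set ℓ} → ⟨ P , s ⟩⇓[ t ] s₁ → t ℕ.≤ T →
               Exec P′ s₁ T′ Q → Exec (P ⨾ P′) s (T + T′) Q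
  exec-after d t (executes e u q) = executes (seq⇓ d e) (ℕ.+-mono-≤ t u) q

  -- The bound adds both branches instead of taking their maximum, in agreement with `cost`; only
  -- constants are affected.
  exec-if : ∀ {ℓ b P P′ s T T′} {Q : State → Set ℓ} →
            (test s b ≡ true → Exec P s T Q) → (test s b ≡ false → Exec P′ s T′ Q) →
            Exec (ifte b P P′) s (testTime b + (T + T′)) Q
  exec-if {b = b} {s = s} {T} {T′} f g with test s b in p
  ... | true with f refl
  ...   | executes d t q = executes (if-true⇓ p d) (ℕ.+-monoʳ-≤ (testTime b) (ℕ.≤-trans t (ℕ.m≤m+n T T′))) q
  exec-if {b = b} {s = s} {T} {T′} f g | false with g refl
  ...   | executes d t q = executes (if-false⇓ p d) (ℕ.+-monoʳ-≤ (testTime b) (ℕ.≤-trans t (ℕ.m≤n+m T′ T))) q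

  -- The list of pending items is the variant of the loop, and it also carries the time of each
  -- iteration.
  exec-while : ∀ {ℓ a} {A : Set a} {b P} {T : A → ℕ} (J : List A → State → Set ℓ) {s} →
    (∀ {s′} → Frame P s s′ → J [] s′ → test s′ b ≡ false) →
    (∀ {x xs s′} → Frame P s s′ → J (x ∷ xs) s′ → test s′ b ≡ true × Exec P s′ (T x) (J xs)) →
    ∀ xs {s₁} → Frame P s s₁ → J xs s₁ →
    Exec (while b P) s₁ (testTime b + sum (map (λ x → testTime b + T x) xs)) (J [])
  exec-while {b = b} J f g [] F j = executes (while-false⇓ (f F j)) (ℕ.m≤m+n (testTime b) 0) j
  exec-while {b = b} {T = T} J f g (x ∷ xs) F j with g F j
  ... | p , executes d t q with exec-while J f g xs (frame-trans F (frame d)) q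
  ...   | executes e u r = executes (while-true⇓ p d e) (ℕ.≤-trans (ℕ.+-monoʳ-≤ (testTime b) (ℕ.+-mono-≤ t u)) (begin
    testTime b + (T x + (testTime b + rest)) ≡⟨ cong (testTime b +_) (trans (sym (ℕ.+-assoc (T x) _ _))
      (trans (cong (_+ rest) (ℕ.+-comm (T x) _)) refl)) ⟩
    testTime b + (testTime b + T x + rest) ∎)) r
    where
    open ℕ.≤-Reasoning
    rest = sum (map (λ x → testTime b + T x) xs)

  -- J must be insensitive to the loop register, which is overwritten between iterations; the value
  -- of the register is tracked separately by `K`.
  exec-for : ∀ {ℓ a} {A : Set a} {v N P} {T : A → ℕ} (J : ℕ → List A → State → Set ℓ) {s} xs →
    writesInt P v ≡ false →
    (∀ {s′} → Frame (for v N P) s s′ → evalInt s′ N ≡ length xs) →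
    (∀ {k rest s′} n → J k rest s′ → J k rest (writeInt v [] n s′)) →
    (∀ {k x rest s′} → Frame (for v N P) s s′ → ints s′ v [] ≡ k → J k (x ∷ rest) s′ →
      Exec P s′ (T x) (J (suc k) rest)) →
    J 0 xs s → Exec (for v N P) s (forTime N (map T xs)) (J (length xs) [])
  exec-for {A = A} {v} {N} {P} {T} J {s} xs v∉ bound stable step j =
    exec-mono time≤ (λ { _ (k , _ , p , j) → subst (λ k → J k [] _) (trans (sym (ℕ.+-identityʳ k)) p) j })
      (exec-seq {P = setInt v [] (lit 0)} {T = 2} {Q = _≡ writeInt v [] 0 s} {R = K []} (exec-setInt refl) λ { F refl →
        exec-while {b = test₁} {P = body} {T = λ x → T x + 4} K {s = writeInt v [] 0 s} stop′ step′ xs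
          (frame-refl {body})
          (0 , write-scalar v 0 s , refl , stable 0 j) })
    where
    test₁ = (int v [] ⊕ lit 1) ≤ⁿ N
    body = P ⨾ setInt v [] (int v [] ⊕ lit 1)

    K : List A → State → Set _
    K rest s′ = ∃[ k ] ints s′ v [] ≡ k × k + length rest ≡ length xs × J k rest s′

    whole : ∀ {s′} → Frame body (writeInt v [] 0 s) s′ → Frame (for v N P) s s′
    whole F = frame-trans {for v N P}
      (frame-left {setInt v [] (lit 0)} {while test₁ body} (frame (setInt⇓ {s = s} {v} {[]} {lit 0})))
      (frame-right {setInt v [] (lit 0)} {while test₁ body} (frame-while {test₁} {body} F))

    stop′ : ∀ {s′} → Frame body (writeInt v [] 0 s) s′ → K [] s′ → test s′ test₁ ≡ false
    stop′ {s′} F (k , p , q , _) = dec-false (evalInt s′ (int v [] ⊕ lit 1) ℕ.≤? evalInt s′ N)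
      λ r → ℕ.<-irrefl {k} (trans (sym (ℕ.+-identityʳ k)) q)
        (subst₂ ℕ._≤_ (trans (cong (_+ 1) p) (ℕ.+-comm k 1)) (bound (whole F)) r)

    step′ : ∀ {x rest s′} → Frame body (writeInt v [] 0 s) s′ → K (x ∷ rest) s′ →
            test s′ test₁ ≡ true × Exec body s′ (T x + 4) (K rest)
    step′ {x} {rest} {s′} F (k , p , q , j) =
      dec-true (evalInt s′ (int v [] ⊕ lit 1) ℕ.≤? evalInt s′ N)
        (subst₂ ℕ._≤_ (sym (trans (cong (_+ 1) p) (ℕ.+-comm k 1))) (sym (bound (whole F)))
          (subst (suc k ℕ.≤_) (trans (sym (ℕ.+-suc k _)) q) (s≤s (ℕ.m≤m+n k _)))) ,
      exec-seq (step (whole F) p j) (λ {s₁} F₁ j₁ → exec-setInt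
        (suc k ,
         trans (write-scalar v _ s₁) (trans (cong (_+ 1) (trans (cong (λ f → f []) (int-frame F₁ v v∉)) p)) (ℕ.+-comm k 1)) ,
         trans (sym (ℕ.+-suc k _)) q , stable _ j₁))
    time≤ : 2 + (testTime test₁ + sum (map (λ x → testTime test₁ + (T x + 4)) xs)) ℕ.≤ forTime N (map T xs)
    time≤ = begin
      6 + intTime N + sum (map (λ x → 4 + intTime N + (T x + 4)) xs)
        ≤⟨ ℕ.+-monoˡ-≤ (sum (map (λ x → 4 + intTime N + (T x + 4)) xs)) (ℕ.m≤n+m (6 + intTime N) 2) ⟩
      8 + intTime N + sum (map (λ x → 4 + intTime N + (T x + 4)) xs)
        ≡⟨ cong (λ ts → 8 + intTime N + sum ts) (trans (List.map-cong rearrange xs) (List.map-∘ xs)) ⟩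
      forTime N (map T xs) ∎
      where
      open ℕ.≤-Reasoning
      rearrange : ∀ x → 4 + intTime N + (T x + 4) ≡ 8 + intTime N + T x
      rearrange x = trans (cong (4 + intTime N +_) (ℕ.+-comm (T x) 4))
        (trans (sym (ℕ.+-assoc (4 + intTime N) 4 (T x))) (cong (λ t → 4 + t + T x) (ℕ.+-comm (intTime N) 4)))

  -- The invariant speaks of the list produced so far, starting from an arbitrary `pre`. In this
  -- form the conclusion for an inner loop is one step of the invariant of the outer loop.
  exec-for-fin : ∀ {ℓ b n} {B : Set b} {v N P} {T : Fin n → ℕ} (J : ℕ → List B → State → Set ℓ)
    (g : Fin n → List B) {s} →
    writesInt P v ≡ false →
    (∀ {s′} → Frame (for v N P) s s′ → evalInt s′ N ≡ n) →
    (∀ {k pre s′} m → J k pre s′ → J k pre (writeInt v [] m s′)) →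
    (∀ {i pre s′} → Frame (for v N P) s s′ → ints s′ v [] ≡ toℕ i → J (toℕ i) pre s′ →
      Exec P s′ (T i) (J (suc (toℕ i)) (pre ++ g i))) →
    ∀ pre → J 0 pre s →
    Exec (for v N P) s (forTime N (map T (allFin n))) (J n (pre ++ concatMap g (allFin n)))
  exec-for-fin {n = n} {v = v} {N} {P} {T} J g {s} v∉ bound stable step pre j =
    exec-map (λ { {s′} _ (pre₁ , j₁ , p , _) → subst₂ (λ k l → J k l s′) (List.length-tabulate id)
        (trans (sym (List.++-identityʳ pre₁)) p) j₁ })
      (exec-for {T = T} K (allFin n) v∉ (λ F → trans (bound F) (sym (List.length-tabulate id))) (λ { n (pre , j , p) → pre , stable n j , p })
        (λ { {k} {i} {rest} {s′} F q (pre₁ , j₁ , p , r , rs) →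
          exec-map (λ {s″} _ j₂ → pre₁ ++ g i , subst (λ k → J (suc k) (pre₁ ++ g i) s″) r j₂ ,
              trans (List.++-assoc pre₁ (g i) _) p , rs)
            (step F (trans q (sym r)) (subst (λ k → J k pre₁ s′) (sym r) j₁)) })
        (pre , j , refl , tabulate-positions 0 id (λ _ → refl)))
    where
    K : ℕ → List (Fin n) → State → Set _
    K k rest s′ = ∃[ pre₁ ] J k pre₁ s′ × pre₁ ++ concatMap g rest ≡ pre ++ concatMap g (allFin n) × Positions k rest

  -- The amount p of time that is still available bounds the number of iterations.
  exec-while-budget : ∀ {ℓ b P} (J : ℕ → State → Set ℓ) {s} →
    (∀ {p s′} → Frame P s s′ → J p s′ → test s′ b ≡ true →
      ∃[ p′ ] ∃[ T ] Exec P s′ T (J p′) × testTime b + T + p′ ℕ.≤ p) →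
    ∀ {p s₁} → Acc ℕ._<_ p → Frame P s s₁ → J p s₁ →
    ∃[ p′ ] ∃[ T ] Exec (while b P) s₁ T (λ s₂ → J p′ s₂ × test s₂ b ≡ false) × T + p′ ℕ.≤ testTime b + p
  exec-while-budget {b = b} J step {p} {s₁} (acc rs) F j with test s₁ b in q
  ... | false = p , testTime b , executes (while-false⇓ q) ℕ.≤-refl (j , q) , ℕ.≤-refl
  ... | true with step F j q
  ...   | p₁ , T₁ , executes d t j₁ , h
    with exec-while-budget J step (rs (smaller b h)) (frame-trans F (frame d)) j₁
    where
    smaller : ∀ b {T p′ p} → testTime b + T + p′ ℕ.≤ p → p′ ℕ.< p
    -- Every test takes at least one operation, which the case distinction exposes; this makes the
    -- budget strictly decrease.
    smaller (_ ≤ⁿ _) h = ℕ.≤-trans (s≤s (ℕ.m≤n+m _ _)) h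
    smaller (_ ≤ᵛ _) h = ℕ.≤-trans (s≤s (ℕ.m≤n+m _ _)) h
  ...     | p₂ , T₂ , executes e u j₂ , h₂ =
    p₂ , testTime b + (T₁ + T₂) , executes (while-true⇓ q d e) (ℕ.+-monoʳ-≤ (testTime b) (ℕ.+-mono-≤ t u)) j₂ , (begin
      testTime b + (T₁ + T₂) + p₂       ≡⟨ ℕ.+-assoc (testTime b) _ p₂ ⟩
      testTime b + (T₁ + T₂ + p₂)       ≡⟨ cong (testTime b +_) (ℕ.+-assoc T₁ T₂ p₂) ⟩
      testTime b + (T₁ + (T₂ + p₂))     ≤⟨ ℕ.+-monoʳ-≤ (testTime b) (ℕ.+-monoʳ-≤ T₁ h₂) ⟩
      testTime b + (T₁ + (testTime b + p₁)) ≡⟨ cong (testTime b +_) (trans (sym (ℕ.+-assoc T₁ _ _))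
        (cong (_+ p₁) (ℕ.+-comm T₁ (testTime b)))) ⟩
      testTime b + (testTime b + T₁ + p₁) ≤⟨ ℕ.+-monoʳ-≤ (testTime b) h ⟩
      testTime b + p                    ∎)
    where open ℕ.≤-Reasoning

  exec-setInt-then : ∀ {ℓ s a is i P T} {Q : State → Set ℓ} →
    Exec P (writeInt a (evalInts s is) (evalInt s i) s) T Q →
    Exec (setInt a is i ⨾ P) s (cost (setInt a is i) + T) Q
  exec-setInt-then (executes d t q) = executes (seq⇓ setInt⇓ d) (ℕ.+-monoʳ-≤ _ t) q

  exec-setVal-then : ∀ {ℓ s a is v P T} {Q : State → Set ℓ} →
    Exec P (writeVal a (evalInts s is) (evalVal s v) s) T Q →
    Exec (setVal a is v ⨾ P) s (cost (setVal a is v) + T) Q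
  exec-setVal-then (executes d t q) = executes (seq⇓ setVal⇓ d) (ℕ.+-monoʳ-≤ _ t) q

  exec-emit-then : ∀ {ℓ s is P T} {Q : State → Set ℓ} →
    Exec P (record s { output = output s ++ evalInts s is ∷ [] }) T Q →
    Exec (emit is ⨾ P) s (cost (emit is) + T) Q
  exec-emit-then (executes d t q) = executes (seq⇓ emit⇓ d) (ℕ.+-monoʳ-≤ _ t) q

  exec-if-true : ∀ {ℓ b P P′ s T} {Q : State → Set ℓ} → test s b ≡ true →
                 Exec P s T Q → Exec (ifte b P P′) s (testTime b + T) Q
  exec-if-true p (executes d t q) = executes (if-true⇓ p d) (ℕ.+-monoʳ-≤ _ t) q

  exec-if-false : ∀ {ℓ b P P′ s T} {Q : State → Set ℓ} → test s b ≡ false →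
                  Exec P′ s T Q → Exec (ifte b P P′) s (testTime b + T) Q
  exec-if-false p (executes d t q) = executes (if-false⇓ p d) (ℕ.+-monoʳ-≤ _ t) q

  -- Integer arrays below 20 are inputs and scalar registers; the rest is the heap.
  record Heap : Set c where
    field
      hi  : Name → List ℕ → ℕ
      hv  : Name → List ℕ → BoundedChain.Carrier 𝕀
      out : List (List ℕ)

  open Heap public

  heap : State → Heap
  heap s = record { hi = λ a → ints s (20 + a) ; hv = vals s ; out = output s }

-- The main loop as a program

-- Names of heap arrays; array a is stored under the name 20 + a.
#sp #stkA #stkB #kind #fX #fY #fT #fA #fC #fR #deg #adj #done #edone #count : Name
#minId #maxId #next #row #alive #plen #payA #payB #rmin #ralive #stopped #width : Name
#sp      = 0
#stkA    = 1
#stkB    = 2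
#kind    = 3
#fX      = 4
#fY      = 5
#fT      = 6
#fA      = 7
#fC      = 8
#fR      = 9
#deg     = 10
#adj     = 11
#done    = 12
#edone   = 13
#count   = 14
#minId   = 15
#maxId   = 16
#next    = 17
#row     = 18
#alive   = 19
#plen    = 20
#payA    = 21
#payB    = 22
#rmin    = 23
#ralive  = 24
#stopped = 25
#width   = 26

-- Scalar registers.
#i #j #k #l #o #q #y #best #cur #arg #col : Name
#i    = 4
#j    = 5
#k    = 6
#l    = 7
#o    = 8
#q    = 9
#y    = 10
#best = 11
#cur  = 12
#arg  = 13
#col  = 14

-- Arrays and registers of truth values.
#result #level #adjV #key #rkey #bestKey #v : Name
#result  = 4
#level   = 5
#adjV    = 6
#key     = 7
#rkey    = 8
#bestKey = 9
#v       = 10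

mem : Name → List IntExp → IntExp
mem a = int (20 + a)

store : Name → List IntExp → IntExp → Program
store a = setInt (20 + a)

reg : Name → IntExp
reg r = int r []

put : Name → IntExp → Program
put r = setInt r []

push : Program
push =
  store #stkA (mem #sp [] ∷ []) (reg #y) ⨾
  store #stkB (mem #sp [] ∷ []) (reg #q) ⨾
  store #sp [] (mem #sp [] ⊕ lit 1)

-- M is not stored on Vmax. A node of Vmax is extracted at the key at which its counter reached 0,
-- so its value is then in `#level`, where `lowerᴾ` reads it.
settleᴾ lowerᴾ edgeᴾ minᴾ maxᴾ popᴾ : Program
settleᴾ = ifte (lit 1 ≤ⁿ mem #edone (reg #o ∷ reg #y ∷ [])) skip (
  store #edone (reg #o ∷ reg #y ∷ []) (lit 1) ⨾
  store #count (reg #y ∷ []) (mem #count (reg #y ∷ []) ⊖ lit 1) ⨾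
  ifte (mem #count (reg #y ∷ []) ≤ⁿ lit 0) (put #q (lit 0) ⨾ push) skip)
lowerᴾ = ifte (lit 1 ≤ⁿ mem #done (reg #y ∷ [])) skip (
  ifte (val #adjV (reg #o ∷ reg #k ∷ []) ≤ᵛ val #level []) skip (
  setVal #result (mem #fX (reg #y ∷ []) ∷ mem #fY (reg #y ∷ []) ∷ []) (val #level []) ⨾
  put #q (lit 0) ⨾ push))
edgeᴾ =
  put #y (reg #q ⊖ lit 1) ⨾
  emit (lit 0 ∷ mem #fX (reg #o ∷ []) ∷ mem #fY (reg #o ∷ []) ∷ mem #fT (reg #y ∷ [])
        ∷ mem #fA (reg #y ∷ []) ∷ mem #fC (reg #y ∷ []) ∷ mem #fR (reg #y ∷ []) ∷ []) ⨾
  settleᴾ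
minᴾ =
  emit (lit 0 ∷ mem #fX (reg #o ∷ []) ∷ mem #fY (reg #o ∷ []) ∷ []) ⨾
  ifte (lit 1 ≤ⁿ mem #done (reg #o ∷ [])) skip (
  for #k (mem #deg (reg #o ∷ [])) (put #y (mem #adj (reg #o ∷ reg #k ∷ [])) ⨾ settleᴾ) ⨾
  store #done (reg #o ∷ []) (lit 1))
maxᴾ =
  emit (mem #fT (reg #o ∷ []) ∷ mem #fA (reg #o ∷ []) ∷ mem #fC (reg #o ∷ []) ∷ mem #fR (reg #o ∷ []) ∷ []) ⨾
  for #k (mem #deg (reg #o ∷ [])) (put #y (mem #adj (reg #o ∷ reg #k ∷ [])) ⨾ lowerᴾ)
popᴾ =
  store #sp [] (mem #sp [] ⊖ lit 1) ⨾
  put #o (mem #stkA (mem #sp [] ∷ [])) ⨾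
  put #q (mem #stkB (mem #sp [] ∷ [])) ⨾
  ifte (lit 1 ≤ⁿ reg #q) edgeᴾ (ifte (mem #kind (reg #o ∷ []) ≤ⁿ lit 0) minᴾ maxᴾ)

bit : Bool → ℕ
bit b = if b then 1 else 0

bit-test : ∀ b {n} → n ≡ bit b → does (1 ℕ.≤? n) ≡ b
bit-test true refl = refl
bit-test false refl = refl

_≟ˡ_ : DecidableEquality (List ℕ)
_≟ˡ_ = List.≡-dec ℕ._≟_

-- Simulation of a function update by an array write through an injective code. The relation R
-- covers contents that represent values indirectly, such as bits for Booleans or values up to `≈`.
update-code : ∀ {a b r} {X : Set} {A : Set a} {B : Set b} (_≟_ : DecidableEquality X)
              (code : X → List ℕ) → (∀ {x y} → code x ≡ code y → x ≡ y) →
              (R : A → B → Set r) {f : List ℕ → A} {g : X → B} {d : A} {e : B} {is : List ℕ} (x : X) →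
              is ≡ code x → R d e → (∀ y → R (f (code y)) (g y)) →
              ∀ y → R (update _≟ˡ_ is d f (code y)) (update _≟_ x e g y)
update-code _≟_ code inj R {f} {g} {d} {e} x refl de fg y
  with update-case _≟_ x e g y
... | inj₁ (refl , p) rewrite p | update-same _≟ˡ_ (code x) d f = de
... | inj₂ (x≢y , p) rewrite p | update-other _≟ˡ_ d f (x≢y ∘ inj) = fg y

singleton-≢ : ∀ {i j : ℕ} → i ≢ j → _≢_ {A = List ℕ} (i ∷ []) (j ∷ [])
singleton-≢ p refl = p refl

forTime-const : ∀ {a} {A : Set a} N t (xs : List A) →
                forTime N (map (λ _ → t) xs) ℕ.≤ (8 + intTime N + t) * suc (length xs)
forTime-const N t xs = begin
  8 + intTime N + sum (map (8 + intTime N +_) (map (λ _ → t) xs))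
    ≤⟨ ℕ.+-monoˡ-≤ _ (ℕ.m≤m+n (8 + intTime N) t) ⟩
  8 + intTime N + t + sum (map (8 + intTime N +_) (map (λ _ → t) xs))
    ≡⟨ cong (8 + intTime N + t +_) (constant xs) ⟩
  8 + intTime N + t + length xs * (8 + intTime N + t)  ≡⟨ ℕ.*-comm (suc (length xs)) _ ⟩
  (8 + intTime N + t) * suc (length xs)                ∎
  where
  open ℕ.≤-Reasoning
  constant : ∀ {a} {A : Set a} (xs : List A) →
             sum (map (8 + intTime N +_) (map (λ _ → t) xs)) ≡ length xs * (8 + intTime N + t)
  constant [] = refl
  constant (x ∷ xs) = cong (8 + intTime N + t +_) (constant xs)

-- A Boolean, so that a whole block of frame conditions is settled by one `refl`.
none-below : (ℕ → Bool) → ℕ → Bool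
none-below f zero    = true
none-below f (suc n) = not (f n) ∧ none-below f n

none-below-lookup : ∀ {f} n → none-below f n ≡ true → ∀ {i} → i ℕ.< n → f i ≡ false
none-below-lookup {f} (suc n) p {i} i<1+n with f n in q
... | false with i ℕ.≟ n
...   | yes refl = q
...   | no i≢n   = none-below-lookup n p (ℕ.≤∧≢⇒< (ℕ.≤-pred i<1+n) i≢n)

-- Configurations in memory, and one extraction

module MainLoop {c ℓ₁ ℓ₂} (𝕀 : BoundedChain c ℓ₁ ℓ₂) (N : Gödel.MinimaxNet 𝕀) where

  open BoundedChain 𝕀 using (Carrier; _≈_; _≤_; _≤?_; 𝟎; module Eq; antisym)
    renaming (refl to ≤-refl; trans to ≤-trans; total to ≤-total; reflexive to ≤-reflexive)
  open Semantics 𝕀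
  open MinimaxNet N
  open MarkingAlgorithm N
  open Marking 𝕀
  open Correctness N
  open Potential 𝕀 N
  open Finite
  open Invariant

  record StaticHeap : Set c where
    field
      kind fX fY fT fA fC fR deg adj : List ℕ → ℕ
      adjV : List ℕ → Carrier

  static : Heap → StaticHeap
  static H = record
    { kind = hi H #kind ; fX = hi H #fX ; fY = hi H #fY ; fT = hi H #fT ; fA = hi H #fA
    ; fC = hi H #fC ; fR = hi H #fR ; deg = hi H #deg ; adj = hi H #adj ; adjV = hv H #adjV }

  -- The numbers are those that the registration of the nodes happens to assign, so the main loop is
  -- verified for an arbitrary numbering. `code` is what is emitted and `loc` the cell of the
  -- result.
  record Numbering : Set c where
    field
      code : Object → List ℕ
      loc    : Vmin → List ℕ
      idMin  : Vmin → ℕ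
      idMax  : Vmax → ℕ
      code-minNode           : ∀ z → code (minNode z) ≡ 0 ∷ loc z
      code-edge          : ∀ z y → code (edge z y) ≡ code (minNode z) ++ code (maxNode y)
      loc-injective        : ∀ {x z} → loc x ≡ loc z → x ≡ z
      code-max-injective : ∀ {y z} → code (maxNode y) ≡ code (maxNode z) → y ≡ z

  module _ (ν : Numbering) where

    open Numbering ν

    record Tables (S : StaticHeap) : Set c where
      open StaticHeap S
      field
        kind-min : ∀ z → kind (idMin z ∷ []) ≡ 0
        kind-max : ∀ y → kind (idMax y ∷ []) ≡ 1
        loc-min  : ∀ z → fX (idMin z ∷ []) ∷ fY (idMin z ∷ []) ∷ [] ≡ loc z
        code-max : ∀ y → fT (idMax y ∷ []) ∷ fA (idMax y ∷ []) ∷ fC (idMax y ∷ []) ∷ fR (idMax y ∷ []) ∷ []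
                         ≡ code (maxNode y)
        deg-min  : ∀ z → deg (idMin z ∷ []) ≡ length (succMin z)
        deg-max  : ∀ y → deg (idMax y ∷ []) ≡ length (succMax y)
        adj-min  : ∀ z → at-list (λ k → adj (idMin z ∷ k ∷ [])) 0 (map idMax (succMin z))
        adj-max  : ∀ y → at-list (λ k → adj (idMax y ∷ k ∷ [])) 0 (map idMin (succMax y))
        adjV-max : ∀ y → at-list (λ k → adjV (idMax y ∷ k ∷ [])) 0 (map (E↓ y) (succMax y))

      -- The tables of coordinates invert the numbering, which makes it injective.
      idMin-injective : ∀ {x z} → idMin x ≡ idMin z → x ≡ z
      idMin-injective {x} {z} p = loc-injective (trans (sym (loc-min x))
        (trans (cong (λ i → fX (i ∷ []) ∷ fY (i ∷ []) ∷ []) p) (loc-min z)))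

      idMax-injective : ∀ {x z} → idMax x ≡ idMax z → x ≡ z
      idMax-injective {x} {z} p = code-max-injective (trans (sym (code-max x))
        (trans (cong (λ i → fT (i ∷ []) ∷ fA (i ∷ []) ∷ fC (i ∷ []) ∷ fR (i ∷ []) ∷ []) p) (code-max z)))

    open Tables

    -- An object is kept on the stack as a pair of numbers.
    codeA codeB : Object → ℕ
    codeA (minNode z) = idMin z
    codeA (maxNode y) = idMax y
    codeA (edge z y)  = idMin z
    codeB (minNode z) = 0
    codeB (maxNode y) = 0
    codeB (edge z y)  = suc (idMax y)

    Cells : (A B : List ℕ → ℕ) → List (Object × Carrier) → Set
    Cells A B [] = ⊤
    Cells A B ((o , _) ∷ st) =
      A (length st ∷ []) ≡ codeA o × B (length st ∷ []) ≡ codeB o × Cells A B st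

    -- Marks are compared up to `≈`: a written mark is a copy of `#level`, which is only known to
    -- bound M(z) from both sides. There is no entry for M on Vmax because it is not kept in memory.
    record Dynamic (H : Heap) (C : Config) : Set (c ⊔ ℓ₁) where
      field
        done-r  : ∀ z → hi H #done (idMin z ∷ []) ≡ bit (done C z)
        edone-r : ∀ ((z , y) : Vmin × Vmax) → hi H #edone (idMin z ∷ idMax y ∷ []) ≡ bit (edgeDone C (z , y))
        count-r : ∀ y → hi H #count (idMax y ∷ []) ≡ count C y
        mark-r  : ∀ z → hv H #result (loc z) ≈ Mmin C z

    open Dynamic

    record Stack (H : Heap) (st : List (Object × Carrier)) : Set where
      constructor stack
      field
        size  : hi H #sp [] ≡ length st
        cells : Cells (hi H #stkA) (hi H #stkB) st

    -- The queue is split into the stack `st`, whose keys are at most the level l, and the part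
    -- `rest` that is not loaded yet. Where l is also below all keys, every entry of the stack is a
    -- legitimate choice of the algorithm.
    record Represents (H : Heap) (C : Config) (rest : List (Object × Carrier)) (l : Carrier)
                      (outp : List (List ℕ)) : Set (c ⊔ ℓ₁ ⊔ ℓ₂) where
      constructor represents
      field
        {st}      : List (Object × Carrier)
        tables    : Tables (static H)
        dynamic   : Dynamic H C
        stk       : Stack H st
        queue-st  : queue C ↭ st ++ rest
        low       : All (λ (_ , k) → k ≤ l) st
        level-r   : hv H #level [] ≡ l
        output-r  : out H ≡ outp

    open Represents

    -- The integer arrays that Represents reads are the first 15 of the heap.
    represents-frame : ∀ {P s s₁ C rest l outp} → Frame P s s₁ →
      none-below (λ a → writesInt P (20 + a)) 15 ≡ true →
      writesVal P #adjV ≡ false → writesVal P #result ≡ false → writesVal P #level ≡ false → emits P ≡ false →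
      Represents (heap s) C rest l outp → Represents (heap s₁) C rest l outp
    represents-frame {P} {s} {s₁} F p q r t u R = represents
      (subst Tables (static≡ (i≡ 3) (i≡ 4) (i≡ 5) (i≡ 6) (i≡ 7) (i≡ 8) (i≡ 9) (i≡ 10) (i≡ 11) (sym (val-frame F #adjV q))) (tables R))
      record
        { done-r  = λ z → trans (cong (λ f → f (idMin z ∷ [])) (i≡′ 12)) (done-r (dynamic R) z)
        ; edone-r = λ (z , y) → trans (cong (λ f → f (idMin z ∷ idMax y ∷ [])) (i≡′ 13)) (edone-r (dynamic R) (z , y))
        ; count-r = λ y → trans (cong (λ f → f (idMax y ∷ [])) (i≡′ 14)) (count-r (dynamic R) y)
        ; mark-r  = λ z → Eq.trans (Eq.reflexive (cong (λ f → f (loc z)) (val-frame F #result r))) (mark-r (dynamic R) z)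
        }
      (stack (trans (cong (λ f → f []) (i≡′ 0)) (Stack.size (stk R)))
        (subst₂ (λ A B → Cells A B (st R)) (i≡ 1) (i≡ 2) (Stack.cells (stk R))))
      (queue-st R) (low R)
      (trans (cong (λ f → f []) (val-frame F #level t)) (level-r R))
      (trans (out-frame F u) (output-r R))
      where
      i≡′ : ∀ a {a<15 : T (a ℕ.<ᵇ 15)} → ints s₁ (20 + a) ≡ ints s (20 + a)
      i≡′ a {a<15} = int-frame F (20 + a) (none-below-lookup {λ a → writesInt P (20 + a)} 15 p (ℕ.<ᵇ⇒< a 15 a<15))

      i≡ : ∀ a {a<15 : T (a ℕ.<ᵇ 15)} → ints s (20 + a) ≡ ints s₁ (20 + a)
      i≡ a {a<15} = sym (i≡′ a {a<15})

      static≡ : ∀ {a₁ a₂ a₃ a₄ a₅ a₆ a₇ a₈ a₉ b₁ b₂ b₃ b₄ b₅ b₆ b₇ b₈ b₉ v w} →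
        a₁ ≡ b₁ → a₂ ≡ b₂ → a₃ ≡ b₃ → a₄ ≡ b₄ → a₅ ≡ b₅ → a₆ ≡ b₆ → a₇ ≡ b₇ → a₈ ≡ b₈ → a₉ ≡ b₉ → v ≡ w →
        record { kind = a₁ ; fX = a₂ ; fY = a₃ ; fT = a₄ ; fA = a₅ ; fC = a₆ ; fR = a₇ ; deg = a₈ ; adj = a₉ ; adjV = v } ≡
        record { kind = b₁ ; fX = b₂ ; fY = b₃ ; fT = b₄ ; fA = b₅ ; fC = b₆ ; fR = b₇ ; deg = b₈ ; adj = b₉ ; adjV = w }
      static≡ refl refl refl refl refl refl refl refl refl refl = refl

    cells-frame : ∀ {A B} n {a b} st → length st ℕ.≤ n → Cells A B st →
                  Cells (update _≟ˡ_ (n ∷ []) a A) (update _≟ˡ_ (n ∷ []) b B) st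
    cells-frame n [] _ _ = tt
    cells-frame {A} {B} n {a} {b} (_ ∷ st) p (q , r , cs) =
      trans (update-other _≟ˡ_ a A ne) q , trans (update-other _≟ˡ_ b B ne) r ,
      cells-frame n st (ℕ.<⇒≤ p) cs
      where
      ne : _≢_ {A = List ℕ} (n ∷ []) (length st ∷ [])
      ne = singleton-≢ (ℕ.<⇒≢ p ∘ sym)

    pushed : State → State
    pushed s = writeInt (20 + #sp) [] (ints s (20 + #sp) [] + 1)
      (writeInt (20 + #stkB) (ints s (20 + #sp) [] ∷ []) (ints s #q [])
        (writeInt (20 + #stkA) (ints s (20 + #sp) [] ∷ []) (ints s #y []) s))

    push-stack : ∀ {s st} o {k} → Stack (heap s) st → ints s #y [] ≡ codeA o → ints s #q [] ≡ codeB o →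
                 Stack (heap (pushed s)) ((o , k) ∷ st)
    push-stack {s} {st} o (stack p cs) py pq rewrite p = stack (ℕ.+-comm _ 1)
      (trans (update-same _≟ˡ_ (length st ∷ []) _ (ints s (20 + #stkA))) py ,
       trans (update-same _≟ˡ_ (length st ∷ []) _ (ints s (20 + #stkB))) pq ,
       cells-frame (length st) st ℕ.≤-refl cs)

    exec-push : ∀ {ℓ s} {Q : State → Set ℓ} → Q (pushed s) → Exec push s (cost push) Q
    exec-push q = exec-setInt-then (exec-setInt-then (exec-setInt q))

    settle-exec : ∀ {s C rest l outp v} z y → Represents (heap s) C rest l outp →
                  ints s #o [] ≡ idMin z → ints s #y [] ≡ idMax y → v ≤ l →
                  Exec settleᴾ s (cost settleᴾ) (λ s′ → Represents (heap s′) (settle v z C y) rest l outp)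
    settle-exec {s} {C} {rest} {l} {outp} {v} z y R po py v≤l = exec-if
      (λ t → exec-skip (subst (λ C → Represents (heap s) C rest l outp)
        (sym (settle-done {v} {z} {C} {y} (trans (sym (bit-test _ flag)) t))) R))
      (λ t → exec-mono ℕ.≤-refl
        (λ _ → subst (λ C → Represents _ C rest l outp) (sym (settle-undone {v} {z} {C} {y} (trans (sym (bit-test _ flag)) t))))
        (exec-setInt-then (exec-setInt-then (exec-if
          (λ t → exec-setInt-then (exec-push (finish-push t)))
          (λ t → exec-skip (finish-skip t))))))
      where
      D = dynamic R
      flag : ints s (20 + #edone) (ints s #o [] ∷ ints s #y [] ∷ []) ≡ bit (edgeDone C (z , y))
      flag rewrite po | py = edone-r D (z , y)

      s₁ s₂ : State
      s₁ = writeInt (20 + #edone) (ints s #o [] ∷ ints s #y [] ∷ []) 1 s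
      s₂ = writeInt (20 + #count) (ints s #y [] ∷ []) (ints s (20 + #count) (ints s #y [] ∷ []) ∸ 1) s₁

      D′ : Dynamic (heap s₂) (settled v z C y)
      D′ = record
        { done-r  = done-r D
        ; edone-r = update-code (_≟_ (×-finite Vmin-finite Vmax-finite))
            (λ (z , y) → idMin z ∷ idMax y ∷ [])
            (λ p → cong₂ _,_ (idMin-injective (tables R) (proj₁ (List.∷-injective p)))
              (idMax-injective (tables R) (proj₁ (List.∷-injective (proj₂ (List.∷-injective p))))))
            (λ n b → n ≡ bit b) {f = ints s (20 + #edone)} {g = edgeDone C} (z , y) (cong₂ (λ a b → a ∷ b ∷ []) po py) refl (edone-r D)
        ; count-r = update-code (_≟_ Vmax-finite) (λ y → idMax y ∷ [])
            (λ p → idMax-injective (tables R) (proj₁ (List.∷-injective p)))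
            _≡_ {f = ints s (20 + #count)} {g = count C} y (cong (_∷ []) py)
            (cong (_∸ 1) (trans (cong (λ i → ints s (20 + #count) (i ∷ [])) py) (count-r D y))) (count-r D)
        ; mark-r  = mark-r D
        }

      empty-test : does (pred (count C y) ℕ.≟ 0) ≡ test s₂ (mem #count (reg #y ∷ []) ≤ⁿ lit 0)
      empty-test = trans (lemma (pred (count C y))) (cong (λ n → does (n ℕ.≤? 0)) (sym
        (trans (update-same _≟ˡ_ (ints s #y [] ∷ []) _ (ints s (20 + #count)))
          (cong (_∸ 1) (trans (cong (λ i → ints s (20 + #count) (i ∷ [])) py) (count-r D y))))))
        where
        lemma : ∀ n → does (n ℕ.≟ 0) ≡ does (n ℕ.≤? 0)
        lemma zero    = refl
        lemma (suc n) = refl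

      finish-push : test s₂ (mem #count (reg #y ∷ []) ≤ⁿ lit 0) ≡ true →
                    Represents (heap (pushed (writeInt #q [] 0 s₂))) (settled v z C y) rest l outp
      -- Rebuilding a record from its own fields moves it to another memory: the arrays it reads are
      -- unchanged by definition, although its index differs. The same device is used wherever only
      -- registers or foreign arrays are written.
      finish-push t = represents (tables R) record { Dynamic D′ }
        (push-stack {writeInt #q [] 0 s₂} (maxNode y) {v} record { Stack (stk R) } py refl)
        (subst (λ b → (if b then (maxNode y , v) ∷ queue C else queue C) ↭ (maxNode y , v) ∷ st R ++ rest)
          (sym (trans empty-test t)) (prep _ (queue-st R)))
        (v≤l ∷ low R) (level-r R) (output-r R)

      finish-skip : test s₂ (mem #count (reg #y ∷ []) ≤ⁿ lit 0) ≡ false →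
                    Represents (heap s₂) (settled v z C y) rest l outp
      finish-skip t = represents (tables R) D′ record { Stack (stk R) }
        (subst (λ b → (if b then (maxNode y , v) ∷ queue C else queue C) ↭ st R ++ rest)
          (sym (trans empty-test t)) (queue-st R))
        (low R) (level-r R) (output-r R)

    -- The program compares with and copies `#level` where the algorithm uses M(z); this is why l
    -- and `Mmax C z` are assumed to bound each other.
    lower-exec : ∀ {s C rest l outp} z x → Represents (heap s) C rest l outp →
                 ints s #o [] ≡ idMax z → ints s #y [] ≡ idMin x →
                 vals s #adjV (idMax z ∷ ints s #k [] ∷ []) ≡ E↓ z x →
                 l ≤ Mmax C z → Mmax C z ≤ l →
                 Exec lowerᴾ s (cost lowerᴾ) (λ s′ → Represents (heap s′) (lower z C x) rest l outp)
    lower-exec {s} {C} {rest} {l} {outp} z x R po py pE l≤ ≤l = exec-if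
      (λ t → exec-skip (unchanged (λ p _ → true≢false t (trans flag p))))
      (λ t → exec-if
        (λ u → exec-skip (unchanged (λ _ p → p (≤-trans
          (subst₂ _≤_ E-read (level-r R) (does-true (_ ≤? _) u)) l≤))))
        (λ u → exec-setVal-then (exec-setInt-then (exec-push
          (subst (λ C′ → Represents (heap (pushed s₁)) C′ rest l outp)
            (sym (changed (trans (sym flag) t) λ p → does-false (_ ≤? _) u
              (subst₂ _≤_ (sym E-read) (sym (level-r R)) (≤-trans p ≤l))))
            finish)))))
      where
      D = dynamic R
      s₁ : State
      s₁ = writeInt #q [] 0 (writeVal #result
        (ints s (20 + #fX) (ints s #y [] ∷ []) ∷ ints s (20 + #fY) (ints s #y [] ∷ []) ∷ []) (vals s #level []) s)

      flag : test s (lit 1 ≤ⁿ mem #done (reg #y ∷ [])) ≡ done C x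
      flag = bit-test (done C x) (trans (cong (λ i → ints s (20 + #done) (i ∷ [])) py) (done-r D x))

      E-read : vals s #adjV (ints s #o [] ∷ ints s #k [] ∷ []) ≡ E↓ z x
      E-read = trans (cong (λ i → vals s #adjV (i ∷ ints s #k [] ∷ [])) po) pE

      unchanged : (done C x ≡ false → ¬ E↓ z x > Mmax C z) → Represents (heap s) (lower z C x) rest l outp
      unchanged p with lower z C x | lowerView z C x
      ... | _ | done-min _   = R
      ... | _ | blocked _    = R
      ... | _ | lowering d E = contradiction E (p d)

      changed : done C x ≡ false → E↓ z x > Mmax C z → lower z C x ≡ lowered z C x
      changed p q with lower z C x | lowerView z C x
      ... | _ | done-min d   = true≢false d p
      ... | _ | blocked b    = contradiction b q
      ... | _ | lowering _ _ = refl

      finish : Represents (heap (pushed s₁)) (lowered z C x) rest l outp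
      finish = represents (tables R)
        record
          { done-r = done-r D ; edone-r = edone-r D ; count-r = count-r D
          ; mark-r = update-code (_≟_ Vmin-finite) loc loc-injective _≈_
              {f = vals s #result} {g = Mmin C} x
              (trans (cong (λ i → ints s (20 + #fX) (i ∷ []) ∷ ints s (20 + #fY) (i ∷ []) ∷ []) py) (loc-min (tables R) x))
              (Eq.trans (Eq.reflexive (level-r R)) (antisym l≤ ≤l)) (mark-r D)
          }
        (push-stack {s₁} (minNode x) {Mmax C z} record { Stack (stk R) } py refl)
        (prep _ (queue-st R))
        (≤l ∷ low R) (level-r R) (output-r R)

    at-list-frame : ∀ {a} {A : Set a} {f g : ℕ → A} k xs → f ≡ g → at-list f k xs → at-list g k xs
    at-list-frame k xs refl p = p

    read-output : ∀ {H C rest l outp} is → Represents H C rest l outp →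
                  Represents (record { hi = hi H ; hv = hv H ; out = out H ++ is ∷ [] }) C rest l (outp ++ is ∷ [])
    read-output is R = represents (tables R) record { Dynamic (dynamic R) } record { Stack (stk R) }
      (queue-st R) (low R) (level-r R) (cong (_++ is ∷ []) (output-r R))

    settles-exec : ∀ {s C rest l outp v} z → Represents (heap s) C rest l outp →
                   ints s #o [] ≡ idMin z → v ≤ l →
                   Exec (for #k (mem #deg (reg #o ∷ [])) (put #y (mem #adj (reg #o ∷ reg #k ∷ [])) ⨾ settleᴾ)) s
                     (forTime (mem #deg (reg #o ∷ [])) (map (λ _ → cost (put #y (mem #adj (reg #o ∷ reg #k ∷ [])) ⨾ settleᴾ)) (succMin z)))
                     (λ s′ → Represents (heap s′) (foldl (settle v z) C (succMin z)) rest l outp)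
    settles-exec {s} {C} {rest} {l} {outp} {v} z R po v≤l =
      exec-map (λ { _ (C′ , R′ , p , _) → subst (λ C → Represents _ C rest l outp) p R′ })
        (exec-for J (succMin z) refl
          (λ {s′} F → trans (cong₂ (λ f i → f (i ∷ [])) (int-frame F (20 + #deg) refl)
              (scalar-frame F #o refl po)) (deg-min (tables R) z))
          (λ n (C′ , R′ , p , a) → C′ , record { Represents R′ } , p , a)
          (λ {k} {y} {ys} {s′} F pk (C′ , R′ , p , a , as) →
            let po′ = scalar-frame F #o refl po in
            exec-setInt-then (exec-map
              (λ G R″ → settle v z C′ y , R″ , p ,
                at-list-frame (suc k) (map idMax ys) (cong (λ f k → f (idMin z ∷ k ∷ [])) (sym (int-frame G (20 + #adj) refl))) as)
              (settle-exec z y (record { Represents R′ }) po′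
                (trans (cong₂ (λ i k → ints s′ (20 + #adj) (i ∷ k ∷ [])) po′ pk) a) v≤l)))
          (C , R , refl , adj-min (tables R) z))
      where
      J : ℕ → List Vmax → State → Set _
      J k ys s′ = ∃[ C′ ] Represents (heap s′) C′ rest l outp ×
        foldl (settle v z) C′ ys ≡ foldl (settle v z) C (succMin z) ×
        at-list (λ k → ints s′ (20 + #adj) (idMin z ∷ k ∷ [])) k (map idMax ys)

    lower-Mmax : ∀ z C x → Mmax (lower z C x) ≡ Mmax C
    lower-Mmax z C x with lower z C x | lowerView z C x
    ... | _ | done-min _   = refl
    ... | _ | blocked _    = refl
    ... | _ | lowering _ _ = refl

    lowers-exec : ∀ {s C rest l outp} z → Represents (heap s) C rest l outp →
                  ints s #o [] ≡ idMax z → l ≤ Mmax C z → Mmax C z ≤ l →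
                  Exec (for #k (mem #deg (reg #o ∷ [])) (put #y (mem #adj (reg #o ∷ reg #k ∷ [])) ⨾ lowerᴾ)) s
                    (forTime (mem #deg (reg #o ∷ [])) (map (λ _ → cost (put #y (mem #adj (reg #o ∷ reg #k ∷ [])) ⨾ lowerᴾ)) (succMax z)))
                    (λ s′ → Represents (heap s′) (foldl (lower z) C (succMax z)) rest l outp)
    lowers-exec {s} {C} {rest} {l} {outp} z R po l≤ ≤l =
      exec-map (λ { _ (C′ , R′ , p , _) → subst (λ C → Represents _ C rest l outp) p R′ })
        (exec-for J (succMax z) refl
          (λ {s′} F → trans (cong₂ (λ f i → f (i ∷ [])) (int-frame F (20 + #deg) refl)
              (scalar-frame F #o refl po)) (deg-max (tables R) z))
          (λ n (C′ , R′ , p , a) → C′ , record { Represents R′ } , p , a)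
          (λ {k} {x} {xs} {s′} F pk (C′ , R′ , p , m , (a , as) , (b , bs)) →
            let po′ = scalar-frame F #o refl po in
            exec-setInt-then (exec-map
              (λ G R″ → lower z C′ x , R″ , p , trans (lower-Mmax z C′ x) m ,
                at-list-frame (suc k) (map idMin xs) (cong (λ f k → f (idMax z ∷ k ∷ [])) (sym (int-frame G (20 + #adj) refl))) as ,
                at-list-frame (suc k) (map (E↓ z) xs) (cong (λ f k → f (idMax z ∷ k ∷ [])) (sym (val-frame G #adjV refl))) bs)
              (lower-exec z x (record { Represents R′ }) po′
                (trans (cong₂ (λ i k → ints s′ (20 + #adj) (i ∷ k ∷ [])) po′ pk) a)
                (trans (cong (λ k → vals s′ #adjV (idMax z ∷ k ∷ [])) pk) b)
                (subst (λ f → l ≤ f z) (sym m) l≤) (subst (λ f → f z ≤ l) (sym m) ≤l))))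
          (C , R , refl , refl , adj-max (tables R) z , adjV-max (tables R) z))
      where
      J : ℕ → List Vmin → State → Set _
      J k xs s′ = ∃[ C′ ] Represents (heap s′) C′ rest l outp ×
        foldl (lower z) C′ xs ≡ foldl (lower z) C (succMax z) ×
        Mmax C′ ≡ Mmax C ×
        at-list (λ k → ints s′ (20 + #adj) (idMax z ∷ k ∷ [])) k (map idMin xs) ×
        at-list (λ k → vals s′ #adjV (idMax z ∷ k ∷ [])) k (map (E↓ z) xs)

    -- Any constant that is not exceeded by the closed expressions arising in `bound`; each
    -- comparison is decided by evaluating `≤ᵇ`.
    popTime : ℕ
    popTime = 200

    affine-time : ∀ x {f} K {w} y → f ℕ.≤ K * w → 1 ℕ.≤ w → T (x + y + K ℕ.≤ᵇ popTime) → x + (f + y) ℕ.≤ popTime * w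
    affine-time x {f} K {w} y p q r = begin
      x + (f + y)             ≡⟨ cong (x +_) (ℕ.+-comm f y) ⟩
      x + (y + f)             ≡⟨ ℕ.+-assoc x y f ⟨
      x + y + f               ≤⟨ ℕ.+-mono-≤ (ℕ.m≤m*n (x + y) w {{ℕ.>-nonZero q}}) p ⟩
      (x + y) * w + K * w     ≡⟨ ℕ.*-distribʳ-+ w (x + y) K ⟨
      (x + y + K) * w         ≤⟨ ℕ.*-monoˡ-≤ w (ℕ.≤ᵇ⇒≤ (x + y + K) popTime r) ⟩
      popTime * w             ∎
      where open ℕ.≤-Reasoning

    constant-time : ∀ x {w} → 1 ℕ.≤ w → T (x ℕ.≤ᵇ popTime) → x ℕ.≤ popTime * w
    constant-time x {w} q r = ℕ.≤-trans (ℕ.≤ᵇ⇒≤ x popTime r) (ℕ.m≤m*n popTime w {{ℕ.>-nonZero q}})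

    popHead : ℕ
    popHead = cost (store #sp [] (mem #sp [] ⊖ lit 1)) +
      (cost (put #o (mem #stkA (mem #sp [] ∷ []))) + cost (put #q (mem #stkB (mem #sp [] ∷ []))))

    minEmit maxEmit : List IntExp
    minEmit = lit 0 ∷ mem #fX (reg #o ∷ []) ∷ mem #fY (reg #o ∷ []) ∷ []
    maxEmit = mem #fT (reg #o ∷ []) ∷ mem #fA (reg #o ∷ []) ∷ mem #fC (reg #o ∷ []) ∷ mem #fR (reg #o ∷ []) ∷ []

    -- No search takes place. The key k of the top entry agrees with l, since the stack lies below l
    -- and the whole queue above, so `#level` supplies the value that this extraction is to use.
    pop-exec : ∀ {s C rest l outp o k st′ a} (R : Represents (heap s) C rest l outp) → st R ≡ (o , k) ∷ st′ →
               Invariant (λ _ → ⊥) a C → (∀ {o k} → (o , k) ∈ queue C → l ≤ k) →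
               Exec popᴾ s (popTime * work o C) λ s′ →
                 Represents (heap s′) (process o (record C { queue = st′ ++ rest })) rest l (outp ++ code o ∷ [])
    pop-exec {s} {C} {rest} {l} {outp} {o} {k} {st′} R refl I l≤key =
      exec-mono (bound o) (λ _ → id) (exec-setInt-then (exec-setInt-then (exec-setInt-then (branch o refl))))
      where
      C₁ = record C { queue = st′ ++ rest }
      s₁ = writeInt (20 + #sp) [] (ints s (20 + #sp) [] ∸ 1) s
      s₂ = writeInt #o [] (ints s (20 + #stkA) (ints s (20 + #sp) [] ∸ 1 ∷ [])) s₁
      s₃ = writeInt #q [] (ints s (20 + #stkB) (ints s (20 + #sp) [] ∸ 1 ∷ [])) s₂

      e : (o , k) ∈ queue C
      e = Perm.∈-resp-↭ (↭-sym (queue-st R)) (here refl)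

      k≤l : k ≤ l
      k≤l = All.lookup (low R) (here refl)

      l≤k : l ≤ k
      l≤k = l≤key e

      top : ints s (20 + #sp) [] ∸ 1 ≡ length st′
      top = cong (_∸ 1) (Stack.size (stk R))

      po : ints s₃ #o [] ≡ codeA o
      po = trans (cong (λ i → ints s (20 + #stkA) (i ∷ [])) top) (proj₁ (Stack.cells (stk R)))

      pq : ints s₃ #q [] ≡ codeB o
      pq = trans (cong (λ i → ints s (20 + #stkB) (i ∷ [])) top) (proj₁ (proj₂ (Stack.cells (stk R))))

      R₃ : Represents (heap s₃) C₁ rest l outp
      R₃ = represents (tables R) record { Dynamic (dynamic R) }
        (stack top (proj₂ (proj₂ (Stack.cells (stk R)))))
        ↭-refl (All.tail (low R)) (level-r R) (output-r R)

      emitted-min : ∀ z → ints s₃ #o [] ≡ idMin z → evalInts s₃ minEmit ≡ code (minNode z)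
      emitted-min z p = trans (cong (λ i → 0 ∷ ints s (20 + #fX) (i ∷ []) ∷ ints s (20 + #fY) (i ∷ []) ∷ []) p)
        (trans (cong (0 ∷_) (loc-min (tables R) z)) (sym (code-minNode z)))

      emitted-max : ∀ y i → i ≡ idMax y →
        ints s (20 + #fT) (i ∷ []) ∷ ints s (20 + #fA) (i ∷ []) ∷ ints s (20 + #fC) (i ∷ []) ∷ ints s (20 + #fR) (i ∷ []) ∷ []
        ≡ code (maxNode y)
      emitted-max y i p = trans (cong (λ i → ints s (20 + #fT) (i ∷ []) ∷ ints s (20 + #fA) (i ∷ [])
        ∷ ints s (20 + #fC) (i ∷ []) ∷ ints s (20 + #fR) (i ∷ []) ∷ []) p) (code-max (tables R) y)

      emission : ∀ {s′ : State} {is o} → is ≡ code o → Represents (heap s′) C₁ rest l outp →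
                 Represents (record { hi = hi (heap s′) ; hv = hv (heap s′) ; out = output s′ ++ is ∷ [] })
                   C₁ rest l (outp ++ code o ∷ [])
      emission refl R = read-output _ R

      Outcome : Object → State → Set _
      Outcome o s′ = Represents (heap s′) (process o C₁) rest l (outp ++ code o ∷ [])

      loopTime : Program → ∀ {a} {A : Set a} → List A → ℕ
      loopTime P xs = forTime (mem #deg (reg #o ∷ []))
        (map (λ _ → cost (put #y (mem #adj (reg #o ∷ reg #k ∷ [])) ⨾ P)) xs)

      minTime : Bool → List Vmax → ℕ
      minTime true  ys = 1
      minTime false ys = loopTime settleᴾ ys + cost (store #done (reg #o ∷ []) (lit 1))

      branchTime : Object → ℕ
      branchTime (minNode z) = testTime (lit 1 ≤ⁿ reg #q) + (testTime (mem #kind (reg #o ∷ []) ≤ⁿ lit 0) +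
        (cost (emit minEmit) + (testTime (lit 1 ≤ⁿ mem #done (reg #o ∷ [])) + minTime (done C z) (succMin z))))
      branchTime (maxNode y) = testTime (lit 1 ≤ⁿ reg #q) + (testTime (mem #kind (reg #o ∷ []) ≤ⁿ lit 0) +
        (cost (emit maxEmit) + loopTime lowerᴾ (succMax y)))
      branchTime (edge z y) = testTime (lit 1 ≤ⁿ reg #q) + cost edgeᴾ

      bound : ∀ o → cost (store #sp [] (mem #sp [] ⊖ lit 1)) +
        (cost (put #o (mem #stkA (mem #sp [] ∷ []))) + (cost (put #q (mem #stkB (mem #sp [] ∷ []))) + branchTime o))
        ℕ.≤ popTime * work o C
      bound (minNode z) with done C z
      ... | true  = constant-time _ {1} (s≤s z≤n) tt
      ... | false = affine-time (popHead + (testTime (lit 1 ≤ⁿ reg #q) + testTime (mem #kind (reg #o ∷ []) ≤ⁿ lit 0)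
                      + cost (emit minEmit) + testTime (lit 1 ≤ⁿ mem #done (reg #o ∷ []))))
                    (8 + intTime (mem #deg (reg #o ∷ [])) + cost (put #y (mem #adj (reg #o ∷ reg #k ∷ [])) ⨾ settleᴾ))
                    (cost (store #done (reg #o ∷ []) (lit 1)))
                    (forTime-const (mem #deg (reg #o ∷ [])) (cost (put #y (mem #adj (reg #o ∷ reg #k ∷ [])) ⨾ settleᴾ)) (succMin z))
                    (s≤s z≤n) tt
      bound (maxNode y) = ℕ.≤-trans
        (ℕ.+-monoʳ-≤ (popHead + (testTime (lit 1 ≤ⁿ reg #q) + testTime (mem #kind (reg #o ∷ []) ≤ⁿ lit 0) + cost (emit maxEmit)))
          (ℕ.m≤m+n (loopTime lowerᴾ (succMax y)) 0))
        (affine-time (popHead + (testTime (lit 1 ≤ⁿ reg #q) + testTime (mem #kind (reg #o ∷ []) ≤ⁿ lit 0)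
                      + cost (emit maxEmit)))
                    (8 + intTime (mem #deg (reg #o ∷ [])) + cost (put #y (mem #adj (reg #o ∷ reg #k ∷ [])) ⨾ lowerᴾ)) 0
                    (forTime-const (mem #deg (reg #o ∷ [])) (cost (put #y (mem #adj (reg #o ∷ reg #k ∷ [])) ⨾ lowerᴾ)) (succMax y))
                    (s≤s z≤n) tt)
      bound (edge z y) = constant-time _ {1} (s≤s z≤n) tt

      q-test : ∀ {o₁} → o₁ ≡ o → codeB o₁ ≡ 0 → test s₃ (lit 1 ≤ⁿ reg #q) ≡ false
      q-test refl p = cong (λ n → does (1 ℕ.≤? n)) (trans pq p)

      kind-test : ∀ i n → ints s₃ #o [] ≡ i → ints s (20 + #kind) (i ∷ []) ≡ n →
                  test s₃ (mem #kind (reg #o ∷ []) ≤ⁿ lit 0) ≡ does (n ℕ.≤? 0)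
      kind-test i n p q = cong (λ n → does (n ℕ.≤? 0)) (trans (cong (λ i → ints s (20 + #kind) (i ∷ [])) p) q)

      branch : ∀ o₁ → o₁ ≡ o → Exec (ifte (lit 1 ≤ⁿ reg #q) edgeᴾ (ifte (mem #kind (reg #o ∷ []) ≤ⁿ lit 0) minᴾ maxᴾ)) s₃
               (branchTime o₁) (Outcome o₁)
      branch (minNode z) refl = exec-if-false (q-test {minNode z} refl refl)
        (exec-if-true (kind-test (idMin z) 0 po (kind-min (tables R) z)) (exec-emit-then after-emit))
        where
        s₄ : State
        s₄ = record s₃ { output = output s₃ ++ evalInts s₃ minEmit ∷ [] }

        R₄ : Represents (heap s₄) C₁ rest l (outp ++ code (minNode z) ∷ [])
        R₄ = emission {s₃} (emitted-min z po) R₃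

        flag : test s₄ (lit 1 ≤ⁿ mem #done (reg #o ∷ [])) ≡ done C z
        flag = bit-test (done C z) (trans (cong (λ i → ints s (20 + #done) (i ∷ [])) po) (done-r (dynamic R) z))

        after-emit : Exec (ifte (lit 1 ≤ⁿ mem #done (reg #o ∷ [])) skip (
            for #k (mem #deg (reg #o ∷ [])) (put #y (mem #adj (reg #o ∷ reg #k ∷ [])) ⨾ settleᴾ) ⨾
            store #done (reg #o ∷ []) (lit 1))) s₄
          (testTime (lit 1 ≤ⁿ mem #done (reg #o ∷ [])) + minTime (done C z) (succMin z)) (Outcome (minNode z))
        after-emit with done C z in d
        ... | true  = exec-if-true (trans flag d) (exec-skip R₄)
        ... | false = exec-if-false (trans flag d) (exec-seq (settles-exec z R₄ po (≤-trans (minKey I e) k≤l))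
          λ {s₅} F R₅ → exec-setInt (represents (tables R₅)
            record
              { done-r = update-code (_≟_ Vmin-finite) (λ z → idMin z ∷ [])
                  (λ p → idMin-injective (tables R) (proj₁ (List.∷-injective p))) (λ n b → n ≡ bit b)
                  {f = ints s₅ (20 + #done)} {g = done (foldl (settle (Mmin C z) z) C₁ (succMin z))} z
                  (cong (_∷ []) (scalar-frame F #o refl po)) refl (done-r (dynamic R₅))
              ; edone-r = edone-r (dynamic R₅) ; count-r = count-r (dynamic R₅) ; mark-r = mark-r (dynamic R₅)
              }
            record { Stack (stk R₅) } (queue-st R₅) (low R₅) (level-r R₅) (output-r R₅)))
      branch (maxNode y) refl = exec-if-false (q-test {maxNode y} refl refl)
        (exec-if-false (kind-test (idMax y) 1 po (kind-max (tables R) y)) (exec-emit-then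
          (lowers-exec y (emission {s₃} (emitted-max y _ po) R₃) po
            (≤-trans l≤k (proj₂ (proj₂ (maxKey I e)))) (≤-trans (proj₁ (proj₂ (maxKey I e))) k≤l))))
      branch (edge z y) refl = exec-if-true (cong (λ n → does (1 ℕ.≤? n)) pq)
        (exec-setInt-then (exec-emit-then (settle-exec {v = E↑ z y} z y
          (emission {writeInt #y [] (ints s₃ #q [] ∸ 1) s₃}
            (trans (cong₂ _++_ (emitted-min z po) (emitted-max y _ (cong (_∸ 1) pq))) (sym (code-edge z y)))
            (record { Represents R₃ }))
          po (cong (_∸ 1) pq) (≤-trans (proj₁ (proj₂ (edgeKey I e))) k≤l))))

-- Selection of the next class

argmin : IntExp → IntExp → ValExp → Program
argmin N a κ =
  -- `arg` = N records that no entry is alive. The start value 1 bounds every key and the test is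
  -- not strict, so a living entry of key 1 is still found.
  put #arg N ⨾ setVal #bestKey [] oneᵥ ⨾
  for #j N (ifte (lit 1 ≤ⁿ a)
    (ifte (κ ≤ᵛ val #bestKey []) (setVal #bestKey [] κ ⨾ put #arg (reg #j)) skip) skip)

-- Only the row that loses a class has its minimum recomputed, so one selection scans the list of
-- rows and a single row.
refreshᴾ selectᴾ mainᴾ : Program
refreshᴾ =
  argmin (mem #width []) (mem #alive (reg #cur ∷ reg #j ∷ [])) (val #key (reg #cur ∷ reg #j ∷ [])) ⨾
  ifte (mem #width [] ≤ⁿ reg #arg) (store #ralive (reg #cur ∷ []) (lit 0)) (
    store #ralive (reg #cur ∷ []) (lit 1) ⨾
    store #rmin (reg #cur ∷ []) (reg #arg) ⨾
    setVal #rkey (reg #cur ∷ []) (val #bestKey []))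
selectᴾ =
  argmin (mem #row []) (mem #ralive (reg #j ∷ [])) (val #rkey (reg #j ∷ [])) ⨾
  ifte (mem #row [] ≤ⁿ reg #arg) (store #stopped [] (lit 1)) (
    put #cur (reg #arg) ⨾
    put #best (mem #rmin (reg #cur ∷ [])) ⨾
    setVal #level [] (val #key (reg #cur ∷ reg #best ∷ [])) ⨾
    for #k (mem #plen (reg #cur ∷ reg #best ∷ [])) (
      put #y (mem #payA (reg #cur ∷ reg #best ∷ reg #k ∷ [])) ⨾
      put #q (mem #payB (reg #cur ∷ reg #best ∷ reg #k ∷ [])) ⨾
      push) ⨾
    store #alive (reg #cur ∷ reg #best ∷ []) (lit 0) ⨾
    refreshᴾ)
mainᴾ = while (mem #stopped [] ≤ⁿ lit 0) (while (lit 1 ≤ⁿ mem #sp []) popᴾ ⨾ selectᴾ)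

module Selection {c ℓ₁ ℓ₂} (𝕀 : BoundedChain c ℓ₁ ℓ₂) where

  open BoundedChain 𝕀 using (Carrier; _≈_; _≤_; _≤?_; 𝟎; 𝟏; maximum; module Eq)
    renaming (refl to ≤-refl; trans to ≤-trans; reflexive to ≤-reflexive)
  open Semantics 𝕀
  open Marking 𝕀 using (≰⇒≥)

  argminTime : IntExp → IntExp → ValExp → ℕ
  argminTime N a κ = 3 + intTime N + (8 + intTime N + cost (ifte (lit 1 ≤ⁿ a)
    (ifte (κ ≤ᵛ val #bestKey []) (setVal #bestKey [] κ ⨾ put #arg (reg #j)) skip) skip))

  record Smallest (s : State) (n : ℕ) (A : ℕ → ℕ) (K : ℕ → Carrier) : Set (c ⊔ ℓ₂) where
    field
      found : (n ≡ ints s #arg [] × (∀ k → k ℕ.< n → ¬ 1 ℕ.≤ A k))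
              ⊎ (ints s #arg [] ℕ.< n × 1 ℕ.≤ A (ints s #arg []) × vals s #bestKey [] ≡ K (ints s #arg []))
      least : ∀ k → k ℕ.< n → 1 ℕ.≤ A k → vals s #bestKey [] ≤ K k

  below-suc : ∀ {p} {P : ℕ → Set p} {k} → (∀ i → i ℕ.< k → P i) → P k → ∀ i → i ℕ.< suc k → P i
  below-suc {k = k} f p i i<1+k with i ℕ.≟ k
  ... | yes refl = p
  ... | no i≢k   = f i (ℕ.≤∧≢⇒< (ℕ.≤-pred i<1+k) i≢k)

  argmin-exec : ∀ {s N a κ} n (A : ℕ → ℕ) (K : ℕ → Carrier) →
    (∀ {s′} → Frame (argmin N a κ) s s′ → evalInt s′ N ≡ n) →
    (∀ {s′} → Frame (argmin N a κ) s s′ → evalInt s′ a ≡ A (ints s′ #j [])) →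
    (∀ {s′} → Frame (argmin N a κ) s s′ → evalVal s′ κ ≡ K (ints s′ #j [])) →
    Exec (argmin N a κ) s (argminTime N a κ * suc n) (λ s′ → Smallest s′ n A K)
  argmin-exec {s} {N} {a} {κ} n A K evalN evalA evalK =
    exec-mono time≤ (λ _ → finish) (exec-setInt-then (exec-setVal-then
      (exec-for J (allFin n) refl
        (λ F → trans (evalN (whole F)) (sym (List.length-tabulate id)))
        (λ m j → record { Partial j })
        (λ {k} F pk j → exec-if
          (λ t → exec-if
            (λ u → exec-setVal-then (exec-setInt (improve k F pk j t u)))
            (λ u → exec-skip (keep k F pk j (inj₂ u))))
          (λ t → exec-skip (keep k F pk j (inj₁ t))))
        start)))
    where
    body = ifte (lit 1 ≤ⁿ a) (ifte (κ ≤ᵛ val #bestKey []) (setVal #bestKey [] κ ⨾ put #arg (reg #j)) skip) skip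

    s₁ s₂ : State
    s₁ = writeInt #arg [] (evalInt s N) s
    s₂ = writeVal #bestKey [] 𝟏 s₁

    record Partial (k : ℕ) (s′ : State) : Set (c ⊔ ℓ₂) where
      field
        found : (n ≡ ints s′ #arg [] × (∀ i → i ℕ.< k → ¬ 1 ℕ.≤ A i))
                ⊎ (ints s′ #arg [] ℕ.< k × 1 ℕ.≤ A (ints s′ #arg []) × vals s′ #bestKey [] ≡ K (ints s′ #arg []))
        -- While nothing has been found the best key is still 1, so the first living entry cannot
        -- fail the comparison; `dead` refutes that case with it.
        top   : (∀ i → i ℕ.< k → ¬ 1 ℕ.≤ A i) → vals s′ #bestKey [] ≡ 𝟏
        least : ∀ i → i ℕ.< k → 1 ℕ.≤ A i → vals s′ #bestKey [] ≤ K i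

    open Partial

    J : ℕ → List (Fin n) → State → Set (c ⊔ ℓ₂)
    J k _ = Partial k

    whole : ∀ {s′} → Frame (for #j N body) s₂ s′ → Frame (argmin N a κ) s s′
    whole F = frame-trans {argmin N a κ} (frame-left {put #arg N} {setVal #bestKey [] oneᵥ ⨾ for #j N body}
        (frame (setInt⇓ {s} {#arg} {[]} {N})))
      (frame-right {put #arg N} {setVal #bestKey [] oneᵥ ⨾ for #j N body}
        (frame-trans (frame-left {setVal #bestKey [] oneᵥ} {for #j N body} (frame (setVal⇓ {s₁} {#bestKey} {[]} {oneᵥ})))
          (frame-right {setVal #bestKey [] oneᵥ} {for #j N body} F)))

    start : Partial 0 s₂
    start = record { found = inj₁ (sym (evalN frame-refl) , λ _ ()) ; top = λ _ → refl ; least = λ _ () }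

    improve : ∀ k {s′} → Frame (for #j N body) s₂ s′ → ints s′ #j [] ≡ k → Partial k s′ →
              test s′ (lit 1 ≤ⁿ a) ≡ true → test s′ (κ ≤ᵛ val #bestKey []) ≡ true →
              Partial (suc k) (writeInt #arg [] (ints s′ #j []) (writeVal #bestKey [] (evalVal s′ κ) s′))
    improve k {s′} F refl j t u = record
      { found = inj₂ (ℕ.n<1+n k , alive , evalK (whole F))
      ; top   = λ none → contradiction alive (none k (ℕ.n<1+n k))
      ; least = below-suc (λ i i<k p → ≤-trans (does-true (_ ≤? _) u) (least j i i<k p))
                  (λ _ → ≤-reflexive (Eq.reflexive (evalK (whole F))))
      }
      where
      alive : 1 ℕ.≤ A k
      alive = subst (1 ℕ.≤_) (evalA (whole F)) (does-true (1 ℕ.≤? evalInt s′ a) t)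

    keep : ∀ k {s′} → Frame (for #j N body) s₂ s′ → ints s′ #j [] ≡ k → Partial k s′ →
           test s′ (lit 1 ≤ⁿ a) ≡ false ⊎ test s′ (κ ≤ᵛ val #bestKey []) ≡ false →
           Partial (suc k) s′
    keep k {s′} F refl j t = record
      { found = case found j of λ where
          (inj₁ (p , none)) → inj₁ (p , below-suc none (dead none t))
          (inj₂ (p , q)) → inj₂ (ℕ.m<n⇒m<1+n p , q)
      ; top = λ none → top j (λ i i<k → none i (ℕ.m<n⇒m<1+n i<k))
      ; least = below-suc (least j) (λ p → case t of λ where
          (inj₁ t) → contradiction (subst (1 ℕ.≤_) (sym (evalA (whole F))) p) (does-false (1 ℕ.≤? evalInt s′ a) t)
          (inj₂ u) → subst (vals s′ #bestKey [] ≤_) (evalK (whole F)) (≰⇒≥ (does-false (_ ≤? _) u)))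
      }
      where
      dead : (∀ i → i ℕ.< k → ¬ 1 ℕ.≤ A i) →
             test s′ (lit 1 ≤ⁿ a) ≡ false ⊎ test s′ (κ ≤ᵛ val #bestKey []) ≡ false → ¬ 1 ℕ.≤ A k
      dead none (inj₁ t) p = contradiction (subst (1 ℕ.≤_) (sym (evalA (whole F))) p) (does-false (1 ℕ.≤? evalInt s′ a) t)
      dead none (inj₂ u) p = contradiction (subst (evalVal s′ κ ≤_) (sym (top j none)) (maximum _)) (does-false (_ ≤? _) u)

    finish : ∀ {s′} → Partial (length (allFin n)) s′ → Smallest s′ n A K
    finish {s′} j = subst (λ k → Partial k s′ → Smallest s′ n A K) (sym (List.length-tabulate id))
      (λ j → record { found = found j ; least = least j }) j

    time≤ : 1 + intTime N + (2 + forTime N (map (λ _ → cost body) (allFin n))) ℕ.≤ argminTime N a κ * suc n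
    time≤ = begin
      1 + intTime N + (2 + forTime N (map (λ _ → cost body) (allFin n)))
        ≡⟨ cong suc (trans (ℕ.+-suc (intTime N) _) (cong suc (ℕ.+-suc (intTime N) _))) ⟩
      3 + intTime N + forTime N (map (λ _ → cost body) (allFin n))
        ≤⟨ ℕ.+-mono-≤ (ℕ.m≤m*n (3 + intTime N) (suc n)) (ℕ.≤-trans (forTime-const N (cost body) (allFin n))
          (ℕ.≤-reflexive (cong (λ k → (8 + intTime N + cost body) * suc k) (List.length-tabulate id)))) ⟩
      (3 + intTime N) * suc n + (8 + intTime N + cost body) * suc n
        ≡⟨ ℕ.*-distribʳ-+ (suc n) (3 + intTime N) (8 + intTime N + cost body) ⟨
      argminTime N a κ * suc n ∎
      where open ℕ.≤-Reasoning

  -- `rmin` and `rkey` are described only for rows with a living class; in an exhausted row their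
  -- old contents remain in memory.
  record RowCache (W : ℕ) (alive : List ℕ → ℕ) (key : List ℕ → Carrier)
                  (ralive rmin : List ℕ → ℕ) (rkey : List ℕ → Carrier) (i : ℕ) : Set (c ⊔ ℓ₂) where
    field
      full  : 1 ℕ.≤ ralive (i ∷ []) → rmin (i ∷ []) ℕ.< W × 1 ℕ.≤ alive (i ∷ rmin (i ∷ []) ∷ [])
              × rkey (i ∷ []) ≡ key (i ∷ rmin (i ∷ []) ∷ [])
      least : 1 ℕ.≤ ralive (i ∷ []) → ∀ j → j ℕ.< W → 1 ℕ.≤ alive (i ∷ j ∷ []) → rkey (i ∷ []) ≤ key (i ∷ j ∷ [])
      empty : ¬ 1 ℕ.≤ ralive (i ∷ []) → ∀ j → j ℕ.< W → ¬ 1 ℕ.≤ alive (i ∷ j ∷ [])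

  open RowCache public

  Cached : ℕ → Heap → ℕ → Set (c ⊔ ℓ₂)
  Cached W H = RowCache W (hi H #alive) (hv H #key) (hi H #ralive) (hi H #rmin) (hv H #rkey)

  cache-cong : ∀ {W alive alive′ key ralive ralive′ rmin rmin′ rkey rkey′ i} →
    (∀ j → alive′ (i ∷ j ∷ []) ≡ alive (i ∷ j ∷ [])) →
    ralive′ (i ∷ []) ≡ ralive (i ∷ []) → rmin′ (i ∷ []) ≡ rmin (i ∷ []) → rkey′ (i ∷ []) ≡ rkey (i ∷ []) →
    RowCache W alive key ralive rmin rkey i → RowCache W alive′ key ralive′ rmin′ rkey′ i
  cache-cong {W} {alive′ = alive′} {key} {i = i} p q r t R = record
    { full  = λ a → let x , y , z = full R (subst (1 ℕ.≤_) q a) in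
        subst (ℕ._< W) (sym r) x , subst (1 ℕ.≤_) (trans (sym (p _)) (cong (λ j → alive′ (i ∷ j ∷ [])) (sym r))) y ,
        trans t (trans z (cong (λ j → key (i ∷ j ∷ [])) (sym r)))
    ; least = λ a j j<W b → subst (_≤ key (i ∷ j ∷ [])) (sym t)
        (least R (subst (1 ℕ.≤_) q a) j j<W (subst (1 ℕ.≤_) (p j) b))
    ; empty = λ a j j<W b → empty R (λ a′ → a (subst (1 ℕ.≤_) (sym q) a′)) j j<W (subst (1 ℕ.≤_) (p j) b)
    }

  RowUnchanged : Heap → Heap → ℕ → Set c
  RowUnchanged H H′ i = hi H′ #ralive (i ∷ []) ≡ hi H #ralive (i ∷ []) ×
    hi H′ #rmin (i ∷ []) ≡ hi H #rmin (i ∷ []) × hv H′ #rkey (i ∷ []) ≡ hv H #rkey (i ∷ [])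

  refreshTime : ℕ
  refreshTime = argminTime (mem #width []) (mem #alive (reg #cur ∷ reg #j ∷ [])) (val #key (reg #cur ∷ reg #j ∷ [])) + 20

  refresh-exec : ∀ {s} i W → ints s #cur [] ≡ i → hi (heap s) #width [] ≡ W →
    Exec refreshᴾ s (refreshTime * suc W) λ s′ →
      Cached W (heap s′) i × (∀ i′ → i′ ≢ i → RowUnchanged (heap s) (heap s′) i′)
  refresh-exec {s} i W pi pW = exec-mono time≤ (λ _ → id) (exec-seq
    (argmin-exec W (λ j → ints s (20 + #alive) (i ∷ j ∷ [])) (λ j → vals s #key (i ∷ j ∷ []))
      (λ F → scalar-frame F (20 + #width) refl pW)
      (λ {s′} F → cong₂ (λ f i → f (i ∷ ints s′ #j [] ∷ [])) (int-frame F (20 + #alive) refl) (cur≡ F))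
      (λ {s′} F → cong₂ (λ f i → f (i ∷ ints s′ #j [] ∷ [])) (val-frame F #key refl) (cur≡ F)))
    λ {s₁} F m → exec-if (λ t → exec-setInt (none F m t)) (λ t → exec-setInt-then (exec-setInt-then (exec-setVal (some F m t)))))
    where
    am = argmin (mem #width []) (mem #alive (reg #cur ∷ reg #j ∷ [])) (val #key (reg #cur ∷ reg #j ∷ []))

    cur≡ : ∀ {s′} → Frame am s s′ → ints s′ #cur [] ≡ i
    cur≡ F = scalar-frame F #cur refl pi

    width≡ : ∀ {s′} → Frame am s s′ → ints s′ (20 + #width) [] ≡ W
    width≡ F = scalar-frame F (20 + #width) refl pW

    Found : State → Set (c ⊔ ℓ₂)
    Found s′ = Smallest s′ W (λ j → ints s (20 + #alive) (i ∷ j ∷ [])) (λ j → vals s #key (i ∷ j ∷ []))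

    Goal : State → Set (c ⊔ ℓ₂)
    Goal s′ = Cached W (heap s′) i × (∀ i′ → i′ ≢ i → RowUnchanged (heap s) (heap s′) i′)

    other : ∀ {a} {A : Set a} {f g : List ℕ → A} {b x i′} → f ≡ g → x ≡ i → i′ ≢ i →
            update _≟ˡ_ (x ∷ []) b f (i′ ∷ []) ≡ g (i′ ∷ [])
    other {f = f} refl refl ne = update-other _≟ˡ_ _ f (singleton-≢ (ne ∘ sym))

    same : ∀ {a} {A : Set a} (f : List ℕ → A) {b x} → x ≡ i → update _≟ˡ_ (x ∷ []) b f (i ∷ []) ≡ b
    same f refl = update-same _≟ˡ_ (i ∷ []) _ f

    none : ∀ {s₁} → Frame am s s₁ → Found s₁ → test s₁ (mem #width [] ≤ⁿ reg #arg) ≡ true →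
           Goal (writeInt (20 + #ralive) (ints s₁ #cur [] ∷ []) 0 s₁)
    none {s₁} F m t = record
      { full  = λ a → contradiction (subst (1 ℕ.≤_) (same (ints s₁ (20 + #ralive)) (cur≡ F)) a) λ ()
      ; least = λ a → contradiction (subst (1 ℕ.≤_) (same (ints s₁ (20 + #ralive)) (cur≡ F)) a) λ ()
      ; empty = λ _ j j<W b → dead j j<W (subst (λ f → 1 ℕ.≤ f (i ∷ j ∷ [])) (int-frame F (20 + #alive) refl) b)
      } , λ i′ ne → other (int-frame F (20 + #ralive) refl) (cur≡ F) ne ,
        cong (λ f → f (i′ ∷ [])) (int-frame F (20 + #rmin) refl) ,
        cong (λ f → f (i′ ∷ [])) (val-frame F #rkey refl)
      where
      dead : ∀ j → j ℕ.< W → ¬ 1 ℕ.≤ ints s (20 + #alive) (i ∷ j ∷ [])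
      dead with Smallest.found m
      ... | inj₁ (_ , d) = d
      ... | inj₂ (p , _) = contradiction
        (subst (ℕ._≤ ints s₁ #arg []) (width≡ F) (does-true (_ ℕ.≤? ints s₁ #arg []) t)) (ℕ.<⇒≱ p)

    some : ∀ {s₁} → Frame am s s₁ → Found s₁ → test s₁ (mem #width [] ≤ⁿ reg #arg) ≡ false →
           Goal (writeVal #rkey (ints s₁ #cur [] ∷ []) (vals s₁ #bestKey [])
             (writeInt (20 + #rmin) (ints s₁ #cur [] ∷ []) (ints s₁ #arg [])
               (writeInt (20 + #ralive) (ints s₁ #cur [] ∷ []) 1 s₁)))
    some {s₁} F m t with Smallest.found m
    ... | inj₁ (p , _) = contradiction (ℕ.≤-reflexive (trans (width≡ F) p)) (does-false (_ ℕ.≤? ints s₁ #arg []) t)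
    ... | inj₂ (p , q , r) = record
      { full  = λ _ →
          subst (ℕ._< W) (sym rmin≡) p ,
          subst₂ (λ f j → 1 ℕ.≤ f (i ∷ j ∷ [])) (sym (int-frame F (20 + #alive) refl)) (sym rmin≡) q ,
          trans rkey≡ (trans r (cong₂ (λ f j → f (i ∷ j ∷ [])) (sym (val-frame F #key refl)) (sym rmin≡)))
      ; least = λ _ j j<W b → subst₂ (λ k f → k ≤ f (i ∷ j ∷ [])) (sym rkey≡) (sym (val-frame F #key refl))
          (Smallest.least m j j<W (subst (λ f → 1 ℕ.≤ f (i ∷ j ∷ [])) (int-frame F (20 + #alive) refl) b))
      ; empty = λ a → contradiction
          (subst (1 ℕ.≤_) (sym (same (ints s₁ (20 + #ralive)) {1} (cur≡ F))) (s≤s z≤n)) a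
      } , λ i′ ne → other (int-frame F (20 + #ralive) refl) (cur≡ F) ne ,
        other (int-frame F (20 + #rmin) refl) (cur≡ F) ne ,
        other (val-frame F #rkey refl) (cur≡ F) ne
      where
      rmin≡ : update _≟ˡ_ (ints s₁ #cur [] ∷ []) (ints s₁ #arg []) (ints s₁ (20 + #rmin)) (i ∷ []) ≡ ints s₁ #arg []
      rmin≡ = same (ints s₁ (20 + #rmin)) (cur≡ F)

      rkey≡ : update _≟ˡ_ (ints s₁ #cur [] ∷ []) (vals s₁ #bestKey []) (vals s₁ #rkey) (i ∷ []) ≡ vals s₁ #bestKey []
      rkey≡ = same (vals s₁ #rkey) (cur≡ F)

    time≤ : argminTime (mem #width []) (mem #alive (reg #cur ∷ reg #j ∷ [])) (val #key (reg #cur ∷ reg #j ∷ [])) * suc W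
            + 15 ℕ.≤ refreshTime * suc W
    time≤ = ℕ.≤-trans (ℕ.+-monoʳ-≤ (argminTime (mem #width []) (mem #alive (reg #cur ∷ reg #j ∷ [])) (val #key (reg #cur ∷ reg #j ∷ [])) * suc W)
        (ℕ.≤-trans (ℕ.m≤m+n 15 5) (ℕ.m≤m*n 20 (suc W))))
      (ℕ.≤-reflexive (sym (ℕ.*-distribʳ-+ (suc W)
        (argminTime (mem #width []) (mem #alive (reg #cur ∷ reg #j ∷ [])) (val #key (reg #cur ∷ reg #j ∷ []))) 20)))

concatMap-↭ : ∀ {a b} {A : Set a} {B : Set b} (f : A → List B) {xs ys} → xs ↭ ys → concatMap f xs ↭ concatMap f ys
concatMap-↭ f Perm.refl = ↭-refl
concatMap-↭ f (prep x p) = Perm.++⁺ˡ (f x) (concatMap-↭ f p)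
concatMap-↭ f (Perm.swap {xs} x y p) = ↭-trans (Perm.shifts (f x) (f y) {concatMap f xs})
  (Perm.++⁺ˡ (f y) (Perm.++⁺ˡ (f x) (concatMap-↭ f p)))
concatMap-↭ f (Perm.trans p q) = ↭-trans (concatMap-↭ f p) (concatMap-↭ f q)

-- Loading a class onto the stack

module SourceLoop {c ℓ₁ ℓ₂} (𝕀 : BoundedChain c ℓ₁ ℓ₂) (N : Gödel.MinimaxNet 𝕀) where

  open BoundedChain 𝕀 using (Carrier; _≈_; _≤_; _≤?_; 𝟎; 𝟏; module Eq)
    renaming (refl to ≤-refl; trans to ≤-trans; reflexive to ≤-reflexive)
  open Semantics 𝕀
  open MinimaxNet N
  open MarkingAlgorithm N
  open Marking 𝕀
  open Correctness N
  open Potential 𝕀 N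
  open MainLoop 𝕀 N
  open Selection 𝕀
  open Invariant

  -- Source (i , j) is the list of all edges, or of nodes in Vmin, that enter the initial
  -- queue on account of one entry of the input tables; they have the same key.
  module _ (ν : Numbering) (R W : ℕ) (payload : ℕ → ℕ → List (Object × Carrier)) where

    open Numbering ν

    entries : List (ℕ × ℕ) → List (Object × Carrier)
    entries = concatMap (uncurry payload)

    -- The list `srcs` of classes not yet loaded exists only in the proof; the memory knows it
    -- through the flags `#alive`, and its order is irrelevant.
    record Sources (H : Heap) (srcs : List (ℕ × ℕ)) : Set (c ⊔ ℓ₁ ⊔ ℓ₂) where
      field
        alive⇒   : ∀ {i j} → i ℕ.< R → j ℕ.< W → 1 ℕ.≤ hi H #alive (i ∷ j ∷ []) → (i , j) ∈ srcs
        ⇒alive   : ∀ {i j} → (i , j) ∈ srcs → i ℕ.< R × j ℕ.< W × 1 ℕ.≤ hi H #alive (i ∷ j ∷ [])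
        distinct : Unique srcs
        plen-r   : ∀ {i j} → (i , j) ∈ srcs → hi H #plen (i ∷ j ∷ []) ≡ length (payload i j)
        payA-r   : ∀ {i j} → (i , j) ∈ srcs →
                   at-list (λ k → hi H #payA (i ∷ j ∷ k ∷ [])) 0 (map (codeA ν ∘ proj₁) (payload i j))
        payB-r   : ∀ {i j} → (i , j) ∈ srcs →
                   at-list (λ k → hi H #payB (i ∷ j ∷ k ∷ [])) 0 (map (codeB ν ∘ proj₁) (payload i j))
        key-r    : ∀ {i j} → (i , j) ∈ srcs → All (λ (_ , k) → k ≈ hv H #key (i ∷ j ∷ [])) (payload i j)
        row-r    : hi H #row [] ≡ R
        width-r  : hi H #width [] ≡ W

    open Sources

    Caches : Heap → Set (c ⊔ ℓ₂)
    Caches H = ∀ i → i ℕ.< R → Cached W H i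

    AllKeys : Config → Carrier → Set (c ⊔ ℓ₂)
    AllKeys C l = ∀ {o k} → (o , k) ∈ queue C → l ≤ k

    searchRows pushPayload : Program
    searchRows = argmin (mem #row []) (mem #ralive (reg #j ∷ [])) (val #rkey (reg #j ∷ []))
    pushPayload = put #y (mem #payA (reg #cur ∷ reg #best ∷ reg #k ∷ [])) ⨾
      put #q (mem #payB (reg #cur ∷ reg #best ∷ reg #k ∷ [])) ⨾ push

    -- The factors of the search, of the recomputation of a row and of the pushes are added, with 40
    -- as slack for the assignments and tests around them.
    searchTime pushTime selectTime : ℕ
    searchTime = argminTime (mem #row []) (mem #ralive (reg #j ∷ [])) (val #rkey (reg #j ∷ []))
    pushTime   = 8 + intTime (mem #plen (reg #cur ∷ reg #best ∷ [])) + cost pushPayload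
    selectTime = searchTime + refreshTime + pushTime + 40

    -- The configuration does not change at all: entries merely cross the border between the
    -- unloaded part and the stack, and the queue is the same up to permutation.
    payload-exec : ∀ {s C rest l outp} i j → Represents ν (heap s) C (payload i j ++ rest) l outp →
      ints s #cur [] ≡ i → ints s #best [] ≡ j →
      ints s (20 + #plen) (i ∷ j ∷ []) ≡ length (payload i j) →
      at-list (λ k → ints s (20 + #payA) (i ∷ j ∷ k ∷ [])) 0 (map (codeA ν ∘ proj₁) (payload i j)) →
      at-list (λ k → ints s (20 + #payB) (i ∷ j ∷ k ∷ [])) 0 (map (codeB ν ∘ proj₁) (payload i j)) →
      All (λ (_ , k) → k ≤ l) (payload i j) →
      Exec (for #k (mem #plen (reg #cur ∷ reg #best ∷ [])) pushPayload) s
        (pushTime * suc (length (payload i j))) (λ s′ → Represents ν (heap s′) C rest l outp)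
    payload-exec {s} {C} {rest} {l} {outp} i j Rep pi pj plen pA pB keys =
      exec-mono (forTime-const (mem #plen (reg #cur ∷ reg #best ∷ [])) (cost pushPayload) (payload i j))
        (λ _ (Rep′ , _) → Rep′)
        (exec-for J (payload i j) refl
          (λ F → trans (cong₂ (λ f is → f is) (int-frame F (20 + #plen) refl) (cong₂ (λ a b → a ∷ b ∷ []) (cur≡ F) (best≡ F))) plen)
          (λ n (Rep′ , x) → record { Represents Rep′ } , x)
          (λ {k} {(o , k₁)} {es} {s′} F pk (Rep′ , (a , as) , (b , bs) , ps) →
            exec-setInt-then (exec-setInt-then (exec-push ν
              ( represents (Represents.tables Rep′) record { Dynamic (Represents.dynamic Rep′) }
                  (push-stack ν {s₂ s′} o record { Stack (Represents.stk Rep′) }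
                    (trans (read #payA F pk) a) (trans (read #payB F pk) b))
                  (↭-trans (Represents.queue-st Rep′) (Perm.shift (o , k₁) (Represents.st Rep′) (es ++ rest)))
                  (All.head ps ∷ Represents.low Rep′) (Represents.level-r Rep′) (Represents.output-r Rep′)
              , as , bs , All.tail ps))))
          (Rep , pA , pB , keys))
      where
      F₀ = for #k (mem #plen (reg #cur ∷ reg #best ∷ [])) pushPayload

      s₂ : State → State
      s₂ s′ = let s₁ = writeInt #y [] (evalInt s′ (mem #payA (reg #cur ∷ reg #best ∷ reg #k ∷ []))) s′ in
        writeInt #q [] (evalInt s₁ (mem #payB (reg #cur ∷ reg #best ∷ reg #k ∷ []))) s₁

      cur≡ : ∀ {s′} → Frame F₀ s s′ → ints s′ #cur [] ≡ i
      cur≡ F = scalar-frame F #cur refl pi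

      best≡ : ∀ {s′} → Frame F₀ s s′ → ints s′ #best [] ≡ j
      best≡ F = scalar-frame F #best refl pj

      read : ∀ a {s′ k} → Frame F₀ s s′ → ints s′ #k [] ≡ k →
             ints s′ (20 + a) (ints s′ #cur [] ∷ ints s′ #best [] ∷ ints s′ #k [] ∷ []) ≡ ints s′ (20 + a) (i ∷ j ∷ k ∷ [])
      read a {s′} F refl = cong₂ (λ x y → ints s′ (20 + a) (x ∷ y ∷ ints s′ #k [] ∷ [])) (cur≡ F) (best≡ F)

      J : ℕ → List (Object × Carrier) → State → Set _
      J k es s′ = Represents ν (heap s′) C (es ++ rest) l outp ×
        at-list (λ k → ints s′ (20 + #payA) (i ∷ j ∷ k ∷ [])) k (map (codeA ν ∘ proj₁) es) ×
        at-list (λ k → ints s′ (20 + #payB) (i ∷ j ∷ k ∷ [])) k (map (codeB ν ∘ proj₁) es) ×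
        All (λ (_ , k) → k ≤ l) es

    -- Only the second case is charged for the entries of a class. Over all rounds these entries
    -- occur once each, so they are paid for globally.
    data Selected (s : State) (C : Config) (srcs : List (ℕ × ℕ)) (outp : List (List ℕ)) : Set (lsuc (c ⊔ ℓ₁ ⊔ ℓ₂)) where
      finished : queue C ≡ [] →
        Exec selectᴾ s (selectTime * (suc R + suc W))
          (λ s′ → hi (heap s′) #stopped [] ≡ 1 × Dynamic ν (heap s′) C × output s′ ≡ outp) →
        Selected s C srcs outp
      continued : ∀ {i j srcs′ l} → srcs ↭ (i , j) ∷ srcs′ → AllKeys C l →
        Exec selectᴾ s (selectTime * (suc R + suc W + length (payload i j)))
          (λ s′ → hi (heap s′) #stopped [] ≡ 0 × Represents ν (heap s′) C (entries srcs′) l outp ×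
                  Sources (heap s′) srcs′ × Caches (heap s′)) →
        Selected s C srcs outp

    module _ {s : State} {C srcs l outp} (Rep : Represents ν (heap s) C (entries srcs) l outp)
             (empty-stack : Represents.st Rep ≡ []) (S : Sources (heap s) srcs) (K : Caches (heap s))
             (running : hi (heap s) #stopped [] ≡ 0) where

      queue-entries : queue C ↭ entries srcs
      queue-entries = subst (λ st → queue C ↭ st ++ entries srcs) empty-stack (Represents.queue-st Rep)

      ralive-entry : ∀ {i j} → (i , j) ∈ srcs → 1 ℕ.≤ ints s (20 + #ralive) (i ∷ [])
      ralive-entry {i} {j} e with 1 ℕ.≤? ints s (20 + #ralive) (i ∷ [])
      ... | yes p = p
      ... | no ¬p = let i<R , j<W , a = ⇒alive S e in contradiction a (empty (K i i<R) ¬p j j<W)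

      Found : State → Set _
      Found s₁ = Smallest s₁ R (λ i → ints s (20 + #ralive) (i ∷ [])) (λ i → vals s #rkey (i ∷ []))

      select-finished : ∀ {s₁ t} → ⟨ searchRows , s ⟩⇓[ t ] s₁ → t ℕ.≤ searchTime * suc R →
        R ≡ ints s₁ #arg [] → (∀ i → i ℕ.< R → ¬ 1 ℕ.≤ ints s (20 + #ralive) (i ∷ [])) → Selected s C srcs outp
      select-finished {s₁} d t p none = finished (nothing-left (queue C) queue-entries) (exec-mono time≤ (λ _ → id)
        (exec-after d t (exec-if-true stop-test (exec-setInt
          (refl , record { Dynamic (Represents.dynamic Rep₁) } , Represents.output-r Rep₁)))))
        where
        F = frame d
        Rep₁ = represents-frame ν F refl refl refl refl refl Rep

        stop-test : test s₁ (mem #row [] ≤ⁿ reg #arg) ≡ true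
        stop-test = dec-true (ints s₁ (20 + #row) [] ℕ.≤? ints s₁ #arg [])
          (ℕ.≤-reflexive (scalar-frame F (20 + #row) refl (trans (row-r S) p)))

        no-source : ∀ {e} → e ∉ entries srcs
        no-source e∈ = let (i , j) , ij∈ , _ = find (∈.∈-concatMap⁻ (uncurry payload) {xs = srcs} e∈) in
          none i (proj₁ (⇒alive S ij∈)) (ralive-entry ij∈)

        nothing-left : ∀ q → q ↭ entries srcs → q ≡ []
        nothing-left [] _ = refl
        nothing-left (e ∷ q) σ = contradiction (Perm.∈-resp-↭ σ (here refl)) no-source

        time≤ : searchTime * suc R + (3 + 2) ℕ.≤ selectTime * (suc R + suc W)
        time≤ = ≤-time (suc R) (suc W) 5 0 (ℕ.≤ᵇ⇒≤ 5 40 tt) z≤n (s≤s z≤n)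
          where
          ≤-time : ∀ r w x y → x ℕ.≤ 40 → y ℕ.≤ refreshTime → 1 ℕ.≤ r → searchTime * r + x ℕ.≤ selectTime * (r + w)
          ≤-time r w x y p _ q = begin
            searchTime * r + x        ≤⟨ ℕ.+-monoʳ-≤ _ (ℕ.≤-trans p (ℕ.m≤m*n 40 r {{ℕ.>-nonZero q}})) ⟩
            searchTime * r + 40 * r   ≡⟨ ℕ.*-distribʳ-+ r searchTime 40 ⟨
            (searchTime + 40) * r     ≤⟨ ℕ.*-mono-≤ (ℕ.+-monoˡ-≤ 40 (ℕ.≤-trans (ℕ.m≤m+n searchTime refreshTime) (ℕ.m≤m+n _ pushTime))) (ℕ.m≤m+n r w) ⟩
            selectTime * (r + w)      ∎
            where open ℕ.≤-Reasoning

      select-continued : ∀ {s₁ t} → ⟨ searchRows , s ⟩⇓[ t ] s₁ → t ℕ.≤ searchTime * suc R → Found s₁ →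
        ints s₁ #arg [] ℕ.< R → 1 ℕ.≤ ints s (20 + #ralive) (ints s₁ #arg [] ∷ []) →
        vals s₁ #bestKey [] ≡ vals s #rkey (ints s₁ #arg [] ∷ []) → Selected s C srcs outp
      select-continued {s₁} d t m i<R alive best≡ =
        continued {i = i} {j} {srcs′} {l′} σ above-l′ (exec-mono time≤ (λ _ → id)
          (exec-after d t (exec-if-false go-test (exec-setInt-then (exec-setInt-then (exec-setVal-then
            (exec-seq (payload-exec i j Rep₄ refl j≡ (trans (cong (λ f → f (i ∷ j ∷ [])) (int-frame F (20 + #plen) refl)) (plen-r S ij∈))
                (at-list-frame ν 0 (map (codeA ν ∘ proj₁) (payload i j))
                  (cong (λ f k → f (i ∷ j ∷ k ∷ [])) (sym (int-frame F (20 + #payA) refl))) (payA-r S ij∈))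
                (at-list-frame ν 0 (map (codeB ν ∘ proj₁) (payload i j))
                  (cong (λ f k → f (i ∷ j ∷ k ∷ [])) (sym (int-frame F (20 + #payB) refl))) (payB-r S ij∈))
                (All.map (λ p → ≤-reflexive p) (key-r S ij∈)))
              λ F₅ Rep₅ → exec-setInt-then (exec-map (λ F₇ (cache-i , others) → conclude F₅ Rep₅ F₇ cache-i others)
                (refresh-exec i W (i≡ F₅)
                  (trans (cong (λ f → f []) (int-frame F₅ (20 + #width) refl))
                    (scalar-frame F (20 + #width) refl (width-r S))))))))))))
        where
        F = frame d
        i = ints s₁ #arg []
        j = ints s (20 + #rmin) (i ∷ [])
        chosen = full (K i i<R) alive
        l′ = vals s #key (i ∷ j ∷ [])

        ij∈ : (i , j) ∈ srcs
        ij∈ = alive⇒ S i<R (proj₁ chosen) (proj₁ (proj₂ chosen))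

        split = ∈.∈-∃++ ij∈
        srcs′ = proj₁ split ++ proj₁ (proj₂ split)

        σ : srcs ↭ (i , j) ∷ srcs′
        σ = ↭-trans (↭-reflexive (proj₂ (proj₂ split))) (Perm.shift (i , j) (proj₁ split) (proj₁ (proj₂ split)))

        unique′ : Unique ((i , j) ∷ srcs′)
        unique′ = SetoidPerm.Unique-resp-↭ (setoid (ℕ × ℕ)) (Perm.↭⇒↭ₛ σ) (distinct S)

        ij∉ : ∀ {p} → p ∈ srcs′ → (i , j) ≢ p
        ij∉ e with unique′
        ... | ps ∷ _ = All.lookup ps e

        -- With the stack empty, every queued entry lies in a living class. The cached minimum of
        -- its row is at most its key, and the chosen key is the least of the cached minima.
        above-l′ : AllKeys C l′
        above-l′ {o} {k} e =
          let (i₁ , j₁) , ij₁∈ , e₁ = find (∈.∈-concatMap⁻ (uncurry payload) {xs = srcs} (Perm.∈-resp-↭ queue-entries e))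
              i₁<R , j₁<W , a₁ = ⇒alive S ij₁∈
              r₁ = ralive-entry ij₁∈
          in ≤-trans (≤-reflexive (Eq.reflexive (trans (sym (proj₂ (proj₂ chosen))) (sym best≡))))
            (≤-trans (Smallest.least m i₁ i₁<R r₁)
              (≤-trans (least (K i₁ i₁<R) r₁ j₁ j₁<W a₁) (≤-reflexive (Eq.sym (All.lookup (key-r S ij₁∈) e₁)))))

        go-test : test s₁ (mem #row [] ≤ⁿ reg #arg) ≡ false
        go-test = dec-false (ints s₁ (20 + #row) [] ℕ.≤? ints s₁ #arg []) λ p → ℕ.<⇒≱ i<R
          (subst (ℕ._≤ i) (scalar-frame F (20 + #row) refl (row-r S)) p)

        s₄ : State
        s₄ = let s₂ = writeInt #cur [] i s₁
                 s₃ = writeInt #best [] (ints s₂ (20 + #rmin) (i ∷ [])) s₂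
             in writeVal #level [] (vals s₃ #key (i ∷ ints s₃ #best [] ∷ [])) s₃

        j≡ : ints s₁ (20 + #rmin) (i ∷ []) ≡ j
        j≡ = cong (λ f → f (i ∷ [])) (int-frame F (20 + #rmin) refl)

        Rep₁ = represents-frame ν F refl refl refl refl refl Rep

        Rep₄ : Represents ν (heap s₄) C (payload i j ++ entries srcs′) l′ outp
        Rep₄ = represents {st = []} (Represents.tables Rep₁) record { Dynamic (Represents.dynamic Rep₁) }
          (stack (trans (Stack.size (Represents.stk Rep₁)) (cong length empty-stack)) tt)
          (↭-trans queue-entries (concatMap-↭ (uncurry payload) σ)) []
          (cong₂ (λ f j → f (i ∷ j ∷ [])) (val-frame F #key refl) j≡) (Represents.output-r Rep₁)

        payloadLoop = for #k (mem #plen (reg #cur ∷ reg #best ∷ [])) pushPayload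

        i≡ : ∀ {s₅} → Frame payloadLoop s₄ s₅ → ints s₅ #cur [] ≡ i
        i≡ F₅ = cong (λ f → f []) (int-frame F₅ #cur refl)

        module _ {s₅ s₇ : State} (F₅ : Frame payloadLoop s₄ s₅) (Rep₅ : Represents ν (heap s₅) C (entries srcs′) l′ outp)
                 (F₇ : Frame refreshᴾ (writeInt (20 + #alive) (ints s₅ #cur [] ∷ ints s₅ #best [] ∷ []) 0 s₅) s₇)
                 (cache-i : Cached W (heap s₇) i)
                 (others : ∀ i′ → i′ ≢ i → RowUnchanged (heap s₅) (heap s₇) i′) where

          best-j : ints s₅ #best [] ≡ j
          best-j = scalar-frame F₅ #best refl j≡

          alive-same : ints s₇ (20 + #alive) (i ∷ j ∷ []) ≡ 0
          alive-same = trans (cong (λ f → f (i ∷ j ∷ [])) (int-frame F₇ (20 + #alive) refl))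
            (trans (cong₂ (λ x y → update _≟ˡ_ (x ∷ y ∷ []) 0 (ints s₅ (20 + #alive)) (i ∷ j ∷ [])) (i≡ F₅) best-j)
              (update-same _≟ˡ_ (i ∷ j ∷ []) 0 (ints s₅ (20 + #alive))))

          alive-other : ∀ {i₁ j₁} → (i , j) ≢ (i₁ , j₁) →
                        ints s₇ (20 + #alive) (i₁ ∷ j₁ ∷ []) ≡ ints s (20 + #alive) (i₁ ∷ j₁ ∷ [])
          alive-other {i₁} {j₁} ne = trans (cong (λ f → f (i₁ ∷ j₁ ∷ [])) (int-frame F₇ (20 + #alive) refl))
            (trans (cong₂ (λ x y → update _≟ˡ_ (x ∷ y ∷ []) 0 (ints s₅ (20 + #alive)) (i₁ ∷ j₁ ∷ [])) (i≡ F₅) best-j)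
              (trans (update-other _≟ˡ_ {i ∷ j ∷ []} {i₁ ∷ j₁ ∷ []} 0 (ints s₅ (20 + #alive)) λ { refl → ne refl })
                (cong (λ f → f (i₁ ∷ j₁ ∷ [])) (trans (int-frame F₅ (20 + #alive) refl) (int-frame F (20 + #alive) refl)))))

          old : ∀ {p} → p ∈ srcs′ → p ∈ srcs
          old e = Perm.∈-resp-↭ (↭-sym σ) (there e)

          S₇ : Sources (heap s₇) srcs′
          S₇ = record
            { alive⇒   = λ {i₁} {j₁} i₁<R j₁<W a → alive⇒′ i₁ j₁ i₁<R j₁<W a
            ; ⇒alive   = λ e → let x , y , a = ⇒alive S (old e) in
                x , y , subst (1 ℕ.≤_) (sym (alive-other (ij∉ e))) a
            ; distinct = tail-unique unique′
            ; plen-r   = λ {i₁} {j₁} e → trans (cong (λ f → f (i₁ ∷ j₁ ∷ []))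
                (trans (int-frame F₇ (20 + #plen) refl) (trans (int-frame F₅ (20 + #plen) refl) (int-frame F (20 + #plen) refl)))) (plen-r S (old e))
            ; payA-r   = λ {i₁} {j₁} e → at-list-frame ν 0 (map (codeA ν ∘ proj₁) (payload i₁ j₁)) (cong (λ f k → f (i₁ ∷ j₁ ∷ k ∷ []))
                (sym (trans (int-frame F₇ (20 + #payA) refl) (trans (int-frame F₅ (20 + #payA) refl) (int-frame F (20 + #payA) refl))))) (payA-r S (old e))
            ; payB-r   = λ {i₁} {j₁} e → at-list-frame ν 0 (map (codeB ν ∘ proj₁) (payload i₁ j₁)) (cong (λ f k → f (i₁ ∷ j₁ ∷ k ∷ []))
                (sym (trans (int-frame F₇ (20 + #payB) refl) (trans (int-frame F₅ (20 + #payB) refl) (int-frame F (20 + #payB) refl))))) (payB-r S (old e))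
            ; key-r    = λ {i₁} {j₁} e → subst (λ f → All (λ (_ , k) → k ≈ f (i₁ ∷ j₁ ∷ [])) (payload i₁ j₁))
                (sym key≡) (key-r S (old e))
            ; row-r    = trans (cong (λ f → f []) (trans (int-frame F₇ (20 + #row) refl)
                (trans (int-frame F₅ (20 + #row) refl) (int-frame F (20 + #row) refl)))) (row-r S)
            ; width-r  = trans (cong (λ f → f []) (trans (int-frame F₇ (20 + #width) refl)
                (trans (int-frame F₅ (20 + #width) refl) (int-frame F (20 + #width) refl)))) (width-r S)
            }
            where
            key≡ : vals s₇ #key ≡ vals s #key
            key≡ = trans (val-frame F₇ #key refl) (trans (val-frame F₅ #key refl) (val-frame F #key refl))

            tail-unique : ∀ {x} {xs : List (ℕ × ℕ)} → Unique (x ∷ xs) → Unique xs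
            tail-unique (_ ∷ u) = u

            alive⇒′ : ∀ i₁ j₁ → i₁ ℕ.< R → j₁ ℕ.< W → 1 ℕ.≤ ints s₇ (20 + #alive) (i₁ ∷ j₁ ∷ []) → (i₁ , j₁) ∈ srcs′
            alive⇒′ i₁ j₁ i₁<R j₁<W a with Prod.≡-dec ℕ._≟_ ℕ._≟_ (i , j) (i₁ , j₁)
            ... | yes refl = contradiction (subst (1 ℕ.≤_) alive-same a) λ ()
            ... | no ne with Perm.∈-resp-↭ σ (alive⇒ S i₁<R j₁<W (subst (1 ℕ.≤_) (alive-other ne) a))
            ...   | here refl = contradiction refl ne
            ...   | there e = e

          -- Clearing one flag can spoil the cached minimum of its own row only, and that row has
          -- just been recomputed.
          K₇ : Caches (heap s₇)
          K₇ i₁ i₁<R with i₁ ℕ.≟ i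
          ... | yes refl = cache-i
          ... | no ne = let p , q , r = others i₁ ne in
            subst (λ key → RowCache W (ints s₇ (20 + #alive)) key (ints s₇ (20 + #ralive)) (ints s₇ (20 + #rmin)) (vals s₇ #rkey) i₁)
              (sym (trans (val-frame F₇ #key refl) (trans (val-frame F₅ #key refl) (val-frame F #key refl))))
              (cache-cong (λ j₁ → alive-other λ { refl → ne refl })
                (trans p (cong (λ f → f (i₁ ∷ [])) (trans (int-frame F₅ (20 + #ralive) refl) (int-frame F (20 + #ralive) refl))))
                (trans q (cong (λ f → f (i₁ ∷ [])) (trans (int-frame F₅ (20 + #rmin) refl) (int-frame F (20 + #rmin) refl))))
                (trans r (cong (λ f → f (i₁ ∷ [])) (trans (val-frame F₅ #rkey refl) (val-frame F #rkey refl))))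
                (K i₁ i₁<R))

          conclude : hi (heap s₇) #stopped [] ≡ 0 × Represents ν (heap s₇) C (entries srcs′) l′ outp ×
                     Sources (heap s₇) srcs′ × Caches (heap s₇)
          conclude = trans (cong (λ f → f []) (trans (int-frame F₇ (20 + #stopped) refl)
              (trans (int-frame F₅ (20 + #stopped) refl) (int-frame F (20 + #stopped) refl)))) running ,
            represents-frame ν F₇ refl refl refl refl refl (represents (Represents.tables Rep₅)
              record { Dynamic (Represents.dynamic Rep₅) } record { Stack (Represents.stk Rep₅) }
              (Represents.queue-st Rep₅) (Represents.low Rep₅) (Represents.level-r Rep₅) (Represents.output-r Rep₅)) ,
            S₇ , K₇

        time≤ : searchTime * suc R + (3 + (2 + (3 + (4 + (pushTime * suc (length (payload i j)) + (4 + refreshTime * suc W))))))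
                ℕ.≤ selectTime * (suc R + suc W + length (payload i j))
        time≤ = begin
          searchTime * suc R + (12 + (pushTime * suc p + (4 + refreshTime * suc W)))
            ≤⟨ ℕ.+-mono-≤ (ℕ.*-monoʳ-≤ searchTime r≤) (ℕ.+-mono-≤ (ℕ.m≤m*n 12 X)
                 (ℕ.+-mono-≤ (ℕ.*-monoʳ-≤ pushTime p≤) (ℕ.+-mono-≤ (ℕ.m≤m*n 4 X) (ℕ.*-monoʳ-≤ refreshTime w≤)))) ⟩
          searchTime * X + (12 * X + (pushTime * X + (4 * X + refreshTime * X)))
            ≡⟨ collect searchTime refreshTime pushTime X ⟩
          (searchTime + refreshTime + pushTime + 16) * X
            ≤⟨ ℕ.*-monoˡ-≤ X (ℕ.+-monoʳ-≤ (searchTime + refreshTime + pushTime) (ℕ.≤ᵇ⇒≤ 16 40 tt)) ⟩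
          selectTime * X ∎
          where
          open ℕ.≤-Reasoning
          p = length (payload i j)
          X = suc R + suc W + p

          r≤ : suc R ℕ.≤ X
          r≤ = ℕ.≤-trans (ℕ.m≤m+n (suc R) (suc W)) (ℕ.m≤m+n _ p)

          w≤ : suc W ℕ.≤ X
          w≤ = ℕ.≤-trans (ℕ.m≤n+m (suc W) (suc R)) (ℕ.m≤m+n _ p)

          p≤ : suc p ℕ.≤ X
          p≤ = s≤s (ℕ.m≤n+m p (R + suc W))

          collect : ∀ a b c x → a * x + (12 * x + (c * x + (4 * x + b * x))) ≡ (a + b + c + 16) * x
          collect = solve-∀

      select-exec : Selected s C srcs outp
      select-exec = choose (argmin-exec {s} {mem #row []} {mem #ralive (reg #j ∷ [])} {val #rkey (reg #j ∷ [])} R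
        (λ i → ints s (20 + #ralive) (i ∷ [])) (λ i → vals s #rkey (i ∷ []))
        (λ F → scalar-frame F (20 + #row) refl (row-r S))
        (λ {s′} F → cong (λ f → f (ints s′ #j [] ∷ [])) (int-frame F (20 + #ralive) refl))
        (λ {s′} F → cong (λ f → f (ints s′ #j [] ∷ [])) (val-frame F #rkey refl)))
        where
        choose : Exec searchRows s (searchTime * suc R) Found → Selected s C srcs outp
        choose (executes d t m) = [ (λ (p , none) → select-finished d t p none) ,
          (λ (p , q , r) → select-continued d t m p q r) ]′ (Smallest.found m)

-- Rounds of the main loop and their total time

module Main {c ℓ₁ ℓ₂} (𝕀 : BoundedChain c ℓ₁ ℓ₂) (N : Gödel.MinimaxNet 𝕀) where

  open BoundedChain 𝕀 using (Carrier; _≈_; _≤_; _≤?_; 𝟎; 𝟏; module Eq)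
    renaming (refl to ≤-refl; trans to ≤-trans; reflexive to ≤-reflexive)
  open Semantics 𝕀
  open MinimaxNet N
  open MarkingAlgorithm N
  open Marking 𝕀
  open Correctness N
  open Potential 𝕀 N
  open MainLoop 𝕀 N
  open Selection 𝕀
  open SourceLoop 𝕀 N
  open Invariant

  module _ (ν : Numbering) (R W : ℕ) (payload : ℕ → ℕ → List (Object × Carrier)) where

    open Numbering ν
    open Represents

    private
      Sources′ = Sources ν R W payload
      Caches′ = Caches ν R W payload
      AllKeys′ = AllKeys ν R W payload
      entries′ = entries ν R W payload
      selectTime′ = selectTime ν R W payload

    sources-frame : ∀ {P s s₁ srcs} → Frame P s s₁ → none-below (λ a → writesInt P (38 + a)) 9 ≡ true →
                    writesVal P #key ≡ false → writesVal P #rkey ≡ false →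
                    Sources′ (heap s) srcs → Caches′ (heap s) → Sources′ (heap s₁) srcs × Caches′ (heap s₁)
    sources-frame {P} {s} {s₁} F p q r S K = record
      { alive⇒   = λ i<R j<W a → alive⇒ i<R j<W (subst (λ f → 1 ℕ.≤ f _) (i≡ 1) a)
      ; ⇒alive   = λ e → let x , y , a = ⇒alive e in x , y , subst (λ f → 1 ℕ.≤ f _) (sym (i≡ 1)) a
      ; distinct = distinct
      ; plen-r   = λ e → trans (cong (λ f → f _) (i≡ 2)) (plen-r e)
      ; payA-r   = λ {i} {j} e → at-list-frame ν 0 (map (codeA ν ∘ proj₁) (payload i j)) (cong (λ f k → f (i ∷ j ∷ k ∷ [])) (sym (i≡ 3))) (payA-r e)
      ; payB-r   = λ {i} {j} e → at-list-frame ν 0 (map (codeB ν ∘ proj₁) (payload i j)) (cong (λ f k → f (i ∷ j ∷ k ∷ [])) (sym (i≡ 4))) (payB-r e)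
      ; key-r    = λ {i} {j} e → subst (λ f → All (λ (_ , k) → k ≈ f (i ∷ j ∷ [])) (payload i j)) (sym (val-frame F #key q)) (key-r e)
      ; row-r    = trans (cong (λ f → f []) (i≡ 0)) row-r
      ; width-r  = trans (cong (λ f → f []) (i≡ 8)) width-r
      } , λ i i<R → subst (λ key → RowCache W (ints s₁ (20 + #alive)) key (ints s₁ (20 + #ralive)) (ints s₁ (20 + #rmin)) (vals s₁ #rkey) i)
            (sym (val-frame F #key q))
            (cache-cong (λ j → cong (λ f → f (i ∷ j ∷ [])) (i≡ 1)) (cong (λ f → f (i ∷ [])) (i≡ 6))
              (cong (λ f → f (i ∷ [])) (i≡ 5)) (cong (λ f → f (i ∷ [])) (val-frame F #rkey r)) (K i i<R))
      where
      open Sources S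
      i≡ : ∀ a {a<9 : T (a ℕ.<ᵇ 9)} → ints s₁ (38 + a) ≡ ints s (38 + a)
      i≡ a {a<9} = int-frame F (38 + a) (none-below-lookup {λ a → writesInt P (38 + a)} 9 p (ℕ.<ᵇ⇒< a 9 a<9))

    -- `Run` is built from its first step, whereas the program adds steps at the end. The
    -- continuation form, extending any run from C to one from `initial`, makes the addition
    -- immediate.
    Reached : Config → List (List ℕ) → Set _
    Reached C outp = ∃[ objs ] outp ≡ map code objs ×
      (∀ {objs′ C′} → Run C objs′ C′ → Run initial (objs ++ objs′) C′)

    Steady : State → Config → List (Object × Carrier) → Carrier → Set _
    Steady s C rest l = ∃[ outp ] Represents ν (heap s) C rest l outp ×
      (∃[ a ] Invariant (λ _ → ⊥) a C) × AllKeys′ C l × Reached C outp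

    -- The price of one unit of potential: an extraction, and 3 for the test of the loop.
    drainUnit : ℕ
    drainUnit = popTime ν + 3

    -- The remaining potential stays in the conclusion, since a single round has no good bound of
    -- its own; all rounds share one budget.
    drain-exec : ∀ {s C rest l} → Steady s C rest l →
      ∃[ C′ ] ∃[ T ] Exec (while (lit 1 ≤ⁿ mem #sp []) popᴾ) s T
          (λ s′ → Steady s′ C′ rest l × test s′ (lit 1 ≤ⁿ mem #sp []) ≡ false) ×
        T + drainUnit * potential C′ ℕ.≤ 3 + drainUnit * potential C
    drain-exec {s} {C} {rest} {l} st₀ with exec-while-budget J step (<-wellFounded _) (frame-refl {popᴾ}) (C , st₀ , refl)
      where
      J : ℕ → State → Set _
      J p s′ = ∃[ C′ ] Steady s′ C′ rest l × drainUnit * potential C′ ≡ p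

      step : ∀ {p s′} → Frame popᴾ s s′ → J p s′ → test s′ (lit 1 ≤ⁿ mem #sp []) ≡ true →
             ∃[ p′ ] ∃[ T ] Exec popᴾ s′ T (J p′) × 3 + T + p′ ℕ.≤ p
      step {s′ = s′} F (C , (outp , Rep , (a , I) , keys , objs , out≡ , run) , refl) t = pop (st Rep) refl
        where
        pop : ∀ st′ → st Rep ≡ st′ →
              ∃[ p′ ] ∃[ T ] Exec popᴾ s′ T (J p′) × 3 + T + p′ ℕ.≤ drainUnit * potential C
        pop [] q = contradiction (subst (1 ℕ.≤_) (trans (Stack.size (stk Rep)) (cong length q))
          (does-true (1 ℕ.≤? ints s′ (20 + #sp) []) t)) λ ()
        pop ((o , k) ∷ st′) q = drainUnit * potential C₂ , popTime ν * work o C ,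
          exec-map (λ _ Rep′ → C₂ ,
            (_ , Rep′ , (k , process-invariant o I σ k≤) , keys′ ,
             objs ++ o ∷ [] , trans (cong (_++ code o ∷ []) out≡) (sym (List.map-++ code objs (o ∷ []))) ,
             λ {objs′} r → subst (λ os → Run initial os _) (sym (List.++-assoc objs (o ∷ []) objs′)) (run (extract σ k≤ then r))) ,
            refl)
            (pop-exec ν Rep q I keys) , time≤
          where
          C₁ = record C { queue = st′ ++ rest }
          C₂ = process o C₁

          σ : queue C ↭ (o , k) ∷ (st′ ++ rest)
          σ = subst (λ st → queue C ↭ st ++ rest) q (queue-st Rep)

          k≤l : k ≤ l
          k≤l = All.lookup (subst (All (λ (_ , k) → k ≤ l)) q (low Rep)) (here refl)

          k≤ : All (λ (_ , k₁) → k ≤ k₁) (st′ ++ rest)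
          k≤ = All.tabulate λ e → ≤-trans k≤l (keys (Perm.∈-resp-↭ (↭-sym σ) (there e)))

          -- The invariant now holds with the key k just extracted as its level, and l ≤ k.
          keys′ : AllKeys′ C₂ l
          keys′ e = ≤-trans (keys (Perm.∈-resp-↭ (↭-sym σ) (here refl))) (a≤key (process-invariant o I σ k≤) e)

          time≤ : 3 + popTime ν * work o C + drainUnit * potential C₂ ℕ.≤ drainUnit * potential C
          time≤ = begin
            3 + popTime ν * work o C + drainUnit * potential C₂
              ≤⟨ ℕ.+-monoˡ-≤ (drainUnit * potential C₂) (ℕ.+-monoˡ-≤ (popTime ν * work o C)
                   (ℕ.m≤m*n 3 (work o C) {{ℕ.>-nonZero (work-positive o C)}})) ⟩
            3 * work o C + popTime ν * work o C + drainUnit * potential C₂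
              ≡⟨ collect (popTime ν) (work o C) (potential C₂) ⟩
            drainUnit * (potential C₂ + work o C)
              ≤⟨ ℕ.*-monoʳ-≤ drainUnit (process-potential (counted I) (proj₁ ∘ edgeKey I) σ) ⟩
            drainUnit * potential C ∎
            where
            open ℕ.≤-Reasoning hiding (stop)
            collect : ∀ a w p → 3 * w + a * w + (a + 3) * p ≡ (a + 3) * (p + w)
            collect = solve-∀
    ... | p′ , T , executes {s₁} d t ((C′ , st₁ , refl) , q) , h = C′ , T , executes d t (st₁ , q) , h

    -- The 6 consists of 3 for the outer test and 3 for the inner test that fails.
    roundTime : ℕ
    roundTime = 6 + selectTime′ * (suc R + suc W)

    Done : State → Set _
    Done s = ∃[ C ] ∃[ objs ] Run initial objs C × output s ≡ map code objs ×
      (∀ z → vals s #result (loc z) ≈ Mmin C z)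

    -- There is one round for each class and a last one that finds none, hence the `suc`.
    budget : Config → List (ℕ × ℕ) → ℕ
    budget C srcs = drainUnit * potential C + selectTime′ * length (entries′ srcs) + suc (length srcs) * roundTime

    Running : ℕ → State → Set _
    Running p s = hi (heap s) #stopped [] ≡ 0 × ∃[ C ] ∃[ srcs ] ∃[ l ] Steady s C (entries′ srcs) l ×
                  Sources′ (heap s) srcs × Caches′ (heap s) × budget C srcs ≡ p

    Finished : State → Set _
    Finished s = hi (heap s) #stopped [] ≡ 1 × Done s

    roundᴾ : Program
    roundᴾ = while (lit 1 ≤ⁿ mem #sp []) popᴾ ⨾ selectᴾ

    Round : State → ℕ → Set _
    Round s p = ∃[ p′ ] ∃[ T ] Exec roundᴾ s T (λ s′ → Running p′ s′ ⊎ Finished s′) × 3 + T + p′ ℕ.≤ p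

    round-finished : ∀ {s t s₁ T₁ C C₁ srcs l} → ⟨ while (lit 1 ≤ⁿ mem #sp []) popᴾ , s ⟩⇓[ t ] s₁ → t ℕ.≤ T₁ →
      T₁ + drainUnit * potential C₁ ℕ.≤ 3 + drainUnit * potential C → Steady s₁ C₁ (entries′ srcs) l → queue C₁ ≡ [] →
      (∀ {outp} → out (heap s₁) ≡ outp → Exec selectᴾ s₁ (selectTime′ * (suc R + suc W))
        (λ s′ → hi (heap s′) #stopped [] ≡ 1 × Dynamic ν (heap s′) C₁ × output s′ ≡ outp)) →
      Round s (budget C srcs)
    round-finished {s} {T₁ = T₁} {C} {C₁} {srcs} d u h (outp , Rep , _ , _ , objs , out≡ , run) none e =
      0 , T₁ + selectTime′ * (suc R + suc W) ,
      exec-after d u (exec-map (λ _ (p , D , o) → inj₂ (p , C₁ , objs ++ [] , run (stop none) ,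
        trans o (trans out≡ (cong (map code) (sym (List.++-identityʳ objs)))) , Dynamic.mark-r D)) (e (output-r Rep))) ,
      (begin
        3 + (T₁ + selectTime′ * (suc R + suc W)) + 0
          ≤⟨ ℕ.+-monoˡ-≤ 0 (ℕ.+-monoʳ-≤ 3 (ℕ.+-monoˡ-≤ (selectTime′ * (suc R + suc W)) (ℕ.m+n≤o⇒m≤o T₁ h))) ⟩
        3 + (3 + drainUnit * potential C + selectTime′ * (suc R + suc W)) + 0
          ≡⟨ arrange (drainUnit * potential C) (selectTime′ * (suc R + suc W)) ⟩
        drainUnit * potential C + roundTime
          ≤⟨ ℕ.+-mono-≤ (ℕ.m≤m+n (drainUnit * potential C) (selectTime′ * length (entries′ srcs)))
               (ℕ.m≤m+n roundTime (length srcs * roundTime)) ⟩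
        budget C srcs ∎)
      where
      open ℕ.≤-Reasoning hiding (stop)
      arrange : ∀ a b → 3 + (3 + a + b) + 0 ≡ a + (6 + b)
      arrange = solve-∀

    round-continued : ∀ {s t s₁ T₁ C C₁ srcs srcs′ l l′ i j} → ⟨ while (lit 1 ≤ⁿ mem #sp []) popᴾ , s ⟩⇓[ t ] s₁ → t ℕ.≤ T₁ →
      T₁ + drainUnit * potential C₁ ℕ.≤ 3 + drainUnit * potential C → Steady s₁ C₁ (entries′ srcs) l →
      srcs ↭ (i , j) ∷ srcs′ → AllKeys′ C₁ l′ →
      (∀ {outp} → out (heap s₁) ≡ outp → Exec selectᴾ s₁ (selectTime′ * (suc R + suc W + length (payload i j)))
        (λ s′ → hi (heap s′) #stopped [] ≡ 0 × Represents ν (heap s′) C₁ (entries′ srcs′) l′ outp ×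
                Sources′ (heap s′) srcs′ × Caches′ (heap s′))) →
      Round s (budget C srcs)
    round-continued {s} {T₁ = T₁} {C} {C₁} {srcs} {srcs′} {l} {l′} {i} {j} d u h (outp , Rep , I , _ , reached) σ keys′ e =
      budget C₁ srcs′ , T₁ + sel * (suc R + suc W + n) ,
      exec-after d u (exec-map (λ _ (p , Rep′ , S′ , K′) → inj₁ (p , C₁ , srcs′ , l′ ,
        (outp , Rep′ , I , keys′ , reached) , S′ , K′ , refl)) (e (output-r Rep))) ,
      (begin
        3 + (T₁ + sel * (suc R + suc W + n)) + (D * potential C₁ + sel * n′ + suc (length srcs′) * roundTime)
          ≡⟨ arrange₁ T₁ (D * potential C₁) sel (suc R + suc W) n n′ (suc (length srcs′) * roundTime) ⟩
        T₁ + D * potential C₁ + (3 + sel * (suc R + suc W) + sel * (n + n′) + suc (length srcs′) * roundTime)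
          ≤⟨ ℕ.+-monoˡ-≤ _ h ⟩
        3 + D * potential C + (3 + sel * (suc R + suc W) + sel * (n + n′) + suc (length srcs′) * roundTime)
          ≡⟨ arrange₂ (D * potential C) (sel * (suc R + suc W)) (sel * (n + n′)) (suc (length srcs′) * roundTime) ⟩
        D * potential C + sel * (n + n′) + suc (suc (length srcs′)) * roundTime
          ≡⟨ cong₂ (λ x y → D * potential C + sel * x + suc y * roundTime) (sym lengths) (sym (Perm.↭-length σ)) ⟩
        budget C srcs ∎)
      where
      open ℕ.≤-Reasoning hiding (stop)
      D = drainUnit
      sel = selectTime′
      n = length (payload i j)
      n′ = length (entries′ srcs′)

      lengths : length (entries′ srcs) ≡ n + n′
      lengths = trans (Perm.↭-length (concatMap-↭ (uncurry payload) σ)) (List.length-++ (payload i j))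

      arrange₁ : ∀ t d s x n m r → 3 + (t + s * (x + n)) + (d + s * m + r) ≡ t + d + (3 + s * x + s * (n + m) + r)
      arrange₁ = solve-∀

      arrange₂ : ∀ d x y r → 3 + d + (3 + x + y + r) ≡ d + y + ((6 + x) + r)
      arrange₂ = solve-∀

    round-exec : ∀ {s p} → Running p s → Round s p
    round-exec {s} (running , C , srcs , l , steady , S , K , refl) = drained (drain-exec steady)
      where
      drained : ∃[ C′ ] ∃[ T ] Exec (while (lit 1 ≤ⁿ mem #sp []) popᴾ) s T
                  (λ s′ → Steady s′ C′ (entries′ srcs) l × test s′ (lit 1 ≤ⁿ mem #sp []) ≡ false) ×
                T + drainUnit * potential C′ ℕ.≤ 3 + drainUnit * potential C →
                Round s (budget C srcs)
      drained (C₁ , T₁ , executes {s₂} d u (st₁@(outp , Rep , rest) , q) , h) =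
        chosen (select-exec ν R W payload Rep (empty-stack (st Rep) refl)
          (proj₁ unchanged) (proj₂ unchanged)
          (trans (cong (λ f → f []) (int-frame (frame d) (20 + #stopped) refl)) running))
        where
        unchanged = sources-frame (frame d) refl refl refl S K

        empty-stack : ∀ st′ → st Rep ≡ st′ → st Rep ≡ []
        empty-stack [] p = p
        empty-stack (e ∷ st′) p = contradiction
          (subst (1 ℕ.≤_) (sym (trans (Stack.size (stk Rep)) (cong length p))) (s≤s z≤n))
          (does-false (1 ℕ.≤? ints s₂ (20 + #sp) []) q)

        chosen : Selected ν R W payload s₂ C₁ srcs outp → Round s (budget C srcs)
        chosen (finished none e) = round-finished {C = C} {srcs = srcs} d u h st₁ none λ { refl → exec-map (λ _ (a , D , o) → a , D , trans o (sym (output-r Rep))) e }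
        chosen (continued {i} {j} {srcs′} σ keys′ e) = round-continued {C = C} {srcs = srcs} {srcs′} {i = i} {j} d u h st₁ σ keys′
          λ { refl → exec-map (λ {s′} _ (a , Rep′ , x) → a , subst (Represents ν (heap s′) C₁ (entries′ srcs′) _) (sym (output-r Rep)) Rep′ , x) e }

    main-exec : ∀ {s C srcs l} → Steady s C (entries′ srcs) l → Sources′ (heap s) srcs → Caches′ (heap s) →
                hi (heap s) #stopped [] ≡ 0 → Exec mainᴾ s (3 + budget C srcs) Done
    main-exec {s} {C} {srcs} {l} st₀ S₀ K₀ running₀ = conclude
      (exec-while-budget J step (<-wellFounded _) (frame-refl {roundᴾ})
        (inj₁ (running₀ , C , srcs , l , st₀ , S₀ , K₀ , refl)))
      where
      J : ℕ → State → Set _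
      J p s′ = Running p s′ ⊎ Finished s′

      step : ∀ {p s′} → Frame roundᴾ s s′ → J p s′ → test s′ (mem #stopped [] ≤ⁿ lit 0) ≡ true → Round s′ p
      step {s′ = s′} F (inj₂ (q , _)) t =
        contradiction (subst (ℕ._≤ 0) q (does-true (ints s′ (20 + #stopped) [] ℕ.≤? 0) t)) λ ()
      step F (inj₁ r) t = round-exec r

      conclude : ∃[ p′ ] ∃[ T ] Exec mainᴾ s T (λ s₂ → J p′ s₂ × test s₂ (mem #stopped [] ≤ⁿ lit 0) ≡ false) ×
                   T + p′ ℕ.≤ 3 + budget C srcs →
                 Exec mainᴾ s (3 + budget C srcs) Done
      conclude (p′ , T , executes d t (inj₁ (q , _) , u) , h) = contradiction (ℕ.≤-reflexive q) (does-false (_ ℕ.≤? 0) u)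
      conclude (p′ , T , executes d t (inj₂ (_ , D) , _) , h) = executes d (ℕ.≤-trans t (ℕ.m+n≤o⇒m≤o T h)) D

-- Construction of the net

when : ∀ {a} {A : Set a} → Bool → List A → List A
when b xs = if b then xs else []

when-[] : ∀ {a} {A : Set a} b → when {A = A} b [] ≡ []
when-[] true  = refl
when-[] false = refl

concatMap-empty : ∀ {a b} {A : Set a} {B : Set b} {f : A → List B} xs → (∀ x → f x ≡ []) → concatMap f xs ≡ []
concatMap-empty [] p = refl
concatMap-empty (x ∷ xs) p rewrite p x = concatMap-empty xs p

concatMap-when : ∀ {a b} {A : Set a} {B : Set b} (f : A → List B) b xs → concatMap f (when b xs) ≡ when b (concatMap f xs)
concatMap-when f true xs = refl
concatMap-when f false xs = refl

concatMap-concatMap : ∀ {a b d} {A : Set a} {B : Set b} {D : Set d} (f : B → List D) (g : A → List B) xs →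
  concatMap f (concatMap g xs) ≡ concatMap (concatMap f ∘ g) xs
concatMap-concatMap f g [] = refl
concatMap-concatMap f g (x ∷ xs) = trans (List.concatMap-++ f (g x) (concatMap g xs))
  (cong (concatMap f (g x) ++_) (concatMap-concatMap f g xs))

-- Every clause of the edge relation of the net compares one coordinate, so a comprehension over
-- that coordinate collapses to the matching term. This is how the lists of the algorithm shrink to
-- lists over edges of the graphs.
concatMap-delta : ∀ {a b} {A : Set a} {B : Set b} {f : A → List B} {x xs} → Unique xs → x ∈ xs →
  (∀ {y} → y ≢ x → f y ≡ []) → concatMap f xs ≡ f x
concatMap-delta {f = f} {x} {.x ∷ xs} (x∉ ∷ u) (here refl) p =
  trans (cong (f x ++_) (none xs x∉)) (List.++-identityʳ (f x))
  where
  none : ∀ xs → All (x ≢_) xs → concatMap f xs ≡ []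
  none [] [] = refl
  none (y ∷ ys) (q ∷ qs) rewrite p (q ∘ sym) = none ys qs
concatMap-delta {f = f} {x} {y ∷ xs} (y∉ ∷ u) (there x∈) p
  rewrite p {y} (λ { refl → All.lookup y∉ x∈ refl }) = concatMap-delta u x∈ p

concatMap-fin-delta : ∀ {b n} {B : Set b} {f : Fin n → List B} i → (∀ {j} → j ≢ i → f j ≡ []) →
  concatMap f (allFin n) ≡ f i
concatMap-fin-delta {n = n} i = concatMap-delta (Unique.allFin⁺ n) (∈.∈-allFin i)

concatMap-cartesianProduct : ∀ {a b d} {A : Set a} {B : Set b} {D : Set d} (f : A × B → List D) xs ys →
  concatMap f (cartesianProduct xs ys) ≡ concatMap (λ x → concatMap (λ y → f (x , y)) ys) xs
concatMap-cartesianProduct f [] ys = refl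
concatMap-cartesianProduct f (x ∷ xs) ys =
  trans (List.concatMap-++ f (map (x ,_) ys) (cartesianProduct xs ys))
    (cong₂ _++_ (List.concatMap-map f (x ,_) ys) (concatMap-cartesianProduct f xs ys))

map-filter : ∀ {a b p} {A : Set a} {B : Set b} {P : A → Set p} (P? : ∀ x → Dec (P x)) (f : A → B) xs →
  map f (filter P? xs) ≡ concatMap (λ x → when (does (P? x)) (f x ∷ [])) xs
map-filter P? f [] = refl
map-filter P? f (x ∷ xs) with does (P? x)
... | true  = cong (f x ∷_) (map-filter P? f xs)
... | false = map-filter P? f xs

-- The edges of the net, generated from the edges of the graphs

module NetLists {c ℓ₁ ℓ₂} (𝕀 : BoundedChain c ℓ₁ ℓ₂) {σV σE : ℕ} (G G′ : Gödel.FuzzyGraph 𝕀 σV σE) where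

  open BoundedChain 𝕀 using (Carrier; _≈_; _≤_; _≤?_; 𝟎; 𝟏; module Eq)
    renaming (refl to ≤-refl; trans to ≤-trans; reflexive to ≤-reflexive)
  open Gödel 𝕀
  open FuzzyGraph G
  open FuzzyGraph G′ renaming (V to V′; E to E′; L to L′; size to size′)
    hiding (nonEmpty)
  open MinimaxNet (net G G′) using (Vmin; Vmax; E↑; E↓; Vmin-finite; Vmax-finite)
  open MarkingAlgorithm (net G G′)

  positive : Carrier → Bool
  positive a = does (a >? 𝟎)

  -- The edges of one of the two graphs, together with the part of the net that they give
  -- rise to: an edge ⟨x,r,y⟩ and a vertex w of the other graph yield the edges from
  -- mkMin y w to mkMax x w r and from mkMax′ w y r to mkMin x w.
  record Side : Set c where
    field
      na nb   : ℕ
      edges   : Fin na → Fin σE → Fin na → Carrier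
      mkMin   : Fin na → Fin nb → Vmin
      mkMax   : Fin na → Fin nb → Fin σE → Vmax
      mkMax′  : Fin nb → Fin na → Fin σE → Vmax
      mkMin-injective  : ∀ {y w y₁ w₁} → mkMin y w ≡ mkMin y₁ w₁ → y ≡ y₁ × w ≡ w₁
      mkMax-injective  : ∀ {x w r x₁ w₁ r₁} → mkMax x w r ≡ mkMax x₁ w₁ r₁ → x ≡ x₁ × w ≡ w₁ × r ≡ r₁
      mkMax′-injective : ∀ {x w r x₁ w₁ r₁} → mkMax′ x w r ≡ mkMax′ x₁ w₁ r₁ → x ≡ x₁ × w ≡ w₁ × r ≡ r₁
      mkMax≢mkMax′     : ∀ {x w r w₁ y₁ r₁} → mkMax x w r ≢ mkMax′ w₁ y₁ r₁
      E↑-edges         : ∀ x r y w → E↑ (mkMin y w) (mkMax x w r) ≡ edges x r y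

  side₁ side₂ : Side
  side₁ = record
    { na = size ; nb = size′ ; edges = E
    ; mkMin = _,_ ; mkMax = λ x w r → inj₁ (x , w , r) ; mkMax′ = λ w y r → inj₂ (w , y , r)
    ; mkMin-injective = λ { refl → refl , refl }
    ; mkMax-injective = λ { refl → refl , refl , refl }
    ; mkMax′-injective = λ { refl → refl , refl , refl }
    ; mkMax≢mkMax′ = λ ()
    ; E↑-edges = λ x r y w → cong (λ b → if b then E x r y else 𝟎) (dec-true (w Fin.≟ w) refl)
    }
  side₂ = record
    { na = size′ ; nb = size ; edges = E′
    ; mkMin = λ u w → w , u ; mkMax = λ x w r → inj₂ (x , w , r) ; mkMax′ = λ w y r → inj₁ (w , y , r)
    ; mkMin-injective = λ { refl → refl , refl }
    ; mkMax-injective = λ { refl → refl , refl , refl }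
    ; mkMax′-injective = λ { refl → refl , refl , refl }
    ; mkMax≢mkMax′ = λ ()
    ; E↑-edges = λ x r y w → cong (λ b → if b then E′ x r y else 𝟎) (dec-true (w Fin.≟ w) refl)
    }

  module Sides (S : Side) where

    open Side S

    overEdges : ∀ {a} {A : Set a} → (Fin na → Fin σE → Fin na → List A) → List A
    overEdges f = concatMap (λ x → concatMap (λ r → concatMap (λ y →
      when (positive (edges x r y)) (f x r y)) (allFin na)) (allFin σE)) (allFin na)

    concatMap-overEdges : ∀ {a b} {A : Set a} {B : Set b} (k : A → List B) f →
      concatMap k (overEdges f) ≡ overEdges (λ x r y → concatMap k (f x r y))
    concatMap-overEdges k f =
      trans (concatMap-concatMap k _ (allFin na)) (List.concatMap-cong (λ x →
      trans (concatMap-concatMap k _ (allFin σE)) (List.concatMap-cong (λ r →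
      trans (concatMap-concatMap k _ (allFin na)) (List.concatMap-cong (λ y →
      concatMap-when k (positive (edges x r y)) (f x r y)) (allFin na))) (allFin σE))) (allFin na))

  -- An edge of the net as the program records it. The edges with `up`, from Vmin to Vmax, are those
  -- that enter the counters.
  record Arc : Set c where
    constructor arc
    field
      from to : ℕ
      weight  : Carrier
      up      : Bool

  open Arc public

  outs : ℕ → List Arc → List ℕ
  outs p = concatMap (λ a → when (does (from a ℕ.≟ p)) (to a ∷ []))

  outWeights : ℕ → List Arc → List Carrier
  outWeights p = concatMap (λ a → when (does (from a ℕ.≟ p)) (Arc.weight a ∷ []))

  ins : ℕ → List Arc → List Arc
  ins q = concatMap (λ a → when (up a ∧ does (to a ℕ.≟ q)) (a ∷ []))

  module Arcs (idMin : Vmin → ℕ) (idMax : Vmax → ℕ)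
              (idMin-injective : ∀ {x z} → idMin x ≡ idMin z → x ≡ z)
              (idMax-injective : ∀ {x z} → idMax x ≡ idMax z → x ≡ z)
              (idMin≢idMax : ∀ {x z} → idMin x ≢ idMax z) where

    module SideArcs (S : Side) where

      open Side S
      open Sides S

      pairArcs : Fin na → Fin σE → Fin na → Fin nb → List Arc
      pairArcs x r y w =
        arc (idMin (mkMin y w)) (idMax (mkMax x w r)) (edges x r y) true ∷
        arc (idMax (mkMax′ w y r)) (idMin (mkMin x w)) (edges x r y) false ∷ []

      edgeArcs : Fin na → Fin σE → Fin na → List Arc
      edgeArcs x r y = concatMap (pairArcs x r y) (allFin nb)

      sideArcs : List Arc
      sideArcs = overEdges edgeArcs

      differ : ∀ {a} {A : Set a} {i j : ℕ} {xs : List A} → i ≢ j → when (does (i ℕ.≟ j)) xs ≡ []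
      differ {i = i} {j} {xs} p = cong (λ b → when b xs) (dec-false (i ℕ.≟ j) p)

      agree : ∀ {a} {A : Set a} i {xs : List A} → when (does (i ℕ.≟ i)) xs ≡ xs
      agree i {xs} = cong (λ b → when b xs) (dec-true (i ℕ.≟ i) refl)

      module _ {b} {B : Set b} (k : Arc → List B) where

        over-pairs : Fin na → Fin σE → Fin na → List B
        over-pairs x r y = concatMap (λ w → concatMap k (pairArcs x r y w)) (allFin nb)

        over-arcs : concatMap k sideArcs ≡ overEdges over-pairs
        over-arcs = trans (concatMap-overEdges k edgeArcs) (List.concatMap-cong (λ x → List.concatMap-cong (λ r →
          List.concatMap-cong (λ y → cong (when (positive (edges x r y))) (concatMap-concatMap k (pairArcs x r y) (allFin nb)))
          (allFin na)) (allFin σE)) (allFin na))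

      -- An equality of lists and not just a permutation: the algorithm folds over its successors in
      -- order, and the adjacency list has to follow it. The nesting x, r, y of `overEdges` is the
      -- order in which Vmax is enumerated.
      outs-min : ∀ y w → outs (idMin (mkMin y w)) sideArcs ≡
        concatMap (λ x → concatMap (λ r → when (positive (edges x r y)) (idMax (mkMax x w r) ∷ [])) (allFin σE)) (allFin na)
      outs-min y w = trans (over-arcs k) (List.concatMap-cong (λ x → List.concatMap-cong (λ r →
        trans (concatMap-fin-delta y λ {y₁} y₁≢y → trans (cong (when (positive (edges x r y₁)))
            (concatMap-empty (allFin nb) λ w₁ → cong₂ _++_ (differ (y₁≢y ∘ proj₁ ∘ mkMin-injective ∘ idMin-injective))
              (cong (_++ []) (differ (idMin≢idMax ∘ sym))))) (when-[] (positive (edges x r y₁))))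
          (cong (when (positive (edges x r y))) (trans
            (concatMap-fin-delta w λ {w₁} w₁≢w → cong₂ _++_ (differ (w₁≢w ∘ proj₂ ∘ mkMin-injective ∘ idMin-injective))
              (cong (_++ []) (differ (idMin≢idMax ∘ sym))))
            (cong₂ _++_ (agree (idMin (mkMin y w)) {xs = idMax (mkMax x w r) ∷ []}) (cong (_++ []) (differ {xs = idMin (mkMin x w) ∷ []} (idMin≢idMax {mkMin y w} {mkMax′ w y r} ∘ sym)))))))
        (allFin σE)) (allFin na))
        where
        k : Arc → List ℕ
        k a = when (does (from a ℕ.≟ idMin (mkMin y w))) (to a ∷ [])

      outs-max′ : ∀ {b} {B : Set b} (h : Arc → B) w y r →
        concatMap (λ a → when (does (from a ℕ.≟ idMax (mkMax′ w y r))) (h a ∷ [])) sideArcs ≡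
        concatMap (λ x → when (positive (edges x r y))
          (h (arc (idMax (mkMax′ w y r)) (idMin (mkMin x w)) (edges x r y) false) ∷ [])) (allFin na)
      outs-max′ {B = B} h w y r = trans (over-arcs k) (List.concatMap-cong (λ x →
        trans (concatMap-fin-delta r λ {r₁} r₁≢r → concatMap-empty (allFin na) λ y₁ →
            trans (cong (when (positive (edges x r₁ y₁))) (concatMap-empty (allFin nb) λ w₁ →
              cong₂ _++_ (differ idMin≢idMax) (cong (_++ []) (differ (r₁≢r ∘ proj₂ ∘ proj₂ ∘ mkMax′-injective ∘ idMax-injective)))))
              (when-[] (positive (edges x r₁ y₁))))
          (trans (concatMap-fin-delta y λ {y₁} y₁≢y →
            trans (cong (when (positive (edges x r y₁))) (concatMap-empty (allFin nb) λ w₁ →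
              cong₂ _++_ (differ idMin≢idMax) (cong (_++ []) (differ (y₁≢y ∘ proj₁ ∘ proj₂ ∘ mkMax′-injective ∘ idMax-injective)))))
              (when-[] (positive (edges x r y₁))))
            (cong (when (positive (edges x r y))) (trans
              (concatMap-fin-delta w λ {w₁} w₁≢w → cong₂ _++_ (differ idMin≢idMax)
                (cong (_++ []) (differ (w₁≢w ∘ proj₁ ∘ mkMax′-injective ∘ idMax-injective))))
              (cong₂ _++_ (differ idMin≢idMax) (cong (_++ []) (agree (idMax (mkMax′ w y r))))))))) (allFin na))
        where
        k : Arc → List B
        k a = when (does (from a ℕ.≟ idMax (mkMax′ w y r))) (h a ∷ [])

      -- A node `mkMax x w r` is entered by edges of this graph and left by edges of the other one.
      outs-max : ∀ {b} {B : Set b} (h : Arc → B) x w r →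
        concatMap (λ a → when (does (from a ℕ.≟ idMax (mkMax x w r))) (h a ∷ [])) sideArcs ≡ []
      outs-max h x w r = trans (over-arcs (λ a → when (does (from a ℕ.≟ idMax (mkMax x w r))) (h a ∷ [])))
        (concatMap-empty (allFin na) λ x₁ → concatMap-empty (allFin σE) λ r₁ → concatMap-empty (allFin na) λ y₁ →
          trans (cong (when (positive (edges x₁ r₁ y₁))) (concatMap-empty (allFin nb) λ w₁ →
            cong₂ _++_ (differ idMin≢idMax) (cong (_++ []) (differ (mkMax≢mkMax′ ∘ sym ∘ idMax-injective)))))
            (when-[] (positive (edges x₁ r₁ y₁))))

      ins-max : ∀ x w r → length (ins (idMax (mkMax x w r)) sideArcs) ≡
        length (concatMap (λ y → when (positive (edges x r y)) (y ∷ [])) (allFin na))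
      ins-max x w r = trans (cong length (over-arcs k)) (trans (cong length (concatMap-fin-delta x λ {x₁} x₁≢x →
          concatMap-empty (allFin σE) λ r₁ → concatMap-empty (allFin na) λ y₁ →
            trans (cong (when (positive (edges x₁ r₁ y₁))) (concatMap-empty (allFin nb) λ w₁ →
              cong₂ _++_ (differ (x₁≢x ∘ proj₁ ∘ mkMax-injective ∘ idMax-injective)) refl))
              (when-[] (positive (edges x₁ r₁ y₁)))))
        (trans (cong length (concatMap-fin-delta r λ {r₁} r₁≢r → concatMap-empty (allFin na) λ y₁ →
            trans (cong (when (positive (edges x r₁ y₁))) (concatMap-empty (allFin nb) λ w₁ →
              cong₂ _++_ (differ (r₁≢r ∘ proj₂ ∘ proj₂ ∘ mkMax-injective ∘ idMax-injective)) refl))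
              (when-[] (positive (edges x r₁ y₁)))))
          (trans (cong length (List.concatMap-cong (λ y → cong (when (positive (edges x r y)))
            (trans (concatMap-fin-delta w λ {w₁} w₁≢w →
                cong₂ _++_ (differ (w₁≢w ∘ proj₁ ∘ proj₂ ∘ mkMax-injective ∘ idMax-injective)) refl)
              (cong₂ _++_ (agree (idMax (mkMax x w r)) {xs = arc (idMin (mkMin y w)) (idMax (mkMax x w r)) (edges x r y) true ∷ []}) refl))) (allFin na)))
            (lengths (allFin na)))))
        where
        k : Arc → List Arc
        k a = when (up a ∧ does (to a ℕ.≟ idMax (mkMax x w r))) (a ∷ [])

        lengths : ∀ ys → length (concatMap (λ y → when (positive (edges x r y))
            (arc (idMin (mkMin y w)) (idMax (mkMax x w r)) (edges x r y) true ∷ [])) ys) ≡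
          length (concatMap (λ y → when (positive (edges x r y)) (y ∷ [])) ys)
        lengths [] = refl
        lengths (y ∷ ys) with positive (edges x r y)
        ... | true  = cong suc (lengths ys)
        ... | false = lengths ys

      ins-max′ : ∀ w y r → ins (idMax (mkMax′ w y r)) sideArcs ≡ []
      ins-max′ w y r = trans (over-arcs (λ a → when (up a ∧ does (to a ℕ.≟ idMax (mkMax′ w y r))) (a ∷ [])))
        (concatMap-empty (allFin na) λ x₁ → concatMap-empty (allFin σE) λ r₁ → concatMap-empty (allFin na) λ y₁ →
          trans (cong (when (positive (edges x₁ r₁ y₁))) (concatMap-empty (allFin nb) λ w₁ →
            cong₂ _++_ (differ (mkMax≢mkMax′ ∘ idMax-injective)) refl))
            (when-[] (positive (edges x₁ r₁ y₁))))

concatMap-cong-↭ : ∀ {a b} {A : Set a} {B : Set b} {f g : A → List B} xs → (∀ x → f x ↭ g x) → concatMap f xs ↭ concatMap g xs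
concatMap-cong-↭ [] p = ↭-refl
concatMap-cong-↭ (x ∷ xs) p = Perm.++⁺ (p x) (concatMap-cong-↭ xs p)

concatMap-++-↭ : ∀ {a b} {A : Set a} {B : Set b} (f g : A → List B) xs →
                 concatMap (λ x → f x ++ g x) xs ↭ concatMap f xs ++ concatMap g xs
concatMap-++-↭ f g [] = ↭-refl
concatMap-++-↭ f g (x ∷ xs) = begin
  (f x ++ g x) ++ concatMap (λ x → f x ++ g x) xs     ↭⟨ Perm.++⁺ˡ (f x ++ g x) (concatMap-++-↭ f g xs) ⟩
  (f x ++ g x) ++ (concatMap f xs ++ concatMap g xs)  ↭⟨ Perm.++-assoc (f x) (g x) _ ⟩
  f x ++ (g x ++ (concatMap f xs ++ concatMap g xs))  ↭⟨ Perm.++⁺ˡ (f x) (Perm.shifts (g x) (concatMap f xs)) ⟩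
  f x ++ (concatMap f xs ++ (g x ++ concatMap g xs))  ↭⟨ Perm.++-assoc (f x) (concatMap f xs) _ ⟨
  (f x ++ concatMap f xs) ++ (g x ++ concatMap g xs)  ∎
  where open Perm.PermutationReasoning

concatMap-swap : ∀ {a b d} {A : Set a} {B : Set b} {D : Set d} (f : A → B → List D) xs ys →
  concatMap (λ x → concatMap (f x) ys) xs ↭ concatMap (λ y → concatMap (λ x → f x y) xs) ys
concatMap-swap f [] ys = ↭-reflexive (sym (concatMap-empty ys λ _ → refl))
concatMap-swap f (x ∷ xs) ys = ↭-trans (Perm.++⁺ˡ (concatMap (f x) ys) (concatMap-swap f xs ys))
  (↭-sym (concatMap-++-↭ (f x) (λ y → concatMap (λ x → f x y) xs) ys))

concatMap-singleton : ∀ {a b} {A : Set a} {B : Set b} (f : A → B) xs → concatMap (λ x → f x ∷ []) xs ≡ map f xs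
concatMap-singleton f [] = refl
concatMap-singleton f (x ∷ xs) = cong (f x ∷_) (concatMap-singleton f xs)

when-concatMap : ∀ {a b} {A : Set a} {B : Set b} b (f : A → List B) xs → concatMap (λ x → when b (f x)) xs ≡ when b (concatMap f xs)
when-concatMap true f xs = refl
when-concatMap false f xs = concatMap-empty xs λ _ → refl

-- The lists of the algorithm, and its initial queue grouped by class

module NetQueue {c ℓ₁ ℓ₂} (𝕀 : BoundedChain c ℓ₁ ℓ₂) {σV σE : ℕ} (G G′ : Gödel.FuzzyGraph 𝕀 σV σE) where

  open BoundedChain 𝕀 using (Carrier; _≈_; _≤_; _≤?_; 𝟎; 𝟏; module Eq)
    renaming (refl to ≤-refl; trans to ≤-trans; reflexive to ≤-reflexive)
  open Gödel 𝕀
  open FuzzyGraph G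
  open FuzzyGraph G′ renaming (V to V′; E to E′; L to L′; size to size′)
    hiding (nonEmpty)
  open MinimaxNet (net G G′) using (Vmin; Vmax; E↑; E↓; Vmin-finite; Vmax-finite) renaming (L to L″)
  open MarkingAlgorithm (net G G′)
  open NetLists 𝕀 G G′
  open Finite

  positive-𝟎 : positive 𝟎 ≡ false
  positive-𝟎 = dec-false (𝟎 >? 𝟎) λ p → p ≤-refl

  positive-if : ∀ {b} a → b ≡ false → positive (if b then a else 𝟎) ≡ false
  positive-if a refl = positive-𝟎

  when-positive : ∀ {a} {A : Set a} {xs : List A} {n} {i j : Fin n} e → i ≢ j →
                  when (positive (if does (i Fin.≟ j) then e else 𝟎)) xs ≡ []
  when-positive {xs = xs} {i = i} {j} e p = cong (λ b → when b xs) (positive-if e (dec-false (i Fin.≟ j) p))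

  when-same : ∀ {a} {A : Set a} {xs : List A} {n} (i : Fin n) e →
              when (positive (if does (i Fin.≟ i) then e else 𝟎)) xs ≡ when (positive e) xs
  when-same {xs = xs} i e = cong (λ b → when (positive (if b then e else 𝟎)) xs) (dec-true (i Fin.≟ i) refl)

  over-Vmin : ∀ {b} {B : Set b} (k : Vmin → List B) →
    concatMap k (elements Vmin-finite) ≡ concatMap (λ x → concatMap (λ x′ → k (x , x′)) (allFin size′)) (allFin size)
  over-Vmin k = concatMap-cartesianProduct k (allFin size) (allFin size′)

  over-Vmax : ∀ {b} {B : Set b} (k : Vmax → List B) →
    concatMap k (elements Vmax-finite) ≡
    concatMap (λ x → concatMap (λ y′ → concatMap (λ r → k (inj₁ (x , y′ , r))) (allFin σE)) (allFin size′)) (allFin size) ++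
    concatMap (λ x′ → concatMap (λ y → concatMap (λ r → k (inj₂ (x′ , y , r))) (allFin σE)) (allFin size)) (allFin size′)
  over-Vmax k = trans (List.concatMap-++ k (map inj₁ (cartesianProduct (allFin size) pairs₁)) (map inj₂ (cartesianProduct (allFin size′) pairs₂)))
    (cong₂ _++_
      (trans (List.concatMap-map k inj₁ (cartesianProduct (allFin size) pairs₁))
        (trans (concatMap-cartesianProduct (λ p → k (inj₁ p)) (allFin size) pairs₁)
          (List.concatMap-cong (λ x → concatMap-cartesianProduct (λ p → k (inj₁ (x , p))) (allFin size′) (allFin σE)) (allFin size))))
      (trans (List.concatMap-map k inj₂ (cartesianProduct (allFin size′) pairs₂))
        (trans (concatMap-cartesianProduct (λ p → k (inj₂ p)) (allFin size′) pairs₂)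
          (List.concatMap-cong (λ x → concatMap-cartesianProduct (λ p → k (inj₂ (x , p))) (allFin size) (allFin σE)) (allFin size′)))))
    where
    pairs₁ = cartesianProduct (allFin size′) (allFin σE)
    pairs₂ = cartesianProduct (allFin size) (allFin σE)

  over-succMin : ∀ {b} {B : Set b} (h : Vmax → B) y w →
    map h (succMin (y , w)) ≡
    concatMap (λ x → concatMap (λ r → when (positive (E x r y)) (h (inj₁ (x , w , r)) ∷ [])) (allFin σE)) (allFin size) ++
    concatMap (λ x′ → concatMap (λ r → when (positive (E′ x′ r w)) (h (inj₂ (x′ , y , r)) ∷ [])) (allFin σE)) (allFin size′)
  over-succMin h y w = trans (map-filter (λ v → E↑ (y , w) v >? 𝟎) h (elements Vmax-finite)) (trans (over-Vmax _) (cong₂ _++_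
    (List.concatMap-cong (λ x → trans
      (concatMap-fin-delta w λ {w₁} ne → concatMap-empty (allFin σE) λ r → when-positive (E x r y) (ne ∘ sym))
      (List.concatMap-cong (λ r → when-same w (E x r y)) (allFin σE))) (allFin size))
    (List.concatMap-cong (λ x′ → trans
      (concatMap-fin-delta y λ {y₁} ne → concatMap-empty (allFin σE) λ r → when-positive (E′ x′ r w) (ne ∘ sym))
      (List.concatMap-cong (λ r → when-same y (E′ x′ r w)) (allFin σE))) (allFin size′))))

  over-succMax₁ : ∀ {b} {B : Set b} (h : Vmin → B) x w r →
    map h (succMax (inj₁ (x , w , r))) ≡ concatMap (λ x′ → when (positive (E′ x′ r w)) (h (x , x′) ∷ [])) (allFin size′)
  over-succMax₁ h x w r = trans (map-filter (λ v → E↓ (inj₁ (x , w , r)) v >? 𝟎) h (elements Vmin-finite)) (trans (over-Vmin _)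
    (trans (concatMap-fin-delta x λ {x₁} ne → concatMap-empty (allFin size′) λ x′ → when-positive (E′ x′ r w) (ne ∘ sym))
      (List.concatMap-cong (λ x′ → when-same x (E′ x′ r w)) (allFin size′))))

  over-succMax₂ : ∀ {b} {B : Set b} (h : Vmin → B) x′ y r →
    map h (succMax (inj₂ (x′ , y , r))) ≡ concatMap (λ x → when (positive (E x r y)) (h (x , x′) ∷ [])) (allFin size)
  over-succMax₂ h x′ y r = trans (map-filter (λ v → E↓ (inj₂ (x′ , y , r)) v >? 𝟎) h (elements Vmin-finite)) (trans (over-Vmin _)
    (List.concatMap-cong (λ x → trans
      (concatMap-fin-delta x′ λ {x₁} ne → when-positive (E x r y) (ne ∘ sym))
      (when-same x′ (E x r y))) (allFin size)))

  over-predMax₁ : ∀ x w r → map proj₁ (predMax (inj₁ (x , w , r))) ≡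
    concatMap (λ y → when (positive (E x r y)) (y ∷ [])) (allFin size)
  over-predMax₁ x w r = trans (map-filter (λ v → E↑ v (inj₁ (x , w , r)) >? 𝟎) proj₁ (elements Vmin-finite)) (trans (over-Vmin _)
    (List.concatMap-cong (λ y → trans
      (concatMap-fin-delta w λ {w₁} ne → when-positive (E x r y) ne)
      (when-same w (E x r y))) (allFin size)))

  over-predMax₂ : ∀ x′ y r → map proj₂ (predMax (inj₂ (x′ , y , r))) ≡
    concatMap (λ y′ → when (positive (E′ x′ r y′)) (y′ ∷ [])) (allFin size′)
  over-predMax₂ x′ y r = trans (map-filter (λ v → E↑ v (inj₂ (x′ , y , r)) >? 𝟎) proj₂ (elements Vmin-finite)) (trans (over-Vmin _)
    (trans (concatMap-fin-delta y λ {y₁} ne → concatMap-empty (allFin size′) λ y′ → when-positive (E′ x′ r y′) ne)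
      (List.concatMap-cong (λ y′ → when-same y (E′ x′ r y′)) (allFin size′))))

  module ArcLists (idMin : Vmin → ℕ) (idMax : Vmax → ℕ)
              (idMin-injective : ∀ {x z} → idMin x ≡ idMin z → x ≡ z)
              (idMax-injective : ∀ {x z} → idMax x ≡ idMax z → x ≡ z)
              (idMin≢idMax : ∀ {x z} → idMin x ≢ idMax z) where

    open Arcs idMin idMax idMin-injective idMax-injective idMin≢idMax

    module A₁ = SideArcs side₁
    module A₂ = SideArcs side₂

    arcs : List Arc
    arcs = A₁.sideArcs ++ A₂.sideArcs

    outs-min : ∀ z → outs (idMin z) arcs ≡ map idMax (succMin z)
    outs-min (y , w) = trans (List.concatMap-++ _ A₁.sideArcs A₂.sideArcs)
      (trans (cong₂ _++_ (A₁.outs-min y w) (A₂.outs-min w y)) (sym (over-succMin idMax y w)))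

    outs-max : ∀ y → outs (idMax y) arcs ≡ map idMin (succMax y)
    outs-max (inj₁ (x , w , r)) = trans (List.concatMap-++ _ A₁.sideArcs A₂.sideArcs)
      (trans (cong₂ _++_ (A₁.outs-max to x w r) (A₂.outs-max′ to x w r)) (sym (over-succMax₁ idMin x w r)))
    outs-max (inj₂ (x′ , y , r)) = trans (List.concatMap-++ _ A₁.sideArcs A₂.sideArcs)
      (trans (cong₂ _++_ (A₁.outs-max′ to x′ y r) (A₂.outs-max to x′ y r))
        (trans (List.++-identityʳ _) (sym (over-succMax₂ idMin x′ y r))))

    outWeights-max : ∀ y → outWeights (idMax y) arcs ≡ map (E↓ y) (succMax y)
    outWeights-max (inj₁ (x , w , r)) = trans (List.concatMap-++ _ A₁.sideArcs A₂.sideArcs)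
      (trans (cong₂ _++_ (A₁.outs-max weight x w r) (A₂.outs-max′ weight x w r)) (trans
        (List.concatMap-cong (λ x′ → cong (λ e → when (positive (E′ x′ r w)) (e ∷ []))
          (cong (λ b → if b then E′ x′ r w else 𝟎) (sym (dec-true (x Fin.≟ x) refl)))) (allFin size′))
        (sym (over-succMax₁ (E↓ (inj₁ (x , w , r))) x w r))))
    outWeights-max (inj₂ (x′ , y , r)) = trans (List.concatMap-++ _ A₁.sideArcs A₂.sideArcs)
      (trans (cong₂ _++_ (A₁.outs-max′ weight x′ y r) (A₂.outs-max weight x′ y r)) (trans (List.++-identityʳ _) (trans
        (List.concatMap-cong (λ x → cong (λ e → when (positive (E x r y)) (e ∷ []))
          (cong (λ b → if b then E x r y else 𝟎) (sym (dec-true (x′ Fin.≟ x′) refl)))) (allFin size))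
        (sym (over-succMax₂ (E↓ (inj₂ (x′ , y , r))) x′ y r)))))

    ins-max : ∀ y → length (ins (idMax y) arcs) ≡ length (predMax y)
    ins-max (inj₁ (x , w , r)) = trans (cong length (List.concatMap-++ _ A₁.sideArcs A₂.sideArcs))
      (trans (cong (λ l → length (ins (idMax (inj₁ (x , w , r))) A₁.sideArcs ++ l)) (A₂.ins-max′ x w r))
        (trans (cong length (List.++-identityʳ (ins (idMax (inj₁ (x , w , r))) A₁.sideArcs)))
          (trans (A₁.ins-max x w r) (trans (cong length (sym (over-predMax₁ x w r))) (List.length-map proj₁ (predMax (inj₁ (x , w , r))))))))
    ins-max (inj₂ (x′ , y , r)) = trans (cong length (List.concatMap-++ _ A₁.sideArcs A₂.sideArcs))
      (trans (cong (λ l → length (l ++ ins (idMax (inj₂ (x′ , y , r))) A₂.sideArcs)) (A₁.ins-max′ x′ y r))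
        (trans (A₂.ins-max x′ y r) (trans (cong length (sym (over-predMax₂ x′ y r))) (List.length-map proj₂ (predMax (inj₂ (x′ , y , r)))))))

  module Entries (S : Side) where
    open Side S
    open Sides S public

    edgeEntries : Fin na → Fin σE → Fin na → List (Object × Carrier)
    edgeEntries x r y = concatMap (λ w → (edge (mkMin y w) (mkMax x w r) , edges x r y) ∷ []) (allFin nb)

    sideEntries : List (Object × Carrier)
    sideEntries = overEdges edgeEntries

    -- The algorithm lists edges of the net by their start, the classes by the edge of the graph
    -- that provides the key. A permutation is enough, as the queue is read up to permutation.
    regroup : ∀ {a} {A : Set a} (f : Fin na → Fin σE → Fin na → Fin nb → List A) →
      concatMap (λ y → concatMap (λ w → concatMap (λ x → concatMap (λ r → when (positive (edges x r y)) (f x r y w))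
        (allFin σE)) (allFin na)) (allFin nb)) (allFin na) ↭ overEdges (λ x r y → concatMap (f x r y) (allFin nb))
    regroup f = begin
      concatMap (λ y → concatMap (λ w → concatMap (λ x → concatMap (λ r → g x r y w) (allFin σE)) (allFin na)) (allFin nb)) (allFin na)
        ↭⟨ concatMap-cong-↭ (allFin na) (λ y → concatMap-swap (λ w x → concatMap (λ r → g x r y w) (allFin σE)) (allFin nb) (allFin na)) ⟩
      concatMap (λ y → concatMap (λ x → concatMap (λ w → concatMap (λ r → g x r y w) (allFin σE)) (allFin nb)) (allFin na)) (allFin na)
        ↭⟨ concatMap-swap (λ y x → concatMap (λ w → concatMap (λ r → g x r y w) (allFin σE)) (allFin nb)) (allFin na) (allFin na) ⟩
      concatMap (λ x → concatMap (λ y → concatMap (λ w → concatMap (λ r → g x r y w) (allFin σE)) (allFin nb)) (allFin na)) (allFin na)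
        ↭⟨ concatMap-cong-↭ (allFin na) (λ x → concatMap-cong-↭ (allFin na) λ y → concatMap-swap (λ w r → g x r y w) (allFin nb) (allFin σE)) ⟩
      concatMap (λ x → concatMap (λ y → concatMap (λ r → concatMap (λ w → g x r y w) (allFin nb)) (allFin σE)) (allFin na)) (allFin na)
        ↭⟨ concatMap-cong-↭ (allFin na) (λ x → concatMap-swap (λ y r → concatMap (λ w → g x r y w) (allFin nb)) (allFin na) (allFin σE)) ⟩
      concatMap (λ x → concatMap (λ r → concatMap (λ y → concatMap (λ w → g x r y w) (allFin nb)) (allFin na)) (allFin σE)) (allFin na)
        ≡⟨ List.concatMap-cong (λ x → List.concatMap-cong (λ r → List.concatMap-cong (λ y →
             when-concatMap (positive (edges x r y)) (f x r y) (allFin nb)) (allFin na)) (allFin σE)) (allFin na) ⟩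
      overEdges (λ x r y → concatMap (f x r y) (allFin nb)) ∎
      where
      open Perm.PermutationReasoning
      g : Fin na → Fin σE → Fin na → Fin nb → List _
      g x r y w = when (positive (edges x r y)) (f x r y w)

  open Entries side₁ using () renaming (sideEntries to entries₁; regroup to regroup₁)
  open Entries side₂ using () renaming (sideEntries to entries₂; regroup to regroup₂)

  edge-queue : List (Object × Carrier)
  edge-queue = map (λ (z , y) → edge z y , E↑ z y)
    (filter (λ (z , y) → E↑ z y >? 𝟎) (cartesianProduct (elements Vmin-finite) (elements Vmax-finite)))

  edge-queue-entries : edge-queue ↭ entries₁ ++ entries₂
  edge-queue-entries = begin
    edge-queue
      ≡⟨ map-filter (λ (z , y) → E↑ z y >? 𝟎) (λ (z , y) → edge z y , E↑ z y) (cartesianProduct (elements Vmin-finite) (elements Vmax-finite)) ⟩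
    concatMap (λ p → when (positive (uncurry E↑ p)) ((uncurry edge p , uncurry E↑ p) ∷ [])) (cartesianProduct (elements Vmin-finite) (elements Vmax-finite))
      ≡⟨ concatMap-cartesianProduct (λ p → when (positive (uncurry E↑ p)) ((uncurry edge p , uncurry E↑ p) ∷ [])) (elements Vmin-finite) (elements Vmax-finite) ⟩
    concatMap (λ z → concatMap (λ v → when (positive (E↑ z v)) ((edge z v , E↑ z v) ∷ [])) (elements Vmax-finite)) (elements Vmin-finite)
      ≡⟨ over-Vmin (λ z → concatMap (λ v → when (positive (E↑ z v)) ((edge z v , E↑ z v) ∷ [])) (elements Vmax-finite)) ⟩
    concatMap (λ y → concatMap (λ w → concatMap (λ v → when (positive (E↑ (y , w) v)) ((edge (y , w) v , E↑ (y , w) v) ∷ [])) (elements Vmax-finite)) (allFin size′)) (allFin size)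
      ≡⟨ List.concatMap-cong (λ y → List.concatMap-cong (λ w → expand y w) (allFin size′)) (allFin size) ⟩
    concatMap (λ y → concatMap (λ w → f₁ y w ++ f₂ y w) (allFin size′)) (allFin size)
      ↭⟨ concatMap-cong-↭ (allFin size) (λ y → concatMap-++-↭ (f₁ y) (f₂ y) (allFin size′)) ⟩
    concatMap (λ y → concatMap (f₁ y) (allFin size′) ++ concatMap (f₂ y) (allFin size′)) (allFin size)
      ↭⟨ concatMap-++-↭ (λ y → concatMap (f₁ y) (allFin size′)) (λ y → concatMap (f₂ y) (allFin size′)) (allFin size) ⟩
    concatMap (λ y → concatMap (f₁ y) (allFin size′)) (allFin size) ++ concatMap (λ y → concatMap (f₂ y) (allFin size′)) (allFin size)
      ↭⟨ Perm.++⁺ (regroup₁ (λ x r y w → (edge (y , w) (inj₁ (x , w , r)) , E x r y) ∷ []))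
           (↭-trans (concatMap-swap f₂ (allFin size) (allFin size′)) (regroup₂ (λ x′ r w y → (edge (y , w) (inj₂ (x′ , y , r)) , E′ x′ r w) ∷ []))) ⟩
    entries₁ ++ entries₂ ∎
    where
    open Perm.PermutationReasoning
    f₁ f₂ : V → V′ → List (Object × Carrier)
    f₁ y w = concatMap (λ x → concatMap (λ r → when (positive (E x r y)) ((edge (y , w) (inj₁ (x , w , r)) , E x r y) ∷ [])) (allFin σE)) (allFin size)
    f₂ y w = concatMap (λ x′ → concatMap (λ r → when (positive (E′ x′ r w)) ((edge (y , w) (inj₂ (x′ , y , r)) , E′ x′ r w) ∷ [])) (allFin σE)) (allFin size′)

    expand : ∀ y w → concatMap (λ v → when (positive (E↑ (y , w) v)) ((edge (y , w) v , E↑ (y , w) v) ∷ [])) (elements Vmax-finite) ≡ f₁ y w ++ f₂ y w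
    expand y w = trans (over-Vmax _) (cong₂ _++_
      (List.concatMap-cong (λ x → trans
        (concatMap-fin-delta w λ {w₁} ne → concatMap-empty (allFin σE) λ r → when-positive (E x r y) (ne ∘ sym))
        (List.concatMap-cong (λ r → cong (λ e → when (positive e) ((edge (y , w) (inj₁ (x , w , r)) , e) ∷ []))
          (Side.E↑-edges side₁ x r y w)) (allFin σE))) (allFin size))
      (List.concatMap-cong (λ x′ → trans
        (concatMap-fin-delta y λ {y₁} ne → concatMap-empty (allFin σE) λ r → when-positive (E′ x′ r w) (ne ∘ sym))
        (List.concatMap-cong (λ r → cong (λ e → when (positive e) ((edge (y , w) (inj₂ (x′ , y , r)) , e) ∷ []))
          (Side.E↑-edges side₂ x′ r w y)) (allFin σE))) (allFin size′)))

  module LabelEntries (arg : V → V′ → Fin (suc σV)) where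

    -- For any function `arg` each node enters exactly one class of the row of x′; that its key is
    -- right depends on the later choice of `arg`.
    labelEntries : V′ → Fin (suc σV) → List (Object × Carrier)
    labelEntries x′ p = concatMap (λ x → when (does (p Fin.≟ arg x x′)) ((minNode (x , x′) , L″ (x , x′)) ∷ [])) (allFin size)

    min-queue-entries : map (λ z → Object.minNode z , L″ z) (elements Vmin-finite) ↭
      concatMap (λ x′ → concatMap (labelEntries x′) (allFin (suc σV))) (allFin size′)
    min-queue-entries = begin
      map (λ z → Object.minNode z , L″ z) (elements Vmin-finite)
        ≡⟨ concatMap-singleton (λ z → Object.minNode z , L″ z) (elements Vmin-finite) ⟨
      concatMap (λ z → (minNode z , L″ z) ∷ []) (elements Vmin-finite)
        ≡⟨ over-Vmin (λ z → (minNode z , L″ z) ∷ []) ⟩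
      concatMap (λ x → concatMap (λ x′ → (minNode (x , x′) , L″ (x , x′)) ∷ []) (allFin size′)) (allFin size)
        ↭⟨ concatMap-swap (λ x x′ → (minNode (x , x′) , L″ (x , x′)) ∷ []) (allFin size) (allFin size′) ⟩
      concatMap (λ x′ → concatMap (λ x → (minNode (x , x′) , L″ (x , x′)) ∷ []) (allFin size)) (allFin size′)
        ≡⟨ List.concatMap-cong (λ x′ → List.concatMap-cong (λ x → sym (trans
             (concatMap-fin-delta (arg x x′) λ {p} ne → cong (λ b → when b _) (dec-false (p Fin.≟ arg x x′) ne))
             (cong (λ b → when b _) (dec-true (arg x x′ Fin.≟ arg x x′) refl)))) (allFin size)) (allFin size′) ⟩
      concatMap (λ x′ → concatMap (λ x → concatMap (λ p → when (does (p Fin.≟ arg x x′)) ((minNode (x , x′) , L″ (x , x′)) ∷ []))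
        (allFin (suc σV))) (allFin size)) (allFin size′)
        ↭⟨ concatMap-cong-↭ (allFin size′) (λ x′ → concatMap-swap
             (λ x p → when (does (p Fin.≟ arg x x′)) ((minNode (x , x′) , L″ (x , x′)) ∷ [])) (allFin size) (allFin (suc σV))) ⟩
      concatMap (λ x′ → concatMap (labelEntries x′) (allFin (suc σV))) (allFin size′) ∎
      where open Perm.PermutationReasoning

-- Numbering the nodes of the net

registerMinᴾ registerMinsᴾ : Program
registerMinᴾ =
  store #minId (lit 1 ∷ reg #i ∷ reg #j ∷ []) (mem #next []) ⨾
  -- The number is stored under both orders of the coordinates, with tags 1 and 2, so that one
  -- program text with the tag as parameter serves both graphs.
  store #minId (lit 2 ∷ reg #j ∷ reg #i ∷ []) (mem #next []) ⨾
  store #fX (mem #next [] ∷ []) (reg #i) ⨾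
  store #fY (mem #next [] ∷ []) (reg #j) ⨾
  store #next [] (mem #next [] ⊕ lit 1)
registerMinsᴾ = for #i (int 0 []) (for #j (int 1 []) registerMinᴾ)

registerMaxᴾ : ℕ → Program
registerMaxᴾ t =
  store #maxId (lit t ∷ reg #i ∷ reg #j ∷ reg #k ∷ []) (mem #next []) ⨾
  store #kind (mem #next [] ∷ []) (lit 1) ⨾
  store #fT (mem #next [] ∷ []) (lit t) ⨾
  store #fA (mem #next [] ∷ []) (reg #i) ⨾
  store #fC (mem #next [] ∷ []) (reg #j) ⨾
  store #fR (mem #next [] ∷ []) (reg #k) ⨾
  store #next [] (mem #next [] ⊕ lit 1)

registerMaxsᴾ : (t na nb : ℕ) → Program
registerMaxsᴾ t na nb = for #i (int na []) (for #j (int nb []) (for #k (int 3 []) (registerMaxᴾ t)))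

∈-concatMap-allFin : ∀ {b n} {B : Set b} {f : Fin n → List B} i {y} → y ∈ f i → y ∈ concatMap f (allFin n)
∈-concatMap-allFin {f = f} i y∈ = ∈.∈-concatMap⁺ f (lose (∈.∈-allFin i) y∈)

module Registration {c ℓ₁ ℓ₂} (𝕀 : BoundedChain c ℓ₁ ℓ₂) {σV σE : ℕ} (G G′ : Gödel.FuzzyGraph 𝕀 σV σE) where

  open Semantics 𝕀
  open FuzzyGraph G
  open FuzzyGraph G′ renaming (V to V′; E to E′; L to L′; size to size′)
    hiding (nonEmpty)
  open MinimaxNet (net G G′) using (Vmin; Vmax)
  open NetLists 𝕀 G G′

  location : Vmin → List ℕ
  location (x , x′) = toℕ x ∷ toℕ x′ ∷ []

  location-injective : ∀ {z z₁} → location z ≡ location z₁ → z ≡ z₁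
  location-injective p = cong₂ _,_ (Fin.toℕ-injective (proj₁ (List.∷-injective p)))
    (Fin.toℕ-injective (proj₁ (List.∷-injective (proj₂ (List.∷-injective p)))))

  -- `below` shows that the number `#next` is fresh, so that registering another node does not
  -- overwrite the fields of this one.
  record MinRegistered (H : Heap) (z : Vmin) : Set where
    field
      both  : hi H #minId (2 ∷ toℕ (proj₂ z) ∷ toℕ (proj₁ z) ∷ []) ≡ hi H #minId (1 ∷ location z)
      field-X : hi H #fX (hi H #minId (1 ∷ location z) ∷ []) ≡ toℕ (proj₁ z)
      field-Y : hi H #fY (hi H #minId (1 ∷ location z) ∷ []) ≡ toℕ (proj₂ z)
      below : hi H #minId (1 ∷ location z) ℕ.< hi H #next []

  open MinRegistered public

  MinsRegistered : List Vmin → Heap → Set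
  MinsRegistered zs H = ∀ {z} → z ∈ zs → MinRegistered H z

  registerMin-exec : ∀ {s} zs (x : V) (x′ : V′) → ints s #i [] ≡ toℕ x → ints s #j [] ≡ toℕ x′ →
    MinsRegistered zs (heap s) →
    Exec registerMinᴾ s (cost registerMinᴾ) (λ s′ → MinsRegistered (zs ++ (x , x′) ∷ []) (heap s′))
  registerMin-exec {s} zs x x′ pi pj M =
    exec-setInt-then (exec-setInt-then (exec-setInt-then (exec-setInt-then (exec-setInt registered))))
    where
    n = ints s (20 + #next) []
    a = ints s #i []
    b = ints s #j []
    s₁ = writeInt (20 + #minId) (1 ∷ a ∷ b ∷ []) n s
    s₂ = writeInt (20 + #minId) (2 ∷ b ∷ a ∷ []) n s₁
    s₃ = writeInt (20 + #fX) (n ∷ []) a s₂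
    s₄ = writeInt (20 + #fY) (n ∷ []) b s₃
    s₅ = writeInt (20 + #next) [] (n + 1) s₄

    n<n+1 : n ℕ.< n + 1
    n<n+1 = ℕ.≤-reflexive (ℕ.+-comm 1 n)

    registered : MinsRegistered (zs ++ (x , x′) ∷ []) (heap s₅)
    registered {z} z∈ with (1 ∷ a ∷ b ∷ []) ≟ˡ (1 ∷ location z)
    ... | yes p = record { both = both′ ; field-X = fieldX ; field-Y = fieldY ; below = below′ }
      where
      a≡ : a ≡ toℕ (proj₁ z)
      a≡ = proj₁ (List.∷-injective (proj₂ (List.∷-injective p)))

      b≡ : b ≡ toℕ (proj₂ z)
      b≡ = proj₁ (List.∷-injective (proj₂ (List.∷-injective (proj₂ (List.∷-injective p)))))

      id≡ : hi (heap s₅) #minId (1 ∷ location z) ≡ n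
      id≡ = trans (cong (λ l → update _≟ˡ_ (1 ∷ a ∷ b ∷ []) n (ints s (20 + #minId)) l) (sym p))
        (update-same _≟ˡ_ (1 ∷ a ∷ b ∷ []) n (ints s (20 + #minId)))

      both′ : hi (heap s₅) #minId (2 ∷ toℕ (proj₂ z) ∷ toℕ (proj₁ z) ∷ []) ≡ hi (heap s₅) #minId (1 ∷ location z)
      both′ = trans (trans (cong₂ (λ a b → update _≟ˡ_ (2 ∷ ints s #j [] ∷ ints s #i [] ∷ []) n (ints s₁ (20 + #minId)) (2 ∷ b ∷ a ∷ [])) (sym a≡) (sym b≡))
        (update-same _≟ˡ_ (2 ∷ b ∷ a ∷ []) n (ints s₁ (20 + #minId)))) (sym id≡)

      fieldX : hi (heap s₅) #fX (hi (heap s₅) #minId (1 ∷ location z) ∷ []) ≡ toℕ (proj₁ z)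
      fieldX = trans (cong (λ i → update _≟ˡ_ (n ∷ []) a (ints s (20 + #fX)) (i ∷ [])) id≡)
        (trans (update-same _≟ˡ_ (n ∷ []) a (ints s (20 + #fX))) a≡)

      fieldY : hi (heap s₅) #fY (hi (heap s₅) #minId (1 ∷ location z) ∷ []) ≡ toℕ (proj₂ z)
      fieldY = trans (cong (λ i → update _≟ˡ_ (n ∷ []) b (ints s (20 + #fY)) (i ∷ [])) id≡)
        (trans (update-same _≟ˡ_ (n ∷ []) b (ints s (20 + #fY))) b≡)

      below′ : hi (heap s₅) #minId (1 ∷ location z) ℕ.< n + 1
      below′ = subst (ℕ._< n + 1) (sym id≡) n<n+1
    ... | no ne = record { both = both′ ; field-X = fieldX ; field-Y = fieldY ; below = below′ }
      where
      old : MinRegistered (heap s) z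
      old with ∈.∈-++⁻ zs z∈
      ... | inj₁ e = M e
      ... | inj₂ (here refl) = contradiction (cong₂ (λ a b → 1 ∷ a ∷ b ∷ []) pi pj) ne

      id≡ : hi (heap s₅) #minId (1 ∷ location z) ≡ ints s (20 + #minId) (1 ∷ location z)
      id≡ = update-other _≟ˡ_ n (ints s (20 + #minId)) ne

      fresh : _≢_ {A = List ℕ} (n ∷ []) (ints s (20 + #minId) (1 ∷ location z) ∷ [])
      fresh = singleton-≢ (ℕ.<⇒≢ (below old) ∘ sym)

      both′ : hi (heap s₅) #minId (2 ∷ toℕ (proj₂ z) ∷ toℕ (proj₁ z) ∷ []) ≡ hi (heap s₅) #minId (1 ∷ location z)
      both′ = trans (update-other _≟ˡ_ {2 ∷ b ∷ a ∷ []} {2 ∷ toℕ (proj₂ z) ∷ toℕ (proj₁ z) ∷ []} n (ints s₁ (20 + #minId))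
          (λ p → ne (cong₂ (λ a b → 1 ∷ a ∷ b ∷ [])
            (proj₁ (List.∷-injective (proj₂ (List.∷-injective (proj₂ (List.∷-injective p))))))
            (proj₁ (List.∷-injective (proj₂ (List.∷-injective p)))))))
        (trans (both old) (sym id≡))

      fieldX : hi (heap s₅) #fX (hi (heap s₅) #minId (1 ∷ location z) ∷ []) ≡ toℕ (proj₁ z)
      fieldX = trans (cong (λ i → update _≟ˡ_ (n ∷ []) a (ints s (20 + #fX)) (i ∷ [])) id≡)
        (trans (update-other _≟ˡ_ a (ints s (20 + #fX)) fresh) (field-X old))

      fieldY : hi (heap s₅) #fY (hi (heap s₅) #minId (1 ∷ location z) ∷ []) ≡ toℕ (proj₂ z)
      fieldY = trans (cong (λ i → update _≟ˡ_ (n ∷ []) b (ints s (20 + #fY)) (i ∷ [])) id≡)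
        (trans (update-other _≟ˡ_ b (ints s (20 + #fY)) fresh) (field-Y old))

      below′ : hi (heap s₅) #minId (1 ∷ location z) ℕ.< n + 1
      below′ = subst (ℕ._< n + 1) (sym id≡) (ℕ.<-trans (below old) n<n+1)

  registerMinsTime : ℕ
  registerMinsTime = forTime (int 0 []) (map (λ (_ : V) →
    forTime (int 1 []) (map (λ (_ : V′) → cost registerMinᴾ) (allFin size′))) (allFin size))

  registerMins-exec : ∀ {s} → ints s 0 [] ≡ size → ints s 1 [] ≡ size′ →
    Exec registerMinsᴾ s registerMinsTime (λ s′ → ∀ z → MinRegistered (heap s′) z)
  registerMins-exec {s} p₁ p₂ = exec-map (λ { _ M (x , x′) → M (∈-concatMap-allFin x (∈-concatMap-allFin x′ (here refl))) })
    (exec-for-fin (λ _ zs s → MinsRegistered zs (heap s)) (λ x → concatMap (λ x′ → (x , x′) ∷ []) (allFin size′)) refl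
      (λ F → scalar-frame F 0 refl p₁) (λ _ M {z} → M {z})
      (λ {x} {zs} F pi M → exec-for-fin (λ _ zs s → MinsRegistered zs (heap s)) (λ x′ → (x , x′) ∷ []) refl
        (λ F₁ → scalar-frame F₁ 1 refl (scalar-frame F 1 refl p₂))
        (λ _ M {z} → M {z})
        (λ {x′} {zs} F₁ pj M → registerMin-exec zs x x′ (scalar-frame F₁ #i refl pi) pj M)
        zs M)
      [] λ ())

  maxLocation : Vmax → List ℕ
  maxLocation = encodeMax G G′

  record MaxRegistered (H : Heap) (y : Vmax) : Set where
    field
      kind-1 : hi H #kind (hi H #maxId (maxLocation y) ∷ []) ≡ 1
      fields : hi H #fT (hi H #maxId (maxLocation y) ∷ []) ∷ hi H #fA (hi H #maxId (maxLocation y) ∷ [])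
               ∷ hi H #fC (hi H #maxId (maxLocation y) ∷ []) ∷ hi H #fR (hi H #maxId (maxLocation y) ∷ []) ∷ []
               ≡ maxLocation y
      below-next : hi H #maxId (maxLocation y) ℕ.< hi H #next []

  open MaxRegistered public

  -- All numbers of Vmin are below n₀, the value of `#next` after the registration of Vmin. There
  -- `#kind` keeps its initial 0, which is how a node of Vmin is recognised.
  record MaxsRegistered (n₀ : ℕ) (ys : List Vmax) (H : Heap) : Set where
    field
      grown      : n₀ ℕ.≤ hi H #next []
      kind-0     : ∀ i → i ℕ.< n₀ → hi H #kind (i ∷ []) ≡ 0
      registered : ∀ {y} → y ∈ ys → MaxRegistered H y

  open MaxsRegistered public

  registerMax-exec : ∀ {s} t n₀ ys y i j k → maxLocation y ≡ t ∷ i ∷ j ∷ k ∷ [] →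
    ints s #i [] ≡ i → ints s #j [] ≡ j → ints s #k [] ≡ k → MaxsRegistered n₀ ys (heap s) →
    Exec (registerMaxᴾ t) s (cost (registerMaxᴾ t)) (λ s′ → MaxsRegistered n₀ (ys ++ y ∷ []) (heap s′))
  registerMax-exec {s} t n₀ ys y i j k loc≡ refl refl refl M =
    exec-setInt-then (exec-setInt-then (exec-setInt-then (exec-setInt-then (exec-setInt-then (exec-setInt-then (exec-setInt
      (record { grown = ℕ.≤-trans (grown M) (ℕ.<⇒≤ n<n+1) ; kind-0 = kind-0′ ; registered = registered′ })))))))
    where
    n = ints s (20 + #next) []
    is = t ∷ i ∷ j ∷ k ∷ []
    s₁ = writeInt (20 + #maxId) is n s
    s₂ = writeInt (20 + #kind) (n ∷ []) 1 s₁
    s₃ = writeInt (20 + #fT) (n ∷ []) t s₂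
    s₄ = writeInt (20 + #fA) (n ∷ []) i s₃
    s₅ = writeInt (20 + #fC) (n ∷ []) j s₄
    s₆ = writeInt (20 + #fR) (n ∷ []) k s₅
    s₇ = writeInt (20 + #next) [] (n + 1) s₆

    n<n+1 : n ℕ.< n + 1
    n<n+1 = ℕ.≤-reflexive (ℕ.+-comm 1 n)

    kind-0′ : ∀ i → i ℕ.< n₀ → hi (heap s₇) #kind (i ∷ []) ≡ 0
    kind-0′ i i<n₀ = trans (update-other _≟ˡ_ 1 (ints s (20 + #kind))
      (singleton-≢ (ℕ.<⇒≢ (ℕ.<-≤-trans i<n₀ (grown M)) ∘ sym))) (kind-0 M i i<n₀)

    registered′ : ∀ {y₁} → y₁ ∈ ys ++ y ∷ [] → MaxRegistered (heap s₇) y₁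
    registered′ {y₁} y₁∈ = by-location (is ≟ˡ maxLocation y₁)
      where
      by-location : Dec (is ≡ maxLocation y₁) → MaxRegistered (heap s₇) y₁
      by-location (yes p) = record
        { kind-1 = trans (cong (λ i → hi (heap s₇) #kind (i ∷ [])) id≡) (update-same _≟ˡ_ (n ∷ []) 1 (ints s (20 + #kind)))
        ; fields = trans (cong (λ i → hi (heap s₇) #fT (i ∷ []) ∷ hi (heap s₇) #fA (i ∷ []) ∷ hi (heap s₇) #fC (i ∷ []) ∷ hi (heap s₇) #fR (i ∷ []) ∷ []) id≡)
            (trans (cong₂ _∷_ (update-same _≟ˡ_ (n ∷ []) t (ints s (20 + #fT)))
              (cong₂ _∷_ (update-same _≟ˡ_ (n ∷ []) i (ints s (20 + #fA)))
                (cong₂ _∷_ (update-same _≟ˡ_ (n ∷ []) j (ints s (20 + #fC)))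
                  (cong (_∷ []) (update-same _≟ˡ_ (n ∷ []) k (ints s (20 + #fR))))))) p)
        ; below-next = subst (ℕ._< n + 1) (sym id≡) n<n+1
        }
        where
        id≡ : hi (heap s₇) #maxId (maxLocation y₁) ≡ n
        id≡ = trans (cong (λ l → update _≟ˡ_ is n (ints s (20 + #maxId)) l) (sym p)) (update-same _≟ˡ_ is n (ints s (20 + #maxId)))
      by-location (no ne) = record
        { kind-1 = trans (cong (λ i → hi (heap s₇) #kind (i ∷ [])) id≡)
            (trans (update-other _≟ˡ_ 1 (ints s (20 + #kind)) fresh) (kind-1 old))
        ; fields = trans (cong (λ i → hi (heap s₇) #fT (i ∷ []) ∷ hi (heap s₇) #fA (i ∷ []) ∷ hi (heap s₇) #fC (i ∷ []) ∷ hi (heap s₇) #fR (i ∷ []) ∷ []) id≡)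
            (trans (cong₂ _∷_ (update-other _≟ˡ_ t (ints s (20 + #fT)) fresh)
              (cong₂ _∷_ (update-other _≟ˡ_ i (ints s (20 + #fA)) fresh)
                (cong₂ _∷_ (update-other _≟ˡ_ j (ints s (20 + #fC)) fresh)
                  (cong (_∷ []) (update-other _≟ˡ_ k (ints s (20 + #fR)) fresh))))) (fields old))
        ; below-next = subst (ℕ._< n + 1) (sym id≡) (ℕ.<-trans (below-next old) n<n+1)
        }
        where
        old : MaxRegistered (heap s) y₁
        old with ∈.∈-++⁻ ys y₁∈
        ... | inj₁ e = registered M e
        ... | inj₂ (here refl) = contradiction (sym loc≡) ne

        id≡ : hi (heap s₇) #maxId (maxLocation y₁) ≡ ints s (20 + #maxId) (maxLocation y₁)
        id≡ = update-other _≟ˡ_ n (ints s (20 + #maxId)) ne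

        fresh : _≢_ {A = List ℕ} (n ∷ []) (ints s (20 + #maxId) (maxLocation y₁) ∷ [])
        fresh = singleton-≢ (ℕ.<⇒≢ (below-next old) ∘ sym)

  module _ (S : Side) where

    open Side S

    registerMaxsTime : (t #na #nb : ℕ) → ℕ
    registerMaxsTime t #na #nb = forTime (int #na []) (map (λ (_ : Fin na) →
      forTime (int #nb []) (map (λ (_ : Fin nb) →
        forTime (int 3 []) (map (λ (_ : Fin σE) → cost (registerMaxᴾ t)) (allFin σE))) (allFin nb))) (allFin na))

    sideMaxs : List Vmax
    sideMaxs = concatMap (λ x → concatMap (λ w → concatMap (λ r → mkMax x w r ∷ []) (allFin σE)) (allFin nb)) (allFin na)

    registerMaxs-exec : ∀ {s} t #na #nb n₀ ys →
      (∀ x w r → maxLocation (mkMax x w r) ≡ t ∷ toℕ x ∷ toℕ w ∷ toℕ r ∷ []) →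
      writesInt (registerMaxsᴾ t #na #nb) #na ≡ false → writesInt (registerMaxsᴾ t #na #nb) #nb ≡ false →
      ints s #na [] ≡ na → ints s #nb [] ≡ nb → ints s 3 [] ≡ σE → MaxsRegistered n₀ ys (heap s) →
      Exec (registerMaxsᴾ t #na #nb) s (registerMaxsTime t #na #nb) (λ s′ → MaxsRegistered n₀ (ys ++ sideMaxs) (heap s′))
    registerMaxs-exec {s} t #na #nb n₀ ys loc≡ ∉na ∉nb pa pb pσ M =
      exec-for-fin (λ _ ys s → MaxsRegistered n₀ ys (heap s)) _ refl
        (λ F → scalar-frame F #na ∉na pa) (λ _ M → M)
        (λ {x} {ys} F pi M → exec-for-fin (λ _ ys s → MaxsRegistered n₀ ys (heap s)) _ refl
          (λ F₁ → scalar-frame F₁ #nb (inner₁ ∉nb) (scalar-frame F #nb ∉nb pb)) (λ _ M → M)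
          (λ {w} {ys} F₁ pj M → exec-for-fin (λ _ ys s → MaxsRegistered n₀ ys (heap s)) _ refl
            (λ F₂ → trans (cong (λ f → f []) (int-frame F₂ 3 refl))
              (scalar-frame F₁ 3 refl (scalar-frame F 3 refl pσ))) (λ _ M → M)
            (λ {r} {ys} F₂ pk M → registerMax-exec t n₀ ys (mkMax x w r) _ _ _ (loc≡ x w r)
              (scalar-frame F₂ #i refl (scalar-frame F₁ #i refl pi))
              (scalar-frame F₂ #j refl pj) pk M)
            ys M) ys M) ys M
      where
      inner₁ : writesInt (registerMaxsᴾ t #na #nb) #nb ≡ false →
               writesInt (for #j (int #nb []) (for #k (int 3 []) (registerMaxᴾ t))) #nb ≡ false
      inner₁ p = proj₁ (or-false (writesInt (for #j (int #nb []) (for #k (int 3 []) (registerMaxᴾ t))) #nb)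
        (proj₂ (or-false (does (#i ℕ.≟ #nb)) p)))

-- Adjacency lists and the table of classes

at-list-cong : ∀ {a} {A : Set a} {f g : ℕ → A} m xs → (∀ k → k ℕ.< m + length xs → g k ≡ f k) → at-list f m xs → at-list g m xs
at-list-cong m [] eq _ = Level.lift tt
at-list-cong m (x ∷ xs) eq (p , ps) = trans (eq m (ℕ.m<m+n m (s≤s z≤n))) p ,
  at-list-cong (suc m) xs (λ k k< → eq k (subst (k ℕ.<_) (sym (ℕ.+-suc m (length xs))) k<)) ps

at-list-snoc : ∀ {a} {A : Set a} {f : ℕ → A} m xs {x} → at-list f m xs → f (m + length xs) ≡ x → at-list f m (xs ++ x ∷ [])
at-list-snoc {f = f} m [] _ p = trans (cong f (sym (ℕ.+-identityʳ m))) p , Level.lift tt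
at-list-snoc {f = f} m (x ∷ xs) (q , qs) p = q , at-list-snoc (suc m) xs qs (trans (cong f (sym (ℕ.+-suc m (length xs)))) p)

arcᴾ countᴾ appendᴾ openᴾ : Program
arcᴾ =
  store #adj (reg #o ∷ mem #deg (reg #o ∷ []) ∷ []) (reg #y) ⨾
  setVal #adjV (reg #o ∷ mem #deg (reg #o ∷ []) ∷ []) (val #v []) ⨾
  store #deg (reg #o ∷ []) (mem #deg (reg #o ∷ []) ⊕ lit 1)
countᴾ = store #count (reg #y ∷ []) (mem #count (reg #y ∷ []) ⊕ lit 1)
appendᴾ =
  store #payA (mem #row [] ∷ reg #col ∷ mem #plen (mem #row [] ∷ reg #col ∷ []) ∷ []) (reg #y) ⨾
  store #payB (mem #row [] ∷ reg #col ∷ mem #plen (mem #row [] ∷ reg #col ∷ []) ∷ []) (reg #q) ⨾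
  store #plen (mem #row [] ∷ reg #col ∷ []) (mem #plen (mem #row [] ∷ reg #col ∷ []) ⊕ lit 1)
openᴾ =
  store #alive (mem #row [] ∷ reg #col ∷ []) (lit 1) ⨾
  store #plen (mem #row [] ∷ reg #col ∷ []) (lit 0) ⨾
  setVal #key (mem #row [] ∷ reg #col ∷ []) (val #v [])

module Building {c ℓ₁ ℓ₂} (𝕀 : BoundedChain c ℓ₁ ℓ₂) {σV σE : ℕ} (G G′ : Gödel.FuzzyGraph 𝕀 σV σE)
                (minTable maxTable : List ℕ → ℕ) where

  open BoundedChain 𝕀 using (Carrier; _≈_; module Eq)
  open Semantics 𝕀
  open FuzzyGraph G
  open FuzzyGraph G′ renaming (V to V′; E to E′; L to L′; size to size′)
    hiding (nonEmpty)
  open MinimaxNet (net G G′) using (Vmin; Vmax)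
  open MarkingAlgorithm (net G G′)
  open NetLists 𝕀 G G′
  open Registration 𝕀 G G′
  open MainLoop 𝕀 (net G G′)

  -- Read off the arrays that the registration leaves behind; `minTable` and `maxTable` are their
  -- contents at that moment. For Vmin the copy with tag 1 is the official one.
  numbering : Numbering
  numbering = record
    { code  = encode G G′
    ; loc   = location
    ; idMin = λ z → minTable (1 ∷ location z)
    ; idMax = λ y → maxTable (maxLocation y)
    ; code-minNode = λ _ → refl
    ; code-edge    = λ _ _ → refl
    ; loc-injective = location-injective
    ; code-max-injective = code-max-injective
    }
    where
    code-max-injective : ∀ {y z} → encode G G′ (maxNode y) ≡ encode G G′ (maxNode z) → y ≡ z
    code-max-injective {inj₁ (x , y , r)} {inj₁ (x₁ , y₁ , r₁)} p =
      let q = proj₂ (List.∷-injective p) ; q₁ = proj₂ (List.∷-injective q) ; q₂ = proj₂ (List.∷-injective q₁) in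
      cong inj₁ (cong₂ _,_ (Fin.toℕ-injective (proj₁ (List.∷-injective q)))
        (cong₂ _,_ (Fin.toℕ-injective (proj₁ (List.∷-injective q₁))) (Fin.toℕ-injective (proj₁ (List.∷-injective q₂)))))
    code-max-injective {inj₂ (x , y , r)} {inj₂ (x₁ , y₁ , r₁)} p =
      let q = proj₂ (List.∷-injective p) ; q₁ = proj₂ (List.∷-injective q) ; q₂ = proj₂ (List.∷-injective q₁) in
      cong inj₂ (cong₂ _,_ (Fin.toℕ-injective (proj₁ (List.∷-injective q)))
        (cong₂ _,_ (Fin.toℕ-injective (proj₁ (List.∷-injective q₁))) (Fin.toℕ-injective (proj₁ (List.∷-injective q₂)))))
    code-max-injective {inj₁ _} {inj₂ _} ()
    code-max-injective {inj₂ _} {inj₁ _} ()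

  open Numbering numbering public using (idMin; idMax)

  Source : Set c
  Source = (ℕ × ℕ) × List (Object × Carrier)

  -- Stated for every number p, whether or not it belongs to a node, so that a write leads only to a
  -- comparison of two numbers.
  record Outs (H : Heap) (as : List Arc) : Set c where
    field
      deg-r  : ∀ p → hi H #deg (p ∷ []) ≡ length (outs p as)
      adj-r  : ∀ p → at-list (λ k → hi H #adj (p ∷ k ∷ [])) 0 (outs p as)
      adjV-r : ∀ p → at-list (λ k → hv H #adjV (p ∷ k ∷ [])) 0 (outWeights p as)

  open Outs public

  Ins : Heap → List Arc → Set
  Ins H as = ∀ q → hi H #count (q ∷ []) ≡ length (ins q as)

  arced : State → State
  arced s = let o = ints s #o [] ; d = ints s (20 + #deg) (o ∷ []) in
    writeInt (20 + #deg) (o ∷ []) (d + 1)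
      (writeVal #adjV (o ∷ d ∷ []) (vals s #v []) (writeInt (20 + #adj) (o ∷ d ∷ []) (ints s #y []) s))

  arc⇓ : ∀ {s} → ⟨ arcᴾ , s ⟩⇓[ cost arcᴾ ] arced s
  arc⇓ = seq⇓ setInt⇓ (seq⇓ setVal⇓ setInt⇓)

  length-outWeights : ∀ p as → length (outWeights p as) ≡ length (outs p as)
  length-outWeights p [] = refl
  length-outWeights p (a ∷ as) with does (from a ℕ.≟ p)
  ... | true  = cong suc (length-outWeights p as)
  ... | false = length-outWeights p as

  -- The conditional hypotheses let one statement cover the row that is extended and all rows that
  -- are not.
  append-row : ∀ {a} {A : Set a} {f : List ℕ → A} p n {b} p₁ xs xs₁ →
               (p ≡ p₁ → length xs ≡ n) → (p ≡ p₁ → xs₁ ≡ xs ++ b ∷ []) → (p ≢ p₁ → xs₁ ≡ xs) →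
               at-list (λ k → f (p₁ ∷ k ∷ [])) 0 xs →
               at-list (λ k → update _≟ˡ_ (p ∷ n ∷ []) b f (p₁ ∷ k ∷ [])) 0 xs₁
  append-row {f = f} p n {b} p₁ xs xs₁ len same other at with p ℕ.≟ p₁
  ... | yes refl rewrite same refl | sym (len refl) = at-list-snoc 0 xs
        (at-list-cong 0 xs (λ k k<n → update-other _≟ˡ_ {p ∷ length xs ∷ []} {p ∷ k ∷ []} b f λ q →
          ℕ.<⇒≢ k<n (sym (proj₁ (List.∷-injective (proj₂ (List.∷-injective q)))))) at)
        (update-same _≟ˡ_ (p ∷ length xs ∷ []) b f)
  ... | no ne rewrite other ne = at-list-cong 0 xs
        (λ k _ → update-other _≟ˡ_ {p ∷ n ∷ []} {p₁ ∷ k ∷ []} b f λ q → ne (proj₁ (List.∷-injective q))) at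

  outs-snoc-same : ∀ {b} {B : Set b} (h : Arc → B) as a →
    concatMap (λ a₁ → when (does (from a₁ ℕ.≟ from a)) (h a₁ ∷ [])) (as ++ a ∷ []) ≡
    concatMap (λ a₁ → when (does (from a₁ ℕ.≟ from a)) (h a₁ ∷ [])) as ++ h a ∷ []
  outs-snoc-same h as a = trans (List.concatMap-++ _ as (a ∷ []))
    (cong (concatMap (λ a₁ → when (does (from a₁ ℕ.≟ from a)) (h a₁ ∷ [])) as ++_)
      (trans (List.++-identityʳ _) (cong (λ b → when b (h a ∷ [])) (dec-true (from a ℕ.≟ from a) refl))))

  outs-snoc-other : ∀ {b} {B : Set b} (h : Arc → B) as a {p} → from a ≢ p →
    concatMap (λ a₁ → when (does (from a₁ ℕ.≟ p)) (h a₁ ∷ [])) (as ++ a ∷ []) ≡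
    concatMap (λ a₁ → when (does (from a₁ ℕ.≟ p)) (h a₁ ∷ [])) as
  outs-snoc-other h as a {p} ne = trans (List.concatMap-++ _ as (a ∷ []))
    (trans (cong (concatMap (λ a₁ → when (does (from a₁ ℕ.≟ p)) (h a₁ ∷ [])) as ++_)
      (trans (List.++-identityʳ _) (cong (λ b → when b (h a ∷ [])) (dec-false (from a ℕ.≟ p) ne))))
      (List.++-identityʳ _))

  arced-outs : ∀ {s as} a → Outs (heap s) as → ints s #o [] ≡ from a → ints s #y [] ≡ to a → vals s #v [] ≡ Arc.weight a →
               Outs (heap (arced s)) (as ++ a ∷ [])
  arced-outs {s} {as} a@(arc _ _ _ _) O refl refl refl = record
    { deg-r  = degree
    ; adj-r  = λ p → append-row {f = ints s (20 + #adj)} o d p (outs p as) (outs p (as ++ a ∷ []))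
        (λ { refl → sym (deg-r O p) }) (λ { refl → outs-snoc-same to as a }) (outs-snoc-other to as a) (adj-r O p)
    ; adjV-r = λ p → append-row {f = vals s #adjV} o d p (outWeights p as) (outWeights p (as ++ a ∷ []))
        (λ { refl → trans (length-outWeights p as) (sym (deg-r O p)) })
        (λ { refl → outs-snoc-same Arc.weight as a }) (outs-snoc-other Arc.weight as a) (adjV-r O p)
    }
    where
    o = ints s #o []
    d = ints s (20 + #deg) (o ∷ [])

    degree : ∀ p → update _≟ˡ_ (o ∷ []) (d + 1) (ints s (20 + #deg)) (p ∷ []) ≡ length (outs p (as ++ a ∷ []))
    degree p with o ℕ.≟ p
    ... | yes refl = trans (update-same _≟ˡ_ (o ∷ []) (d + 1) (ints s (20 + #deg)))
          (trans (cong (_+ 1) (deg-r O o)) (trans (sym (List.length-++ (outs o as))) (cong length (sym (outs-snoc-same to as a)))))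
    ... | no ne = trans (update-other _≟ˡ_ (d + 1) (ints s (20 + #deg)) (singleton-≢ ne))
          (trans (deg-r O p) (cong length (sym (outs-snoc-other to as a ne))))

  counted⁺ : State → State
  counted⁺ s = writeInt (20 + #count) (ints s #y [] ∷ []) (ints s (20 + #count) (ints s #y [] ∷ []) + 1) s

  ins-snoc : ∀ q as a → ins q (as ++ a ∷ []) ≡ ins q as ++ when (up a ∧ does (to a ℕ.≟ q)) (a ∷ [])
  ins-snoc q as a = trans (List.concatMap-++ _ as (a ∷ [])) (cong (ins q as ++_) (List.++-identityʳ _))

  counted-ins : ∀ {s as} p w → Ins (heap s) as → Ins (heap (counted⁺ s)) (as ++ arc p (ints s #y []) w true ∷ [])
  counted-ins {s} {as} p w I q with ints s #y [] ℕ.≟ q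
  ... | yes refl = trans (update-same _≟ˡ_ (ints s #y [] ∷ []) _ (ints s (20 + #count)))
        (trans (cong (_+ 1) (I q)) (sym (trans (cong length (trans (ins-snoc q as a)
          (cong (λ b → ins q as ++ when b (a ∷ [])) (dec-true (q ℕ.≟ q) refl)))) (List.length-++ (ins q as)))))
    where a = arc p (ints s #y []) w true
  ... | no ne = trans (update-other _≟ˡ_ _ (ints s (20 + #count)) (singleton-≢ ne))
        (trans (I q) (sym (cong length (trans (ins-snoc q as a)
          (trans (cong (λ b → ins q as ++ when b (a ∷ [])) (dec-false (ints s #y [] ℕ.≟ q) ne)) (List.++-identityʳ _))))))
    where a = arc p (ints s #y []) w true

  uncounted-ins : ∀ {H as} p q w → Ins H as → Ins H (as ++ arc p q w false ∷ [])
  uncounted-ins {as = as} p q w I q₁ = trans (I q₁) (cong length (sym (trans (ins-snoc q₁ as (arc p q w false)) (List.++-identityʳ _))))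

  record SourceHeap : Set c where
    field
      alive plen payA payB : List ℕ → ℕ
      key : List ℕ → Carrier

  sourceHeap : State → SourceHeap
  sourceHeap s = record
    { alive = ints s (20 + #alive) ; plen = ints s (20 + #plen) ; payA = ints s (20 + #payA)
    ; payB = ints s (20 + #payB) ; key = vals s #key }

  open SourceHeap

  record SourceStored (H : SourceHeap) (src : Source) : Set (c ⊔ ℓ₁) where
    private
      i = proj₁ (proj₁ src)
      j = proj₂ (proj₁ src)
    field
      alive-r : 1 ℕ.≤ alive H (i ∷ j ∷ [])
      plen-r  : plen H (i ∷ j ∷ []) ≡ length (proj₂ src)
      payA-r  : at-list (λ k → payA H (i ∷ j ∷ k ∷ [])) 0 (map (codeA numbering ∘ proj₁) (proj₂ src))
      payB-r  : at-list (λ k → payB H (i ∷ j ∷ k ∷ [])) 0 (map (codeB numbering ∘ proj₁) (proj₂ src))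
      key-r   : All (λ (_ , k) → k ≈ key H (i ∷ j ∷ [])) (proj₂ src)

  open SourceStored public

  record Stored (H : SourceHeap) (F : List Source) : Set (c ⊔ ℓ₁) where
    field
      alive⇒   : ∀ {i j} → 1 ℕ.≤ alive H (i ∷ j ∷ []) → (i , j) ∈ map proj₁ F
      each     : All (SourceStored H) F
      distinct : Unique (map proj₁ F)

  open Stored public

  appended : State → State
  appended s = let r = ints s (20 + #row) [] ; j = ints s #col [] ; n = ints s (20 + #plen) (r ∷ j ∷ []) in
    writeInt (20 + #plen) (r ∷ j ∷ []) (n + 1)
      (writeInt (20 + #payB) (r ∷ j ∷ n ∷ []) (ints s #q []) (writeInt (20 + #payA) (r ∷ j ∷ n ∷ []) (ints s #y []) s))

  append⇓ : ∀ {s} → ⟨ appendᴾ , s ⟩⇓[ cost appendᴾ ] appended s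
  append⇓ = seq⇓ setInt⇓ (seq⇓ setInt⇓ setInt⇓)

  pair-≢ : ∀ {i j i₁ j₁ : ℕ} → (i , j) ≢ (i₁ , j₁) → _≢_ {A = List ℕ} (i ∷ j ∷ []) (i₁ ∷ j₁ ∷ [])
  pair-≢ ne refl = ne refl

  triple-≢ : ∀ {i j k i₁ j₁ k₁ : ℕ} → (i , j) ≢ (i₁ , j₁) → _≢_ {A = List ℕ} (i ∷ j ∷ k ∷ []) (i₁ ∷ j₁ ∷ k₁ ∷ [])
  triple-≢ ne refl = ne refl

  -- A write whose indices begin with (r , j) misses every class at another position; it remains to
  -- know that all positions in F are different.
  others : ∀ {H H′ : SourceHeap} {r j} F →
    (∀ {i₁ j₁} → (r , j) ≢ (i₁ , j₁) → alive H′ (i₁ ∷ j₁ ∷ []) ≡ alive H (i₁ ∷ j₁ ∷ [])) →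
    (∀ {i₁ j₁} → (r , j) ≢ (i₁ , j₁) → plen H′ (i₁ ∷ j₁ ∷ []) ≡ plen H (i₁ ∷ j₁ ∷ [])) →
    (∀ {i₁ j₁ k} → (r , j) ≢ (i₁ , j₁) → payA H′ (i₁ ∷ j₁ ∷ k ∷ []) ≡ payA H (i₁ ∷ j₁ ∷ k ∷ [])) →
    (∀ {i₁ j₁ k} → (r , j) ≢ (i₁ , j₁) → payB H′ (i₁ ∷ j₁ ∷ k ∷ []) ≡ payB H (i₁ ∷ j₁ ∷ k ∷ [])) →
    (∀ {i₁ j₁} → (r , j) ≢ (i₁ , j₁) → key H′ (i₁ ∷ j₁ ∷ []) ≡ key H (i₁ ∷ j₁ ∷ [])) →
    All ((r , j) ≢_) (map proj₁ F) → All (SourceStored H) F → All (SourceStored H′) F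
  others [] al pl pA pB ky [] [] = []
  others (((i , j) , es) ∷ F) al pl pA pB ky (ne ∷ nes) (S ∷ Ss) = record
    { alive-r = subst (1 ℕ.≤_) (sym (al ne)) (alive-r S)
    ; plen-r  = trans (pl ne) (plen-r S)
    ; payA-r  = at-list-cong 0 (map (codeA numbering ∘ proj₁) es) (λ k _ → pA ne) (payA-r S)
    ; payB-r  = at-list-cong 0 (map (codeB numbering ∘ proj₁) es) (λ k _ → pB ne) (payB-r S)
    ; key-r   = subst (λ v → All (λ (_ , k) → k ≈ v) es) (sym (ky ne)) (key-r S)
    } ∷ others F al pl pA pB ky nes Ss

  append-payload : ∀ {A : Set} {f : List ℕ → A} r j n {b} xs {b₁} → length xs ≡ n → b ≡ b₁ →
                   at-list (λ k → f (r ∷ j ∷ k ∷ [])) 0 xs →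
                   at-list (λ k → update _≟ˡ_ (r ∷ j ∷ n ∷ []) b f (r ∷ j ∷ k ∷ [])) 0 (xs ++ b₁ ∷ [])
  append-payload {f = f} r j n {b} xs refl refl at = at-list-snoc 0 xs
    (at-list-cong 0 xs (λ k k<n → update-other _≟ˡ_ {r ∷ j ∷ length xs ∷ []} {r ∷ j ∷ k ∷ []} b f λ q →
      ℕ.<⇒≢ k<n (sym (proj₁ (List.∷-injective (proj₂ (List.∷-injective (proj₂ (List.∷-injective q)))))))) at)
    (update-same _≟ˡ_ (r ∷ j ∷ length xs ∷ []) b f)

  appended-stored : ∀ {s es F} r j o {k} → Stored (sourceHeap s) (((r , j) , es) ∷ F) →
    ints s (20 + #row) [] ≡ r → ints s #col [] ≡ j →
    ints s #y [] ≡ codeA numbering o → ints s #q [] ≡ codeB numbering o → k ≈ vals s #key (r ∷ j ∷ []) →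
    Stored (sourceHeap (appended s)) (((r , j) , es ++ (o , k) ∷ []) ∷ F)
  appended-stored {s} {es} {F} r j o {k} St refl refl py pq k≈ with each St | distinct St
  ... | S ∷ Ss | ne ∷ u = record
    { alive⇒   = alive⇒ St
    ; each     = record
      { alive-r = alive-r S
      ; plen-r  = trans (update-same _≟ˡ_ (r ∷ j ∷ []) (n + 1) (ints s (20 + #plen)))
          (trans (cong (_+ 1) (plen-r S)) (sym (List.length-++ es)))
      ; payA-r  = subst (at-list (λ k → update _≟ˡ_ (r ∷ j ∷ n ∷ []) (ints s #y []) (ints s (20 + #payA)) (r ∷ j ∷ k ∷ [])) 0)
          (sym (List.map-++ (codeA numbering ∘ proj₁) es ((o , k) ∷ [])))
          (append-payload {f = ints s (20 + #payA)} r j n (map (codeA numbering ∘ proj₁) es)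
            (trans (List.length-map (codeA numbering ∘ proj₁) es) (sym (plen-r S))) py (payA-r S))
      ; payB-r  = subst (at-list (λ k → update _≟ˡ_ (r ∷ j ∷ n ∷ []) (ints s #q []) (ints s (20 + #payB)) (r ∷ j ∷ k ∷ [])) 0)
          (sym (List.map-++ (codeB numbering ∘ proj₁) es ((o , k) ∷ [])))
          (append-payload {f = ints s (20 + #payB)} r j n (map (codeB numbering ∘ proj₁) es)
            (trans (List.length-map (codeB numbering ∘ proj₁) es) (sym (plen-r S))) pq (payB-r S))
      ; key-r   = All.++⁺ (key-r S) (k≈ ∷ [])
      } ∷ others F (λ _ → refl)
            (λ ne → update-other _≟ˡ_ (n + 1) (ints s (20 + #plen)) (pair-≢ ne))
            (λ ne → update-other _≟ˡ_ (ints s #y []) (ints s (20 + #payA)) (triple-≢ {k = n} ne))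
            (λ ne → update-other _≟ˡ_ (ints s #q []) (ints s (20 + #payB)) (triple-≢ {k = n} ne))
            (λ _ → refl) ne Ss
    ; distinct = ne ∷ u
    }
    where
    n = ints s (20 + #plen) (r ∷ j ∷ [])

  opened : State → State
  opened s = let is = ints s (20 + #row) [] ∷ ints s #col [] ∷ [] in
    writeVal #key is (vals s #v []) (writeInt (20 + #plen) is 0 (writeInt (20 + #alive) is 1 s))

  open⇓ : ∀ {s} → ⟨ openᴾ , s ⟩⇓[ cost openᴾ ] opened s
  open⇓ = seq⇓ setInt⇓ (seq⇓ setInt⇓ setVal⇓)

  opened-stored : ∀ {s F} r j → Stored (sourceHeap s) F → ints s (20 + #row) [] ≡ r → ints s #col [] ≡ j →
                  All ((r , j) ≢_) (map proj₁ F) → Stored (sourceHeap (opened s)) (((r , j) , []) ∷ F)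
  opened-stored {s} {F} r j St refl refl new = record
    { alive⇒   = alive′
    ; each     = record
      { alive-r = subst (1 ℕ.≤_) (sym (update-same _≟ˡ_ (r ∷ j ∷ []) 1 (ints s (20 + #alive)))) (s≤s z≤n)
      ; plen-r  = update-same _≟ˡ_ (r ∷ j ∷ []) 0 (ints s (20 + #plen))
      ; payA-r  = Level.lift tt
      ; payB-r  = Level.lift tt
      ; key-r   = []
      } ∷ others F
            (λ ne → update-other _≟ˡ_ 1 (ints s (20 + #alive)) (pair-≢ ne))
            (λ ne → update-other _≟ˡ_ 0 (ints s (20 + #plen)) (pair-≢ ne))
            (λ _ → refl) (λ _ → refl)
            (λ ne → update-other _≟ˡ_ (vals s #v []) (vals s #key) (pair-≢ ne)) new (each St)
    ; distinct = new ∷ distinct St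
    }
    where
    alive′ : ∀ {i₁ j₁} → 1 ℕ.≤ update _≟ˡ_ (r ∷ j ∷ []) 1 (ints s (20 + #alive)) (i₁ ∷ j₁ ∷ []) → (i₁ , j₁) ∈ (r , j) ∷ map proj₁ F
    alive′ {i₁} {j₁} a with Prod.≡-dec ℕ._≟_ ℕ._≟_ (r , j) (i₁ , j₁)
    ... | yes refl = here refl
    ... | no ne = there (alive⇒ St (subst (1 ℕ.≤_) (update-other _≟ˡ_ 1 (ints s (20 + #alive)) (pair-≢ ne)) a))

  opened-key : ∀ {s} r j → ints s (20 + #row) [] ≡ r → ints s #col [] ≡ j →
               vals (opened s) #key (r ∷ j ∷ []) ≡ vals s #v []
  opened-key {s} r j refl refl = update-same _≟ˡ_ (r ∷ j ∷ []) (vals s #v []) (vals s #key)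

-- Traversal of the edges of a graph

pairᴾ : (t t′ : ℕ) → Program
pairᴾ t t′ =
  put #o (mem #minId (lit t ∷ reg #k ∷ reg #l ∷ [])) ⨾
  put #y (mem #maxId (lit t ∷ reg #i ∷ reg #l ∷ reg #j ∷ [])) ⨾
  arcᴾ ⨾ countᴾ ⨾
  put #q (reg #y ⊕ lit 1) ⨾ put #y (reg #o) ⨾ appendᴾ ⨾
  put #o (mem #maxId (lit t′ ∷ reg #l ∷ reg #k ∷ reg #j ∷ [])) ⨾
  put #y (mem #minId (lit t ∷ reg #i ∷ reg #l ∷ [])) ⨾
  arcᴾ

-- The table of classes gets one row for each pair (x , r), with y as the column. `#row` runs on
-- through the second graph and then through the labels.
edgeStepᴾ rowᴾ edgesᴾ : (t t′ na nb e : ℕ) → Program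
edgeStepᴾ t t′ na nb e =
  setVal #v [] (val e (reg #i ∷ reg #j ∷ reg #k ∷ [])) ⨾
  ifte (val #v [] ≤ᵛ zeroᵥ) skip (put #col (reg #k) ⨾ openᴾ ⨾ for #l (int nb []) (pairᴾ t t′))
rowᴾ t t′ na nb e = for #k (int na []) (edgeStepᴾ t t′ na nb e) ⨾ store #row [] (mem #row [] ⊕ lit 1)
edgesᴾ t t′ na nb e = for #i (int na []) (for #j (int 3 []) (rowᴾ t t′ na nb e))

module Edges {c ℓ₁ ℓ₂} (𝕀 : BoundedChain c ℓ₁ ℓ₂) {σV σE : ℕ} (G G′ : Gödel.FuzzyGraph 𝕀 σV σE)
             (minTable maxTable : List ℕ → ℕ) where

  open BoundedChain 𝕀 using (Carrier; _≈_; _≤?_; 𝟎; module Eq)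
  open Semantics 𝕀
  open MinimaxNet (net G G′) using (Vmin; Vmax)
  open MarkingAlgorithm (net G G′)
  open NetLists 𝕀 G G′
  open NetQueue 𝕀 G G′ using (module Entries)
  open Registration 𝕀 G G′
  open MainLoop 𝕀 (net G G′)
  open Building 𝕀 G G′ minTable maxTable

  -- One width for all rows: a row of edges has `size` or `size′` columns, a row of labels σV + 1.
  width : ℕ
  width = FuzzyGraph.size G + FuzzyGraph.size G′ + σV + 1

  -- The table is filled in lexicographic order, so a new position differs from all earlier ones.
  Before : ℕ → ℕ → Source → Set
  Before R m ((i , j) , _) = (i ℕ.< R ⊎ (i ≡ R × j ℕ.< m)) × j ℕ.< width

  -- `as` and `es` are the arcs and the queue entries so far, n is the number of sources,
  -- which precede position (R , m) of the table of sources.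
  record Progress (s : State) (as : List Arc) (es : List (Object × Carrier)) (n R m : ℕ) : Set (c ⊔ ℓ₁) where
    field
      {sources}  : List Source
      outs-r     : Outs (heap s) as
      ins-r      : Ins (heap s) as
      stored     : Stored (sourceHeap s) sources
      before     : All (Before R m) sources
      row-r      : hi (heap s) #row [] ≡ R
      entries-r  : concatMap proj₂ sources ↭ es
      number     : length sources ≡ n
      min-table  : hi (heap s) #minId ≡ minTable
      max-table  : hi (heap s) #maxId ≡ maxTable

  -- The counterpart of `Progress` while the class at (R , m) is being filled: it heads the list of
  -- classes and contains es so far.
  record Filling (s : State) (as : List Arc) (R m : ℕ) (es : List (Object × Carrier)) (F : List Source) (e : Carrier) : Set (c ⊔ ℓ₁) where
    field
      outs-f     : Outs (heap s) as
      ins-f      : Ins (heap s) as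
      stored-f   : Stored (sourceHeap s) (((R , m) , es) ∷ F)
      row-f      : hi (heap s) #row [] ≡ R
      key-f      : hv (heap s) #key (R ∷ m ∷ []) ≡ e
      min-table-f  : hi (heap s) #minId ≡ minTable
      max-table-f  : hi (heap s) #maxId ≡ maxTable

  open Progress public
  open Filling public

  next-row : ∀ {R m} {F : List Source} → All (Before R m) F → All (Before (suc R) 0) F
  next-row = All.map λ where
    (inj₁ p , q)        → inj₁ (ℕ.m<n⇒m<1+n p) , q
    (inj₂ (refl , p) , q) → inj₁ (ℕ.n<1+n _) , q

  next-column : ∀ {R m} {F : List Source} → All (Before R m) F → All (Before R (suc m)) F
  next-column = All.map λ where
    (inj₁ p , q)       → inj₁ p , q
    (inj₂ (e , p) , q) → inj₂ (e , ℕ.m<n⇒m<1+n p) , q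

  fresh-source : ∀ {R m} {F : List Source} → All (Before R m) F → All ((R , m) ≢_) (map proj₁ F)
  fresh-source [] = []
  fresh-source ((inj₁ p , _) ∷ ps) = (λ { refl → ℕ.<-irrefl refl p }) ∷ fresh-source ps
  fresh-source ((inj₂ (_ , p) , _) ∷ ps) = (λ { refl → ℕ.<-irrefl refl p }) ∷ fresh-source ps

  module _ (idMin-injective : ∀ {x z} → idMin x ≡ idMin z → x ≡ z)
           (idMax-injective : ∀ {x z} → idMax x ≡ idMax z → x ≡ z)
           (idMin≢idMax : ∀ {x z} → idMin x ≢ idMax z)
           (S : Side) (t t′ : ℕ)
           (min-index : ∀ u w → minTable (t ∷ toℕ u ∷ toℕ w ∷ []) ≡ idMin (Side.mkMin S u w))
           (max-index : ∀ x w r → maxTable (t ∷ toℕ x ∷ toℕ w ∷ toℕ r ∷ []) ≡ idMax (Side.mkMax S x w r))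
           (max′-index : ∀ w y r → maxTable (t′ ∷ toℕ w ∷ toℕ y ∷ toℕ r ∷ []) ≡ idMax (Side.mkMax′ S w y r))
           where

    open Side S
    open Arcs idMin idMax idMin-injective idMax-injective idMin≢idMax
    open SideArcs S
    open Entries S

    entry : Fin na → Fin σE → Fin na → Fin nb → Object × Carrier
    entry x r y w = edge (mkMin y w) (mkMax x w r) , edges x r y

    pair-exec : ∀ {s as R m es F} x r y w → Filling s as R m es F (edges x r y) →
      ints s #i [] ≡ toℕ x → ints s #j [] ≡ toℕ r → ints s #k [] ≡ toℕ y → ints s #l [] ≡ toℕ w → ints s #col [] ≡ m →
      vals s #v [] ≡ edges x r y →
      Exec (pairᴾ t t′) s (cost (pairᴾ t t′))
        (λ s′ → Filling s′ (as ++ pairArcs x r y w) R m (es ++ entry x r y w ∷ []) F (edges x r y))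
    pair-exec {s} {as} {R} {m} {es} {F} x r y w f pi pj pk pl pcol pv =
      exec-setInt-then (exec-setInt-then (exec-after arc⇓ ℕ.≤-refl (exec-setInt-then
        (exec-setInt-then (exec-setInt-then (exec-after append⇓ ℕ.≤-refl
          (exec-setInt-then (exec-setInt-then (executes arc⇓ ℕ.≤-refl (record
            { outs-f = subst (Outs (heap s₁₀)) (List.++-assoc as (a₁ ∷ []) (a₂ ∷ [])) outs₁₀
            ; ins-f = subst (Ins (heap s₁₀)) (List.++-assoc as (a₁ ∷ []) (a₂ ∷ []))
                (uncounted-ins {heap s₁₀} {as ++ a₁ ∷ []} (from a₂) (to a₂) (Arc.weight a₂) ins₄)
            ; stored-f = stored₇
            ; row-f = row-f f ; key-f = key-f f
            ; min-table-f = min-table-f f ; max-table-f = max-table-f f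
            }))))))))))
      where
      e = edges x r y
      a₁ = arc (idMin (mkMin y w)) (idMax (mkMax x w r)) e true
      a₂ = arc (idMax (mkMax′ w y r)) (idMin (mkMin x w)) e false

      s₁ = writeInt #o [] (ints s (20 + #minId) (t ∷ ints s #k [] ∷ ints s #l [] ∷ [])) s
      s₂ = writeInt #y [] (ints s (20 + #maxId) (t ∷ ints s #i [] ∷ ints s #l [] ∷ ints s #j [] ∷ [])) s₁
      s₃ = arced s₂
      s₄ = counted⁺ s₃
      s₅ = writeInt #q [] (ints s₄ #y [] + 1) s₄
      s₆ = writeInt #y [] (ints s₅ #o []) s₅
      s₇ = appended s₆
      s₈ = writeInt #o [] (ints s (20 + #maxId) (t′ ∷ ints s #l [] ∷ ints s #k [] ∷ ints s #j [] ∷ [])) s₇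
      s₉ = writeInt #y [] (ints s (20 + #minId) (t ∷ ints s #i [] ∷ ints s #l [] ∷ [])) s₈
      s₁₀ = arced s₉

      o₁ : ints s₂ #o [] ≡ idMin (mkMin y w)
      o₁ = trans (cong (λ f → f (t ∷ ints s #k [] ∷ ints s #l [] ∷ [])) (min-table-f f))
        (trans (cong₂ (λ a b → minTable (t ∷ a ∷ b ∷ [])) pk pl) (min-index y w))

      y₁ : ints s₂ #y [] ≡ idMax (mkMax x w r)
      y₁ = trans (cong (λ f → f (t ∷ ints s #i [] ∷ ints s #l [] ∷ ints s #j [] ∷ [])) (max-table-f f))
        (trans (cong (λ l → maxTable (t ∷ l)) (cong₂ _∷_ pi (cong₂ _∷_ pl (cong (_∷ []) pj)))) (max-index x w r))

      o₂ : ints s₉ #o [] ≡ idMax (mkMax′ w y r)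
      o₂ = trans (cong (λ f → f (t′ ∷ ints s #l [] ∷ ints s #k [] ∷ ints s #j [] ∷ [])) (max-table-f f))
        (trans (cong (λ l → maxTable (t′ ∷ l)) (cong₂ _∷_ pl (cong₂ _∷_ pk (cong (_∷ []) pj)))) (max′-index w y r))

      y₂ : ints s₉ #y [] ≡ idMin (mkMin x w)
      y₂ = trans (cong (λ f → f (t ∷ ints s #i [] ∷ ints s #l [] ∷ [])) (min-table-f f))
        (trans (cong₂ (λ a b → minTable (t ∷ a ∷ b ∷ [])) pi pl) (min-index x w))

      outs₃ : Outs (heap s₃) (as ++ a₁ ∷ [])
      outs₃ = arced-outs {s₂} a₁ (record { Outs (outs-f f) }) o₁ y₁ pv

      outs₁₀ : Outs (heap s₁₀) ((as ++ a₁ ∷ []) ++ a₂ ∷ [])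
      outs₁₀ = arced-outs {s₉} a₂ (record { Outs outs₃ }) o₂ y₂ pv

      ins₄ : Ins (heap s₄) (as ++ a₁ ∷ [])
      ins₄ = subst (λ q → Ins (heap s₄) (as ++ arc (from a₁) q e true ∷ [])) y₁
        (counted-ins {s₃} {as} (from a₁) e (ins-f f))

      stored₇ : Stored (sourceHeap s₇) (((R , m) , es ++ entry x r y w ∷ []) ∷ F)
      stored₇ = appended-stored {s₆} R m (edge (mkMin y w) (mkMax x w r)) (stored-f f)
        (row-f f) pcol o₁ (trans (ℕ.+-comm _ 1) (cong suc y₁)) (Eq.reflexive (sym (key-f f)))

    fillTime : ℕ → ℕ
    fillTime #nb = cost (put #col (reg #k)) + (cost openᴾ +
      forTime (int #nb []) (map (λ (_ : Fin nb) → cost (pairᴾ t t′)) (allFin nb)))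

    stepTime : (#nb #e : ℕ) → Fin na → Fin σE → Fin na → ℕ
    stepTime #nb #e x r y = cost (setVal #v [] (val #e (reg #i ∷ reg #j ∷ reg #k ∷ []))) +
      (testTime (val #v [] ≤ᵛ zeroᵥ) + (if positive (edges x r y) then fillTime #nb else 1))

    edgesTime : (#na #nb #e : ℕ) → ℕ
    edgesTime #na #nb #e = forTime (int #na []) (map (λ x → forTime (int 3 []) (map (λ r →
      forTime (int #na []) (map (stepTime #nb #e x r) (allFin na)) + cost (store #row [] (mem #row [] ⊕ lit 1))) (allFin σE))) (allFin na))

    Triple : Set
    Triple = Fin na × Fin σE × Fin na

    module _ (#na #nb #e : ℕ) (as₀ : List Arc) (es₀ : List (Object × Carrier)) (n₀ R₀ : ℕ) (na≤width : na ℕ.≤ width) where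

      step = edgeStepᴾ t t′ #na #nb #e

      At : State → ℕ → ℕ → List Triple → Set _
      At s R m pre = Progress s (as₀ ++ concatMap (λ (x , r , y) → edgeArcs x r y) pre)
        (es₀ ++ concatMap (λ (x , r , y) → edgeEntries x r y) pre) (n₀ + length pre) R m

      here-triple : Fin na → Fin σE → Fin na → List Triple
      here-triple x r y = when (positive (edges x r y)) ((x , r , y) ∷ [])

      step-exec : ∀ {s R pre} x r y → writesInt step #nb ≡ false → ints s #nb [] ≡ nb →
        vals s #e (toℕ x ∷ toℕ r ∷ toℕ y ∷ []) ≡ edges x r y →
        ints s #i [] ≡ toℕ x → ints s #j [] ≡ toℕ r → ints s #k [] ≡ toℕ y → At s R (toℕ y) pre →
        Exec step s (stepTime #nb #e x r y) (λ s′ → At s′ R (suc (toℕ y)) (pre ++ here-triple x r y))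
      step-exec {s} {R} {pre} x r y ∉nb pnb pe pi pj pk A = exec-setVal-then (by-sign (positive (edges x r y)) refl)
        where
        e = edges x r y
        s₁ = writeVal #v [] (vals s #e (ints s #i [] ∷ ints s #j [] ∷ ints s #k [] ∷ [])) s

        v≡ : vals s₁ #v [] ≡ e
        v≡ = trans (cong (vals s #e) (cong₂ _∷_ pi (cong₂ _∷_ pj (cong (_∷ []) pk)))) pe

        sign : not (test s₁ (val #v [] ≤ᵛ zeroᵥ)) ≡ positive e
        sign = cong (λ v → not (does (v ≤? 𝟎))) v≡

        not-true : ∀ {b} → not b ≡ true → b ≡ false
        not-true {false} _ = refl

        not-false : ∀ {b} → not b ≡ false → b ≡ true
        not-false {true} _ = refl

        skipped : At s R (suc (toℕ y)) pre
        skipped = record { Progress A ; before = next-column (before A) }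

        s₂ s₃ : State
        s₂ = writeInt #col [] (ints s₁ #k []) s₁
        s₃ = opened s₂

        pcol : ints s₂ #col [] ≡ toℕ y
        pcol = pk

        J : ℕ → List (Fin nb) → State → Set _
        J _ ws s′ = Filling s′ ((as₀ ++ concatMap (λ (x , r , y) → edgeArcs x r y) pre) ++ concatMap (pairArcs x r y) ws)
          R (toℕ y) (concatMap (λ w → entry x r y w ∷ []) ws) (sources A) e

        start : J 0 [] s₃
        start = record
          { outs-f = subst (Outs (heap s₃)) (sym (List.++-identityʳ _)) record { Outs (outs-r A) }
          ; ins-f = subst (Ins (heap s₃)) (sym (List.++-identityʳ (as₀ ++ concatMap (λ (x , r , y) → edgeArcs x r y) pre))) (ins-r A)
          ; stored-f = opened-stored {s₂} R (toℕ y) (stored A) (row-r A) pcol (fresh-source (before A))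
          ; row-f = row-r A
          ; key-f = trans (opened-key {s₂} R (toℕ y) (row-r A) pcol) v≡
          ; min-table-f = min-table A ; max-table-f = max-table A
          }

        filled : ∀ {s′} → J nb (allFin nb) s′ → At s′ R (suc (toℕ y)) (pre ++ (x , r , y) ∷ [])
        filled {s′} f = record
          { outs-r = subst (Outs (heap s′)) arcs≡ (outs-f f)
          ; ins-r = subst (Ins (heap s′)) arcs≡ (ins-f f)
          ; stored = stored-f f
          ; before = (inj₂ (refl , ℕ.n<1+n (toℕ y)) , ℕ.<-≤-trans (Fin.toℕ<n y) na≤width) ∷ next-column (before A)
          ; row-r = row-f f
          ; entries-r = ↭-trans (Perm.++⁺ˡ (edgeEntries x r y) (entries-r A))
              (↭-trans (Perm.++-comm (edgeEntries x r y) _) (↭-reflexive (snoc es₀ (λ (x , r , y) → edgeEntries x r y))))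
          ; number = trans (cong suc (number A)) (trans (sym (ℕ.+-suc n₀ (length pre)))
              (cong (n₀ +_) (trans (ℕ.+-comm 1 (length pre)) (sym (List.length-++ pre)))))
          ; min-table = min-table-f f ; max-table = max-table-f f
          }
          where
          snoc : ∀ {b} {B : Set b} (bs : List B) (h : Triple → List B) →
                 (bs ++ concatMap h pre) ++ h (x , r , y) ≡ bs ++ concatMap h (pre ++ (x , r , y) ∷ [])
          snoc bs h = trans (List.++-assoc bs (concatMap h pre) (h (x , r , y)))
            (cong (bs ++_) (sym (trans (List.concatMap-++ h pre ((x , r , y) ∷ [])) (cong (concatMap h pre ++_) (List.++-identityʳ _)))))

          arcs≡ = snoc as₀ (λ (x , r , y) → edgeArcs x r y)

        fill : Exec (put #col (reg #k) ⨾ openᴾ ⨾ for #l (int #nb []) (pairᴾ t t′)) s₁ (fillTime #nb)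
                 (λ s′ → At s′ R (suc (toℕ y)) (pre ++ (x , r , y) ∷ []))
        fill = exec-setInt-then (exec-after open⇓ ℕ.≤-refl (exec-map (λ {s′} _ f → filled (subst (λ ws → J nb ws s′) (List.concatMap-pure (allFin nb)) f))
          (exec-for-fin J (λ w → w ∷ []) refl
            (λ F → trans (cong (λ f → f []) (int-frame F #nb (∉fill ∉nb)))
              (scalar-frame (frame (open⇓ {s₂})) #nb (∉open ∉nb) (trans (∉col ∉nb) pnb)))
            (λ _ f → record { Filling f })
            (λ {w} {ws} {s′} F pl f → exec-map (λ _ → subst₂ (λ as es → Filling _ as R (toℕ y) es (sources A) e)
                (trans (List.++-assoc (as₀ ++ concatMap (λ (x , r , y) → edgeArcs x r y) pre) (concatMap (pairArcs x r y) ws) (pairArcs x r y w))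
                  (cong ((as₀ ++ concatMap (λ (x , r , y) → edgeArcs x r y) pre) ++_) (sym (trans (List.concatMap-++ (pairArcs x r y) ws (w ∷ []))
                    (cong (concatMap (pairArcs x r y) ws ++_) (List.++-identityʳ _))))))
                (sym (List.concatMap-++ (λ w → entry x r y w ∷ []) ws (w ∷ []))))
              (pair-exec x r y w f (at F #i refl refl pi) (at F #j refl refl pj) (at F #k refl refl pk) pl
                (scalar-frame F #col refl pcol)
                (trans (cong (λ f → f []) (val-frame F #v refl)) v≡)))
            [] start)))
          where
          at : ∀ {s′ n} → Frame (for #l (int #nb []) (pairᴾ t t′)) s₃ s′ → ∀ a → writesInt (for #l (int #nb []) (pairᴾ t t′)) a ≡ false →
               ints s₃ a [] ≡ ints s a [] → ints s a [] ≡ n → ints s′ a [] ≡ n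
          at F a p q r = scalar-frame F a p (trans q r)

          ∉rest : writesInt step #nb ≡ false → writesInt (openᴾ ⨾ for #l (int #nb []) (pairᴾ t t′)) #nb ≡ false
          ∉rest p = proj₂ (or-false (does (#col ℕ.≟ #nb)) p)

          ∉fill : writesInt step #nb ≡ false → writesInt (for #l (int #nb []) (pairᴾ t t′)) #nb ≡ false
          ∉fill p = proj₂ (or-false (writesInt openᴾ #nb) (∉rest p))

          ∉open : writesInt step #nb ≡ false → writesInt openᴾ #nb ≡ false
          ∉open p = proj₁ (or-false (writesInt openᴾ #nb) (∉rest p))

          ∉col : writesInt step #nb ≡ false → ints s₂ #nb [] ≡ ints s₁ #nb []
          ∉col p = cong (λ f → f []) (if-false {x = update _≟ˡ_ [] (ints s₁ #k []) (ints s₁ #col)} {ints s₁ #nb} (proj₁ (or-false (does (#col ℕ.≟ #nb)) p)))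

        by-sign : ∀ b → positive e ≡ b →
          Exec (ifte (val #v [] ≤ᵛ zeroᵥ) skip (put #col (reg #k) ⨾ openᴾ ⨾ for #l (int #nb []) (pairᴾ t t′))) s₁
            (testTime (val #v [] ≤ᵛ zeroᵥ) + (if positive e then fillTime #nb else 1))
            (λ s′ → At s′ R (suc (toℕ y)) (pre ++ here-triple x r y))
        by-sign true p = exec-if-false (not-true (trans sign p)) (exec-mono
          (ℕ.≤-reflexive (cong (λ b → if b then fillTime #nb else 1) (sym p)))
          (λ {s′} _ → subst (λ b → At s′ R (suc (toℕ y)) (pre ++ when b ((x , r , y) ∷ []))) (sym p)) fill)
        by-sign false p = exec-if-true (not-false (trans sign p)) (exec-mono
          (ℕ.≤-reflexive (cong (λ b → if b then fillTime #nb else 1) (sym p)))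
          (λ {s′} _ A → subst (λ b → At s′ R (suc (toℕ y)) (pre ++ when b ((x , r , y) ∷ []))) (sym p)
            (subst (At s′ R (suc (toℕ y))) (sym (List.++-identityʳ pre)) A))
          (exec-skip (record { Progress skipped ; outs-r = record { Outs (outs-r A) } ; stored = (stored A) })))

      triples : List Triple
      triples = overEdges (λ x r y → (x , r , y) ∷ [])

      edges-exec : ∀ {s} → writesInt (edgesᴾ t t′ #na #nb #e) #na ≡ false → writesInt (edgesᴾ t t′ #na #nb #e) #nb ≡ false →
        writesVal (edgesᴾ t t′ #na #nb #e) #e ≡ false → writesInt (edgesᴾ t t′ #na #nb #e) 3 ≡ false →
        ints s #na [] ≡ na → ints s #nb [] ≡ nb → ints s 3 [] ≡ σE →
        (∀ x r y → vals s #e (toℕ x ∷ toℕ r ∷ toℕ y ∷ []) ≡ edges x r y) → At s R₀ 0 [] →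
        Exec (edgesᴾ t t′ #na #nb #e) s (edgesTime #na #nb #e) (λ s′ → At s′ (R₀ + na * σE) 0 triples)
      edges-exec {s} ∉na ∉nb ∉e ∉3 pna pnb pσ pe A =
        exec-for-fin (λ k pre s → At s (R₀ + k * σE) 0 pre) over-x refl
          (λ F → scalar-frame F #na ∉na pna) (λ _ A → record { Progress A })
          (λ {x} {pre} {s₁} F pi A → exec-map
            (λ {s′} _ → subst (λ R → At s′ R 0 (pre ++ over-x x)) (trans (ℕ.+-assoc R₀ (toℕ x * σE) σE) (cong (R₀ +_) (ℕ.+-comm (toℕ x * σE) σE))))
            (exec-for-fin (λ k pre s → At s (R₀ + toℕ x * σE + k) 0 pre) (over-r x) refl
              (λ F₁ → scalar-frame F₁ 3 (∉j 3 ∉3) (scalar-frame F 3 ∉3 pσ))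
              (λ _ A → record { Progress A })
              (λ {r} {pre} {s₂} F₁ pj A → exec-seq
                (exec-for-fin (λ k pre s → At s (R₀ + toℕ x * σE + toℕ r) k pre) (here-triple x r) refl
                  (λ F₂ → trans (cong (λ f → f []) (int-frame F₂ #na (∉k #na ∉na)))
                    (scalar-frame F₁ #na (∉j #na ∉na) (scalar-frame F #na ∉na pna)))
                  (λ _ A → record { Progress A })
                  (λ {y} {pre} {s₃} F₂ pk A → step-exec {pre = pre} x r y (∉step #nb ∉nb)
                    (trans (cong (λ f → f []) (int-frame F₂ #nb (∉k #nb ∉nb)))
                      (scalar-frame F₁ #nb (∉j #nb ∉nb) (scalar-frame F #nb ∉nb pnb)))
                    (trans (cong (λ f → f (toℕ x ∷ toℕ r ∷ toℕ y ∷ [])) (trans (val-frame F₂ #e (∉eₖ ∉e)) (trans (val-frame F₁ #e (∉eⱼ ∉e)) (val-frame F #e ∉e))))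
                      (pe x r y))
                    (scalar-frame F₂ #i refl (scalar-frame F₁ #i refl pi))
                    (scalar-frame F₂ #j refl pj) pk A)
                  pre A)
                (λ {s₃} _ A → exec-setInt (record
                  { outs-r = record { Outs (outs-r A) } ; ins-r = ins-r A ; stored = (stored A)
                  ; before = subst (λ R → All (Before R 0) (sources A)) (sym (ℕ.+-suc (R₀ + toℕ x * σE) (toℕ r))) (next-row (before A))
                  ; row-r = trans (cong (_+ 1) (row-r A)) (trans (ℕ.+-comm _ 1) (sym (ℕ.+-suc (R₀ + toℕ x * σE) (toℕ r))))
                  ; entries-r = entries-r A ; number = number A ; min-table = min-table A ; max-table = max-table A
                  })))
              pre (subst (λ R → At s₁ R 0 pre) (sym (ℕ.+-identityʳ _)) A)))
          [] (subst (λ R → At s R 0 []) (sym (ℕ.+-identityʳ R₀)) A)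
        where
        over-r : Fin na → Fin σE → List Triple
        over-r x r = concatMap (here-triple x r) (allFin na)

        over-x : Fin na → List Triple
        over-x x = concatMap (over-r x) (allFin σE)

        ∉j : ∀ a → writesInt (edgesᴾ t t′ #na #nb #e) a ≡ false → writesInt (for #j (int 3 []) (rowᴾ t t′ #na #nb #e)) a ≡ false
        ∉j a p = proj₁ (or-false (writesInt (for #j (int 3 []) (rowᴾ t t′ #na #nb #e)) a) (proj₂ (or-false (does (#i ℕ.≟ a)) p)))

        ∉k : ∀ a → writesInt (edgesᴾ t t′ #na #nb #e) a ≡ false → writesInt (for #k (int #na []) step) a ≡ false
        ∉k a p = proj₁ (or-false (writesInt (for #k (int #na []) step) a)
          (proj₁ (or-false (writesInt (rowᴾ t t′ #na #nb #e) a) (proj₂ (or-false (does (#j ℕ.≟ a)) (∉j a p))))))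

        ∉step : ∀ a → writesInt (edgesᴾ t t′ #na #nb #e) a ≡ false → writesInt step a ≡ false
        ∉step a p = proj₁ (or-false (writesInt step a) (proj₂ (or-false (does (#k ℕ.≟ a)) (∉k a p))))

        ∉eⱼ : writesVal (edgesᴾ t t′ #na #nb #e) #e ≡ false → writesVal (for #j (int 3 []) (rowᴾ t t′ #na #nb #e)) #e ≡ false
        ∉eⱼ p = proj₁ (or-false (writesVal (for #j (int 3 []) (rowᴾ t t′ #na #nb #e)) #e) p)

        ∉eₖ : writesVal (edgesᴾ t t′ #na #nb #e) #e ≡ false → writesVal (for #k (int #na []) step) #e ≡ false
        ∉eₖ p = proj₁ (or-false (writesVal (for #k (int #na []) step) #e) (proj₁ (or-false (writesVal (rowᴾ t t′ #na #nb #e) #e) (∉eⱼ p))))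

-- Keys of the nodes in Vmin, and their classes

bestLabelᴾ labelStepᴾ labelSourceᴾ labelsᴾ : Program
bestLabelᴾ =
  setVal #v [] oneᵥ ⨾ put #arg (int 2 []) ⨾
  -- If L(x)(l) ≤ L′(x′)(l), the implication is 1 and the label does not matter; otherwise the
  -- implication is L′(x′)(l) itself.
  for #l (int 2 []) (ifte (val 0 (reg #k ∷ reg #l ∷ []) ≤ᵛ val 1 (reg #i ∷ reg #l ∷ [])) skip
    (ifte (val 1 (reg #i ∷ reg #l ∷ []) ≤ᵛ val #v [])
      (setVal #v [] (val 1 (reg #i ∷ reg #l ∷ [])) ⨾ put #arg (reg #l)) skip))
labelStepᴾ =
  -- The scan is repeated in every column j, which costs a factor depending on the number of labels
  -- only. The same initial mark is written each time.
  bestLabelᴾ ⨾ setVal #result (reg #k ∷ reg #i ∷ []) (val #v []) ⨾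
  ifte (reg #arg ≤ⁿ reg #j)
    (ifte (reg #j ≤ⁿ reg #arg)
      (put #y (mem #minId (lit 1 ∷ reg #k ∷ reg #i ∷ [])) ⨾ put #q (lit 0) ⨾ appendᴾ) skip) skip
labelSourceᴾ =
  -- Column |Σ_V|, the last one, belongs to no label: it is the class of key 1.
  ifte ((reg #j ⊕ lit 1) ≤ⁿ int 2 []) (setVal #v [] (val 1 (reg #i ∷ reg #j ∷ []))) (setVal #v [] oneᵥ) ⨾
  put #col (reg #j) ⨾ openᴾ ⨾ for #k (int 0 []) labelStepᴾ
labelsᴾ = for #i (int 1 []) (for #j (int 2 [] ⊕ lit 1) labelSourceᴾ ⨾ store #row [] (mem #row [] ⊕ lit 1))

module Labels {c ℓ₁ ℓ₂} (𝕀 : BoundedChain c ℓ₁ ℓ₂) {σV σE : ℕ} (G G′ : Gödel.FuzzyGraph 𝕀 σV σE)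
              (minTable maxTable : List ℕ → ℕ) where

  open BoundedChain 𝕀 using (Carrier; _≈_; _≤_; _≤?_; 𝟎; 𝟏; maximum; antisym; module Eq)
    renaming (refl to ≤-refl; trans to ≤-trans; reflexive to ≤-reflexive)
  open Semantics 𝕀
  open FuzzyGraph G
  open FuzzyGraph G′ renaming (V to V′; E to E′; L to L′; size to size′)
    hiding (nonEmpty)
  open MinimaxNet (net G G′) using (Vmin; Vmax) renaming (L to L″)
  open MarkingAlgorithm (net G G′)
  open Marking 𝕀
  open Simulation 𝕀 using (⋀-glb; ⋀-lower)
  open NetLists 𝕀 G G′
  open NetQueue 𝕀 G G′ using (module LabelEntries)
  open Registration 𝕀 G G′
  open MainLoop 𝕀 (net G G′)
  open Building 𝕀 G G′ minTable maxTable
  open Edges 𝕀 G G′ minTable maxTable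

  -- Index n stands for the value 1, which L″ takes where no label restricts it.
  labelAt : ∀ {n} → (Fin n → Carrier) → Fin (suc n) → Carrier
  labelAt {zero}  f zero    = 𝟏
  labelAt {suc n} f zero    = f zero
  labelAt {suc n} f (suc i) = labelAt (f ∘ suc) i

  labelAt-inject₁ : ∀ {n} (f : Fin n → Carrier) i → labelAt f (inject₁ i) ≡ f i
  labelAt-inject₁ f zero    = refl
  labelAt-inject₁ f (suc i) = labelAt-inject₁ (f ∘ suc) i

  labelAt-fromℕ : ∀ {n} (f : Fin n → Carrier) → labelAt f (fromℕ n) ≡ 𝟏
  labelAt-fromℕ {zero}  f = refl
  labelAt-fromℕ {suc n} f = labelAt-fromℕ (f ∘ suc)

  labelAt-cases : ∀ {n} (f : Fin n → Carrier) p →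
                  (toℕ p ≡ n × labelAt f p ≡ 𝟏) ⊎ ∃[ i ] toℕ i ≡ toℕ p × labelAt f p ≡ f i
  labelAt-cases {zero}  f zero    = inj₁ (refl , refl)
  labelAt-cases {suc n} f zero    = inj₂ (zero , refl , refl)
  labelAt-cases {suc n} f (suc p) with labelAt-cases (f ∘ suc) p
  ... | inj₁ (q , r)     = inj₁ (cong suc q , r)
  ... | inj₂ (i , q , r) = inj₂ (suc i , cong suc q , r)

  Choice : Set c
  Choice = Carrier × Fin (suc σV)

  improve : V → V′ → Choice → Fin σV → Choice
  improve x x′ (v , a) l =
    if does (L x l ≤? L′ x′ l) then (v , a)
    else if does (L′ x′ l ≤? v) then (L′ x′ l , inject₁ l) else (v , a)

  best : V → V′ → Choice
  best x x′ = foldl (improve x x′) (𝟏 , fromℕ σV) (allFin σV)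

  -- Invariant of the scan, with ls the labels still to be scanned. The two inequalities squeeze the
  -- value to L″ at the end, while `source` keeps it an entry of L′ or 1; this is possible because a
  -- Gödel implication takes no other values.
  record GoodChoice (x : V) (x′ : V′) (ls : List (Fin σV)) (ch : Choice) : Set (c ⊔ ℓ₁ ⊔ ℓ₂) where
    field
      source : labelAt (L′ x′) (proj₂ ch) ≡ proj₁ ch
      upper  : L″ (x , x′) ≤ proj₁ ch
      lower′ : ∀ l → l ∈ ls ⊎ proj₁ ch ≤ (L x l ⇒ L′ x′ l)

  open GoodChoice

  ⇒-true : ∀ {a b} → a ≤ b → (a ⇒ b) ≡ 𝟏
  ⇒-true {a} {b} p = cong (λ t → if not t then b else 𝟏) (dec-true (a ≤? b) p)

  ⇒-false : ∀ {a b} → ¬ a ≤ b → (a ⇒ b) ≡ b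
  ⇒-false {a} {b} p = cong (λ t → if not t then b else 𝟏) (dec-false (a ≤? b) p)

  improve-good : ∀ {x x′ l ls ch} → GoodChoice x x′ (l ∷ ls) ch → GoodChoice x x′ ls (improve x x′ ch l)
  improve-good {x} {x′} {l} {ls} {v , a} g with L x l ≤? L′ x′ l
  ... | yes p = record { source = source g ; upper = upper g ; lower′ = λ l₁ → case lower′ g l₁ of λ where
        (inj₁ (here refl)) → inj₂ (subst (v ≤_) (sym (⇒-true p)) (maximum v))
        (inj₁ (there e))   → inj₁ e
        (inj₂ q)           → inj₂ q }
  ... | no ¬p with L′ x′ l ≤? v
  ...   | yes q = record
        { source = labelAt-inject₁ (L′ x′) l
        ; upper  = subst (L″ (x , x′) ≤_) (⇒-false ¬p) (⋀-lower (λ p → L x p ⇒ L′ x′ p) l)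
        ; lower′ = λ l₁ → case lower′ g l₁ of λ where
            (inj₁ (here refl)) → inj₂ (subst (L′ x′ l ≤_) (sym (⇒-false ¬p)) ≤-refl)
            (inj₁ (there e))   → inj₁ e
            (inj₂ r)           → inj₂ (≤-trans q r) }
  ...   | no ¬q = record { source = source g ; upper = upper g ; lower′ = λ l₁ → case lower′ g l₁ of λ where
        (inj₁ (here refl)) → inj₂ (subst (v ≤_) (sym (⇒-false ¬p)) (≰⇒≥ ¬q))
        (inj₁ (there e))   → inj₁ e
        (inj₂ r)           → inj₂ r }

  foldl-good : ∀ {x x′} ls {ch} → GoodChoice x x′ ls ch → GoodChoice x x′ [] (foldl (improve x x′) ch ls)
  foldl-good [] g = g
  foldl-good (l ∷ ls) g = foldl-good ls (improve-good g)

  best-good : ∀ x x′ → GoodChoice x x′ [] (best x x′)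
  best-good x x′ = foldl-good (allFin σV) record
    { source = labelAt-fromℕ (L′ x′) ; upper = maximum _ ; lower′ = λ l → inj₁ (∈.∈-allFin l) }

  best-value : ∀ x x′ → proj₁ (best x x′) ≈ L″ (x , x′)
  best-value x x′ = antisym (⋀-glb (λ p → L x p ⇒ L′ x′ p) (λ l → [ (λ ()) , id ]′ (lower′ (best-good x x′) l))) (upper (best-good x x′))

  arg : V → V′ → Fin (suc σV)
  arg x x′ = proj₂ (best x x′)

  open LabelEntries arg public

  labelEntry : V → V′ → Fin (suc σV) → List (Object × Carrier)
  labelEntry x x′ p = when (does (p Fin.≟ arg x x′)) ((minNode (x , x′) , L″ (x , x′)) ∷ [])

  Marked : State → Vmin → Set ℓ₁
  Marked s z = vals s #result (location z) ≈ L″ z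

  bestTime : ℕ
  bestTime = cost (setVal #v [] oneᵥ) + (cost (put #arg (int 2 [])) + forTime (int 2 []) (map (λ (_ : Fin σV) →
    cost (ifte (val 0 (reg #k ∷ reg #l ∷ []) ≤ᵛ val 1 (reg #i ∷ reg #l ∷ [])) skip
      (ifte (val 1 (reg #i ∷ reg #l ∷ []) ≤ᵛ val #v [])
        (setVal #v [] (val 1 (reg #i ∷ reg #l ∷ [])) ⨾ put #arg (reg #l)) skip))) (allFin σV)))

  record Inputs (s : State) : Set c where
    field
      size-in  : ints s 0 [] ≡ size
      size′-in : ints s 1 [] ≡ size′
      σV-in    : ints s 2 [] ≡ σV
      L-in     : ∀ x l → vals s 0 (toℕ x ∷ toℕ l ∷ []) ≡ L x l
      L′-in    : ∀ x l → vals s 1 (toℕ x ∷ toℕ l ∷ []) ≡ L′ x l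

  open Inputs public

  inputs-frame : ∀ {P s s₁} → Frame P s s₁ → writesInt P 0 ≡ false → writesInt P 1 ≡ false → writesInt P 2 ≡ false →
                 writesVal P 0 ≡ false → writesVal P 1 ≡ false → Inputs s → Inputs s₁
  inputs-frame F p₀ p₁ p₂ q₀ q₁ I = record
    { size-in  = scalar-frame F 0 p₀ (size-in I)
    ; size′-in = scalar-frame F 1 p₁ (size′-in I)
    ; σV-in    = scalar-frame F 2 p₂ (σV-in I)
    ; L-in     = λ x l → trans (cong (λ f → f (toℕ x ∷ toℕ l ∷ [])) (val-frame F 0 q₀)) (L-in I x l)
    ; L′-in    = λ x l → trans (cong (λ f → f (toℕ x ∷ toℕ l ∷ [])) (val-frame F 1 q₁)) (L′-in I x l)
    }

  -- K carries the surrounding invariant through the scan; it has to ignore the three registers that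
  -- the scan uses.
  best-exec : ∀ {ℓ s} (K : State → Set ℓ) x x′ →
    (∀ {s} n → K s → K (writeInt #l [] n s)) → (∀ {s} n → K s → K (writeInt #arg [] n s)) →
    (∀ {s} v → K s → K (writeVal #v [] v s)) →
    Inputs s → ints s #i [] ≡ toℕ x′ → ints s #k [] ≡ toℕ x → K s →
    Exec bestLabelᴾ s bestTime (λ s′ → K s′ × vals s′ #v [] ≡ proj₁ (best x x′) × ints s′ #arg [] ≡ toℕ (arg x x′))
  best-exec {s = s} K x x′ K-l K-arg K-v I pi pk K₀ = exec-setVal-then (exec-setInt-then (exec-map
    (λ { _ (ch , refl , p , q , _ , κ) → κ , p , q })
    (exec-for J (allFin σV) refl (λ F → trans (σV-in (inputs-frame F refl refl refl refl refl I₂)) (sym (List.length-tabulate id)))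
      (λ n (ch , fold , p , q , ps , κ) → ch , fold , p , q , ps , K-l n κ)
      (λ { {k} {l} {ls} {s′} F pl (ch , fold , p , q , (r , rs) , κ) → exec-if
        (λ t → exec-skip (ch , trans (cong (λ ch → foldl (improve x x′) ch ls) (sym (kept F (trans pl (sym r)) ch p (inj₁ t)))) fold , p , q , rs , κ))
        (λ t → exec-if
          (λ u → exec-setVal-then (exec-setInt (improve x x′ ch l , fold ,
            trans (L′≡ F (trans pl (sym r))) (cong proj₁ (sym (changed F (trans pl (sym r)) ch p t u))) ,
            trans (trans pl (trans (sym r) (sym (Fin.toℕ-inject₁ l)))) (cong (toℕ ∘ proj₂) (sym (changed F (trans pl (sym r)) ch p t u))) , rs , K-arg _ (K-v _ κ))))
          (λ u → exec-skip (ch , trans (cong (λ ch → foldl (improve x x′) ch ls) (sym (kept F (trans pl (sym r)) ch p (inj₂ (t , u))))) fold , p , q , rs , κ))) })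
      ((𝟏 , fromℕ σV) , refl , refl , trans (σV-in I) (sym (Fin.toℕ-fromℕ σV)) , tabulate-positions 0 id (λ _ → refl) , K-arg _ (K-v _ K₀)))))
    where
    body = ifte (val 0 (reg #k ∷ reg #l ∷ []) ≤ᵛ val 1 (reg #i ∷ reg #l ∷ [])) skip
      (ifte (val 1 (reg #i ∷ reg #l ∷ []) ≤ᵛ val #v [])
        (setVal #v [] (val 1 (reg #i ∷ reg #l ∷ [])) ⨾ put #arg (reg #l)) skip)

    s₂ = writeInt #arg [] (ints s 2 []) (writeVal #v [] 𝟏 s)

    I₂ : Inputs s₂
    I₂ = record { Inputs I }

    J : ℕ → List (Fin σV) → State → Set _
    J k ls s′ = ∃[ ch ] foldl (improve x x′) ch ls ≡ best x x′ × vals s′ #v [] ≡ proj₁ ch ×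
      ints s′ #arg [] ≡ toℕ (proj₂ ch) × Positions k ls × K s′

    L≡ : ∀ {s′ l} → Frame (for #l (int 2 []) body) s₂ s′ → ints s′ #l [] ≡ toℕ l →
         vals s′ 0 (ints s′ #k [] ∷ ints s′ #l [] ∷ []) ≡ L x l
    L≡ {s′} {l} F p = trans (cong₂ (λ a b → vals s′ 0 (a ∷ b ∷ [])) (scalar-frame F #k refl pk) p)
      (L-in (inputs-frame F refl refl refl refl refl I₂) x l)

    L′≡ : ∀ {s′ l} → Frame (for #l (int 2 []) body) s₂ s′ → ints s′ #l [] ≡ toℕ l →
          vals s′ 1 (ints s′ #i [] ∷ ints s′ #l [] ∷ []) ≡ L′ x′ l
    L′≡ {s′} {l} F p = trans (cong₂ (λ a b → vals s′ 1 (a ∷ b ∷ [])) (scalar-frame F #i refl pi) p)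
      (L′-in (inputs-frame F refl refl refl refl refl I₂) x′ l)

    test₁ : ∀ {s′ l} → Frame (for #l (int 2 []) body) s₂ s′ → ints s′ #l [] ≡ toℕ l →
            test s′ (val 0 (reg #k ∷ reg #l ∷ []) ≤ᵛ val 1 (reg #i ∷ reg #l ∷ [])) ≡ does (L x l ≤? L′ x′ l)
    test₁ F p = cong₂ (λ a b → does (a ≤? b)) (L≡ F p) (L′≡ F p)

    test₂ : ∀ {s′ l v} → Frame (for #l (int 2 []) body) s₂ s′ → ints s′ #l [] ≡ toℕ l → vals s′ #v [] ≡ v →
            test s′ (val 1 (reg #i ∷ reg #l ∷ []) ≤ᵛ val #v []) ≡ does (L′ x′ l ≤? v)
    test₂ F p q = cong₂ (λ a b → does (a ≤? b)) (L′≡ F p) q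

    kept : ∀ {s′ l} → Frame (for #l (int 2 []) body) s₂ s′ → ints s′ #l [] ≡ toℕ l → ∀ ch → vals s′ #v [] ≡ proj₁ ch →
      test s′ (val 0 (reg #k ∷ reg #l ∷ []) ≤ᵛ val 1 (reg #i ∷ reg #l ∷ [])) ≡ true ⊎
      (test s′ (val 0 (reg #k ∷ reg #l ∷ []) ≤ᵛ val 1 (reg #i ∷ reg #l ∷ [])) ≡ false ×
       test s′ (val 1 (reg #i ∷ reg #l ∷ []) ≤ᵛ val #v []) ≡ false) →
      improve x x′ ch l ≡ ch
    kept {l = l} F p (v , a) q (inj₁ t) = cong (λ b → if b then (v , a) else
      if does (L′ x′ l ≤? v) then (L′ x′ l , inject₁ l) else (v , a)) (trans (sym (test₁ F p)) t)
    kept {l = l} F p (v , a) q (inj₂ (t , u)) = cong₂ (λ b b₁ → if b then (v , a) else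
      if b₁ then (L′ x′ l , inject₁ l) else (v , a)) (trans (sym (test₁ F p)) t) (trans (sym (test₂ F p q)) u)

    changed : ∀ {s′ l} → Frame (for #l (int 2 []) body) s₂ s′ → ints s′ #l [] ≡ toℕ l → ∀ ch → vals s′ #v [] ≡ proj₁ ch →
      test s′ (val 0 (reg #k ∷ reg #l ∷ []) ≤ᵛ val 1 (reg #i ∷ reg #l ∷ [])) ≡ false →
      test s′ (val 1 (reg #i ∷ reg #l ∷ []) ≤ᵛ val #v []) ≡ true →
      improve x x′ ch l ≡ (L′ x′ l , inject₁ l)
    changed {l = l} F p (v , a) q t u = cong₂ (λ b b₁ → if b then (v , a) else
      if b₁ then (L′ x′ l , inject₁ l) else (v , a)) (trans (sym (test₁ F p)) t) (trans (sym (test₂ F p q)) u)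

module LabelPhase {c ℓ₁ ℓ₂} (𝕀 : BoundedChain c ℓ₁ ℓ₂) {σV σE : ℕ} (G G′ : Gödel.FuzzyGraph 𝕀 σV σE)
              (minTable maxTable : List ℕ → ℕ) where

  open BoundedChain 𝕀 using (Carrier; _≈_; _≤_; _≤?_; 𝟎; 𝟏; module Eq)
  open Semantics 𝕀
  open FuzzyGraph G
  open FuzzyGraph G′ renaming (V to V′; E to E′; L to L′; size to size′)
    hiding (nonEmpty)
  open MinimaxNet (net G G′) using (Vmin; Vmax) renaming (L to L″)
  open MarkingAlgorithm (net G G′)
  open NetLists 𝕀 G G′
  open Registration 𝕀 G G′
  open MainLoop 𝕀 (net G G′)
  open Building 𝕀 G G′ minTable maxTable
  open Edges 𝕀 G G′ minTable maxTable
  open Labels 𝕀 G G′ minTable maxTable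

  Marks : State → List Vmin → Set ℓ₁
  Marks s zs = ∀ {z} → z ∈ zs → Marked s z

  marks-snoc : ∀ {s zs v is} z → is ≡ location z → v ≈ L″ z → Marks s zs → Marks (writeVal #result is v s) (zs ++ z ∷ [])
  marks-snoc {s} {zs} {v} z refl v≈ M {z₁} e with location z ≟ˡ location z₁
  ... | yes p = subst (λ z₁ → update _≟ˡ_ (location z) v (vals s #result) (location z₁) ≈ L″ z₁) (location-injective p)
        (Eq.trans (Eq.reflexive (update-same _≟ˡ_ (location z) v (vals s #result))) v≈)
  ... | no ne with ∈.∈-++⁻ zs e
  ...   | inj₁ e₁ = Eq.trans (Eq.reflexive (update-other _≟ˡ_ v (vals s #result) ne)) (M e₁)
  ...   | inj₂ (here refl) = contradiction refl ne

  labelStepTime : ℕ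
  labelStepTime = bestTime + (cost (setVal #result (reg #k ∷ reg #i ∷ []) (val #v [])) +
    cost (ifte (reg #arg ≤ⁿ reg #j)
      (ifte (reg #j ≤ⁿ reg #arg)
        (put #y (mem #minId (lit 1 ∷ reg #k ∷ reg #i ∷ [])) ⨾ put #q (lit 0) ⨾ appendᴾ) skip) skip))

  filling-registers : ∀ {s s₁ as R m es F e} → (∀ a → ints s₁ (20 + a) ≡ ints s (20 + a)) →
                      vals s₁ #key ≡ vals s #key → vals s₁ #adjV ≡ vals s #adjV →
                      Filling s as R m es F e → Filling s₁ as R m es F e
  filling-registers {s} {s₁} {as} {R} {m} {es} {F} {e} i≡ k≡ a≡ f = record
    { outs-f = record
      { deg-r  = λ p → trans (cong (λ f → f (p ∷ [])) (i≡ #deg)) (deg-r (outs-f f) p)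
      ; adj-r  = λ p → at-list-cong 0 _ (λ k _ → cong (λ f → f (p ∷ k ∷ [])) (i≡ #adj)) (adj-r (outs-f f) p)
      ; adjV-r = λ p → at-list-cong 0 _ (λ k _ → cong (λ f → f (p ∷ k ∷ [])) a≡) (adjV-r (outs-f f) p)
      }
    ; ins-f = λ q → trans (cong (λ f → f (q ∷ [])) (i≡ #count)) (ins-f f q)
    ; stored-f = subst (λ H → Stored H (((R , m) , es) ∷ F)) (sym (source≡ (i≡ #alive) (i≡ #plen) (i≡ #payA) (i≡ #payB) k≡)) (stored-f f)
    ; row-f = trans (cong (λ f → f []) (i≡ #row)) (row-f f)
    ; key-f = trans (cong (λ f → f _) k≡) (key-f f)
    ; min-table-f = trans (i≡ #minId) (min-table-f f)
    ; max-table-f = trans (i≡ #maxId) (max-table-f f)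
    }
    where
    source≡ : ∀ {a₁ a₂ a₃ a₄ b₁ b₂ b₃ b₄ v w} → a₁ ≡ b₁ → a₂ ≡ b₂ → a₃ ≡ b₃ → a₄ ≡ b₄ → v ≡ w →
      record { alive = a₁ ; plen = a₂ ; payA = a₃ ; payB = a₄ ; key = v } ≡
      record { alive = b₁ ; plen = b₂ ; payA = b₃ ; payB = b₄ ; key = w }
    source≡ refl refl refl refl refl = refl

  module _ (min-index : ∀ x x′ → minTable (1 ∷ toℕ x ∷ toℕ x′ ∷ []) ≡ idMin (x , x′)) where

    labelStep-exec : ∀ {s as R es F zs} x x′ p → Inputs s → ints s #i [] ≡ toℕ x′ → ints s #k [] ≡ toℕ x →
      ints s #j [] ≡ toℕ p → ints s #col [] ≡ toℕ p → Filling s as R (toℕ p) es F (labelAt (L′ x′) p) → Marks s zs →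
      Exec labelStepᴾ s labelStepTime
        (λ s′ → Filling s′ as R (toℕ p) (es ++ labelEntry x x′ p) F (labelAt (L′ x′) p) × Marks s′ (zs ++ (x , x′) ∷ []))
    labelStep-exec {s} {as} {R} {es} {F} {zs} x x′ p I pi pk pj pcol f M =
      exec-seq (best-exec K x x′
          (λ {s} n (f , M) → filling-registers (λ _ → refl) refl refl f , λ {z} → M {z})
          (λ n (f , M) → filling-registers (λ _ → refl) refl refl f , λ {z} → M {z})
          (λ v (f , M) → filling-registers (λ _ → refl) refl refl f , λ {z} → M {z}) I pi pk (f , M))
        λ {s₁} F₁ ((f₁ , M₁) , v≡ , a≡) → after s₁
          (scalar-frame F₁ #i refl pi) (scalar-frame F₁ #k refl pk)
          (scalar-frame F₁ #j refl pj) (scalar-frame F₁ #col refl pcol) f₁ M₁ v≡ a≡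
      where
      e = labelAt (L′ x′) p

      K : State → Set _
      K s = Filling s as R (toℕ p) es F e × Marks s zs

      entry-key : p ≡ arg x x′ → L″ (x , x′) ≈ e
      entry-key refl = Eq.sym (Eq.trans (Eq.reflexive (GoodChoice.source (best-good x x′))) (best-value x x′))

      Goal : State → Set _
      Goal s′ = Filling s′ as R (toℕ p) (es ++ labelEntry x x′ p) F e × Marks s′ (zs ++ (x , x′) ∷ [])

      after : ∀ s₁ → ints s₁ #i [] ≡ toℕ x′ → ints s₁ #k [] ≡ toℕ x → ints s₁ #j [] ≡ toℕ p → ints s₁ #col [] ≡ toℕ p →
        Filling s₁ as R (toℕ p) es F e → Marks s₁ zs → vals s₁ #v [] ≡ proj₁ (best x x′) → ints s₁ #arg [] ≡ toℕ (arg x x′) →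
        Exec (setVal #result (reg #k ∷ reg #i ∷ []) (val #v []) ⨾
          ifte (reg #arg ≤ⁿ reg #j) (ifte (reg #j ≤ⁿ reg #arg)
            (put #y (mem #minId (lit 1 ∷ reg #k ∷ reg #i ∷ [])) ⨾ put #q (lit 0) ⨾ appendᴾ) skip) skip) s₁ _ Goal
      after s₁ pi pk pj pcol f M v≡ a≡ = exec-setVal-then (exec-if
        (λ t → exec-if
          (λ u → exec-setInt-then (exec-setInt-then (executes append⇓ ℕ.≤-refl (finish t u))))
          (λ u → exec-skip (unchanged λ q → ℕ.≤-reflexive (trans pj (trans (cong toℕ q) (sym a≡))) ∷≰ does-false (_ ℕ.≤? _) u)))
        (λ t → exec-skip (unchanged λ q → ℕ.≤-reflexive (trans a≡ (trans (cong toℕ (sym q)) (sym pj))) ∷≰ does-false (_ ℕ.≤? _) t)))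
        where
        _∷≰_ : ∀ {i j} → i ℕ.≤ j → ¬ i ℕ.≤ j → ⊥
        p ∷≰ q = q p

        s₂ s₃ s₄ : State
        s₂ = writeVal #result (ints s₁ #k [] ∷ ints s₁ #i [] ∷ []) (vals s₁ #v []) s₁
        s₃ = writeInt #y [] (ints s₂ (20 + #minId) (1 ∷ ints s₂ #k [] ∷ ints s₂ #i [] ∷ [])) s₂
        s₄ = writeInt #q [] 0 s₃

        M₂ : Marks s₂ (zs ++ (x , x′) ∷ [])
        M₂ = marks-snoc {s₁} (x , x′) (cong₂ (λ a b → a ∷ b ∷ []) pk pi) (Eq.trans (Eq.reflexive v≡) (best-value x x′)) M

        f₂ : Filling s₂ as R (toℕ p) es F e
        f₂ = filling-registers (λ _ → refl) refl refl f

        unchanged : ¬ p ≡ arg x x′ → Goal s₂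
        unchanged ne = subst (λ es → Filling s₂ as R (toℕ p) es F e)
          (sym (trans (cong (λ b → es ++ when b _) (dec-false (p Fin.≟ arg x x′) ne)) (List.++-identityʳ es))) f₂ , M₂

        finish : test s₂ (reg #arg ≤ⁿ reg #j) ≡ true → test s₂ (reg #j ≤ⁿ reg #arg) ≡ true → Goal (appended s₄)
        finish t u = subst (λ b → Filling (appended s₄) as R (toℕ p) (es ++ when b _) F e) (sym (dec-true (p Fin.≟ arg x x′) p≡)) (record
          { outs-f = record { Outs (outs-f f₂) } ; ins-f = ins-f f₂
          ; stored-f = appended-stored {s₄} R (toℕ p) (minNode (x , x′)) (stored-f f₂) (row-f f₂) pcol
              (trans (cong (λ f → f (1 ∷ ints s₁ #k [] ∷ ints s₁ #i [] ∷ [])) (min-table-f f₂))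
                (trans (cong₂ (λ a b → minTable (1 ∷ a ∷ b ∷ [])) pk pi) (min-index x x′)))
              refl (Eq.trans (entry-key p≡) (Eq.reflexive (sym (key-f f₂))))
          ; row-f = row-f f₂ ; key-f = key-f f₂ ; min-table-f = min-table-f f₂ ; max-table-f = max-table-f f₂
          }) , λ {z} → M₂ {z}
          where
          p≡ : p ≡ arg x x′
          p≡ = Fin.toℕ-injective (ℕ.≤-antisym
            (subst₂ ℕ._≤_ pj a≡ (does-true (ints s₁ #j [] ℕ.≤? ints s₁ #arg []) u))
            (subst₂ ℕ._≤_ a≡ pj (does-true (ints s₁ #arg [] ℕ.≤? ints s₁ #j []) t)))

    module _ (as : List Arc) (es₀ : List (Object × Carrier)) (n₀ R₀ : ℕ) where

      LabelSource : Set
      LabelSource = V′ × Fin (suc σV)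

      -- Each column of a row marks the same pairs again. The repetition is kept, since the list
      -- follows the loops.
      marksOf : List LabelSource → List Vmin
      marksOf = concatMap (λ (x′ , p) → map (_, x′) (allFin size))

      LabelsAt : State → ℕ → ℕ → List LabelSource → Set _
      LabelsAt s R m pre = Progress s as (es₀ ++ concatMap (uncurry labelEntries) pre) (n₀ + length pre) R m × Marks s (marksOf pre)

      sourceTime labelsTime : ℕ
      sourceTime = cost (ifte ((reg #j ⊕ lit 1) ≤ⁿ int 2 []) (setVal #v [] (val 1 (reg #i ∷ reg #j ∷ []))) (setVal #v [] oneᵥ)) +
        (cost (put #col (reg #j)) + (cost openᴾ + forTime (int 0 []) (map (λ (_ : V) → labelStepTime) (allFin size))))
      labelsTime = forTime (int 1 []) (map (λ (_ : V′) →
        forTime (int 2 [] ⊕ lit 1) (map (λ (_ : Fin (suc σV)) → sourceTime) (allFin (suc σV))) +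
        cost (store #row [] (mem #row [] ⊕ lit 1))) (allFin size′))

      source-exec : ∀ {s R pre} x′ p → Inputs s → ints s #i [] ≡ toℕ x′ → ints s #j [] ≡ toℕ p → LabelsAt s R (toℕ p) pre →
        Exec labelSourceᴾ s sourceTime (λ s′ → LabelsAt s′ R (suc (toℕ p)) (pre ++ (x′ , p) ∷ []))
      source-exec {s} {R} {pre} x′ p I pi pj (A , M) = exec-seq {Q = λ s₁ → ∃[ v ] s₁ ≡ writeVal #v [] v s × v ≡ labelAt (L′ x′) p}
        (exec-if
          (λ t → exec-setVal (_ , refl , key-label t))
          (λ t → exec-setVal (_ , refl , key-one t)))
        λ { _ (v , refl , v≡) → after v v≡ }
        where
        e = labelAt (L′ x′) p

        -- The columns satisfying j + 1 ≤ |Σ_V| are those of labels, by `labelAt-cases`; in the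
        -- remaining column the key is 1.
        key-label : test s ((reg #j ⊕ lit 1) ≤ⁿ int 2 []) ≡ true → vals s 1 (ints s #i [] ∷ ints s #j [] ∷ []) ≡ e
        key-label t with labelAt-cases (L′ x′) p
        ... | inj₁ (q , _) = contradiction
              (subst₂ ℕ._≤_ (trans (ℕ.+-comm _ 1) (cong suc (trans pj q))) (σV-in I) (does-true (ints s #j [] + 1 ℕ.≤? ints s 2 []) t))
              (ℕ.<-irrefl refl)
        ... | inj₂ (l , q , r) = trans (cong₂ (λ a b → vals s 1 (a ∷ b ∷ [])) pi (trans pj (sym q))) (trans (L′-in I x′ l) (sym r))

        key-one : test s ((reg #j ⊕ lit 1) ≤ⁿ int 2 []) ≡ false → 𝟏 ≡ e
        key-one t with labelAt-cases (L′ x′) p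
        ... | inj₁ (_ , r) = sym r
        ... | inj₂ (l , q , r) = contradiction
              (subst₂ ℕ._≤_ (trans (cong suc (trans q (sym pj))) (ℕ.+-comm 1 _)) (sym (σV-in I)) (Fin.toℕ<n l))
              (does-false (ints s #j [] + 1 ℕ.≤? ints s 2 []) t)

        after : ∀ v → v ≡ e → Exec (put #col (reg #j) ⨾ openᴾ ⨾ for #k (int 0 []) labelStepᴾ) (writeVal #v [] v s) _
                  (λ s′ → LabelsAt s′ R (suc (toℕ p)) (pre ++ (x′ , p) ∷ []))
        after v v≡ = exec-setInt-then (exec-after open⇓ ℕ.≤-refl (exec-map (λ _ → filled)
          (exec-for-fin J (λ x → x ∷ []) refl
            (λ F → size-in (inputs-frame F refl refl refl refl refl I₃))
            (λ _ (f , M) → filling-registers (λ _ → refl) refl refl f , λ {z} → M {z})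
            (λ {x} {xs} {s′} F pk (f , M) → exec-map
              (λ {s″} _ (f , M) → subst (λ es → Filling s″ as R (toℕ p) es (sources A) e)
                  (sym (trans (List.concatMap-++ (λ x → labelEntry x x′ p) xs (x ∷ []))
                    (cong (concatMap (λ x → labelEntry x x′ p) xs ++_) (List.++-identityʳ _)))) f ,
                subst (Marks s″) (trans (List.++-assoc (marksOf pre) (map (_, x′) xs) ((x , x′) ∷ []))
                  (cong (marksOf pre ++_) (sym (List.map-++ (_, x′) xs (x ∷ []))))) M)
              (labelStep-exec x x′ p (inputs-frame F refl refl refl refl refl I₃)
                (scalar-frame F #i refl pi) pk
                (scalar-frame F #j refl pj)
                (scalar-frame F #col refl pj) f M))
            [] start)))
          where
          s₁ s₂ s₃ : State
          s₁ = writeVal #v [] v s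
          s₂ = writeInt #col [] (ints s #j []) s₁
          s₃ = opened s₂

          I₃ : Inputs s₃
          I₃ = record { Inputs I }

          J : ℕ → List V → State → Set _
          J _ xs s′ = Filling s′ as R (toℕ p) (concatMap (λ x → labelEntry x x′ p) xs) (sources A) e ×
            Marks s′ (marksOf pre ++ map (_, x′) xs)

          start : J 0 [] s₃
          start = record
            { outs-f = record { Outs (outs-r A) } ; ins-f = ins-r A
            ; stored-f = opened-stored {s₂} R (toℕ p) (stored A) (row-r A) pj (fresh-source (before A))
            ; row-f = row-r A ; key-f = trans (opened-key {s₂} R (toℕ p) (row-r A) pj) v≡
            ; min-table-f = min-table A ; max-table-f = max-table A
            } , λ {z} z∈ → M {z} (subst (z ∈_) (List.++-identityʳ (marksOf pre)) z∈)

          filled : ∀ {s′} → J size (concatMap (λ x → x ∷ []) (allFin size)) s′ → LabelsAt s′ R (suc (toℕ p)) (pre ++ (x′ , p) ∷ [])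
          filled {s′} j = let f , M = subst (λ xs → J size xs s′) (List.concatMap-pure (allFin size)) j in record
            { outs-r = outs-f f ; ins-r = ins-f f ; stored = stored-f f
            ; before = (inj₂ (refl , ℕ.n<1+n (toℕ p)) , p<width) ∷ next-column (before A)
            ; row-r = row-f f
            ; entries-r = ↭-trans (Perm.++⁺ˡ (labelEntries x′ p) (entries-r A))
                (↭-trans (Perm.++-comm (labelEntries x′ p) _) (↭-reflexive
                  (trans (List.++-assoc es₀ (concatMap (uncurry labelEntries) pre) (labelEntries x′ p))
                    (cong (es₀ ++_) (sym (trans (List.concatMap-++ (uncurry labelEntries) pre ((x′ , p) ∷ []))
                      (cong (concatMap (uncurry labelEntries) pre ++_) (List.++-identityʳ _))))))))
            ; number = trans (cong suc (number A)) (trans (sym (ℕ.+-suc n₀ (length pre)))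
                (cong (n₀ +_) (trans (ℕ.+-comm 1 (length pre)) (sym (List.length-++ pre)))))
            ; min-table = min-table-f f ; max-table = max-table-f f
            } , subst (Marks s′) (sym (trans (List.concatMap-++ (λ (x′ , p) → map (_, x′) (allFin size)) pre ((x′ , p) ∷ []))
                  (cong (marksOf pre ++_) (List.++-identityʳ _)))) M
            where
            p<width : toℕ p ℕ.< width
            p<width = ℕ.<-≤-trans (Fin.toℕ<n p) (ℕ.≤-trans (ℕ.≤-reflexive (ℕ.+-comm 1 σV)) (ℕ.+-monoˡ-≤ 1 (ℕ.m≤n+m σV (size + size′))))

      labelSources : List LabelSource
      labelSources = concatMap (λ x′ → concatMap (λ p → (x′ , p) ∷ []) (allFin (suc σV))) (allFin size′)

      labels-exec : ∀ {s} → Inputs s → LabelsAt s R₀ 0 [] →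
        Exec labelsᴾ s labelsTime (λ s′ → LabelsAt s′ (R₀ + size′) 0 labelSources)
      labels-exec {s} I A = exec-for-fin (λ k pre s → LabelsAt s (R₀ + k) 0 pre) (λ x′ → concatMap (λ p → (x′ , p) ∷ []) (allFin (suc σV))) refl
        (λ F → size′-in (inputs-frame F refl refl refl refl refl I)) (λ n (A , M) → record { Progress A } , λ {z} → M {z})
        (λ {x′} {pre} {s₁} F pi A → exec-seq
          (exec-for-fin (λ k pre s → LabelsAt s (R₀ + toℕ x′) k pre) (λ p → (x′ , p) ∷ []) refl
            (λ F₁ → trans (cong (_+ 1) (σV-in (inputs-frame F₁ refl refl refl refl refl (inputs-frame F refl refl refl refl refl I)))) (ℕ.+-comm σV 1))
            (λ n (A , M) → record { Progress A } , λ {z} → M {z})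
            (λ {p} {pre} F₁ pj A → source-exec {pre = pre} x′ p (inputs-frame F₁ refl refl refl refl refl (inputs-frame F refl refl refl refl refl I))
              (scalar-frame F₁ #i refl pi) pj A)
            pre A)
          (λ {s₂} _ (A , M) → exec-setInt (record
            { outs-r = record { Outs (outs-r A) } ; ins-r = ins-r A ; stored = stored A
            ; before = subst (λ R → All (Before R 0) (sources A)) (sym (ℕ.+-suc R₀ (toℕ x′))) (next-row (before A))
            ; row-r = trans (cong (_+ 1) (row-r A)) (trans (ℕ.+-comm _ 1) (sym (ℕ.+-suc R₀ (toℕ x′))))
            ; entries-r = entries-r A ; number = number A ; min-table = min-table A ; max-table = max-table A
            } , λ {z} → M {z})))
        [] (subst (λ R → LabelsAt s R 0 []) (sym (ℕ.+-identityʳ R₀)) A)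

-- Preparation of the main loop

zeroStepᴾ : ℕ → Program
zeroStepᴾ t =
  put #y (mem #maxId (lit t ∷ reg #i ∷ reg #j ∷ reg #k ∷ [])) ⨾
  ifte (mem #count (reg #y ∷ []) ≤ⁿ lit 0) (put #q (lit 0) ⨾ push) skip

zerosᴾ : (t na nb : ℕ) → Program
zerosᴾ t na nb = for #i (int na []) (for #j (int nb []) (for #k (int 3 []) (zeroStepᴾ t)))

refreshAllᴾ : Program
refreshAllᴾ =
  store #width [] (((int 0 [] ⊕ int 1 []) ⊕ int 2 []) ⊕ lit 1) ⨾
  for #i (mem #row []) (put #cur (reg #i) ⨾ refreshᴾ)

module Refresh {c ℓ₁ ℓ₂} (𝕀 : BoundedChain c ℓ₁ ℓ₂) where

  open Semantics 𝕀
  open Selection 𝕀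

  refreshAllTime : ℕ → ℕ → ℕ
  refreshAllTime R W = cost (store #width [] (((int 0 [] ⊕ int 1 []) ⊕ int 2 []) ⊕ lit 1)) +
    forTime (mem #row []) (map (λ (_ : Fin R) → cost (put #cur (reg #i)) + refreshTime * suc W) (allFin R))

  refreshAll-exec : ∀ {s} R W → ints s 0 [] + ints s 1 [] + ints s 2 [] + 1 ≡ W → hi (heap s) #row [] ≡ R →
    Exec refreshAllᴾ s (refreshAllTime R W) (λ s′ → hi (heap s′) #width [] ≡ W × (∀ i → i ℕ.< R → Cached W (heap s′) i))
  refreshAll-exec {s} R W pW pR = exec-setInt-then (exec-map
    (λ F C → scalar-frame F (20 + #width) refl pW , C)
    (exec-for-fin {B = ⊤} (λ k _ s → ∀ i → i ℕ.< k → Cached W (heap s) i) (λ _ → []) refl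
      (λ F → scalar-frame F (20 + #row) refl pR)
      (λ _ C i i<k → record { RowCache (C i i<k) })
      (λ {i} {_} {s′} F pi C → exec-setInt-then (exec-map
        (λ {s″} F₁ (cache , others) → below-suc {P = Cached W (heap s″)}
          (λ i₁ i₁<i → let p , q , r = others i₁ (ℕ.<⇒≢ i₁<i) in
            subst (λ key → RowCache W (ints s″ (20 + #alive)) key (ints s″ (20 + #ralive)) (ints s″ (20 + #rmin)) (vals s″ #rkey) i₁)
              (sym (val-frame F₁ #key refl))
              (cache-cong (λ j → cong (λ f → f (i₁ ∷ j ∷ [])) (int-frame F₁ (20 + #alive) refl)) p q r (C i₁ i₁<i)))
          cache)
        (refresh-exec (toℕ i) W pi (scalar-frame F (20 + #width) refl pW))))
      [] λ _ ()))

module Zeros {c ℓ₁ ℓ₂} (𝕀 : BoundedChain c ℓ₁ ℓ₂) {σV σE : ℕ} (G G′ : Gödel.FuzzyGraph 𝕀 σV σE)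
             (minTable maxTable : List ℕ → ℕ) where

  open BoundedChain 𝕀 using (Carrier; 𝟎)
  open Semantics 𝕀
  open MinimaxNet (net G G′) using (Vmin; Vmax)
  open MarkingAlgorithm (net G G′)
  open NetLists 𝕀 G G′
  open Registration 𝕀 G G′
  open MainLoop 𝕀 (net G G′)
  open Building 𝕀 G G′ minTable maxTable

  -- A node of Vmax without predecessors has key 0, the least value. These nodes thus form the first
  -- class, which is put on the stack directly, and the initial level is 0.
  zeroEntries : List Vmax → List (Object × Carrier)
  zeroEntries = concatMap (λ y → when (does (length (predMax y) ℕ.≟ 0)) ((maxNode y , 𝟎) ∷ []))

  Pushed : State → List Vmax → Set c
  Pushed s ys = ∃[ st ] Stack numbering (heap s) st × st ↭ zeroEntries ys

  zeroStep-exec : ∀ {s ys} t y i j k → maxTable (t ∷ i ∷ j ∷ k ∷ []) ≡ idMax y → ints s (20 + #maxId) ≡ maxTable →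
    ints s (20 + #count) (idMax y ∷ []) ≡ length (predMax y) →
    ints s #i [] ≡ i → ints s #j [] ≡ j → ints s #k [] ≡ k → Pushed s ys →
    Exec (zeroStepᴾ t) s (cost (zeroStepᴾ t)) (λ s′ → Pushed s′ (ys ++ y ∷ []))
  zeroStep-exec {s} {ys} t y i j k index table count≡ refl refl refl (st , S , σ) = exec-setInt-then (exec-if
    (λ u → exec-setInt-then (exec-push numbering ((maxNode y , 𝟎) ∷ st ,
      push-stack numbering {s₂} (maxNode y) record { Stack S } id≡ refl ,
      ↭-trans (prep _ σ) (↭-trans (Perm.∷↭∷ʳ (maxNode y , 𝟎) (zeroEntries ys)) (↭-reflexive (snoc true (trans empty u)))))))
    (λ u → exec-skip (st , record { Stack S } ,
      ↭-trans σ (↭-reflexive (trans (sym (List.++-identityʳ _)) (snoc false (trans empty u)))))))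
    where
    s₁ s₂ : State
    s₁ = writeInt #y [] (ints s (20 + #maxId) (t ∷ i ∷ j ∷ k ∷ [])) s
    s₂ = writeInt #q [] 0 s₁

    id≡ : ints s₁ #y [] ≡ idMax y
    id≡ = trans (cong (λ f → f (t ∷ i ∷ j ∷ k ∷ [])) table) index

    empty : does (length (predMax y) ℕ.≟ 0) ≡ test s₁ (mem #count (reg #y ∷ []) ≤ⁿ lit 0)
    empty = trans (lemma (length (predMax y)))
      (cong (λ n → does (n ℕ.≤? 0)) (sym (trans (cong (λ i → ints s (20 + #count) (i ∷ [])) id≡) count≡)))
      where
      lemma : ∀ n → does (n ℕ.≟ 0) ≡ does (n ℕ.≤? 0)
      lemma zero    = refl
      lemma (suc n) = refl

    snoc : ∀ b → does (length (predMax y) ℕ.≟ 0) ≡ b →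
           zeroEntries ys ++ when b ((maxNode y , 𝟎) ∷ []) ≡ zeroEntries (ys ++ y ∷ [])
    snoc b p = trans (cong (λ b → zeroEntries ys ++ when b ((maxNode y , 𝟎) ∷ [])) (sym p))
      (sym (trans (List.concatMap-++ _ ys (y ∷ [])) (cong (zeroEntries ys ++_) (List.++-identityʳ _))))

  module _ (S : Side) where

    open Side S

    zerosTime : (t #na #nb : ℕ) → ℕ
    zerosTime t #na #nb = forTime (int #na []) (map (λ (_ : Fin na) →
      forTime (int #nb []) (map (λ (_ : Fin nb) →
        forTime (int 3 []) (map (λ (_ : Fin σE) → cost (zeroStepᴾ t)) (allFin σE))) (allFin nb))) (allFin na))

    zeros-exec : ∀ {s} t #na #nb ys →
      (∀ x w r → maxTable (t ∷ toℕ x ∷ toℕ w ∷ toℕ r ∷ []) ≡ idMax (mkMax x w r)) → ints s (20 + #maxId) ≡ maxTable →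
      (∀ y → ints s (20 + #count) (idMax y ∷ []) ≡ length (predMax y)) →
      writesInt (zerosᴾ t #na #nb) #na ≡ false → writesInt (zerosᴾ t #na #nb) #nb ≡ false →
      ints s #na [] ≡ na → ints s #nb [] ≡ nb → ints s 3 [] ≡ σE → Pushed s ys →
      Exec (zerosᴾ t #na #nb) s (zerosTime t #na #nb) (λ s′ → Pushed s′ (ys ++ sideMaxs S))
    zeros-exec {s} t #na #nb ys index table count≡ ∉na ∉nb pa pb pσ M =
      exec-for-fin (λ _ ys s → Pushed s ys) _ refl
        (λ F → scalar-frame F #na ∉na pa) (λ _ (st , S , σ) → st , record { Stack S } , σ)
        (λ {x} {ys} F pi M → exec-for-fin (λ _ ys s → Pushed s ys) _ refl
          (λ F₁ → scalar-frame F₁ #nb (inner₁ ∉nb) (scalar-frame F #nb ∉nb pb))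
          (λ _ (st , S , σ) → st , record { Stack S } , σ)
          (λ {w} {ys} F₁ pj M → exec-for-fin (λ _ ys s → Pushed s ys) _ refl
            (λ F₂ → trans (cong (λ f → f []) (int-frame F₂ 3 refl))
              (scalar-frame F₁ 3 refl (scalar-frame F 3 refl pσ)))
            (λ _ (st , S , σ) → st , record { Stack S } , σ)
            (λ {r} {ys} F₂ pk M → zeroStep-exec {ys = ys} t (mkMax x w r) (toℕ x) (toℕ w) (toℕ r) (index x w r)
              (trans (int-frame F₂ (20 + #maxId) refl) (trans (int-frame F₁ (20 + #maxId) refl) (trans (int-frame F (20 + #maxId) refl) table)))
              (trans (cong (λ f → f (idMax (mkMax x w r) ∷ [])) (trans (int-frame F₂ (20 + #count) refl)
                (trans (int-frame F₁ (20 + #count) refl) (int-frame F (20 + #count) refl)))) (count≡ (mkMax x w r)))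
              (scalar-frame F₂ #i refl (scalar-frame F₁ #i refl pi))
              (scalar-frame F₂ #j refl pj) pk M)
            ys M) ys M) ys M
      where
      inner₁ : writesInt (zerosᴾ t #na #nb) #nb ≡ false →
               writesInt (for #j (int #nb []) (for #k (int 3 []) (zeroStepᴾ t))) #nb ≡ false
      inner₁ p = proj₁ (or-false (writesInt (for #j (int #nb []) (for #k (int 3 []) (zeroStepᴾ t))) #nb)
        (proj₂ (or-false (does (#i ℕ.≟ #nb)) p)))

-- The phases composed and run on the input

registerᴾ buildᴾ prepareᴾ algorithmᴾ : Program
-- The numerals are the tag of a graph (for `edgesᴾ` followed by the tag of the other one), the
-- names 0 and 1 of the scalars |V| and |V′| in the order required, and for `edgesᴾ` the name 2 or 3
-- of the edge table.
registerᴾ  = registerMinsᴾ ⨾ registerMaxsᴾ 1 0 1 ⨾ registerMaxsᴾ 2 1 0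
buildᴾ     = edgesᴾ 1 2 0 1 2 ⨾ edgesᴾ 2 1 1 0 3 ⨾ labelsᴾ
prepareᴾ   = zerosᴾ 1 0 1 ⨾ zerosᴾ 2 1 0 ⨾ refreshAllᴾ ⨾ setVal #level [] zeroᵥ
algorithmᴾ = registerᴾ ⨾ buildᴾ ⨾ prepareᴾ ⨾ mainᴾ

module Assembly {c ℓ₁ ℓ₂} (𝕀 : BoundedChain c ℓ₁ ℓ₂) {σV σE : ℕ} (G G′ : Gödel.FuzzyGraph 𝕀 σV σE) where

  open BoundedChain 𝕀 using (Carrier; _≈_; _≤_; 𝟎; module Eq) renaming (refl to ≤-refl)
  open Semantics 𝕀
  open FuzzyGraph G
  open FuzzyGraph G′ renaming (V to V′; E to E′; L to L′; size to size′)
    hiding (nonEmpty)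
  open MinimaxNet (net G G′) using (Vmin; Vmax; E↑; E↓; Vmin-finite; Vmax-finite) renaming (L to L″)
  open MarkingAlgorithm (net G G′)
  open Marking 𝕀 using (𝟎≤)
  open Marking.Correctness 𝕀 (net G G′) using (initial-invariant)
  open NetLists 𝕀 G G′
  open NetQueue 𝕀 G G′ using (module ArcLists; module Entries; over-Vmax; edge-queue; edge-queue-entries)
  open Registration 𝕀 G G′
  open MainLoop 𝕀 (net G G′)
  open Selection 𝕀
  open Finite

  extend-toℕ : ∀ {n} (f : Fin n → Carrier) i → extend f (toℕ i) ≡ f i
  extend-toℕ {n} f i with toℕ i ℕ.<? n
  ... | yes p = cong f (Fin.fromℕ<-toℕ i p)
  ... | no ¬p = contradiction (Fin.toℕ<n i) ¬p

  s₀ : State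
  s₀ = input G G′

  record Registered (s : State) : Set where
    field
      min-registered : ∀ z → MinRegistered (heap s) z
      max-registered : ∀ y → MaxRegistered (heap s) y
      kind-min-0     : ∀ z → hi (heap s) #kind (hi (heap s) #minId (1 ∷ location z) ∷ []) ≡ 0

  open Registered

  registerTime : ℕ
  registerTime = registerMinsTime + (registerMaxsTime side₁ 1 0 1 + registerMaxsTime side₂ 2 1 0)

  register-exec : Exec registerᴾ s₀ registerTime Registered
  register-exec = exec-seq (registerMins-exec refl refl) λ {s₁} F₁ mins →
    exec-seq (registerMaxs-exec side₁ 1 0 1 (hi (heap s₁) #next []) [] (λ _ _ _ → refl) refl refl
        (cong (λ f → f []) (int-frame F₁ 0 refl)) (cong (λ f → f []) (int-frame F₁ 1 refl)) (cong (λ f → f []) (int-frame F₁ 3 refl))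
        record { grown = ℕ.≤-refl ; kind-0 = λ i _ → cong (λ f → f (i ∷ [])) (int-frame F₁ (20 + #kind) refl) ; registered = λ () })
      λ {s₂} F₂ M → exec-map (λ {s₃} F₃ M′ →
        let minId≡ = trans (int-frame F₃ (20 + #minId) refl) (int-frame F₂ (20 + #minId) refl)
            id≡ = λ z → cong (λ f → f (1 ∷ location z)) minId≡ in record
        { min-registered = λ z → record
          { both    = trans (cong (λ f → f (2 ∷ toℕ (proj₂ z) ∷ toℕ (proj₁ z) ∷ [])) minId≡) (trans (both (mins z)) (sym (id≡ z)))
          ; field-X = trans (cong₂ (λ f i → f (i ∷ [])) (trans (int-frame F₃ (20 + #fX) refl) (int-frame F₂ (20 + #fX) refl)) (id≡ z)) (field-X (mins z))
          ; field-Y = trans (cong₂ (λ f i → f (i ∷ [])) (trans (int-frame F₃ (20 + #fY) refl) (int-frame F₂ (20 + #fY) refl)) (id≡ z)) (field-Y (mins z))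
          ; below   = ℕ.<-≤-trans (subst (ℕ._< hi (heap s₁) #next []) (sym (id≡ z)) (below (mins z))) (grown M′)
          }
        ; max-registered = λ y → registered M′ (every-max y)
        ; kind-min-0 = λ z → trans (cong (λ i → hi (heap s₃) #kind (i ∷ [])) (id≡ z)) (kind-0 M′ _ (below (mins z)))
        })
        (registerMaxs-exec side₂ 2 1 0 (hi (heap s₁) #next []) (sideMaxs side₁) (λ _ _ _ → refl) refl refl
          (scalar-frame F₂ 1 refl (cong (λ f → f []) (int-frame F₁ 1 refl)))
          (scalar-frame F₂ 0 refl (cong (λ f → f []) (int-frame F₁ 0 refl)))
          (scalar-frame F₂ 3 refl (cong (λ f → f []) (int-frame F₁ 3 refl))) M)
    where
    every-max : ∀ y → y ∈ sideMaxs side₁ ++ sideMaxs side₂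
    every-max (inj₁ (x , w , r)) = ∈.∈-++⁺ˡ (∈-concatMap-allFin x (∈-concatMap-allFin w (∈-concatMap-allFin r (here refl))))
    every-max (inj₂ (x , w , r)) = ∈.∈-++⁺ʳ (sideMaxs side₁) (∈-concatMap-allFin x (∈-concatMap-allFin w (∈-concatMap-allFin r (here refl))))

  module Registeredᴹ (s₁ : State) (F₁ : Frame registerᴾ s₀ s₁) (Reg : Registered s₁) where

    minTable maxTable : List ℕ → ℕ
    minTable = ints s₁ (20 + #minId)
    maxTable = ints s₁ (20 + #maxId)

    open Building 𝕀 G G′ minTable maxTable
    open Edges 𝕀 G G′ minTable maxTable
    open Labels 𝕀 G G′ minTable maxTable
    open LabelPhase 𝕀 G G′ minTable maxTable
    open Zeros 𝕀 G G′ minTable maxTable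

    idMin-injective : ∀ {x z} → idMin x ≡ idMin z → x ≡ z
    idMin-injective {x} {z} p = cong₂ _,_
      (Fin.toℕ-injective (trans (sym (field-X (min-registered Reg x))) (trans (cong (λ i → ints s₁ (20 + #fX) (i ∷ [])) p) (field-X (min-registered Reg z)))))
      (Fin.toℕ-injective (trans (sym (field-Y (min-registered Reg x))) (trans (cong (λ i → ints s₁ (20 + #fY) (i ∷ [])) p) (field-Y (min-registered Reg z)))))

    idMax-injective : ∀ {x z} → idMax x ≡ idMax z → x ≡ z
    idMax-injective {x} {z} p = Numbering.code-max-injective numbering (trans (sym (fields (max-registered Reg x)))
      (trans (cong (λ i → ints s₁ (20 + #fT) (i ∷ []) ∷ ints s₁ (20 + #fA) (i ∷ []) ∷ ints s₁ (20 + #fC) (i ∷ []) ∷ ints s₁ (20 + #fR) (i ∷ []) ∷ []) p)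
        (fields (max-registered Reg z))))

    idMin≢idMax : ∀ {x z} → idMin x ≢ idMax z
    idMin≢idMax {x} {z} p = contradiction (trans (sym (kind-min-0 Reg x)) (trans (cong (λ i → ints s₁ (20 + #kind) (i ∷ [])) p) (kind-1 (max-registered Reg z)))) λ ()

    open ArcLists idMin idMax idMin-injective idMax-injective idMin≢idMax
    module S₁ = Sides side₁
    module S₂ = Sides side₂

    min-index₂ : ∀ u w → minTable (2 ∷ toℕ u ∷ toℕ w ∷ []) ≡ idMin (w , u)
    min-index₂ u w = both (min-registered Reg (w , u))

    triples₁ : List (Fin size × Fin σE × Fin size)
    triples₁ = S₁.overEdges (λ x r y → (x , r , y) ∷ [])

    triples₂ : List (Fin size′ × Fin σE × Fin size′)
    triples₂ = S₂.overEdges (λ x r y → (x , r , y) ∷ [])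

    module E₁ = Entries side₁
    module E₂ = Entries side₂

    arcs₁ arcs₂ : List Arc
    arcs₁ = concatMap (λ (x , r , y) → A₁.edgeArcs x r y) triples₁
    arcs₂ = concatMap (λ (x , r , y) → A₂.edgeArcs x r y) triples₂

    entries₁ entries₂ : List (Object × Carrier)
    entries₁ = concatMap (λ (x , r , y) → E₁.edgeEntries x r y) triples₁
    entries₂ = concatMap (λ (x , r , y) → E₂.edgeEntries x r y) triples₂

    side-arcs : ∀ (S : Side) {b} {B : Set b} (h : Fin (Side.na S) → Fin σE → Fin (Side.na S) → List B) →
      concatMap (λ (x , r , y) → h x r y) (Sides.overEdges S (λ x r y → (x , r , y) ∷ [])) ≡ Sides.overEdges S h
    side-arcs S h = trans (Sides.concatMap-overEdges S (λ (x , r , y) → h x r y) _)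
      (List.concatMap-cong (λ x → List.concatMap-cong (λ r → List.concatMap-cong (λ y →
        cong (when (positive (Side.edges S x r y))) (List.++-identityʳ (h x r y))) (allFin _)) (allFin σE)) (allFin _))

    arcs-all : arcs₁ ++ arcs₂ ≡ arcs
    arcs-all = cong₂ _++_ (side-arcs side₁ A₁.edgeArcs) (side-arcs side₂ A₂.edgeArcs)

    rows : ℕ
    rows = size * σE + size′ * σE + size′

    buildTime : ℕ
    buildTime = edgesTime idMin-injective idMax-injective idMin≢idMax side₁ 1 2 (λ _ _ → refl) (λ _ _ _ → refl) (λ _ _ _ → refl) 0 1 2 +
      (edgesTime idMin-injective idMax-injective idMin≢idMax side₂ 2 1 min-index₂ (λ _ _ _ → refl) (λ _ _ _ → refl) 1 0 3 +
       labelsTime (λ _ _ → refl) (arcs₁ ++ arcs₂) (entries₁ ++ entries₂) (length triples₁ + length triples₂) (size * σE + size′ * σE))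

    allEntries : List (Object × Carrier)
    allEntries = (entries₁ ++ entries₂) ++ concatMap (uncurry labelEntries) labels
      where labels = labelSources (λ _ _ → refl) (arcs₁ ++ arcs₂) (entries₁ ++ entries₂) (length triples₁ + length triples₂) (size * σE + size′ * σE)

    record Built (s : State) : Set (c ⊔ ℓ₁) where
      field
        progress : ∃[ n ] n ≡ length triples₁ + length triples₂ + size′ * suc σV × Progress s (arcs₁ ++ arcs₂) allEntries n rows 0
        marked   : ∀ z → Marked s z

    weaken-entries : ∀ {s as es n R} → Progress s as es n R 0 → Progress s as (es ++ []) (n + 0) R 0
    weaken-entries {s} {as} {es} {n} {R} P = subst₂ (λ es n → Progress s as es n R 0) (sym (List.++-identityʳ es)) (sym (ℕ.+-identityʳ n)) P

    weaken-start : ∀ {s as es n R} → Progress s as es n R 0 → Progress s (as ++ []) (es ++ []) (n + 0) R 0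
    weaken-start {s} {as} {es} {n} {R} P = subst (λ as → Progress s as (es ++ []) (n + 0) R 0) (sym (List.++-identityʳ as)) (weaken-entries P)

    start : Progress s₁ [] [] 0 0 0
    start = record
      { sources = []
      -- Arrays that the registration did not write still hold 0, the right degree of a node without
      -- arcs.
      ; outs-r = record { deg-r = λ p → cong (λ f → f (p ∷ [])) (int-frame F₁ (20 + #deg) refl) ; adj-r = λ _ → Level.lift tt ; adjV-r = λ _ → Level.lift tt }
      ; ins-r = λ q → cong (λ f → f (q ∷ [])) (int-frame F₁ (20 + #count) refl)
      ; stored = record { alive⇒ = λ {i} {j} a → contradiction (subst (λ f → 1 ℕ.≤ f (i ∷ j ∷ [])) (int-frame F₁ (20 + #alive) refl) a) λ () ; each = [] ; distinct = [] }
      ; before = [] ; row-r = cong (λ f → f []) (int-frame F₁ (20 + #row) refl)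
      ; entries-r = ↭-refl ; number = refl ; min-table = refl ; max-table = refl
      }

    size≤width : size ℕ.≤ width
    size≤width = ℕ.≤-trans (ℕ.m≤m+n size size′) (ℕ.≤-trans (ℕ.m≤m+n (size + size′) σV) (ℕ.m≤m+n (size + size′ + σV) 1))

    size′≤width : size′ ℕ.≤ width
    size′≤width = ℕ.≤-trans (ℕ.m≤n+m size′ size) (ℕ.≤-trans (ℕ.m≤m+n (size + size′) σV) (ℕ.m≤m+n (size + size′ + σV) 1))

    int₁ : ∀ a → writesInt registerᴾ a ≡ false → ints s₁ a ≡ ints s₀ a
    int₁ = int-frame F₁

    build-exec : Exec buildᴾ s₁ buildTime Built
    build-exec = exec-seq
      (edges-exec idMin-injective idMax-injective idMin≢idMax side₁ 1 2 (λ _ _ → refl) (λ _ _ _ → refl) (λ _ _ _ → refl)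
        0 1 2 [] [] 0 0 size≤width refl refl refl refl (cong (λ f → f []) (int₁ 0 refl)) (cong (λ f → f []) (int₁ 1 refl)) (cong (λ f → f []) (int₁ 3 refl))
        (λ x r y → trans (cong (λ f → f (toℕ x ∷ toℕ r ∷ toℕ y ∷ [])) (val-frame F₁ 2 refl))
          (trans (extend-toℕ _ x) (trans (extend-toℕ _ r) (extend-toℕ _ y)))) start)
      λ {s₂} F₂ P → exec-seq
        (edges-exec idMin-injective idMax-injective idMin≢idMax side₂ 2 1 min-index₂ (λ _ _ _ → refl) (λ _ _ _ → refl)
          1 0 3 arcs₁ entries₁ (length triples₁) (size * σE) size′≤width refl refl refl refl
          (cong (λ f → f []) (trans (int-frame F₂ 1 refl) (int₁ 1 refl))) (cong (λ f → f []) (trans (int-frame F₂ 0 refl) (int₁ 0 refl)))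
          (cong (λ f → f []) (trans (int-frame F₂ 3 refl) (int₁ 3 refl)))
          (λ x r y → trans (cong (λ f → f (toℕ x ∷ toℕ r ∷ toℕ y ∷ [])) (trans (val-frame F₂ 3 refl) (val-frame F₁ 3 refl)))
            (trans (extend-toℕ _ x) (trans (extend-toℕ _ r) (extend-toℕ _ y)))) (weaken-start P))
        λ {s₃} F₃ P → exec-map (λ {s₄} _ (P , M) → record
            { progress = _ , cong (length triples₁ + length triples₂ +_) length-labels , P
            ; marked = λ (x , x′) → M (mark-all x x′) })
          (labels-exec (λ _ _ → refl) (arcs₁ ++ arcs₂) (entries₁ ++ entries₂) (length triples₁ + length triples₂) (size * σE + size′ * σE)
            record
              { size-in = cong (λ f → f []) (trans (int-frame F₃ 0 refl) (trans (int-frame F₂ 0 refl) (int₁ 0 refl)))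
              ; size′-in = cong (λ f → f []) (trans (int-frame F₃ 1 refl) (trans (int-frame F₂ 1 refl) (int₁ 1 refl)))
              ; σV-in = cong (λ f → f []) (trans (int-frame F₃ 2 refl) (trans (int-frame F₂ 2 refl) (int₁ 2 refl)))
              ; L-in = λ x l → trans (cong (λ f → f (toℕ x ∷ toℕ l ∷ [])) (trans (val-frame F₃ 0 refl) (trans (val-frame F₂ 0 refl) (val-frame F₁ 0 refl))))
                  (trans (extend-toℕ _ x) (extend-toℕ _ l))
              ; L′-in = λ x l → trans (cong (λ f → f (toℕ x ∷ toℕ l ∷ [])) (trans (val-frame F₃ 1 refl) (trans (val-frame F₂ 1 refl) (val-frame F₁ 1 refl))))
                  (trans (extend-toℕ _ x) (extend-toℕ _ l))
              }
            (weaken-entries P , λ ()))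
      where
      length-pairs : ∀ {n} (xs : List V′) → length (concatMap (λ x′ → concatMap (λ p → (x′ , p) ∷ []) (allFin n)) xs) ≡ length xs * n
      length-pairs [] = refl
      length-pairs {n} (x ∷ xs) = trans (List.length-++ (concatMap (λ p → (x , p) ∷ []) (allFin n)))
        (cong₂ _+_ (trans (cong length (concatMap-singleton (x ,_) (allFin n))) (trans (List.length-map (x ,_) (allFin n)) (List.length-tabulate id))) (length-pairs xs))

      length-labels : length (concatMap (λ x′ → concatMap (λ p → (x′ , p) ∷ []) (allFin (suc σV))) (allFin size′)) ≡ size′ * suc σV
      length-labels = trans (length-pairs (allFin size′)) (cong (_* suc σV) {length (allFin size′)} {size′} (List.length-tabulate id))

      mark-all : ∀ x x′ → (x , x′) ∈ concatMap (λ (x′ , p) → map (_, x′) (allFin size))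
        (concatMap (λ x′ → concatMap (λ p → (x′ , p) ∷ []) (allFin (suc σV))) (allFin size′))
      -- Column 0 exists even without vertex labels, because of the class of key 1. So every pair
      -- receives its mark.
      mark-all x x′ = ∈.∈-concatMap⁺ (λ (x′ , p) → map (_, x′) (allFin size))
        (lose (∈-concatMap-allFin x′ (∈-concatMap-allFin {f = λ p → (x′ , p) ∷ []} zero (here refl))) (∈.∈-map⁺ (_, x′) (∈.∈-allFin x)))

-- The state in which the main loop starts

module FinalRun {c ℓ₁ ℓ₂} (𝕀 : BoundedChain c ℓ₁ ℓ₂) {σV σE : ℕ} (G G′ : Gödel.FuzzyGraph 𝕀 σV σE) where

  open BoundedChain 𝕀 using (Carrier; _≈_; _≤_; 𝟎; module Eq) renaming (refl to ≤-refl)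
  open Semantics 𝕀
  open FuzzyGraph G
  open FuzzyGraph G′ renaming (V to V′; E to E′; L to L′; size to size′)
    hiding (nonEmpty)
  open MinimaxNet (net G G′) using (Vmin; Vmax; E↑; E↓; Vmin-finite; Vmax-finite) renaming (L to L″)
  open MarkingAlgorithm (net G G′)
  open Marking 𝕀 using (𝟎≤)
  open Marking.Correctness 𝕀 (net G G′) using (initial-invariant)
  open Simulation 𝕀 using (v₀; v₀′)
  open Potential 𝕀 (net G G′) using (potential)
  open NetLists 𝕀 G G′
  open NetQueue 𝕀 G G′ using (module ArcLists; module Entries; over-Vmax; edge-queue; edge-queue-entries)
  open Registration 𝕀 G G′
  open MainLoop 𝕀 (net G G′)
  open SourceLoop 𝕀 (net G G′) using (Sources; entries)
  open Main 𝕀 (net G G′)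
  open Selection 𝕀
  open Refresh 𝕀
  open Assembly 𝕀 G G′
  open Registered
  open Finite

  module Builtᴹ (s₁ : State) (F₁ : Frame registerᴾ s₀ s₁) (Reg : Registered s₁) where

    open Registeredᴹ s₁ F₁ Reg
    open Building 𝕀 G G′ minTable maxTable
    open Edges 𝕀 G G′ minTable maxTable
    open Labels 𝕀 G G′ minTable maxTable
    open LabelPhase 𝕀 G G′ minTable maxTable
    open Zeros 𝕀 G G′ minTable maxTable
    open ArcLists idMin idMax idMin-injective idMax-injective idMin≢idMax using (arcs; outs-min; outs-max; outWeights-max; ins-max)

    record Prepared (s : State) : Set (c ⊔ ℓ₂) where
      field
        pushed-p : Pushed s (sideMaxs side₁ ++ sideMaxs side₂)
        width-p  : hi (heap s) #width [] ≡ width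
        caches-p : ∀ i → i ℕ.< rows → Cached width (heap s) i
        level-p  : vals s #level [] ≡ 𝟎

    open Prepared

    prepareTime : ℕ
    prepareTime = zerosTime side₁ 1 0 1 + (zerosTime side₂ 2 1 0 + (refreshAllTime rows width + cost (setVal #level [] zeroᵥ)))

    module _ {s₂ : State} (F₂ : Frame buildᴾ s₁ s₂) (B : Built s₂) where

      sourceCount = proj₁ (Built.progress B)
      sourceCount≡ = proj₁ (proj₂ (Built.progress B))
      P = proj₂ (proj₂ (Built.progress B))

      int₂ : ∀ a → writesInt registerᴾ a ≡ false → writesInt buildᴾ a ≡ false → ints s₂ a ≡ ints s₀ a
      int₂ a p q = trans (int-frame F₂ a q) (int-frame F₁ a p)

      count≡ : ∀ y → ints s₂ (20 + #count) (idMax y ∷ []) ≡ length (predMax y)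
      count≡ y = trans (ins-r P (idMax y)) (trans (cong (λ as → length (ins (idMax y) as)) arcs-all) (ins-max y))

      pushed-frame : ∀ {P s s′ ys} → Frame P s s′ → writesInt P 20 ≡ false → writesInt P 21 ≡ false → writesInt P 22 ≡ false →
                     Pushed s ys → Pushed s′ ys
      pushed-frame F p q r (st , S , σ) = st , stack (scalar-frame F 20 p (Stack.size S))
        (subst₂ (λ A B → Cells numbering A B st) (sym (int-frame F 21 q)) (sym (int-frame F 22 r)) (Stack.cells S)) , σ

      prepare-exec : Exec prepareᴾ s₂ prepareTime Prepared
      prepare-exec = exec-seq
        (zeros-exec side₁ {s₂} 1 0 1 [] (λ _ _ _ → refl) (max-table P) count≡ refl refl
          (cong (λ f → f []) (int₂ 0 refl refl)) (cong (λ f → f []) (int₂ 1 refl refl)) (cong (λ f → f []) (int₂ 3 refl refl))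
          ([] , stack (cong (λ f → f []) (int₂ 20 refl refl)) tt , ↭-refl))
        λ {s₃} F₃ Q → exec-seq
          (zeros-exec side₂ {s₃} 2 1 0 (sideMaxs side₁) (λ _ _ _ → refl) (trans (int-frame F₃ (20 + #maxId) refl) (max-table P))
            (λ y → trans (cong (λ f → f (idMax y ∷ [])) (int-frame F₃ (20 + #count) refl)) (count≡ y)) refl refl
            (cong (λ f → f []) (trans (int-frame F₃ 1 refl) (int₂ 1 refl refl))) (cong (λ f → f []) (trans (int-frame F₃ 0 refl) (int₂ 0 refl refl)))
            (cong (λ f → f []) (trans (int-frame F₃ 3 refl) (int₂ 3 refl refl))) Q)
          λ {s₄} F₄ Q → exec-seq
            (refreshAll-exec rows width
              (cong₂ (λ a b → a + b + 1) (cong₂ _+_ (cong (λ f → f []) (trans (int-frame F₄ 0 refl) (trans (int-frame F₃ 0 refl) (int₂ 0 refl refl))))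
                  (cong (λ f → f []) (trans (int-frame F₄ 1 refl) (trans (int-frame F₃ 1 refl) (int₂ 1 refl refl)))))
                (cong (λ f → f []) (trans (int-frame F₄ 2 refl) (trans (int-frame F₃ 2 refl) (int₂ 2 refl refl)))))
              (trans (cong (λ f → f []) (trans (int-frame F₄ (20 + #row) refl) (int-frame F₃ (20 + #row) refl))) (row-r P)))
            λ {s₅} F₅ (W , K) → exec-setVal (let st , S , σ = pushed-frame {ys = sideMaxs side₁ ++ sideMaxs side₂} F₅ refl refl refl Q in record
              { pushed-p = st , record { Stack S } , σ
              ; width-p = W ; caches-p = λ i i<R → record { RowCache (K i i<R) } ; level-p = refl })

      -- The construction yields an association list, while the main loop is stated for classes
      -- given by a function of the position. Positions are distinct, so nothing is lost.
      lookup : List Source → ℕ → ℕ → List (Object × Carrier)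
      lookup [] i j = []
      lookup ((k , es) ∷ F) i j = if does (Prod.≡-dec ℕ._≟_ ℕ._≟_ k (i , j)) then es else lookup F i j

      lookup-∈ : ∀ F {i j es} → Unique (map proj₁ F) → ((i , j) , es) ∈ F → lookup F i j ≡ es
      lookup-∈ ((k , es) ∷ F) {i} {j} (k∉ ∷ u) (here refl) =
        cong (λ b → if b then es else lookup F i j) (dec-true (Prod.≡-dec ℕ._≟_ ℕ._≟_ (i , j) (i , j)) refl)
      lookup-∈ ((k , es) ∷ F) {i} {j} (k∉ ∷ u) (there e) = trans
        (cong (λ b → if b then es else lookup F i j) (dec-false (Prod.≡-dec ℕ._≟_ ℕ._≟_ k (i , j)) (All.lookup k∉ (∈.∈-map⁺ proj₁ e))))
        (lookup-∈ F u e)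

      payload : ℕ → ℕ → List (Object × Carrier)
      payload = lookup (sources P)

      srcs : List (ℕ × ℕ)
      srcs = map proj₁ (sources P)

      stored-source : ∀ {i j} → (i , j) ∈ srcs → ((i , j) , payload i j) ∈ sources P
      stored-source e with ∈.∈-map⁻ proj₁ e
      ... | (k , es) , e₁ , refl = subst (λ es → (k , es) ∈ sources P) (sym (lookup-∈ (sources P) (distinct (stored P)) e₁)) e₁

      payload-entries : entries numbering rows width payload srcs ≡ concatMap proj₂ (sources P)
      payload-entries = go (sources P) id
        where
        go : ∀ F → (∀ {e} → e ∈ F → e ∈ sources P) → concatMap (uncurry payload) (map proj₁ F) ≡ concatMap proj₂ F
        go [] f = refl
        go ((k , es) ∷ F) f = cong₂ _++_ (lookup-∈ (sources P) (distinct (stored P)) (f (here refl))) (go F (f ∘ there))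

      module _ {s₃ : State} (F₃ : Frame prepareᴾ s₂ s₃) (Q : Prepared s₃) where

        reg₃ : ∀ a → writesInt buildᴾ a ≡ false → writesInt prepareᴾ a ≡ false → ints s₃ a ≡ ints s₁ a
        reg₃ a p q = trans (int-frame F₃ a q) (int-frame F₂ a p)

        sources₃ : Sources numbering rows width payload (heap s₃) srcs
        sources₃ = record
          { alive⇒ = λ {i} {j} _ _ a → alive⇒ (stored P) (subst (λ f → 1 ℕ.≤ f (i ∷ j ∷ [])) (int-frame F₃ (20 + #alive) refl) a)
          ; ⇒alive = λ {i} {j} e → let e₁ = stored-source e in
              bounds (proj₁ (All.lookup (before P) e₁)) , proj₂ (All.lookup (before P) e₁) ,
              subst (λ f → 1 ℕ.≤ f (i ∷ j ∷ [])) (sym (int-frame F₃ (20 + #alive) refl)) (alive-r (All.lookup (each (stored P)) e₁))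
          ; distinct = distinct (stored P)
          ; plen-r = λ {i} {j} e → trans (cong (λ f → f (i ∷ j ∷ [])) (int-frame F₃ (20 + #plen) refl)) (plen-r (All.lookup (each (stored P)) (stored-source e)))
          ; payA-r = λ {i} {j} e → at-list-cong 0 _ (λ k _ → cong (λ f → f (i ∷ j ∷ k ∷ [])) (int-frame F₃ (20 + #payA) refl)) (payA-r (All.lookup (each (stored P)) (stored-source e)))
          ; payB-r = λ {i} {j} e → at-list-cong 0 _ (λ k _ → cong (λ f → f (i ∷ j ∷ k ∷ [])) (int-frame F₃ (20 + #payB) refl)) (payB-r (All.lookup (each (stored P)) (stored-source e)))
          ; key-r = λ {i} {j} e → subst (λ f → All (λ (_ , k) → k ≈ f (i ∷ j ∷ [])) (payload i j)) (sym (val-frame F₃ #key refl)) (key-r (All.lookup (each (stored P)) (stored-source e)))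
          ; row-r = scalar-frame F₃ (20 + #row) refl (row-r P)
          ; width-r = width-p Q
          }
          where
          bounds : ∀ {i j} → i ℕ.< rows ⊎ (i ≡ rows × j ℕ.< 0) → i ℕ.< rows
          bounds (inj₁ p) = p

        tables₃ : Tables numbering (static (heap s₃))
        tables₃ = record
          { kind-min = λ z → trans (cong (λ f → f (idMin z ∷ [])) (reg₃ (20 + #kind) refl refl)) (kind-min-0 Reg z)
          ; kind-max = λ y → trans (cong (λ f → f (idMax y ∷ [])) (reg₃ (20 + #kind) refl refl)) (kind-1 (max-registered Reg y))
          ; loc-min = λ z → cong₂ (λ a b → a ∷ b ∷ [])
              (trans (cong (λ f → f (idMin z ∷ [])) (reg₃ (20 + #fX) refl refl)) (field-X (min-registered Reg z)))
              (trans (cong (λ f → f (idMin z ∷ [])) (reg₃ (20 + #fY) refl refl)) (field-Y (min-registered Reg z)))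
          ; code-max = λ y → trans
              (cong₂ _∷_ (cong (λ f → f (idMax y ∷ [])) (reg₃ (20 + #fT) refl refl))
                (cong₂ _∷_ (cong (λ f → f (idMax y ∷ [])) (reg₃ (20 + #fA) refl refl))
                  (cong₂ (λ a b → a ∷ b ∷ []) (cong (λ f → f (idMax y ∷ [])) (reg₃ (20 + #fC) refl refl))
                    (cong (λ f → f (idMax y ∷ [])) (reg₃ (20 + #fR) refl refl)))))
              (fields (max-registered Reg y))
          ; deg-min = λ z → degree (idMin z) (trans (cong (λ as → length (outs (idMin z) as)) arcs-all)
              (trans (cong length (outs-min z)) (List.length-map idMax (succMin z))))
          ; deg-max = λ y → degree (idMax y) (trans (cong (λ as → length (outs (idMax y) as)) arcs-all)
              (trans (cong length (outs-max y)) (List.length-map idMin (succMax y))))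
          ; adj-min = λ z → adjacent (idMin z) (trans (cong (outs (idMin z)) arcs-all) (outs-min z))
          ; adj-max = λ y → adjacent (idMax y) (trans (cong (outs (idMax y)) arcs-all) (outs-max y))
          ; adjV-max = λ y → at-list-cong 0 _ (λ k _ → cong (λ f → f (idMax y ∷ k ∷ [])) (val-frame F₃ #adjV refl))
              (subst (at-list (λ k → vals s₂ #adjV (idMax y ∷ k ∷ [])) 0) (trans (cong (outWeights (idMax y)) arcs-all) (outWeights-max y)) (adjV-r (outs-r P) (idMax y)))
          }
          where
          degree : ∀ p {n} → length (outs p (arcs₁ ++ arcs₂)) ≡ n → ints s₃ (20 + #deg) (p ∷ []) ≡ n
          degree p q = trans (cong (λ f → f (p ∷ [])) (int-frame F₃ (20 + #deg) refl)) (trans (deg-r (outs-r P) p) q)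

          adjacent : ∀ p {xs} → outs p (arcs₁ ++ arcs₂) ≡ xs → at-list (λ k → ints s₃ (20 + #adj) (p ∷ k ∷ [])) 0 xs
          adjacent p q = at-list-cong 0 _ (λ k _ → cong (λ f → f (p ∷ k ∷ [])) (int-frame F₃ (20 + #adj) refl))
            (subst (at-list (λ k → ints s₂ (20 + #adj) (p ∷ k ∷ [])) 0) q (adj-r (outs-r P) p))

        int₃ : ∀ a → writesInt registerᴾ a ≡ false → writesInt buildᴾ a ≡ false → writesInt prepareᴾ a ≡ false → ints s₃ a ≡ ints s₀ a
        int₃ a p q r = trans (int-frame F₃ a r) (int₂ a p q)

        dynamic₃ : Dynamic numbering (heap s₃) initial
        dynamic₃ = record
          -- No earlier phase writes the two arrays of flags, and the 0 of the initial memory reads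
          -- as `false`. The flags of all pairs are thus initialised at no cost.
          { done-r  = λ z → cong (λ f → f (idMin z ∷ [])) (int₃ (20 + #done) refl refl refl)
          ; edone-r = λ (z , y) → cong (λ f → f (idMin z ∷ idMax y ∷ [])) (int₃ (20 + #edone) refl refl refl)
          ; count-r = λ y → trans (cong (λ f → f (idMax y ∷ [])) (int-frame F₃ (20 + #count) refl)) (count≡ y)
          ; mark-r  = λ z → Eq.trans (Eq.reflexive (cong (λ f → f (location z)) (val-frame F₃ #result refl))) (Built.marked B z)
          }

        maxs≡ : map (λ y → Object.maxNode y , 𝟎) (filter (λ y → length (predMax y) ℕ.≟ 0) (elements Vmax-finite)) ≡
                zeroEntries (sideMaxs side₁ ++ sideMaxs side₂)
        maxs≡ = trans (map-filter (λ y → length (predMax y) ℕ.≟ 0) (λ y → Object.maxNode y , 𝟎) (elements Vmax-finite))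
          (cong zeroEntries (trans (sym (List.concatMap-pure (elements Vmax-finite))) (over-Vmax (λ y → y ∷ []))))

        labels≡ : concatMap (uncurry labelEntries) (concatMap (λ x′ → concatMap (λ p → (x′ , p) ∷ []) (allFin (suc σV))) (allFin size′)) ≡
                  concatMap (λ x′ → concatMap (labelEntries x′) (allFin (suc σV))) (allFin size′)
        labels≡ = trans (concatMap-concatMap (uncurry labelEntries) (λ x′ → concatMap (λ p → (x′ , p) ∷ []) (allFin (suc σV))) (allFin size′))
          (List.concatMap-cong (λ x′ → trans (concatMap-concatMap (uncurry labelEntries) (λ p → (x′ , p) ∷ []) (allFin (suc σV)))
            (List.concatMap-cong (λ p → List.++-identityʳ (labelEntries x′ p)) (allFin (suc σV)))) (allFin size′))

        -- The nodes of key 0 move to the front and become the stack. What remains is regrouped by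
        -- class, separately for the edges and for the nodes of Vmin.
        queue≡ : queue initial ↭ proj₁ (pushed-p Q) ++ entries numbering rows width payload srcs
        queue≡ = begin
          mins ++ (maxs ++ edge-queue)              ↭⟨ Perm.shifts mins maxs ⟩
          maxs ++ (mins ++ edge-queue)              ≡⟨ cong (_++ (mins ++ edge-queue)) maxs≡ ⟩
          zeroEntries (sideMaxs side₁ ++ sideMaxs side₂) ++ (mins ++ edge-queue)
            ↭⟨ Perm.++⁺ (↭-sym (proj₂ (proj₂ (pushed-p Q)))) (Perm.++-comm mins edge-queue) ⟩
          proj₁ (pushed-p Q) ++ (edge-queue ++ mins)
            ↭⟨ Perm.++⁺ˡ (proj₁ (pushed-p Q)) (Perm.++⁺ edge-queue-entries min-queue-entries) ⟩
          proj₁ (pushed-p Q) ++ ((Entries.sideEntries side₁ ++ Entries.sideEntries side₂) ++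
            concatMap (λ x′ → concatMap (labelEntries x′) (allFin (suc σV))) (allFin size′))
            ≡⟨ cong (proj₁ (pushed-p Q) ++_) (cong₂ _++_ (cong₂ _++_ (sym (side-arcs side₁ E₁.edgeEntries)) (sym (side-arcs side₂ E₂.edgeEntries))) (sym labels≡)) ⟩
          proj₁ (pushed-p Q) ++ allEntries          ↭⟨ Perm.++⁺ˡ (proj₁ (pushed-p Q)) (↭-sym (entries-r P)) ⟩
          proj₁ (pushed-p Q) ++ concatMap proj₂ (sources P)  ≡⟨ cong (proj₁ (pushed-p Q) ++_) (sym payload-entries) ⟩
          proj₁ (pushed-p Q) ++ entries numbering rows width payload srcs ∎
          where
          open Perm.PermutationReasoning
          mins = map (λ z → Object.minNode z , L″ z) (elements Vmin-finite)
          maxs = map (λ y → Object.maxNode y , 𝟎) (filter (λ y → length (predMax y) ℕ.≟ 0) (elements Vmax-finite))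

        low₃ : All (λ (_ , k) → k ≤ 𝟎) (proj₁ (pushed-p Q))
        low₃ = Perm.All-resp-↭ (↭-sym (proj₂ (proj₂ (pushed-p Q)))) (zero-keys (sideMaxs side₁ ++ sideMaxs side₂))
          where
          zero-keys : ∀ ys → All (λ (_ , k) → k ≤ 𝟎) (zeroEntries ys)
          zero-keys [] = []
          zero-keys (y ∷ ys) with does (length (predMax y) ℕ.≟ 0)
          ... | true  = ≤-refl ∷ zero-keys ys
          ... | false = zero-keys ys

        steady₃ : Steady numbering rows width payload s₃ initial (entries numbering rows width payload srcs) 𝟎
        steady₃ = [] , represents tables₃ dynamic₃ (proj₁ (proj₂ (pushed-p Q))) queue≡ low₃ (level-p Q)
            (trans (out-frame F₃ refl) (trans (out-frame F₂ refl) (out-frame F₁ refl))) ,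
          (𝟎 , initial-invariant (v₀ G G′ , v₀′ G G′)) , (λ _ → 𝟎≤) , [] , refl , id

        main₃ : Exec mainᴾ s₃ (3 + budget numbering rows width payload initial srcs) (Done numbering rows width payload)
        main₃ = main-exec numbering rows width payload steady₃ sources₃ (caches-p Q)
          (cong (λ f → f []) (int₃ (20 + #stopped) refl refl refl))

        implementation : ∀ {s₄ T} → Done numbering rows width payload s₄ → ∀ {t} → ⟨ algorithmᴾ , s₀ ⟩⇓[ t ] s₄ → t ℕ.≤ T →
                         ∃[ t ] Implements G G′ algorithmᴾ t × t ℕ.≤ T
        implementation (C , objs , run , out≡ , marks) halts t≤ = _ , record
          { halts = halts ; execution = returns run ; trace = out≡ ; result = λ x x′ → marks (x , x′) } , t≤

-- Time bounds

-- The part `f * p x` depends on the item and is summed over the loop instead of being bounded for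
-- each iteration. With p the number of positive edges met, the loops over the edge tables cost O(n²
-- + mn) rather than O(n³).
forTime-sum : ∀ {a} {A : Set a} N {T p : A → ℕ} {b f} xs → (∀ x → T x ℕ.≤ b + f * p x) →
              forTime N (map T xs) ℕ.≤ (8 + intTime N + b) * suc (length xs) + f * sum (map p xs)
forTime-sum N {T} {p} {b} {f} [] h = begin
  8 + intTime N + 0                      ≡⟨ ℕ.+-identityʳ _ ⟩
  8 + intTime N                          ≤⟨ ℕ.m≤m+n (8 + intTime N) b ⟩
  8 + intTime N + b                      ≡⟨ ℕ.*-identityʳ _ ⟨
  (8 + intTime N + b) * 1                ≤⟨ ℕ.m≤m+n _ (f * 0) ⟩
  (8 + intTime N + b) * 1 + f * 0        ∎
  where open ℕ.≤-Reasoning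
forTime-sum N {T} {p} {b} {f} (x ∷ xs) h = begin
  8 + intTime N + (8 + intTime N + T x + rest)
    ≡⟨ swap₁ (8 + intTime N) (T x) rest ⟩
  8 + intTime N + T x + (8 + intTime N + rest)
    ≤⟨ ℕ.+-mono-≤ (ℕ.+-monoʳ-≤ (8 + intTime N) (h x)) (forTime-sum N {p = p} {b} {f} xs h) ⟩
  8 + intTime N + (b + f * p x) + ((8 + intTime N + b) * suc (length xs) + f * sum (map p xs))
    ≡⟨ swap₂ (8 + intTime N) b f (p x) (length xs) (sum (map p xs)) ⟩
  (8 + intTime N + b) * suc (suc (length xs)) + f * (p x + sum (map p xs)) ∎
  where
  open ℕ.≤-Reasoning
  rest = sum (map (8 + intTime N +_) (map T xs))

  swap₁ : ∀ a t r → a + (a + t + r) ≡ a + t + (a + r)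
  swap₁ = solve-∀

  swap₂ : ∀ a b f p l s → a + (b + f * p) + ((a + b) * suc l + f * s) ≡ (a + b) * suc (suc l) + f * (p + s)
  swap₂ = solve-∀

forTime-≤ : ∀ {a} {A : Set a} N {T : A → ℕ} {b} xs → (∀ x → T x ℕ.≤ b) →
            forTime N (map T xs) ℕ.≤ (8 + intTime N + b) * suc (length xs)
forTime-≤ N {T} {b} xs h = ℕ.≤-trans (forTime-sum N {p = λ _ → 0} {f = 0} xs λ x → ℕ.≤-trans (h x) (ℕ.m≤m+n b 0))
  (ℕ.≤-reflexive (ℕ.+-identityʳ _))

-- The 2 comes from `suc-double`: with l items and l ≤ n, 1 ≤ n, the l + 1 tests number at most 2n.
loop : IntExp → ℕ → ℕ
loop N c = 2 * (8 + intTime N + c)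

suc-double : ∀ {l n} → l ℕ.≤ n → 1 ℕ.≤ n → suc l ℕ.≤ 2 * n
suc-double {l} {n} l≤n 1≤n = ℕ.+-mono-≤ 1≤n (ℕ.≤-trans l≤n (ℕ.m≤m+n n 0))

loop-linear : ∀ {a} {A : Set a} N {T : A → ℕ} {c n} xs → length xs ℕ.≤ n → 1 ℕ.≤ n → (∀ x → T x ℕ.≤ c) →
              forTime N (map T xs) ℕ.≤ loop N c * n
loop-linear N {c = c} {n} xs l≤n 1≤n h = ℕ.≤-trans (forTime-≤ N xs h)
  (ℕ.≤-trans (ℕ.*-monoʳ-≤ (8 + intTime N + c) (suc-double l≤n 1≤n)) (ℕ.≤-reflexive (rearrange (8 + intTime N + c) n)))
  where
  rearrange : ∀ a n → a * (2 * n) ≡ 2 * a * n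
  rearrange = solve-∀

absorb : ∀ a c n → 1 ℕ.≤ n → a + c * n ℕ.≤ (a + c) * n
absorb a c n 1≤n = ℕ.≤-trans (ℕ.+-monoˡ-≤ (c * n) (ℕ.m≤m*n a n {{ℕ.>-nonZero 1≤n}})) (ℕ.≤-reflexive (sym (ℕ.*-distribʳ-+ n a c)))

loop-quadratic : ∀ {a} {A : Set a} N {T : A → ℕ} {c n} xs → length xs ℕ.≤ n → 1 ℕ.≤ n → (∀ x → T x ℕ.≤ c * n) →
                 forTime N (map T xs) ℕ.≤ loop N c * (n * n)
loop-quadratic N {c = c} {n} xs l≤n 1≤n h = begin
  forTime N (map _ xs)                          ≤⟨ forTime-≤ N xs h ⟩
  (8 + intTime N + c * n) * suc (length xs)     ≤⟨ ℕ.*-mono-≤ (absorb (8 + intTime N) c n 1≤n) (suc-double l≤n 1≤n) ⟩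
  (8 + intTime N + c) * n * (2 * n)             ≡⟨ rearrange (8 + intTime N + c) n ⟩
  loop N c * (n * n)                            ∎
  where
  open ℕ.≤-Reasoning
  rearrange : ∀ a n → a * n * (2 * n) ≡ 2 * a * (n * n)
  rearrange = solve-∀

-- For loops over the signature, whose number of iterations is absorbed in the constant.
fixedLoop : IntExp → ℕ → ℕ → ℕ
fixedLoop N q c = (8 + intTime N + c) * suc q

loop-fixed : ∀ {a} {A : Set a} N {T : A → ℕ} {c n} xs → 1 ℕ.≤ n → (∀ x → T x ℕ.≤ c * n) →
             forTime N (map T xs) ℕ.≤ fixedLoop N (length xs) c * n
loop-fixed N {c = c} {n} xs 1≤n h = ℕ.≤-trans (forTime-≤ N xs h)
  (ℕ.≤-trans (ℕ.*-monoˡ-≤ (suc (length xs)) (absorb (8 + intTime N) c n 1≤n)) (ℕ.≤-reflexive (rearrange (8 + intTime N + c) n (suc (length xs)))))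
  where
  rearrange : ∀ a n q → a * n * q ≡ a * q * n
  rearrange = solve-∀

length-concatMap : ∀ {a b} {A : Set a} {B : Set b} (f : A → List B) xs → length (concatMap f xs) ≡ sum (map (length ∘ f) xs)
length-concatMap f [] = refl
length-concatMap f (x ∷ xs) = trans (List.length-++ (f x)) (cong (length (f x) +_) (length-concatMap f xs))

length-concatMap-const : ∀ {a b} {A : Set a} {B : Set b} {f : A → List B} {n} xs → (∀ x → length (f x) ≡ n) →
                         length (concatMap f xs) ≡ length xs * n
length-concatMap-const [] h = refl
length-concatMap-const {f = f} (x ∷ xs) h = trans (List.length-++ (f x)) (cong₂ _+_ (h x) (length-concatMap-const xs h))

sum-cong : ∀ {a} {A : Set a} {f g : A → ℕ} xs → (∀ x → f x ≡ g x) → sum (map f xs) ≡ sum (map g xs)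
sum-cong xs h = cong sum (List.map-cong h xs)

sum-mono : ∀ {a} {A : Set a} {f g : A → ℕ} xs → (∀ x → f x ℕ.≤ g x) → sum (map f xs) ℕ.≤ sum (map g xs)
sum-mono [] h = z≤n
sum-mono (x ∷ xs) h = ℕ.+-mono-≤ (h x) (sum-mono xs h)

sum-filter : ∀ {a p} {A : Set a} {P : A → Set p} (P? : ∀ x → Dec (P x)) (f : A → ℕ) xs → sum (map f (filter P? xs)) ℕ.≤ sum (map f xs)
sum-filter P? f [] = z≤n
sum-filter P? f (x ∷ xs) with does (P? x)
... | true  = ℕ.+-monoʳ-≤ (f x) (sum-filter P? f xs)
... | false = ℕ.≤-trans (sum-filter P? f xs) (ℕ.m≤n+m _ (f x))

sum-suc-double : ∀ {a} {A : Set a} (f : A → ℕ) xs → sum (map (λ x → 1 + (f x + f x)) xs) ≡ length xs + 2 * sum (map f xs)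
sum-suc-double f [] = refl
sum-suc-double f (x ∷ xs) = trans (cong (1 + (f x + f x) +_) (sum-suc-double f xs)) (rearrange (f x) (length xs) (sum (map f xs)))
  where
  rearrange : ∀ a l s → 1 + (a + a) + (l + 2 * s) ≡ 1 + l + 2 * (a + s)
  rearrange = solve-∀

-- Size of the net in terms of the two graphs

module Counting {c ℓ₁ ℓ₂} (𝕀 : BoundedChain c ℓ₁ ℓ₂) {σV σE : ℕ} (G G′ : Gödel.FuzzyGraph 𝕀 σV σE) where

  open BoundedChain 𝕀 using (Carrier; 𝟎)
  open Gödel 𝕀
  open FuzzyGraph G
  open FuzzyGraph G′ renaming (V to V′; E to E′; L to L′; size to size′)
    hiding (nonEmpty)
  open MinimaxNet (net G G′) using (Vmin; Vmax; E↑; E↓; Vmin-finite; Vmax-finite) renaming (L to L″)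
  open MarkingAlgorithm (net G G′)
  open Potential 𝕀 (net G G′)
  open NetLists 𝕀 G G′ hiding (weight)
  open NetQueue 𝕀 G G′
  open Finite

  m₁ m₂ n : ℕ
  m₁ = positiveEdges G
  m₂ = positiveEdges G′
  n = size + size′

  module SideCount (S : Side) where
    open Side S
    open Sides S

    triples : List (Fin na × Fin σE × Fin na)
    triples = overEdges (λ x r y → (x , r , y) ∷ [])

    overEdges-triples : ∀ {a} {A : Set a} (f : Fin na → Fin σE → Fin na → List A) →
                        concatMap (λ (x , r , y) → f x r y) triples ≡ overEdges f
    overEdges-triples f = trans (concatMap-overEdges (λ (x , r , y) → f x r y) _)
      (List.concatMap-cong (λ x → List.concatMap-cong (λ r → List.concatMap-cong (λ y →
        cong (when (positive (edges x r y))) (List.++-identityʳ (f x r y))) (allFin na)) (allFin σE)) (allFin na))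

    length-overEdges : ∀ {a} {A : Set a} {k} (f : Fin na → Fin σE → Fin na → List A) → (∀ x r y → length (f x r y) ≡ k) →
                       length (overEdges f) ≡ length triples * k
    length-overEdges f h = trans (cong length (sym (overEdges-triples f))) (length-concatMap-const triples λ (x , r , y) → h x r y)

  module T₁ = SideCount side₁
  module T₂ = SideCount side₂

  length-positive : ∀ {A : Set} {B : Set} {C : Set} (e : A → B → C → Carrier) as bs cs →
    length (filter (λ (x , r , y) → e x r y >? 𝟎) (cartesianProduct as (cartesianProduct bs cs))) ≡
    length (concatMap (λ x → concatMap (λ r → concatMap (λ y → when (positive (e x r y)) ((x , r , y) ∷ [])) cs) bs) as)
  length-positive e as bs cs = cong length (trans (sym (List.map-id (filter (λ (x , r , y) → e x r y >? 𝟎) (cartesianProduct as (cartesianProduct bs cs))))) (trans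
    (map-filter (λ (x , r , y) → e x r y >? 𝟎) id (cartesianProduct as (cartesianProduct bs cs)))
    (trans (concatMap-cartesianProduct _ as (cartesianProduct bs cs))
      (List.concatMap-cong (λ x → concatMap-cartesianProduct _ bs cs) as))))

  triples₁-positive : length T₁.triples ≡ m₁
  triples₁-positive = sym (length-positive E (allFin size) (allFin σE) (allFin size))

  triples₂-positive : length T₂.triples ≡ m₂
  triples₂-positive = sym (length-positive E′ (allFin size′) (allFin σE) (allFin size′))

  length-allFin : ∀ k → length (allFin k) ≡ k
  length-allFin k = List.length-tabulate id

  length-sideEntries : ∀ (S : Side) → length (Entries.sideEntries S) ≡ length (SideCount.triples S) * Side.nb S
  length-sideEntries S = SideCount.length-overEdges S (Entries.edgeEntries S) λ x r y →
    trans (length-concatMap-const {n = 1} (allFin (Side.nb S)) (λ _ → refl)) (trans (ℕ.*-identityʳ _) (length-allFin (Side.nb S)))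

  length-edge-queue : length edge-queue ≡ m₁ * size′ + m₂ * size
  length-edge-queue = trans (Perm.↭-length edge-queue-entries) (trans (List.length-++ (Entries.sideEntries side₁))
    (cong₂ _+_ (trans (length-sideEntries side₁) (cong (_* size′) triples₁-positive))
      (trans (length-sideEntries side₂) (cong (_* size) triples₂-positive))))

  length-Vmin : length (elements Vmin-finite) ≡ size * size′
  length-Vmin = trans (cong length (sym (List.concatMap-pure (elements Vmin-finite)))) (trans (cong length (over-Vmin (λ z → z ∷ [])))
    (trans (length-concatMap-const {n = size′} (allFin size) (λ x → trans (length-concatMap-const {n = 1} (allFin size′) (λ _ → refl))
      (trans (ℕ.*-identityʳ _) (length-allFin size′)))) (cong (_* size′) (length-allFin size))))

  length-Vmax : length (elements Vmax-finite) ≡ size * (size′ * σE) + size′ * (size * σE)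
  length-Vmax = trans (cong length (sym (List.concatMap-pure (elements Vmax-finite)))) (trans (cong length (over-Vmax (λ z → z ∷ [])))
    (trans (List.length-++ (concatMap (λ x → concatMap (λ y′ → concatMap (λ r → inj₁ (x , y′ , r) ∷ []) (allFin σE)) (allFin size′)) (allFin size)))
      (cong₂ _+_ (grid (λ x y r → inj₁ (x , y , r))) (grid (λ x y r → inj₂ (x , y , r))))))
    where
    grid : ∀ {a b} (f : Fin a → Fin b → Fin σE → Vmax) →
      length (concatMap (λ x → concatMap (λ y → concatMap (λ r → f x y r ∷ []) (allFin σE)) (allFin b)) (allFin a)) ≡ a * (b * σE)
    grid {a} {b} f = trans (length-concatMap-const {n = b * σE} (allFin a) λ x → trans (length-concatMap-const {n = σE} (allFin b) λ y →
      trans (length-concatMap-const {n = 1} (allFin σE) (λ _ → refl)) (trans (ℕ.*-identityʳ _) (length-allFin σE)))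
        (cong (_* σE) (length-allFin b))) (cong (_* (b * σE)) (length-allFin a))

  -- The queue of edges contains every positive edge from Vmin once, so its length, already known
  -- from the grouping by edges of the graphs, is this sum.
  sum-succMin : sum (map (λ z → length (succMin z)) (elements Vmin-finite)) ≡ m₁ * size′ + m₂ * size
  sum-succMin = trans (sym (trans (cong length edge≡) (trans (length-concatMap _ (elements Vmin-finite))
      (sum-cong (elements Vmin-finite) λ z → List.length-map _ (succMin z))))) length-edge-queue
    where
    edge≡ : edge-queue ≡ concatMap (λ z → map (λ v → edge z v , E↑ z v) (succMin z)) (elements Vmin-finite)
    edge≡ = trans (map-filter (λ (z , y) → E↑ z y >? 𝟎) (λ (z , y) → edge z y , E↑ z y) (cartesianProduct (elements Vmin-finite) (elements Vmax-finite)))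
      (trans (concatMap-cartesianProduct _ (elements Vmin-finite) (elements Vmax-finite))
        (List.concatMap-cong (λ z → sym (map-filter (λ v → E↑ z v >? 𝟎) (λ v → edge z v , E↑ z v) (elements Vmax-finite))) (elements Vmin-finite)))

  module _ (S : Side) {X : Set} where
    open Side S
    open Sides S

    -- The order in which the successors of the nodes mkMax′ u y r are listed differs from that of overEdges.
    reorder : (f : Fin na → X) →
      concatMap (λ y → concatMap (λ r → concatMap (λ x → when (positive (edges x r y)) (f x ∷ [])) (allFin na)) (allFin σE)) (allFin na) ↭
      overEdges (λ x r y → f x ∷ [])
    reorder f = begin
      concatMap (λ y → concatMap (λ r → concatMap (λ x → g x r y) (allFin na)) (allFin σE)) (allFin na)
        ↭⟨ concatMap-cong-↭ (allFin na) (λ y → concatMap-swap (λ r x → g x r y) (allFin σE) (allFin na)) ⟩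
      concatMap (λ y → concatMap (λ x → concatMap (λ r → g x r y) (allFin σE)) (allFin na)) (allFin na)
        ↭⟨ concatMap-swap (λ y x → concatMap (λ r → g x r y) (allFin σE)) (allFin na) (allFin na) ⟩
      concatMap (λ x → concatMap (λ y → concatMap (λ r → g x r y) (allFin σE)) (allFin na)) (allFin na)
        ↭⟨ concatMap-cong-↭ (allFin na) (λ x → concatMap-swap (λ y r → g x r y) (allFin na) (allFin σE)) ⟩
      concatMap (λ x → concatMap (λ r → concatMap (λ y → g x r y) (allFin na)) (allFin σE)) (allFin na) ∎
      where
      open Perm.PermutationReasoning
      g : Fin na → Fin σE → Fin na → List X
      g x r y = when (positive (edges x r y)) (f x ∷ [])

  sum-succMax : sum (map (λ y → length (succMax y)) (elements Vmax-finite)) ≡ size * m₂ + size′ * m₁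
  sum-succMax = trans (sym (length-concatMap succMax (elements Vmax-finite))) (trans (cong length (over-Vmax succMax))
    (trans (List.length-++ (concatMap (λ x → concatMap (λ w → concatMap (λ r → succMax (inj₁ (x , w , r))) (allFin σE)) (allFin size′)) (allFin size)))
      (cong₂ _+_
        (trans (length-concatMap-const {n = m₂} (allFin size) λ x → trans (cong length (List.concatMap-cong (λ w → List.concatMap-cong (λ r →
              trans (sym (List.map-id _)) (over-succMax₁ id x w r)) (allFin σE)) (allFin size′)))
            (trans (Perm.↭-length (reorder side₂ (x ,_)))
              (trans (T₂.length-overEdges {k = 1} (λ x′ r w → (x , x′) ∷ []) (λ _ _ _ → refl)) (trans (ℕ.*-identityʳ _) triples₂-positive))))
          (cong (_* m₂) (length-allFin size)))
        (trans (length-concatMap-const {n = m₁} (allFin size′) λ x′ → trans (cong length (List.concatMap-cong (λ y → List.concatMap-cong (λ r →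
              trans (sym (List.map-id _)) (over-succMax₂ id x′ y r)) (allFin σE)) (allFin size)))
            (trans (Perm.↭-length (reorder side₁ (_, x′)))
              (trans (T₁.length-overEdges {k = 1} (λ x r y → (x , x′) ∷ []) (λ _ _ _ → refl)) (trans (ℕ.*-identityʳ _) triples₁-positive))))
          (cong (_* m₁) (length-allFin size′))))))

  sum-weight : sum (map (weight ∘ maxNode) (elements Vmax-finite)) ≡
               size * (size′ * σE) + size′ * (size * σE) + 2 * (size * m₂ + size′ * m₁)
  sum-weight = trans (sum-suc-double (λ y → length (succMax y)) (elements Vmax-finite)) (cong₂ (λ a b → a + 2 * b) length-Vmax sum-succMax)

  -- A node of Vmax has its weight either in the queue or in `maxWeight`. Both parts are bounded by
  -- the sum over all nodes, at the price of a factor 2.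
  potential-initial : potential initial ℕ.≤
    size * size′ + (sum (map (weight ∘ maxNode) (elements Vmax-finite)) + (m₁ * size′ + m₂ * size)) +
    sum (map (weight ∘ maxNode) (elements Vmax-finite)) + (m₁ * size′ + m₂ * size)
  potential-initial = ℕ.+-mono-≤ (ℕ.+-mono-≤ queue≤ (sum-mono (elements Vmax-finite) max≤)) (ℕ.≤-reflexive sum-succMin)
    where
    ones : ∀ {A : Set} (f : A → Object × Carrier) xs → (∀ x → weight (proj₁ (f x)) ≡ 1) → queueWeight (map f xs) ≡ length xs
    ones f [] h = refl
    ones f (x ∷ xs) h = cong₂ _+_ (h x) (ones f xs h)

    queueWeight-++ : ∀ xs ys → queueWeight (xs ++ ys) ≡ queueWeight xs + queueWeight ys
    queueWeight-++ xs ys = trans (cong sum (List.map-++ (weight ∘ proj₁) xs ys)) (sum-++ (map (weight ∘ proj₁) xs) (map (weight ∘ proj₁) ys))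

    mins = map (λ x → Object.minNode x , L″ x) (elements Vmin-finite)
    maxs = map (λ y → Object.maxNode y , 𝟎) (filter (λ y → length (predMax y) ℕ.≟ 0) (elements Vmax-finite))

    queue≤ : queueWeight (queue initial) ℕ.≤ size * size′ + (sum (map (weight ∘ maxNode) (elements Vmax-finite)) + (m₁ * size′ + m₂ * size))
    queue≤ = ℕ.≤-trans (ℕ.≤-reflexive (trans (queueWeight-++ mins (maxs ++ edge-queue)) (cong (queueWeight mins +_) (queueWeight-++ maxs edge-queue))))
      (ℕ.+-mono-≤ (ℕ.≤-reflexive (trans (ones _ (elements Vmin-finite) (λ _ → refl)) length-Vmin))
        (ℕ.+-mono-≤ (ℕ.≤-trans (ℕ.≤-reflexive (cong sum (sym (List.map-∘ (filter (λ y → length (predMax y) ℕ.≟ 0) (elements Vmax-finite))))))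
            (sum-filter (λ y → length (predMax y) ℕ.≟ 0) (weight ∘ maxNode) (elements Vmax-finite)))
          (ℕ.≤-reflexive (trans (ones _ (filter (λ (z , y) → E↑ z y >? 𝟎) (cartesianProduct (elements Vmin-finite) (elements Vmax-finite))) (λ _ → refl))
            (trans (sym (List.length-map _ (filter (λ (z , y) → E↑ z y >? 𝟎) (cartesianProduct (elements Vmin-finite) (elements Vmax-finite))))) length-edge-queue)))))

    max≤ : ∀ y → (if does (length (predMax y) ℕ.≟ 0) then 0 else weight (maxNode y)) ℕ.≤ weight (maxNode y)
    max≤ y with does (length (predMax y) ℕ.≟ 0)
    ... | true  = z≤n
    ... | false = ℕ.≤-refl

-- Reading a scalar takes the same time whatever its name, so `int 0 []` stands for any of the
-- scalar loop bounds.
gridBound : ℕ → ℕ → ℕ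
gridBound σE c = loop (int 0 []) (loop (int 0 []) ((9 + c) * suc σE))

-- Constants in terms of the signature alone. In `budgetBound`, 203 is `drainUnit`, 4σE + 7 comes
-- from the initial potential, 2σE + 2 from the length of the queue and σV + 2 from the number of
-- classes. The plain numerals, such as 400 for a selection, are rounded upper bounds of closed
-- expressions and are checked by evaluation.
minsBound refreshBound edgeRowBound edgesBound labelStepBound sourceBound labelsBound selectBound roundBound budgetBound : (σV σE : ℕ) → ℕ
registerBound buildBound prepareBound timeBound : (σV σE : ℕ) → ℕ
minsBound σV σE    = loop (int 0 []) (loop (int 1 []) (cost registerMinᴾ))
refreshBound σV σE = 50 + (10 + (100 + 200 * (σV + 3))) * (σE + 2)
edgeRowBound σV σE = (9 + (2 * (9 + 20) + 4)) * suc σE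
edgesBound σV σE   = loop (int 0 []) (edgeRowBound σV σE) + (50 + loop (int 0 []) (cost (pairᴾ 1 2)))
labelStepBound σV σE = 100 + 40 * suc σV
sourceBound σV σE  = 100 + loop (int 0 []) (labelStepBound σV σE)
labelsBound σV σE  = loop (int 1 []) (fixedLoop (int 2 [] ⊕ lit 1) (suc σV) (sourceBound σV σE) + 4)
selectBound σV σE  = 400
roundBound σV σE   = 6 + selectBound σV σE * (σE + 2 + (σV + 3))
budgetBound σV σE  = 203 * (4 * σE + 7) + selectBound σV σE * (2 * σE + 2) + (σV + 2) * roundBound σV σE
registerBound σV σE = minsBound σV σE + (gridBound σE (cost (registerMaxᴾ 1)) + gridBound σE (cost (registerMaxᴾ 2)))
buildBound σV σE   = edgesBound σV σE + (edgesBound σV σE + labelsBound σV σE)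
prepareBound σV σE = gridBound σE (cost (zeroStepᴾ 1)) + (gridBound σE (cost (zeroStepᴾ 2)) + (refreshBound σV σE + 3))
timeBound σV σE    = registerBound σV σE + (buildBound σV σE + (prepareBound σV σE + (3 + budgetBound σV σE)))

-- Time bounds for the phases

module Bounds {c ℓ₁ ℓ₂} (𝕀 : BoundedChain c ℓ₁ ℓ₂) {σV σE : ℕ} (G G′ : Gödel.FuzzyGraph 𝕀 σV σE) where

  open Semantics 𝕀
  open FuzzyGraph G
  open FuzzyGraph G′ renaming (V to V′; E to E′; L to L′; size to size′)
    hiding (nonEmpty)
  open MarkingAlgorithm (net G G′)
  open Potential 𝕀 (net G G′) using (potential)
  open NetLists 𝕀 G G′
  open NetQueue 𝕀 G G′
  open Counting 𝕀 G G′
  open Selection 𝕀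
  open Refresh 𝕀
  open Registration 𝕀 G G′
  open SourceLoop 𝕀 (net G G′) using (entries)
  open Main 𝕀 (net G G′)
  open Assembly 𝕀 G G′
  open FinalRun 𝕀 G G′
  open Finite

  m B : ℕ
  m = m₁ + m₂
  B = (m + n) * n

  size≤n : size ℕ.≤ n
  size≤n = ℕ.m≤m+n size size′

  size′≤n : size′ ℕ.≤ n
  size′≤n = ℕ.m≤n+m size′ size

  1≤n : 1 ℕ.≤ n
  1≤n = ℕ.≤-trans (ℕ.>-nonZero⁻¹ size {{FuzzyGraph.nonEmpty G}}) size≤n

  nn≤B : n * n ℕ.≤ B
  nn≤B = ℕ.*-monoˡ-≤ n (ℕ.m≤n+m n m)

  mn≤B : m * n ℕ.≤ B
  mn≤B = ℕ.*-monoˡ-≤ n (ℕ.m≤m+n m n)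

  n≤B : n ℕ.≤ B
  n≤B = ℕ.≤-trans (ℕ.m≤m*n n n {{ℕ.>-nonZero 1≤n}}) nn≤B

  1≤B : 1 ℕ.≤ B
  1≤B = ℕ.≤-trans 1≤n n≤B

  quadratic : ∀ {t} k → t ℕ.≤ k * (n * n) → t ℕ.≤ k * B
  quadratic k h = ℕ.≤-trans h (ℕ.*-monoʳ-≤ k nn≤B)

  constant : ∀ k → k ℕ.≤ k * B
  constant k = ℕ.m≤m*n k B {{ℕ.>-nonZero 1≤B}}

  plus : ∀ {t u} a b → t ℕ.≤ a * B → u ℕ.≤ b * B → t + u ℕ.≤ (a + b) * B
  plus a b p q = ℕ.≤-trans (ℕ.+-mono-≤ p q) (ℕ.≤-reflexive (sym (ℕ.*-distribʳ-+ B a b)))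

  ≤-allFin : ∀ {k} → k ℕ.≤ n → length (allFin k) ℕ.≤ n
  ≤-allFin h = ℕ.≤-trans (ℕ.≤-reflexive (length-allFin _)) h

  mins-time : registerMinsTime ℕ.≤ minsBound σV σE * B
  mins-time = quadratic (minsBound σV σE) (loop-quadratic (int 0 []) {c = loop (int 1 []) (cost registerMinᴾ)} (allFin size) (≤-allFin size≤n) 1≤n λ _ →
    loop-linear (int 1 []) {c = cost registerMinᴾ} (allFin size′) (≤-allFin size′≤n) 1≤n λ _ → ℕ.≤-refl)

  grid-time : ∀ a b k₁ k₂ c → k₁ ℕ.≤ n → k₂ ℕ.≤ n →
    forTime (int a []) (map (λ (_ : Fin k₁) → forTime (int b []) (map (λ (_ : Fin k₂) →
      forTime (int 3 []) (map (λ (_ : Fin σE) → c) (allFin σE))) (allFin k₂))) (allFin k₁)) ℕ.≤ gridBound σE c * B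
  grid-time a b k₁ k₂ c p q = quadratic (gridBound σE c) (loop-quadratic (int 0 []) {c = loop (int 0 []) ((9 + c) * suc σE)} (allFin k₁) (≤-allFin p) 1≤n λ _ →
    loop-linear (int 0 []) {c = (9 + c) * suc σE} (allFin k₂) (≤-allFin q) 1≤n λ _ →
    ℕ.≤-trans (forTime-≤ (int 3 []) (allFin σE) λ _ → ℕ.≤-refl) (ℕ.≤-reflexive (cong (λ k → (9 + c) * suc k) (length-allFin σE))))

  rows≤ : suc (size * σE + size′ * σE + size′) ℕ.≤ (σE + 2) * n
  rows≤ = begin
    suc (size * σE + size′ * σE + size′)  ≤⟨ ℕ.+-mono-≤ 1≤n (ℕ.+-monoʳ-≤ (size * σE + size′ * σE) size′≤n) ⟩
    n + (size * σE + size′ * σE + n)      ≡⟨ rearrange size size′ σE ⟩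
    (σE + 2) * n                          ∎
    where
    open ℕ.≤-Reasoning
    rearrange : ∀ a b s → a + b + (a * s + b * s + (a + b)) ≡ (s + 2) * (a + b)
    rearrange = solve-∀

  width≤ : suc (size + size′ + σV + 1) ℕ.≤ (σV + 3) * n
  width≤ = begin
    suc (n + σV + 1)       ≡⟨ rearrange n σV ⟩
    n + (σV + 2) * 1       ≤⟨ ℕ.+-monoʳ-≤ n (ℕ.*-monoʳ-≤ (σV + 2) 1≤n) ⟩
    n + (σV + 2) * n       ≡⟨ rearrange′ n σV ⟩
    (σV + 3) * n           ∎
    where
    open ℕ.≤-Reasoning
    rearrange : ∀ n s → suc (n + s + 1) ≡ n + (s + 2) * 1
    rearrange = solve-∀

    rearrange′ : ∀ n s → n + (s + 2) * n ≡ (s + 3) * n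
    rearrange′ = solve-∀

  refresh-time : refreshAllTime (size * σE + size′ * σE + size′) (size + size′ + σV + 1) ℕ.≤ refreshBound σV σE * B
  refresh-time = quadratic (refreshBound σV σE) (begin
    refreshAllTime R W
      ≤⟨ ℕ.+-mono-≤ (ℕ.≤ᵇ⇒≤ (cost (store #width [] (((int 0 [] ⊕ int 1 []) ⊕ int 2 []) ⊕ lit 1))) 50 tt) (forTime-≤ (mem #row []) (allFin R) λ _ → row≤) ⟩
    50 + (9 + (100 + 200 * (σV + 3)) * n) * suc (length (allFin R))
      ≤⟨ ℕ.+-mono-≤ (ℕ.m≤m*n 50 (n * n) {{ℕ.>-nonZero (ℕ.*-mono-≤ 1≤n 1≤n)}})
           (ℕ.*-mono-≤ (ℕ.≤-trans (absorb 9 (100 + 200 * (σV + 3)) n 1≤n) (ℕ.*-monoˡ-≤ n (ℕ.n≤1+n (9 + (100 + 200 * (σV + 3))))))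
             (ℕ.≤-trans (ℕ.≤-reflexive (cong suc (length-allFin R))) rows≤)) ⟩
    50 * (n * n) + (10 + (100 + 200 * (σV + 3))) * n * ((σE + 2) * n)
      ≡⟨ rearrange (10 + (100 + 200 * (σV + 3))) n (σE + 2) ⟩
    refreshBound σV σE * (n * n) ∎)
    where
    open ℕ.≤-Reasoning
    R = size * σE + size′ * σE + size′
    W = size + size′ + σV + 1

    row≤ : cost (put #cur (reg #i)) + refreshTime * suc W ℕ.≤ (100 + 200 * (σV + 3)) * n
    row≤ = ℕ.≤-trans (ℕ.+-mono-≤ (ℕ.≤ᵇ⇒≤ (cost (put #cur (reg #i))) 100 tt) (ℕ.*-mono-≤ (ℕ.≤ᵇ⇒≤ refreshTime 200 tt) width≤))
      (ℕ.≤-trans (ℕ.≤-reflexive (cong (100 +_) (sym (ℕ.*-assoc 200 (σV + 3) n)))) (absorb 100 (200 * (σV + 3)) n 1≤n))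

    rearrange : ∀ a n s → 50 * (n * n) + a * n * (s * n) ≡ (50 + a * s) * (n * n)
    rearrange = solve-∀

  module SideTime (S : Side) (na≤n : Side.na S ℕ.≤ n) (nb≤n : Side.nb S ℕ.≤ n) (fill : ℕ)
                  (fill≤ : fill ℕ.≤ (50 + loop (int 0 []) (cost (pairᴾ 1 2))) * n) where
    open Side S
    open SideCount S

    -- Looking at a triple costs a constant, here 20. The cost `fill` of a class, which is O(n), is
    -- incurred by positive triples alone, and there are at most m of them.
    edges-time : ∀ (#na : ℕ) (T : Fin na → Fin σE → Fin na → ℕ) →
      (∀ x r y → T x r y ℕ.≤ 20 + fill * length (when (positive (edges x r y)) ((x , r , y) ∷ []))) →
      length triples ℕ.≤ m →
      forTime (int #na []) (map (λ x → forTime (int 3 []) (map (λ r →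
        forTime (int #na []) (map (T x r) (allFin na)) + 4) (allFin σE))) (allFin na)) ℕ.≤ edgesBound σV σE * B
    edges-time #na T h triples≤ = begin
      forTime (int #na []) (map _ (allFin na))
        ≤⟨ forTime-sum (int #na []) {p = λ x → length (overX x)} {edgeRowBound σV σE * n} {fill} (allFin na) overX≤ ⟩
      (9 + edgeRowBound σV σE * n) * suc (length (allFin na)) + fill * sum (map (λ x → length (overX x)) (allFin na))
        ≡⟨ cong (λ k → (9 + edgeRowBound σV σE * n) * suc (length (allFin na)) + fill * k) (sym (length-concatMap overX (allFin na))) ⟩
      (9 + edgeRowBound σV σE * n) * suc (length (allFin na)) + fill * length triples
        ≤⟨ ℕ.+-mono-≤ (ℕ.*-mono-≤ (absorb 9 (edgeRowBound σV σE) n 1≤n) (suc-double (≤-allFin na≤n) 1≤n)) (ℕ.*-mono-≤ fill≤ triples≤) ⟩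
      (9 + edgeRowBound σV σE) * n * (2 * n) + kf * n * m
        ≡⟨ rearrange (9 + edgeRowBound σV σE) kf n m ⟩
      loop (int 0 []) (edgeRowBound σV σE) * (n * n) + kf * (m * n)
        ≤⟨ ℕ.+-mono-≤ (ℕ.*-monoʳ-≤ (loop (int 0 []) (edgeRowBound σV σE)) nn≤B) (ℕ.*-monoʳ-≤ kf mn≤B) ⟩
      loop (int 0 []) (edgeRowBound σV σE) * B + kf * B
        ≡⟨ ℕ.*-distribʳ-+ B (loop (int 0 []) (edgeRowBound σV σE)) kf ⟨
      edgesBound σV σE * B ∎
      where
      open ℕ.≤-Reasoning
      kf = 50 + loop (int 0 []) (cost (pairᴾ 1 2))

      point : Fin na → Fin σE → Fin na → List (Fin na × Fin σE × Fin na)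
      point x r y = when (positive (edges x r y)) ((x , r , y) ∷ [])

      overR : Fin na → Fin σE → List (Fin na × Fin σE × Fin na)
      overR x r = concatMap (point x r) (allFin na)

      overX : Fin na → List (Fin na × Fin σE × Fin na)
      overX x = concatMap (overR x) (allFin σE)

      overR≤ : ∀ x r → forTime (int #na []) (map (T x r) (allFin na)) + 4 ℕ.≤ (2 * (9 + 20) + 4) * n + fill * length (overR x r)
      overR≤ x r = begin
        forTime (int #na []) (map (T x r) (allFin na)) + 4
          ≤⟨ ℕ.+-mono-≤ (forTime-sum (int #na []) {p = λ y → length (point x r y)} {20} {fill} (allFin na) (h x r)) (ℕ.m≤m*n 4 n {{ℕ.>-nonZero 1≤n}}) ⟩
        (9 + 20) * suc (length (allFin na)) + fill * sum (map (λ y → length (point x r y)) (allFin na)) + 4 * n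
          ≤⟨ ℕ.+-monoˡ-≤ (4 * n) (ℕ.+-mono-≤ (ℕ.*-monoʳ-≤ (9 + 20) (suc-double (≤-allFin na≤n) 1≤n))
               (ℕ.≤-reflexive (cong (fill *_) (sym (length-concatMap (point x r) (allFin na)))))) ⟩
        (9 + 20) * (2 * n) + fill * length (overR x r) + 4 * n
          ≡⟨ collect n (fill * length (overR x r)) ⟩
        (2 * (9 + 20) + 4) * n + fill * length (overR x r) ∎
        where
        collect : ∀ n f → (9 + 20) * (2 * n) + f + 4 * n ≡ (2 * (9 + 20) + 4) * n + f
        collect = solve-∀

      overX≤ : ∀ x → forTime (int 3 []) (map (λ r → forTime (int #na []) (map (T x r) (allFin na)) + 4) (allFin σE)) ℕ.≤
               edgeRowBound σV σE * n + fill * length (overX x)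
      overX≤ x = begin
        forTime (int 3 []) (map (λ r → forTime (int #na []) (map (T x r) (allFin na)) + 4) (allFin σE))
          ≤⟨ forTime-sum (int 3 []) {p = λ r → length (overR x r)} {(2 * (9 + 20) + 4) * n} {fill} (allFin σE) (overR≤ x) ⟩
        (9 + (2 * (9 + 20) + 4) * n) * suc (length (allFin σE)) + fill * sum (map (λ r → length (overR x r)) (allFin σE))
          ≤⟨ ℕ.+-mono-≤ (ℕ.*-mono-≤ (absorb 9 (2 * (9 + 20) + 4) n 1≤n) (ℕ.≤-reflexive (cong suc (length-allFin σE))))
               (ℕ.≤-reflexive (cong (fill *_) (sym (length-concatMap (overR x) (allFin σE))))) ⟩
        (9 + (2 * (9 + 20) + 4)) * n * suc σE + fill * length (overX x)
          ≡⟨ cong (_+ fill * length (overX x)) (commute (9 + (2 * (9 + 20) + 4)) n (suc σE)) ⟩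
        edgeRowBound σV σE * n + fill * length (overX x) ∎
        where
        commute : ∀ a n s → a * n * s ≡ a * s * n
        commute = solve-∀

      rearrange : ∀ a k n m → a * n * (2 * n) + k * n * m ≡ 2 * a * (n * n) + k * (m * n)
      rearrange = solve-∀

  size-size′≤ : size * size′ ℕ.≤ B
  size-size′≤ = ℕ.≤-trans (ℕ.*-mono-≤ size≤n size′≤n) nn≤B

  min-edges≤ : m₁ * size′ + m₂ * size ℕ.≤ B
  min-edges≤ = ℕ.≤-trans (ℕ.+-mono-≤ (ℕ.*-monoʳ-≤ m₁ size′≤n) (ℕ.*-monoʳ-≤ m₂ size≤n))
    (ℕ.≤-trans (ℕ.≤-reflexive (sym (ℕ.*-distribʳ-+ n m₁ m₂))) mn≤B)

  max-edges≤ : size * m₂ + size′ * m₁ ℕ.≤ B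
  max-edges≤ = ℕ.≤-trans (ℕ.≤-reflexive (swap size m₂ size′ m₁)) min-edges≤
    where
    swap : ∀ a b c d → a * b + c * d ≡ d * c + b * a
    swap = solve-∀

  Vmax≤ : size * (size′ * σE) + size′ * (size * σE) ℕ.≤ 2 * σE * B
  Vmax≤ = ℕ.≤-trans (ℕ.≤-reflexive (collect size size′ σE)) (ℕ.*-monoʳ-≤ (2 * σE) size-size′≤)
    where
    collect : ∀ a b s → a * (b * s) + b * (a * s) ≡ 2 * s * (a * b)
    collect = solve-∀

  weight≤ : sum (map (Potential.weight 𝕀 (net G G′) ∘ maxNode) (elements (MinimaxNet.Vmax-finite (net G G′)))) ℕ.≤ (2 * σE + 2) * B
  weight≤ = ℕ.≤-trans (ℕ.≤-reflexive sum-weight) (plus (2 * σE) 2 Vmax≤ (ℕ.*-monoʳ-≤ 2 max-edges≤))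

  potential≤ : potential initial ℕ.≤ (4 * σE + 7) * B
  potential≤ = begin
    potential initial                               ≤⟨ potential-initial ⟩
    size * size′ + (w + e) + w + e                  ≤⟨ ℕ.+-mono-≤ (ℕ.+-mono-≤ (ℕ.+-mono-≤ size-size′≤ (ℕ.+-mono-≤ weight≤ min-edges≤)) weight≤) min-edges≤ ⟩
    B + ((2 * σE + 2) * B + B) + (2 * σE + 2) * B + B ≡⟨ collect σE B ⟩
    (4 * σE + 7) * B                                ∎
    where
    open ℕ.≤-Reasoning
    w = sum (map (Potential.weight 𝕀 (net G G′) ∘ maxNode) (elements (MinimaxNet.Vmax-finite (net G G′))))
    e = m₁ * size′ + m₂ * size

    collect : ∀ s b → b + ((2 * s + 2) * b + b) + (2 * s + 2) * b + b ≡ (4 * s + 7) * b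
    collect = solve-∀

  queue-length≤ : length (queue initial) ℕ.≤ (2 * σE + 2) * B
  queue-length≤ = begin
    length (mins ++ (maxs ++ edge-queue))             ≡⟨ trans (List.length-++ mins) (cong (length mins +_) (List.length-++ maxs)) ⟩
    length mins + (length maxs + length edge-queue)   ≤⟨ ℕ.+-mono-≤
      (ℕ.≤-trans (ℕ.≤-reflexive (trans (List.length-map _ (elements (MinimaxNet.Vmin-finite (net G G′)))) length-Vmin)) size-size′≤)
      (ℕ.+-mono-≤ (ℕ.≤-trans (ℕ.≤-reflexive (List.length-map _ (filter (λ y → length (predMax y) ℕ.≟ 0) (elements (MinimaxNet.Vmax-finite (net G G′))))))
          (ℕ.≤-trans (List.length-filter (λ y → length (predMax y) ℕ.≟ 0) (elements (MinimaxNet.Vmax-finite (net G G′)))) (ℕ.≤-trans (ℕ.≤-reflexive length-Vmax) Vmax≤)))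
        (ℕ.≤-trans (ℕ.≤-reflexive length-edge-queue) min-edges≤)) ⟩
    B + (2 * σE * B + B)                              ≡⟨ collect σE B ⟩
    (2 * σE + 2) * B                                  ∎
    where
    open ℕ.≤-Reasoning
    mins = map (λ z → Object.minNode z , MinimaxNet.L (net G G′) z) (elements (MinimaxNet.Vmin-finite (net G G′)))
    maxs = map (λ y → Object.maxNode y , BoundedChain.𝟎 𝕀) (filter (λ y → length (predMax y) ℕ.≟ 0) (elements (MinimaxNet.Vmax-finite (net G G′))))

    collect : ∀ s b → b + (2 * s * b + b) ≡ (2 * s + 2) * b
    collect = solve-∀

-- The program and its total time

module Implementation {c ℓ₁ ℓ₂} (𝕀 : BoundedChain c ℓ₁ ℓ₂) {σV σE : ℕ} (G G′ : Gödel.FuzzyGraph 𝕀 σV σE) where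

  open BoundedChain 𝕀 using (Carrier)
  open Semantics 𝕀
  open FuzzyGraph G
  open FuzzyGraph G′ renaming (V to V′; E to E′; L to L′; size to size′)
    hiding (nonEmpty)
  open MarkingAlgorithm (net G G′)
  open Potential 𝕀 (net G G′) using (potential)
  open NetLists 𝕀 G G′
  open NetQueue 𝕀 G G′ using (edge-queue)
  open Counting 𝕀 G G′
  open Bounds 𝕀 G G′
  open Registration 𝕀 G G′
  open SourceLoop 𝕀 (net G G′) using (entries; selectTime)
  open Main 𝕀 (net G G′)
  open Assembly 𝕀 G G′
  open FinalRun 𝕀 G G′

  register-time : registerTime ℕ.≤ registerBound σV σE * B
  register-time = plus (minsBound σV σE) (gridBound σE (cost (registerMaxᴾ 1)) + gridBound σE (cost (registerMaxᴾ 2))) mins-time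
    (plus (gridBound σE (cost (registerMaxᴾ 1))) (gridBound σE (cost (registerMaxᴾ 2)))
      (grid-time 0 1 size size′ (cost (registerMaxᴾ 1)) size≤n size′≤n) (grid-time 1 0 size′ size (cost (registerMaxᴾ 2)) size′≤n size≤n))

  module _ {s₁ : State} (F₁ : Frame registerᴾ s₀ s₁) (Reg : Registered s₁) where

    open Registeredᴹ s₁ F₁ Reg
    open Builtᴹ s₁ F₁ Reg
    open Building 𝕀 G G′ minTable maxTable using (numbering)
    open Edges 𝕀 G G′ minTable maxTable
    open Labels 𝕀 G G′ minTable maxTable using (bestTime)
    open LabelPhase 𝕀 G G′ minTable maxTable using (labelStepTime; sourceTime; labelsTime)

    fill-time : ∀ (#nb : ℕ) {k} → k ℕ.≤ n → cost (put #col (reg #k)) + (cost openᴾ +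
      forTime (int #nb []) (map (λ (_ : Fin k) → cost (pairᴾ 1 2)) (allFin k))) ℕ.≤ (50 + loop (int 0 []) (cost (pairᴾ 1 2))) * n
    fill-time #nb {k} h = ℕ.≤-trans (ℕ.+-monoʳ-≤ (cost (put #col (reg #k)) + cost openᴾ)
        (loop-linear (int #nb []) {c = cost (pairᴾ 1 2)} (allFin k) (≤-allFin h) 1≤n λ _ → ℕ.≤-refl))
      (ℕ.≤-trans (ℕ.+-monoˡ-≤ _ (ℕ.≤ᵇ⇒≤ (cost (put #col (reg #k)) + cost openᴾ) 50 tt)) (absorb 50 (loop (int 0 []) (cost (pairᴾ 1 2))) n 1≤n))

    step-bound : ∀ {A : Set} b f (x : A) → 8 + (if b then f else 1) ℕ.≤ 20 + f * length (when b (x ∷ []))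
    step-bound true  f x = ℕ.+-mono-≤ (ℕ.≤ᵇ⇒≤ 8 20 tt) (ℕ.≤-reflexive (sym (ℕ.*-identityʳ f)))
    step-bound false f x = ℕ.≤-trans (ℕ.≤ᵇ⇒≤ 9 20 tt) (ℕ.m≤m+n 20 (f * 0))

    best-bound : bestTime ℕ.≤ 20 + 40 * suc σV
    best-bound = ℕ.+-mono-≤ (ℕ.≤ᵇ⇒≤ (cost (setVal #v [] oneᵥ) + cost (put #arg (int 2 []))) 20 tt)
      (ℕ.≤-trans (forTime-≤ (int 2 []) {b = 31} (allFin σV) λ _ → ℕ.≤ᵇ⇒≤ _ 31 tt) (ℕ.≤-reflexive (cong (λ k → 40 * suc k) (length-allFin σV))))

    label-step-bound : labelStepTime ℕ.≤ labelStepBound σV σE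
    label-step-bound = ℕ.≤-trans (ℕ.+-mono-≤ best-bound (ℕ.≤ᵇ⇒≤ _ 80 tt)) (ℕ.≤-reflexive (rearrange (40 * suc σV)))
      where
      rearrange : ∀ a → 20 + a + 80 ≡ 100 + a
      rearrange = solve-∀

    module _ {as : List Arc} {es : List (Object × Carrier)} {n₀ R₀ : ℕ} where

      source-bound : sourceTime (λ _ _ → refl) as es n₀ R₀ ℕ.≤ sourceBound σV σE * n
      source-bound = ℕ.≤-trans (ℕ.+-mono-≤ {fixed} {100} (ℕ.≤ᵇ⇒≤ fixed 100 tt)
          (loop-linear (int 0 []) {c = labelStepBound σV σE} (allFin size) (≤-allFin size≤n) 1≤n λ _ → label-step-bound))
        (absorb 100 (loop (int 0 []) (labelStepBound σV σE)) n 1≤n)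
        where
        fixed : ℕ
        fixed = cost (ifte ((reg #j ⊕ lit 1) ≤ⁿ int 2 []) (setVal #v [] (val 1 (reg #i ∷ reg #j ∷ []))) (setVal #v [] oneᵥ)) +
          (cost (put #col (reg #j)) + cost openᴾ)

      labels-bound : labelsTime (λ _ _ → refl) as es n₀ R₀ ℕ.≤ labelsBound σV σE * B
      labels-bound = quadratic (labelsBound σV σE) (loop-quadratic (int 1 [])
        {c = fixedLoop (int 2 [] ⊕ lit 1) (suc σV) (sourceBound σV σE) + 4} (allFin size′) (≤-allFin size′≤n) 1≤n λ _ →
        ℕ.≤-trans (ℕ.+-mono-≤
            (ℕ.≤-trans (loop-fixed (int 2 [] ⊕ lit 1) {c = sourceBound σV σE} (allFin (suc σV)) 1≤n λ _ → source-bound)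
              (ℕ.≤-reflexive (cong (λ k → fixedLoop (int 2 [] ⊕ lit 1) k (sourceBound σV σE) * n) (length-allFin (suc σV)))))
            (ℕ.m≤m*n 4 n {{ℕ.>-nonZero 1≤n}}))
          (ℕ.≤-reflexive (sym (ℕ.*-distribʳ-+ n (fixedLoop (int 2 [] ⊕ lit 1) (suc σV) (sourceBound σV σE)) 4))))

    m₁≤m : length T₁.triples ℕ.≤ m
    m₁≤m = ℕ.≤-trans (ℕ.≤-reflexive triples₁-positive) (ℕ.m≤m+n m₁ m₂)

    m₂≤m : length T₂.triples ℕ.≤ m
    m₂≤m = ℕ.≤-trans (ℕ.≤-reflexive triples₂-positive) (ℕ.m≤n+m m₂ m₁)

    build-time : buildTime ℕ.≤ buildBound σV σE * B
    build-time = plus (edgesBound σV σE) (edgesBound σV σE + labelsBound σV σE)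
      (SideTime.edges-time side₁ size≤n size′≤n _ (fill-time 1 size′≤n) 0
        _ (λ x r y → step-bound (positive (Side.edges side₁ x r y)) _ (x , r , y)) m₁≤m)
      (plus (edgesBound σV σE) (labelsBound σV σE)
        (SideTime.edges-time side₂ size′≤n size≤n _ (fill-time 0 size≤n) 1
          _ (λ x r y → step-bound (positive (Side.edges side₂ x r y)) _ (x , r , y)) m₂≤m)
        (labels-bound {arcs₁ ++ arcs₂} {entries₁ ++ entries₂} {length triples₁ + length triples₂} {size * σE + size′ * σE}))

    prepare-time : prepareTime ℕ.≤ prepareBound σV σE * B
    prepare-time = plus (gridBound σE (cost (zeroStepᴾ 1))) (gridBound σE (cost (zeroStepᴾ 2)) + (refreshBound σV σE + 3))
      (grid-time 0 1 size size′ (cost (zeroStepᴾ 1)) size≤n size′≤n)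
      (plus (gridBound σE (cost (zeroStepᴾ 2))) (refreshBound σV σE + 3)
        (grid-time 1 0 size′ size (cost (zeroStepᴾ 2)) size′≤n size≤n)
        (plus (refreshBound σV σE) 3 refresh-time (ℕ.≤-trans (ℕ.≤ᵇ⇒≤ (cost (setVal #level [] zeroᵥ)) 3 tt) (constant 3))))

    module _ {s₂ : State} (F₂ : Frame buildᴾ s₁ s₂) (Bt : Built s₂) where

      srcs′ = srcs F₂ Bt
      payload′ = payload F₂ Bt

      -- There is one class for each positive edge and there are |Σ_V| + 1 for each vertex of G′;
      -- the `suc` is the round that finds none. The count must be linear in m + n, because every
      -- round costs O(n).
      sources-bound : suc (length srcs′) ℕ.≤ (σV + 2) * (m + n)
      sources-bound = begin
        suc (length srcs′)
          ≡⟨ cong suc (trans (List.length-map proj₁ (sources (P F₂ Bt))) (trans (number (P F₂ Bt)) (trans (sourceCount≡ F₂ Bt)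
               (cong₂ (λ a b → a + b + size′ * suc σV) triples₁-positive triples₂-positive)))) ⟩
        suc (m + size′ * suc σV)             ≤⟨ s≤s (ℕ.+-monoʳ-≤ m (ℕ.*-monoˡ-≤ (suc σV) size′≤n)) ⟩
        suc (m + n * suc σV)                 ≤⟨ ℕ.+-monoˡ-≤ (m + n * suc σV) 1≤n ⟩
        n + (m + n * suc σV)                 ≡⟨ arrange n m σV ⟩
        m + (σV + 2) * n                     ≤⟨ ℕ.+-monoˡ-≤ ((σV + 2) * n) (ℕ.m≤n*m m (σV + 2) {{ℕ.>-nonZero (ℕ.≤-trans (s≤s z≤n) (ℕ.m≤n+m 2 σV))}}) ⟩
        (σV + 2) * m + (σV + 2) * n          ≡⟨ ℕ.*-distribˡ-+ (σV + 2) m n ⟨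
        (σV + 2) * (m + n)                   ∎
        where
        open ℕ.≤-Reasoning hiding (stop)
        arrange : ∀ n m s → n + (m + n * suc s) ≡ m + (s + 2) * n
        arrange = solve-∀

      select-bound : selectTime numbering rows width payload′ ℕ.≤ selectBound σV σE
      select-bound = ℕ.≤ᵇ⇒≤ (selectTime numbering rows width payload′) 400 tt

      round-bound : roundTime numbering rows width payload′ ℕ.≤ roundBound σV σE * n
      round-bound = ℕ.≤-trans (ℕ.+-monoʳ-≤ 6 (ℕ.*-mono-≤ select-bound (ℕ.+-mono-≤ rows≤ width≤)))
        (ℕ.≤-trans (ℕ.≤-reflexive (arrange 400 (σE + 2) (σV + 3) n)) (absorb 6 (400 * (σE + 2 + (σV + 3))) n 1≤n))
        where
        arrange : ∀ s a b n → 6 + s * (a * n + b * n) ≡ 6 + s * (a + b) * n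
        arrange = solve-∀

      module _ {s₃ : State} (F₃ : Frame prepareᴾ s₂ s₃) (Q : Prepared s₃) where

        -- The classes are part of the initial queue, whose length has been counted.
        entries-bound : length (entries numbering rows width payload′ srcs′) ℕ.≤ (2 * σE + 2) * B
        entries-bound = ℕ.≤-trans (ℕ.m≤n+m _ (length (proj₁ (Prepared.pushed-p Q))))
          (ℕ.≤-trans (ℕ.≤-reflexive (sym (trans (Perm.↭-length (queue≡ F₂ Bt F₃ Q)) (List.length-++ (proj₁ (Prepared.pushed-p Q)))))) queue-length≤)

        budget-bound : budget numbering rows width payload′ initial srcs′ ℕ.≤ budgetBound σV σE * B
        budget-bound = plus (203 * (4 * σE + 7) + 400 * (2 * σE + 2)) ((σV + 2) * roundBound σV σE)
          (plus (203 * (4 * σE + 7)) (400 * (2 * σE + 2))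
            (ℕ.≤-trans (ℕ.*-mono-≤ {drainUnit numbering rows width payload′} {203} (ℕ.≤ᵇ⇒≤ (drainUnit numbering rows width payload′) 203 tt) potential≤)
              (ℕ.≤-reflexive (sym (ℕ.*-assoc 203 (4 * σE + 7) B))))
            (ℕ.≤-trans (ℕ.*-mono-≤ select-bound entries-bound) (ℕ.≤-reflexive (sym (ℕ.*-assoc 400 (2 * σE + 2) B)))))
          (ℕ.≤-trans (ℕ.*-mono-≤ sources-bound round-bound) (ℕ.≤-reflexive (arrange (σV + 2) (roundBound σV σE) (m + n) n)))
          where
          arrange : ∀ a r x n → a * x * (r * n) ≡ a * r * (x * n)
          arrange = solve-∀

        main-time : 3 + budget numbering rows width payload′ initial srcs′ ℕ.≤ (3 + budgetBound σV σE) * B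
        main-time = plus 3 (budgetBound σV σE) (constant 3) budget-bound

  implemented : ∃[ t ] Implements G G′ algorithmᴾ t × t ℕ.≤ timeBound σV σE * B
  implemented = registered′ register-exec
    where
    Outcome = ∃[ t ] Implements G G′ algorithmᴾ t × t ℕ.≤ timeBound σV σE * B

    -- The tables left by one phase occur in the statements about the next, so the run of each phase
    -- is a parameter of all that follow.
    module _ {s₁ : State} {t₁ : ℕ} (d₁ : ⟨ registerᴾ , s₀ ⟩⇓[ t₁ ] s₁) (≤₁ : t₁ ℕ.≤ registerTime) (Reg : Registered s₁) where
      open Registeredᴹ s₁ (frame d₁) Reg
      open Builtᴹ s₁ (frame d₁) Reg
      open Building 𝕀 G G′ minTable maxTable using (numbering)
      open Edges 𝕀 G G′ minTable maxTable using (width)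

      module _ {s₂ : State} {t₂ : ℕ} (d₂ : ⟨ buildᴾ , s₁ ⟩⇓[ t₂ ] s₂) (≤₂ : t₂ ℕ.≤ buildTime) (Bt : Built s₂) where

        prepared′ : Exec prepareᴾ s₂ prepareTime Prepared → Outcome
        prepared′ (executes d₃ ≤₃ Q) = finished′ (main₃ (frame d₂) Bt (frame d₃) Q)
          where
          finished′ : Exec mainᴾ _ _ (Done numbering rows width (payload (frame d₂) Bt)) → Outcome
          finished′ (executes d₄ ≤₄ D) = implementation (frame d₂) Bt (frame d₃) Q D (seq⇓ d₁ (seq⇓ d₂ (seq⇓ d₃ d₄))) total
            where
            collect : ∀ a b c d x → a * x + (b * x + (c * x + d * x)) ≡ (a + (b + (c + d))) * x
            collect = solve-∀

            bound₄ = ℕ.≤-trans ≤₄ (main-time (frame d₁) Reg (frame d₂) Bt (frame d₃) Q)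
            bound₃ = ℕ.≤-trans ≤₃ (prepare-time (frame d₁) Reg)
            bound₂ = ℕ.≤-trans ≤₂ (build-time (frame d₁) Reg)
            bound₁ = ℕ.≤-trans ≤₁ register-time

            total = ℕ.≤-trans (ℕ.+-mono-≤ bound₁ (ℕ.+-mono-≤ bound₂ (ℕ.+-mono-≤ bound₃ bound₄)))
              (ℕ.≤-reflexive (collect (registerBound σV σE) (buildBound σV σE) (prepareBound σV σE) (3 + budgetBound σV σE) B))

      built′ : Exec buildᴾ s₁ buildTime Built → Outcome
      built′ (executes d₂ ≤₂ Bt) = prepared′ d₂ ≤₂ Bt (prepare-exec (frame d₂) Bt)

    registered′ : Exec registerᴾ s₀ registerTime Registered → Outcome
    registered′ (executes {s₁} d₁ ≤₁ Reg) = built′ d₁ ≤₁ Reg (Registeredᴹ.build-exec s₁ (frame d₁) Reg)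

theorem4p8 :
  (_≤?_ : Decidable _≤ᵢ_) →
  let open Gödel ([0,1] _≤?_) in
  (∀ {σV σE} (G G′ : FuzzyGraph σV σE) →
    SimulationAlgorithmTerminates G G′ ×
    (∀ {objs Z} → SimulationAlgorithm G G′ objs Z → IsGreatestDirectedSimulation G G′ Z))
  ×
  (∃[ P ] ∀ σV σE → ∃[ k ] ∀ (G G′ : FuzzyGraph σV σE) →
    let n = FuzzyGraph.size G + FuzzyGraph.size G′
        m = positiveEdges G + positiveEdges G′
    in ∃[ t ] Implements G G′ P t × t ℕ.≤ k * ((m + n) * n))
-- One program serves all signatures: it reads |Σ_V| and |Σ_E| from its input, and only the constant
-- of the time bound depends on them.
theorem4p8 _≤?_ =
  (λ G G′ → Simulation.simulation-terminates ([0,1] _≤?_) G G′ , Simulation.simulation-greatest ([0,1] _≤?_) G G′) ,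
  algorithmᴾ , λ σV σE → timeBound σV σE , λ G G′ → Implementation.implemented ([0,1] _≤?_) G G′
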